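{- Let $P,Q\subset\mathbb R^3$ be lattice polytopes with $L(P)=L(Q)=1$, $L(P+Q)=2$, $|P|=5$ and $|Q|=4$. Then the pair $(P,Q)$ is equivalent to $(K_1,S_1)$, $(K_2,S)$, or $(E,S_2)$, where $S=\operatorname{conv}\{(0,0,0),(0,1,0),(1,0,0),(1,1,2)\}$ (which is equivalent to $S_2$). Further: if $P$ is a lattice translate of $E$ then $Q$ is a lattice translate of $S_2$; if $P$ is a lattice translate of $K_2$ then $Q$ is a lattice translate of $S$; and if $P$ is a lattice translate of $K_1$ then $Q$ is a lattice translate of one of the four empty tetrahedra properly contained in $K_1$.
   Context: $|P|$ is the number of lattice points of $P$. A lattice polytope is empty if its only lattice points are its vertices. The Minkowski length $L(P)$ is the largest $L$ such that $P$ contains a Minkowski sum of $L$ lattice polytopes each of positive dimension. Pairs $(P,Q)$, $(P',Q')$ are equivalent if there is an affine unimodular map $\varphi$ ($x\mapsto Ux+b$, $U\in\mathrm{GL}(3,\mathbb Z)$, $b\in\mathbb Z^3$) and lattice vectors $v,w$ with $P'=\varphi(P)+v$, $Q'=\varphi(Q)+w$. $S_1=\operatorname{conv}\{0,e_1,e_2,e_3\}$, $S_2=\operatorname{conv}\{e_1,e_2,e_3,e_1+e_2+e_3\}$, $E=\operatorname{conv}\{0,e_1,e_2,e_3,e_1+e_2+e_3\}$, $K_1=\operatorname{conv}\{e_1,e_2,e_3,-e_1-e_2-e_3\}$, $K_2=\operatorname{conv}\{e_1,e_2,e_1+e_2+2e_3,-e_1-e_2-e_3\}$. -}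

module Defs where

open import Data.Nat using (ℕ; zero; suc)
import Data.Nat as ℕ
open import Data.Integer using (ℤ; +_; -[1+_])
import Data.Integer as ℤ
open import Data.Rational using (ℚ; _/_; 0ℚ; 1ℚ)
import Data.Rational as ℚ
open import Data.List using (List; []; _∷_; length; zipWith; foldr)
open import Data.List.Membership.Propositional using (_∈_)
open import Data.List.Relation.Unary.All using (All)
open import Data.List.Relation.Unary.Unique.Propositional using (Unique)
open import Data.Vec using (Vec)
import Data.Vec as Vec
open import Data.Product using (Σ; ∃; ∃-syntax; _×_; _,_)
open import Data.Sum using (_⊎_)
open import Relation.Nullary using (¬_)
open import Relation.Binary.PropositionalEquality using (_≡_; _≢_)
open import Function.Bundles using (_⇔_)

-- Points.  Lattice points are elements of ℤ³; polytopes are regarded as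
-- sets of rational points (ℚ³).

Z3 : Set
Z3 = ℤ × ℤ × ℤ

Q3 : Set
Q3 = ℚ × ℚ × ℚ

ιℤ : ℤ → ℚ
ιℤ n = n / 1

ι : Z3 → Q3
ι (a , b , c) = ιℤ a , ιℤ b , ιℤ c

_+³_ : Q3 → Q3 → Q3
(a , b , c) +³ (a' , b' , c') = (a ℚ.+ a') , (b ℚ.+ b') , (c ℚ.+ c')

_·³_ : ℚ → Q3 → Q3
t ·³ (a , b , c) = (t ℚ.* a) , (t ℚ.* b) , (t ℚ.* c)

0³ : Q3
0³ = 0ℚ , 0ℚ , 0ℚ

_-ℤ³_ : Z3 → Z3 → Z3
(a , b , c) -ℤ³ (a' , b' , c') = (a ℤ.- a') , (b ℤ.- b') , (c ℤ.- c')

Region : Set₁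
Region = Q3 → Set

_⊆ᴿ_ : Region → Region → Set
A ⊆ᴿ B = ∀ x → A x → B x

_≐_ : Region → Region → Set
A ≐ B = ∀ x → A x ⇔ B x

_⊕_ : Region → Region → Region
(A ⊕ B) x = ∃[ p ] ∃[ q ] (A p × B q × x ≡ p +³ q)

⨁ : List Region → Region
⨁ [] x = x ≡ 0³
⨁ (A ∷ As) = A ⊕ ⨁ As

_+ᵛ_ : Region → Z3 → Region
(A +ᵛ v) x = ∃[ p ] (A p × x ≡ p +³ ι v)

lincomb : List ℚ → List Z3 → Q3
lincomb ts vs = foldr _+³_ 0³ (zipWith (λ t v → t ·³ ι v) ts vs)

conv : List Z3 → Region
conv vs x = ∃[ ts ] (length ts ≡ length vs × All (ℚ._≤_ 0ℚ) ts
                     × foldr ℚ._+_ 0ℚ ts ≡ 1ℚ × lincomb ts vs ≡ x)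

NumLatticePoints : Region → ℕ → Set
NumLatticePoints A n =
  ∃[ l ] (Unique l × length l ≡ n × (∀ (z : Z3) → (z ∈ l) ⇔ A (ι z)))

PosDim : Region → Set
PosDim A = ∃[ x ] ∃[ y ] (A x × A y × x ≢ y)

HasMinkSum : Region → ℕ → Set
HasMinkSum S L =
  ∃[ Ps ] (length Ps ≡ L × All (λ V → PosDim (conv V)) Ps
           × ⨁ (Data.List.map conv Ps) ⊆ᴿ S)

MinkowskiLength : Region → ℕ → Set
MinkowskiLength S L = HasMinkSum S L × (∀ M → HasMinkSum S M → M ℕ.≤ L)

Mat3 : Set
Mat3 = Z3 × Z3 × Z3   -- rows

dotℤ : Z3 → Z3 → ℤ
dotℤ (a , b , c) (a' , b' , c') = a ℤ.* a' ℤ.+ b ℤ.* b' ℤ.+ c ℤ.* c'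

col : Mat3 → Z3 × Z3 × Z3
col ((a , b , c) , (d , e , f) , (g , h , i)) =
  (a , d , g) , (b , e , h) , (c , f , i)

_⊗_ : Mat3 → Mat3 → Mat3
U ⊗ V with U | col V
... | (r₁ , r₂ , r₃) | (c₁ , c₂ , c₃) =
  (dotℤ r₁ c₁ , dotℤ r₁ c₂ , dotℤ r₁ c₃) ,
  (dotℤ r₂ c₁ , dotℤ r₂ c₂ , dotℤ r₂ c₃) ,
  (dotℤ r₃ c₁ , dotℤ r₃ c₂ , dotℤ r₃ c₃)

I3 : Mat3
I3 = (+ 1 , + 0 , + 0) , (+ 0 , + 1 , + 0) , (+ 0 , + 0 , + 1)

GL3ℤ : Mat3 → Set
GL3ℤ U = ∃[ V ] (U ⊗ V ≡ I3 × V ⊗ U ≡ I3)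

dotℚ : Z3 → Q3 → ℚ
dotℚ (a , b , c) (x , y , z) = ιℤ a ℚ.* x ℚ.+ ιℤ b ℚ.* y ℚ.+ ιℤ c ℚ.* z

affine : Mat3 → Z3 → Q3 → Q3
affine (r₁ , r₂ , r₃) b x = (dotℚ r₁ x , dotℚ r₂ x , dotℚ r₃ x) +³ ι b

image : (Q3 → Q3) → Region → Region
image φ A x = ∃[ p ] (A p × x ≡ φ p)

PairEquiv : Region × Region → Region × Region → Set
PairEquiv (P , Q) (P' , Q') =
  ∃[ U ] ∃[ b ] ∃[ v ] ∃[ w ] (GL3ℤ U
    × P' ≐ (image (affine U b) P +ᵛ v)
    × Q' ≐ (image (affine U b) Q +ᵛ w))

LatticeTranslate : Region → Region → Set
LatticeTranslate A B = ∃[ v ] (A ≐ (B +ᵛ v))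

det3 : Z3 → Z3 → Z3 → ℤ
det3 (a , b , c) (d , e , f) (g , h , i) =
  a ℤ.* (e ℤ.* i ℤ.- f ℤ.* h) ℤ.- b ℤ.* (d ℤ.* i ℤ.- f ℤ.* g)
  ℤ.+ c ℤ.* (d ℤ.* h ℤ.- e ℤ.* g)

Empty : List Z3 → Set
Empty vs = ∀ (z : Z3) → conv vs (ι z) → z ∈ vs

Tetrahedron : List Z3 → Set
Tetrahedron vs = ∃[ a ] ∃[ b ] ∃[ c ] ∃[ d ]
  (vs ≡ a ∷ b ∷ c ∷ d ∷ [] × det3 (b -ℤ³ a) (c -ℤ³ a) (d -ℤ³ a) ≢ + 0)

ProperlyContained : Region → Region → Set
ProperlyContained A B = A ⊆ᴿ B × ¬ (B ⊆ᴿ A)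

e₁ e₂ e₃ o : Z3
e₁ = + 1 , + 0 , + 0
e₂ = + 0 , + 1 , + 0
e₃ = + 0 , + 0 , + 1
o  = + 0 , + 0 , + 0

S₁ S₂ E K₁ K₂ S : Region
S₁ = conv (o ∷ e₁ ∷ e₂ ∷ e₃ ∷ [])
S₂ = conv (e₁ ∷ e₂ ∷ e₃ ∷ (+ 1 , + 1 , + 1) ∷ [])
E  = conv (o ∷ e₁ ∷ e₂ ∷ e₃ ∷ (+ 1 , + 1 , + 1) ∷ [])
K₁ = conv (e₁ ∷ e₂ ∷ e₃ ∷ (-[1+ 0 ] , -[1+ 0 ] , -[1+ 0 ]) ∷ [])
K₂ = conv (e₁ ∷ e₂ ∷ (+ 1 , + 1 , + 2) ∷ (-[1+ 0 ] , -[1+ 0 ] , -[1+ 0 ]) ∷ [])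
S  = conv (o ∷ (+ 0 , + 1 , + 0) ∷ (+ 1 , + 0 , + 0) ∷ (+ 1 , + 1 , + 2) ∷ [])

{-# OPTIONS --safe #-}

-- Let K be the set of lattice points of P + Q. As L(P + Q) = 2, distinct points of K are incongruent
-- modulo three and K contains no vertices of a lattice parallelepiped; as L(P) = L(Q) = 1, P and Q contain
-- no vertices of a lattice parallelogram and no two distinct points congruent modulo some m ≥ 2. Four vectors of
-- ℤ³ are dependent modulo three, and a dependence of differences of points of P and Q usually makes two sums
-- p + q congruent, so that they coincide. The few configurations which survive have a triangle common to P and Q
-- up to translation; then Q is a translate of P without a point a, and a satisfies one of the
-- linear relations that hold in E, K₂ and K₁. It remains to see that the differences of the points of P generate
-- ℤ³. Otherwise a vector outside their lattice can be moved into a fundamental cell, where it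
-- is either a new lattice point of P up to sign and translation, or yields so many points of K that
-- two of them are congruent modulo three.

module Submission where

open import Defs
open import Data.Empty using (⊥; ⊥-elim)
open import Data.Fin as Fin using (Fin; zero; suc; toℕ; fromℕ<; finToFun; funToFin)
import Data.Fin.Properties as FinP
open import Data.Integer as ℤ using (ℤ; +_; -[1+_]; 0ℤ)
open import Data.Integer.DivMod using (_%ℕ_; _/ℕ_; n%ℕd<d; a≡a%ℕn+[a/ℕn]*n)
open import Data.Integer.Divisibility.Signed as Div using (divides)
import Data.Integer.Properties as ℤP
open import Data.Integer.Tactic.RingSolver using (solve-∀)
open import Data.List as List using (List; []; _∷_; _++_; length; filter)
open import Data.List.Membership.Propositional using (_∈_; find; lose)
import Data.List.Membership.Propositional.Properties as MemP
import Data.List.Properties as ListP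
open import Data.List.Relation.Binary.Pointwise using (Pointwise; []; _∷_)
open import Data.List.Relation.Unary.All as All using (All; []; _∷_; all?)
import Data.List.Relation.Unary.All.Properties as AllP
open import Data.List.Relation.Unary.AllPairs as AllPairs using (AllPairs; []; _∷_)
import Data.List.Relation.Unary.AllPairs.Properties as AllPairsP
open import Data.List.Relation.Unary.Any as Any using (Any; here; there; any?)
import Data.List.Relation.Unary.Any.Properties as AnyP
open import Data.Nat as ℕ using (ℕ; zero; suc; NonZero; s≤s; z≤n)
import Data.Nat.ListAction as ListAction
import Data.Nat.Properties as ℕP
open import Data.Product using (∃-syntax; _×_; _,_; proj₁; proj₂; uncurry)
open import Data.Rational as ℚ using (ℚ; 0ℚ; 1ℚ; fromℚᵘ)
import Data.Rational.Properties as ℚP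
open import Data.Rational.Solver using (module +-*-Solver)
open import Data.Rational.Unnormalised as ℚᵘ using (mkℚᵘ; *≡*)
import Data.Rational.Unnormalised.Properties as ℚᵘP
open import Data.Sum using (_⊎_; inj₁; inj₂)
open import Data.Vec as Vec using (Vec; []; _∷_; lookup; tabulate)
import Data.Vec.Properties as VecP
open import Function.Bundles using (_⇔_; mk⇔; Equivalence)
open import Relation.Binary.PropositionalEquality
open import Relation.Nullary using (Dec; yes; no; ¬_; contradiction)
open import Relation.Nullary.Decidable using (toWitness; True; _→-dec_; _×-dec_; _⊎-dec_; ¬?; map′; decidable-stable)
open +-*-Solver using (_:=_) renaming (solve to solveℚ; _:+_ to _⟨+⟩_; _:*_ to _⟨*⟩_)

-- Linear relations between lattice vectors

-- P is not known to span the lattice until the end, so the proof cannot start from coordinates. It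
-- works with formal integer combinations of a few vectors, and relations between them are combined
-- with explicit multipliers. This makes the case analysis finite: four vectors have 81 combinations
-- with digits modulo three, and for each nontrivial one the known points of P + Q are searched for
-- a pair whose difference it makes divisible by three. Enough points are known only if vectors are
-- first compared modulo two. When p' - p and q' - q agree modulo two, their half sum and half
-- difference are lattice vectors, and midpoints of known points become known. Hence triangles of P
-- and Q with edges matching modulo two are sought. Such triangles may have opposite edges or
-- lattice centroids instead of being translates, so several of them must be played off against each
-- other. Relations alone cannot show that P spans the lattice, since they do not see an
-- overlattice. There, membership in P and P + Q is certified by convex combinations whose weights
-- are linear forms in rational coordinates.

infixl 6 _⊞_
infixl 6 _⊟_
infixr 7 _∙_

_⊞_ : Z3 → Z3 → Z3
(a , b , c) ⊞ (a' , b' , c') = a ℤ.+ a' , b ℤ.+ b' , c ℤ.+ c'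

_⊟_ : Z3 → Z3 → Z3
_⊟_ = _-ℤ³_

_∙_ : ℤ → Z3 → Z3
n ∙ (a , b , c) = n ℤ.* a , n ℤ.* b , n ℤ.* c

z3≡ : {a b c a' b' c' : ℤ} → a ≡ a' → b ≡ b' → c ≡ c' → (a , b , c) ≡ (a' , b' , c')
z3≡ refl refl refl = refl

V : ℕ → Set
V n = Vec ℤ n

infixl 6 _⊕ᵥ_ _⊖ᵥ_
infixr 7 _⊛_

_⊕ᵥ_ _⊖ᵥ_ : ∀ {n} → V n → V n → V n
_⊕ᵥ_ = Vec.zipWith ℤ._+_
_⊖ᵥ_ = Vec.zipWith ℤ._-_

_⊛_ : ∀ {n} → ℤ → V n → V n
c ⊛ f = Vec.map (c ℤ.*_) f

ev : ∀ {n} → V n → Vec Z3 n → Z3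
ev [] [] = o
ev (c ∷ f) (x ∷ g) = c ∙ x ⊞ ev f g

private
  add-step : ∀ (c d x e f : ℤ) → (c ℤ.+ d) ℤ.* x ℤ.+ (e ℤ.+ f) ≡ (c ℤ.* x ℤ.+ e) ℤ.+ (d ℤ.* x ℤ.+ f)
  add-step = solve-∀
  sub-step : ∀ (c d x e f : ℤ) → (c ℤ.- d) ℤ.* x ℤ.+ (e ℤ.- f) ≡ (c ℤ.* x ℤ.+ e) ℤ.- (d ℤ.* x ℤ.+ f)
  sub-step = solve-∀
  scale-step : ∀ (k c x e : ℤ) → (k ℤ.* c) ℤ.* x ℤ.+ k ℤ.* e ≡ k ℤ.* (c ℤ.* x ℤ.+ e)
  scale-step = solve-∀

ev-⊕ : ∀ {n} (f h : V n) g → ev (f ⊕ᵥ h) g ≡ ev f g ⊞ ev h g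
ev-⊕ [] [] [] = refl
ev-⊕ (c ∷ f) (d ∷ h) ((x , y , z) ∷ g) rewrite ev-⊕ f h g =
  z3≡ (add-step c d x _ _) (add-step c d y _ _) (add-step c d z _ _)

ev-⊖ : ∀ {n} (f h : V n) g → ev (f ⊖ᵥ h) g ≡ ev f g ⊟ ev h g
ev-⊖ [] [] [] = refl
ev-⊖ (c ∷ f) (d ∷ h) ((x , y , z) ∷ g) rewrite ev-⊖ f h g =
  z3≡ (sub-step c d x _ _) (sub-step c d y _ _) (sub-step c d z _ _)

ev-⊛ : ∀ {n} k (f : V n) g → ev (k ⊛ f) g ≡ k ∙ ev f g
ev-⊛ k [] [] = z3≡ (sym (ℤP.*-zeroʳ k)) (sym (ℤP.*-zeroʳ k)) (sym (ℤP.*-zeroʳ k))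
ev-⊛ k (c ∷ f) ((x , y , z) ∷ g) rewrite ev-⊛ k f g =
  z3≡ (scale-step k c x _) (scale-step k c y _) (scale-step k c z _)

ev-0 : ∀ {n} (g : Vec Z3 n) → ev (Vec.replicate n 0ℤ) g ≡ o
ev-0 [] = refl
ev-0 (x ∷ g) rewrite ev-0 g = refl

unit : ∀ {n} → Fin n → V n
unit {suc n} zero = + 1 ∷ Vec.replicate n 0ℤ
unit (suc i) = 0ℤ ∷ unit i

ev-unit : ∀ {n} (i : Fin n) g → ev (unit i) g ≡ lookup g i
ev-unit zero ((x , y , z) ∷ g) rewrite ev-0 g =
  z3≡ (one x) (one y) (one z)
  where one : ∀ (x : ℤ) → + 1 ℤ.* x ℤ.+ 0ℤ ≡ x
        one = solve-∀
ev-unit (suc i) ((x , y , z) ∷ g) rewrite ev-unit i g =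
  z3≡ (ℤP.+-identityˡ _) (ℤP.+-identityˡ _) (ℤP.+-identityˡ _)

infixl 6 _:+_ _:-_
infixr 7 _:*_

data Expr (n : ℕ) : Set where
  var       : Fin n → Expr n
  :0        : Expr n
  _:+_ _:-_ : Expr n → Expr n → Expr n
  _:*_      : ℤ → Expr n → Expr n
  :ev       : V n → Expr n

⟦_⟧ : ∀ {n} → Expr n → Vec Z3 n → Z3
⟦ var i ⟧ g = lookup g i
⟦ :0 ⟧ g = o
⟦ a :+ b ⟧ g = ⟦ a ⟧ g ⊞ ⟦ b ⟧ g
⟦ a :- b ⟧ g = ⟦ a ⟧ g ⊟ ⟦ b ⟧ g
⟦ k :* a ⟧ g = k ∙ ⟦ a ⟧ g
⟦ :ev f ⟧ g = ev f g

nf : ∀ {n} → Expr n → V n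
nf (var i) = unit i
nf {n} :0 = Vec.replicate n 0ℤ
nf (a :+ b) = nf a ⊕ᵥ nf b
nf (a :- b) = nf a ⊖ᵥ nf b
nf (k :* a) = k ⊛ nf a
nf (:ev f) = f

nf-sound : ∀ {n} (e : Expr n) g → ⟦ e ⟧ g ≡ ev (nf e) g
nf-sound (var i) g = sym (ev-unit i g)
nf-sound :0 g = sym (ev-0 g)
nf-sound (a :+ b) g = trans (cong₂ _⊞_ (nf-sound a g) (nf-sound b g)) (sym (ev-⊕ (nf a) (nf b) g))
nf-sound (a :- b) g = trans (cong₂ _⊟_ (nf-sound a g) (nf-sound b g)) (sym (ev-⊖ (nf a) (nf b) g))
nf-sound (k :* a) g = trans (cong (k ∙_) (nf-sound a g)) (sym (ev-⊛ k (nf a) g))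
nf-sound (:ev f) g = refl

vec≡ : ∀ {n} (g : Vec Z3 n) (a b : Expr n) → nf a ≡ nf b → ⟦ a ⟧ g ≡ ⟦ b ⟧ g
vec≡ g a b eq = trans (nf-sound a g) (trans (cong (λ f → ev f g) eq) (sym (nf-sound b g)))

Eqn : ℕ → Set
Eqn n = ℤ × Expr n × Expr n

Holds : ∀ {n} → Vec Z3 n → Eqn n → Set
Holds g (_ , a , b) = ⟦ a ⟧ g ≡ ⟦ b ⟧ g

combine : ∀ {n} → List (Eqn n) → V n
combine {n} [] = Vec.replicate n 0ℤ
combine ((k , a , b) ∷ es) = k ⊛ (nf a ⊖ᵥ nf b) ⊕ᵥ combine es

⊟-self : ∀ x → x ⊟ x ≡ o
⊟-self (x , y , z) = z3≡ (ℤP.+-inverseʳ x) (ℤP.+-inverseʳ y) (ℤP.+-inverseʳ z)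

⊟≡o⇒≡ : ∀ {x y} → x ⊟ y ≡ o → x ≡ y
⊟≡o⇒≡ {a , b , c} {a' , b' , c'} eq = z3≡
  (ℤP.i-j≡0⇒i≡j a a' (cong proj₁ eq))
  (ℤP.i-j≡0⇒i≡j b b' (cong (λ t → proj₁ (proj₂ t)) eq))
  (ℤP.i-j≡0⇒i≡j c c' (cong (λ t → proj₂ (proj₂ t)) eq))

∙-o : ∀ k → k ∙ o ≡ o
∙-o k = z3≡ (ℤP.*-zeroʳ k) (ℤP.*-zeroʳ k) (ℤP.*-zeroʳ k)

combine-0 : ∀ {n} (g : Vec Z3 n) es → All (Holds g) es → ev (combine es) g ≡ o
combine-0 g [] [] = ev-0 g
combine-0 g ((k , a , b) ∷ es) (h ∷ hs) = begin
  ev (k ⊛ (nf a ⊖ᵥ nf b) ⊕ᵥ combine es) g     ≡⟨ ev-⊕ (k ⊛ (nf a ⊖ᵥ nf b)) (combine es) g ⟩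
  ev (k ⊛ (nf a ⊖ᵥ nf b)) g ⊞ ev (combine es) g ≡⟨ cong₂ _⊞_ (trans (ev-⊛ k (nf a ⊖ᵥ nf b) g) (trans (cong (k ∙_) eq) (∙-o k))) (combine-0 g es hs) ⟩
  o ∎
  where
  open ≡-Reasoning
  eq : ev (nf a ⊖ᵥ nf b) g ≡ o
  eq = trans (ev-⊖ (nf a) (nf b) g)
         (trans (cong₂ _⊟_ (sym (nf-sound a g)) (sym (nf-sound b g)))
           (trans (cong (_⊟ ⟦ b ⟧ g) h) (⊟-self (⟦ b ⟧ g))))

-- The multipliers in `es` are the certificate: with them the claim becomes an identity of
-- coefficient vectors, which `refl` settles for numerals.
lin≡ : ∀ {n} (g : Vec Z3 n) (es : List (Eqn n)) → All (Holds g) es →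
       (a b : Expr n) → nf a ⊖ᵥ nf b ≡ combine es → ⟦ a ⟧ g ≡ ⟦ b ⟧ g
lin≡ g es hs a b eq = ⊟≡o⇒≡ (begin
  ⟦ a ⟧ g ⊟ ⟦ b ⟧ g           ≡⟨ cong₂ _⊟_ (nf-sound a g) (nf-sound b g) ⟩
  ev (nf a) g ⊟ ev (nf b) g   ≡⟨ ev-⊖ (nf a) (nf b) g ⟨
  ev (nf a ⊖ᵥ nf b) g         ≡⟨ cong (λ f → ev f g) eq ⟩
  ev (combine es) g           ≡⟨ combine-0 g es hs ⟩
  o ∎)
  where open ≡-Reasoning

∙-cancel : ∀ k .{{_ : ℤ.NonZero k}} {x y} → k ∙ x ≡ k ∙ y → x ≡ y
∙-cancel k {a , b , c} {a' , b' , c'} eq = z3≡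
  (ℤP.*-cancelˡ-≡ k a a' (cong proj₁ eq))
  (ℤP.*-cancelˡ-≡ k b b' (cong (λ t → proj₁ (proj₂ t)) eq))
  (ℤP.*-cancelˡ-≡ k c c' (cong (λ t → proj₂ (proj₂ t)) eq))

infix 4 _≟³_
_≟³_ : (x y : Z3) → Dec (x ≡ y)
(a , b , c) ≟³ (a' , b' , c') with a ℤ.≟ a' | b ℤ.≟ b' | c ℤ.≟ c'
... | yes refl | yes refl | yes refl = yes refl
... | no ne | _ | _ = no λ e → ne (cong proj₁ e)
... | yes _ | no ne | _ = no λ e → ne (cong (λ t → proj₁ (proj₂ t)) e)
... | yes _ | yes _ | no ne = no λ e → ne (cong (λ t → proj₂ (proj₂ t)) e)

∙-⊟ : ∀ k x y → k ∙ x ⊟ k ∙ y ≡ k ∙ (x ⊟ y)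
∙-⊟ k (a , b , c) (a' , b' , c') = z3≡ (go k a a') (go k b b') (go k c c')
  where go : ∀ (k a b : ℤ) → k ℤ.* a ℤ.- k ℤ.* b ≡ k ℤ.* (a ℤ.- b)
        go = solve-∀

Multiple : ℕ → Z3 → Set
Multiple m x = ∃[ y ] x ≡ + m ∙ y

-- Linear dependence modulo m of four vectors of ℤ³, by the pigeonhole principle m³ < m⁴.
module Dependence (m : ℕ) .{{_ : NonZero m}} (1<m : 1 ℕ.< m)
  (residue-inj : ∀ (a b : Fin m) → (+ toℕ a ℤ.- + toℕ b) %ℕ m ≡ 0 → a ≡ b) where

  coord : Z3 → Fin 3 → ℤ
  coord (a , b , c) zero = a
  coord (a , b , c) (suc zero) = b
  coord (a , b , c) (suc (suc zero)) = c

  residue : Z3 → Fin 3 → Fin m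
  residue x i = fromℕ< (n%ℕd<d (coord x i) m)

  private
    sub-mod : ∀ (a b r p q m : ℤ) → a ≡ r ℤ.+ p ℤ.* m → b ≡ r ℤ.+ q ℤ.* m → a ℤ.- b ≡ m ℤ.* (p ℤ.- q)
    sub-mod a b r p q m refl refl = go r p q m
      where go : ∀ (r p q m : ℤ) → (r ℤ.+ p ℤ.* m) ℤ.- (r ℤ.+ q ℤ.* m) ≡ m ℤ.* (p ℤ.- q)
            go = solve-∀
    coord-mod : ∀ a b → fromℕ< (n%ℕd<d a m) ≡ fromℕ< (n%ℕd<d b m) → a ℤ.- b ≡ + m ℤ.* (a /ℕ m ℤ.- b /ℕ m)
    coord-mod a b eq = sub-mod a b (+ (a %ℕ m)) (a /ℕ m) (b /ℕ m) (+ m) (a≡a%ℕn+[a/ℕn]*n a m)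
      (trans (a≡a%ℕn+[a/ℕn]*n b m) (cong (λ r → + r ℤ.+ b /ℕ m ℤ.* + m)
        (trans (sym (FinP.toℕ-fromℕ< (n%ℕd<d b m))) (trans (cong toℕ (sym eq)) (FinP.toℕ-fromℕ< (n%ℕd<d a m))))))

  same-residue : ∀ x y → (∀ i → residue x i ≡ residue y i) → Multiple m (x ⊟ y)
  same-residue (a , b , c) (a' , b' , c') eq = _ , z3≡
    (coord-mod a a' (eq zero)) (coord-mod b b' (eq (suc zero))) (coord-mod c c' (eq (suc (suc zero))))

  digits : Vec (Fin m) 4 → V 4
  digits = Vec.map (λ d → + toℕ d)

  reduce : ∀ {n} → V n → Vec (Fin m) n
  reduce = Vec.map (λ c → fromℕ< (n%ℕd<d c m))

  reduce-ev : ∀ {n} (f : V n) → ∃[ h ] Vec.map (λ d → + toℕ d) (reduce f) ≡ f ⊖ᵥ + m ⊛ h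
  reduce-ev [] = [] , refl
  reduce-ev (c ∷ f) with reduce-ev f
  ... | h , eq = c /ℕ m ∷ h , cong₂ _∷_
      (trans (cong +_ (FinP.toℕ-fromℕ< (n%ℕd<d c m))) (go c (+ (c %ℕ m)) (c /ℕ m) (+ m) (a≡a%ℕn+[a/ℕn]*n c m))) eq
    where
    go : ∀ (c r q m : ℤ) → c ≡ r ℤ.+ q ℤ.* m → r ≡ c ℤ.- m ℤ.* q
    go c r q m refl = go' r q m
      where go' : ∀ (r q m : ℤ) → r ≡ (r ℤ.+ q ℤ.* m) ℤ.- m ℤ.* q
            go' = solve-∀

  zeros : Vec (Fin m) 4
  zeros = Vec.replicate 4 (fromℕ< (ℕP.<-trans (s≤s z≤n) 1<m))

  private
    difference-mod : ∀ (a b : Vec (Fin m) 4) v →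
      Multiple m (ev (digits a) v ⊟ ev (digits b) v) → Multiple m (ev (digits (reduce (digits a ⊖ᵥ digits b))) v)
    difference-mod a b v (y , eq') with reduce-ev (digits a ⊖ᵥ digits b)
    ... | h , eq = y ⊟ ev h v , (begin
        ev (digits (reduce f)) v             ≡⟨ cong (λ q → ev q v) eq ⟩
        ev (f ⊖ᵥ + m ⊛ h) v                  ≡⟨ ev-⊖ f (+ m ⊛ h) v ⟩
        ev f v ⊟ ev (+ m ⊛ h) v              ≡⟨ cong₂ _⊟_ (trans (ev-⊖ (digits a) (digits b) v) eq') (ev-⊛ (+ m) h v) ⟩
        + m ∙ y ⊟ + m ∙ ev h v               ≡⟨ ∙-⊟ (+ m) y (ev h v) ⟩
        + m ∙ (y ⊟ ev h v) ∎)
      where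
      open ≡-Reasoning
      f = digits a ⊖ᵥ digits b

    digit≡ : ∀ a b → fromℕ< (n%ℕd<d (+ toℕ a ℤ.- + toℕ b) m) ≡ fromℕ< (ℕP.<-trans (s≤s z≤n) 1<m) → a ≡ b
    digit≡ a b eq = residue-inj a b (trans (sym (FinP.toℕ-fromℕ< (n%ℕd<d (+ toℕ a ℤ.- + toℕ b) m)))
      (trans (cong toℕ eq) (FinP.toℕ-fromℕ< (ℕP.<-trans (s≤s z≤n) 1<m))))

    digits≡ : ∀ {n} (a b : Vec (Fin m) n) →
              reduce (Vec.map (λ d → + toℕ d) a ⊖ᵥ Vec.map (λ d → + toℕ d) b)
                ≡ Vec.replicate n (fromℕ< (ℕP.<-trans (s≤s z≤n) 1<m)) → a ≡ b
    digits≡ [] [] eq = refl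
    digits≡ (a ∷ as) (b ∷ bs) eq = cong₂ _∷_ (digit≡ a b (VecP.∷-injectiveˡ eq)) (digits≡ as bs (VecP.∷-injectiveʳ eq))

    funToFin-cong : ∀ {k n} {p q : Fin k → Fin n} → (∀ t → p t ≡ q t) → funToFin p ≡ funToFin q
    funToFin-cong {zero} _ = refl
    funToFin-cong {suc k} h = cong₂ Fin.combine (h zero) (funToFin-cong (λ t → h (suc t)))

    funToFin-inj : ∀ {k n} {p q : Fin k → Fin n} → funToFin p ≡ funToFin q → ∀ t → p t ≡ q t
    funToFin-inj {p = p} {q} eq t = trans (sym (FinP.finToFun-funToFin p t))
      (trans (cong (λ z → finToFun z t) eq) (FinP.finToFun-funToFin q t))

    toDigits : Fin (m ℕ.^ 4) → Vec (Fin m) 4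
    toDigits k = tabulate (finToFun k)

    toDigits-inj : ∀ i j → toDigits i ≡ toDigits j → i ≡ j
    toDigits-inj i j eq = trans (sym (FinP.funToFin-finToFin {4} {m} i))
      (trans (funToFin-cong {4} {m} (λ t → trans (sym (VecP.lookup∘tabulate (finToFun i) t))
                     (trans (cong (λ w → lookup w t) eq) (VecP.lookup∘tabulate (finToFun j) t))))
      (FinP.funToFin-finToFin {4} {m} j))

    combination : Vec Z3 4 → Fin (m ℕ.^ 4) → Z3
    combination v k = ev (digits (toDigits k)) v

    -- The difference of two colliding digit vectors may have negative entries; reducing it keeps it
    -- nonzero, because distinct digits differ modulo m.
    collide : ∀ v i j → i ≢ j → funToFin (residue (combination v i)) ≡ funToFin (residue (combination v j)) →
              ∃[ d ] (d ≢ zeros × Multiple m (ev (digits d) v))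
    collide v i j i≢j eq = reduce (digits (toDigits i) ⊖ᵥ digits (toDigits j)) ,
      (λ z → i≢j (toDigits-inj i j (digits≡ (toDigits i) (toDigits j) z))) ,
      difference-mod (toDigits i) (toDigits j) v (same-residue (combination v i) (combination v j) (funToFin-inj eq))

  dependent : (v : Vec Z3 4) → ∃[ d ] (d ≢ zeros × Multiple m (ev (digits d) v))
  dependent v with FinP.pigeonhole (ℕP.^-monoʳ-< m 1<m (ℕP.n<1+n 3)) (λ k → funToFin (residue (combination v k)))
  ... | i , j , i<j , eq = collide v i j (FinP.<⇒≢ i<j) eq

-- Only the moduli three and two occur, so the separation of digits by their residues is a finite
-- check.
module Mod3 = Dependence 3 (s≤s (s≤s z≤n))
  (toWitness {a? = FinP.all? λ a → FinP.all? λ b → (((+ toℕ a ℤ.- + toℕ b) %ℕ 3) ℕ.≟ 0) →-dec (a Fin.≟ b)} _)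
module Mod2 = Dependence 2 (s≤s (s≤s z≤n))
  (toWitness {a? = FinP.all? λ a → FinP.all? λ b → (((+ toℕ a ℤ.- + toℕ b) %ℕ 2) ℕ.≟ 0) →-dec (a Fin.≟ b)} _)

-- Configurations and collisions modulo three

-- Formal combinations of five vectors; once one of these is dropped, the other four are dependent
-- modulo three.
F : Set
F = V 5

infix 4 _≟ᵥ_
_≟ᵥ_ : ∀ {n} (f h : V n) → Dec (f ≡ h)
_≟ᵥ_ = VecP.≡-dec ℤ._≟_

Divides : ∀ {n} (p : ℕ) .{{_ : NonZero p}} → V n → Set
Divides p f = f ≡ + p ⊛ Vec.map (_/ℕ p) f

divides? : ∀ {n} (p : ℕ) .{{_ : NonZero p}} (f : V n) → Dec (Divides p f)
divides? p f = f ≟ᵥ + p ⊛ Vec.map (_/ℕ p) f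

addIfNew : F → List F → List F
addIfNew f fs with any? (f ≟ᵥ_) fs
... | yes _ = fs
... | no _ = f ∷ fs

sums : List F → List F → List F
sums [] bs = []
sums (a ∷ as) bs = List.foldr (λ b → addIfNew (a ⊕ᵥ b)) (sums as bs) bs

addHalf : F → F → List F → List F
addHalf f h fs with divides? 2 (f ⊕ᵥ h)
... | yes _ = addIfNew (Vec.map (_/ℕ 2) (f ⊕ᵥ h)) fs
... | no _ = fs

withHalves : List F → List F → List F → List F
withHalves [] gs acc = acc
withHalves (f ∷ fs) gs acc = List.foldr (addHalf f) (withHalves fs gs acc) gs

-- Convexity makes midpoints of points of K again points of K. A single round suffices for the
-- checks below.
halves : List F → List F
halves fs = withHalves fs fs fs

differences : List F → List F
differences [] = []
differences (a ∷ as) = List.map (a ⊖ᵥ_) as ++ differences as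

-- All a + b - c - d with a, b, c, d in distinct positions, up to sign.
crossings₄ : F → F → F → List F → List F
crossings₄ a b c [] = []
crossings₄ a b c (d ∷ ds) =
  a ⊕ᵥ b ⊖ᵥ (c ⊕ᵥ d) ∷ a ⊕ᵥ c ⊖ᵥ (b ⊕ᵥ d) ∷ a ⊕ᵥ d ⊖ᵥ (b ⊕ᵥ c) ∷ crossings₄ a b c ds

crossings₃ : F → F → List F → List F
crossings₃ a b [] = []
crossings₃ a b (c ∷ cs) = crossings₄ a b c cs ++ crossings₃ a b cs

crossings₂ : F → List F → List F
crossings₂ a [] = []
crossings₂ a (b ∷ bs) = crossings₃ a b bs ++ crossings₂ a bs

crossings : List F → List F
crossings [] = []
crossings (a ∷ as) = crossings₂ a as ++ crossings as

factors : List ℤ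
factors = + 1 ∷ -[1+ 0 ] ∷ + 2 ∷ -[1+ 1 ] ∷ + 3 ∷ -[1+ 2 ] ∷ []

-- As ℤ³ is torsion free, `r` and `z` then vanish together; the short list of factors keeps the
-- search small.
data Proportional (r z : F) : Set where
  prop : Any (λ k → (r ≡ k ⊛ z) ⊎ (z ≡ k ⊛ r)) factors → Proportional r z

proportional? : ∀ r z → Dec (Proportional r z)
proportional? r z with any? (λ k → (r ≟ᵥ k ⊛ z) ⊎-dec (z ≟ᵥ k ⊛ r)) factors
... | yes p = yes (prop p)
... | no np = no λ { (prop p) → np p }

-- The relation r = 0 makes the primitive vector z divisible by p.
Imprimitive : (p : ℕ) .{{_ : NonZero p}} → F → F → Set
Imprimitive p r z = Any (λ m → Divides p (z ⊖ᵥ + m ⊛ r)) (List.upTo p)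

imprimitive? : (p : ℕ) .{{_ : NonZero p}} (r z : F) → Dec (Imprimitive p r z)
imprimitive? p r z = any? (λ m → divides? p (z ⊖ᵥ + m ⊛ r)) (List.upTo p)

-- A difference of two distinct points of P, or of Q, is divisible by no prime; two, three and five
-- cover the relations that arise.
BadPrimitive : F → F → Set
BadPrimitive r z = Imprimitive 2 r z ⊎ Imprimitive 3 r z ⊎ Imprimitive 5 r z

badPrimitive? : ∀ r z → Dec (BadPrimitive r z)
badPrimitive? r z = imprimitive? 2 r z ⊎-dec (imprimitive? 3 r z ⊎-dec imprimitive? 5 r z)

-- Only a multiple of `r` is subtracted, so values do not change where `r` vanishes. If the entry
-- `j` of `r` is a unit, the entry `j` of the result is zero.
eliminate : Fin 5 → F → F → F
eliminate j r f = f ⊖ᵥ (lookup f j ℤ.* lookup r j) ⊛ r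

NonzeroIn : List F → F → Set
NonzeroIn nz v = Any (Proportional v) nz

-- Two parallel segments of lattice length two; together with their midpoints they give a sum of
-- three segments inside P + Q.
Ladder : List F → List F → Set
Ladder kn nz = Any (λ x → Any (λ x' → Divides 2 (x' ⊖ᵥ x) × NonzeroIn nz (x' ⊖ᵥ x) ×
  Any (λ y → NonzeroIn nz (y ⊖ᵥ x) × (y ⊕ᵥ (x' ⊖ᵥ x)) ∈ kn) kn) kn) kn

ladder? : ∀ kn nz → Dec (Ladder kn nz)
ladder? kn nz = any? (λ x → any? (λ x' → divides? 2 (x' ⊖ᵥ x) ×-dec (any? (proportional? (x' ⊖ᵥ x)) nz ×-dec
  any? (λ y → any? (proportional? (y ⊖ᵥ x)) nz ×-dec any? ((y ⊕ᵥ (x' ⊖ᵥ x)) ≟ᵥ_) kn) kn)) kn) kn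

-- A ladder may become visible only after a vector is eliminated by the relation. New midpoints
-- appear as well, hence the second use of `halves`.
BadLadder : List F → List F → F → Set
BadLadder kn nz r = Any (λ j → (ℤ.∣ lookup r j ∣ ≡ 1) ×
  Ladder (halves (List.map (eliminate j r) kn)) (List.map (eliminate j r) nz)) (List.allFin 5)

badLadder? : ∀ kn nz r → Dec (BadLadder kn nz r)
badLadder? kn nz r = any? (λ j → (ℤ.∣ lookup r j ∣ ℕ.≟ 1) ×-dec
  ladder? (halves (List.map (eliminate j r) kn)) (List.map (eliminate j r) nz)) (List.allFin 5)

-- Here `l` is supposed to vanish modulo three. Then the points at `f` and `h` are congruent modulo
-- three, hence equal, and `f ⊖ᵥ h` is a relation that holds.
Collision : List F → F → (F → Set) → Set
Collision kn l Q = Any (λ f → Any (λ h → Divides 3 ((f ⊖ᵥ h) ⊖ᵥ l) × Q (f ⊖ᵥ h)) kn) kn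

collision? : ∀ kn l {Q : F → Set} → (∀ r → Dec (Q r)) → Dec (Collision kn l Q)
collision? kn l Q? = any? (λ f → any? (λ h → divides? 3 ((f ⊖ᵥ h) ⊖ᵥ l) ×-dec Q? (f ⊖ᵥ h)) kn) kn

-- Resolved kn pd nz res l: if l vanishes modulo 3, then some collision modulo 3 of known points is
-- absurd, or yields a relation listed in res.
Resolved : List F → List F → List F → List F → F → Set
Resolved kn pd nz res l =
    Collision kn l (λ r → Any (BadPrimitive r) pd)
  ⊎ Collision kn l (λ r → Any (Proportional r) nz)
  ⊎ Collision kn l (_∈ res)
  ⊎ Collision kn l (BadLadder kn (pd ++ nz))

resolved? : ∀ kn pd nz res l → Dec (Resolved kn pd nz res l)
resolved? kn pd nz res l =
    collision? kn l (λ r → any? (badPrimitive? r) pd)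
  ⊎-dec (collision? kn l (λ r → any? (proportional? r) nz)
  ⊎-dec (collision? kn l (λ r → any? (r ≟ᵥ_) res)
  ⊎-dec collision? kn l (badLadder? kn (pd ++ nz))))

-- `as` and `bs` are points of P and Q relative to base points and `extra` lists vectors known to be
-- nonzero; `res` collects the relations and `miss` the dependences modulo three that may survive.
record Config : Set where
  constructor config
  field
    as bs extra res miss : List F
    dropped : Fin 5

insertDigits : Fin 5 → Vec (Fin 3) 4 → F
insertDigits j d = Vec.insertAt (Vec.map (λ t → + toℕ t) d) j 0ℤ

Good : List F → List F → List F → List F → List F → F → Set
Good kn pd nz res miss l = l ≡ Vec.replicate 5 0ℤ ⊎ l ∈ miss ⊎ Resolved kn pd nz res l

good? : ∀ kn pd nz res miss l → Dec (Good kn pd nz res miss l)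
good? kn pd nz res miss l = (l ≟ᵥ _) ⊎-dec (any? (l ≟ᵥ_) miss ⊎-dec resolved? kn pd nz res l)

AllGood : List F → List F → List F → List F → List F → Fin 5 → Set
AllGood kn pd nz res miss j = ∀ a b c d → Good kn pd nz res miss (insertDigits j (a ∷ b ∷ c ∷ d ∷ []))

allGood? : ∀ kn pd nz res miss j → Dec (AllGood kn pd nz res miss j)
allGood? kn pd nz res miss j = FinP.all? λ a → FinP.all? λ b → FinP.all? λ c → FinP.all? λ d → good? kn pd nz res miss _

known primitives nonzeros : Config → List F
known c = halves (sums (Config.as c) (Config.bs c))
primitives c = differences (Config.as c) ++ differences (Config.bs c)
nonzeros c = Config.extra c ++ crossings (Config.as c) ++ crossings (Config.bs c)

Checked : Config → Set
Checked c = AllGood (known c) (primitives c) (nonzeros c) (Config.res c) (Config.miss c) (Config.dropped c)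

checked? : ∀ c → Dec (Checked c)
checked? c = allGood? (known c) (primitives c) (nonzeros c) (Config.res c) (Config.miss c) (Config.dropped c)

i1 i2 i3 i4 i5 : F
i1 = unit zero
i2 = unit (suc zero)
i3 = unit (suc (suc zero))
i4 = unit (suc (suc (suc zero)))
i5 = unit (suc (suc (suc (suc zero))))
0ᵥ : F
0ᵥ = Vec.replicate 5 0ℤ

-- The properties of lattice points on which the argument rests

total : List (ℕ × Z3) → ℕ
total [] = 0
total ((n , _) ∷ ws) = n ℕ.+ total ws

weighted : List (ℕ × Z3) → Z3
weighted [] = o
weighted ((n , x) ∷ ws) = + n ∙ x ⊞ weighted ws

-- X contains the lattice points of the convex hull of its elements.
Convex : (Z3 → Set) → Set
Convex X = ∀ (ws : List (ℕ × Z3)) z → All (λ w → X (proj₂ w)) ws → 0 ℕ.< total ws →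
           + total ws ∙ z ≡ weighted ws → X z

-- The consequences for the lattice points X of a polytope of Minkowski length one.
record LengthOne (X : Z3 → Set) : Set where
  field
    convex    : Convex X
    indivisible : ∀ {x y} p → 2 ℕ.≤ p → X x → X y → Multiple p (x ⊟ y) → x ≡ y
    crossing  : ∀ {a b c d} → X a → X b → X c → X d → a ⊞ b ≡ c ⊞ d → a ≡ c ⊎ b ≡ c

-- P, Q and K are the lattice points of two polytopes and of their sum.
record System (P Q K : Z3 → Set) : Set where
  field
    oneP   : LengthOne P
    oneQ   : LengthOne Q
    sum    : ∀ {x y} → P x → Q y → K (x ⊞ y)
    convex : Convex K
    triple : ∀ {x y} → K x → K y → Multiple 3 (x ⊟ y) → x ≡ y
    ladder : ∀ {x x' y y'} w → K x → K x' → K y → K y' → x' ⊟ x ≡ + 2 ∙ w → y' ⊟ y ≡ + 2 ∙ w →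
             w ≡ o ⊎ x ≡ y
    box    : ∀ {x} u v w → K x → K (x ⊞ u) → K (x ⊞ v) → K (x ⊞ w) → K (x ⊞ (u ⊞ v)) → K (x ⊞ (u ⊞ w)) →
             K (x ⊞ (v ⊞ w)) → K (x ⊞ (u ⊞ (v ⊞ w))) → u ≡ o ⊎ v ≡ o ⊎ w ≡ o

swap : ∀ {P Q K} → System P Q K → System Q P K
swap {K = K} S = record
  { oneP = oneQ ; oneQ = oneP ; sum = λ {x} {y} q p → subst K (vec≡ (y ∷ x ∷ []) (v0 :+ v1) (v1 :+ v0) refl) (sum p q)
  ; convex = convex ; triple = triple ; ladder = ladder ; box = box }
  where
  open System S
  v0 v1 : Expr 2
  v0 = var zero
  v1 = var (suc zero)

-- Soundness of the collision checks

ev-divides : ∀ {n} p .{{_ : NonZero p}} (f : V n) g → Divides p f → Multiple p (ev f g)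
ev-divides p f g d = ev (Vec.map (_/ℕ p) f) g , trans (cong (λ q → ev q g) d) (ev-⊛ (+ p) (Vec.map (_/ℕ p) f) g)

factors-nonzero : All ℤ.NonZero factors
factors-nonzero = _ ∷ _ ∷ _ ∷ _ ∷ _ ∷ _ ∷ []

ev-proportional : ∀ {r z} g → Proportional r z → ev r g ≡ o → ev z g ≡ o
ev-proportional {r} {z} g (prop a) e with find a
... | k , k∈ , inj₁ refl = ∙-cancel k {{All.lookup factors-nonzero k∈}} (trans (sym (ev-⊛ k z g)) (trans e (sym (∙-o k))))
... | k , k∈ , inj₂ refl = trans (ev-⊛ k r g) (trans (cong (k ∙_) e) (∙-o k))

ev-⊖-relation : ∀ {n} k (f r : V n) g → ev r g ≡ o → ev (f ⊖ᵥ k ⊛ r) g ≡ ev f g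
ev-⊖-relation k f r g e = lin≡ g ((ℤ.- k , :ev r , :0) ∷ []) (e ∷ []) (:ev (f ⊖ᵥ k ⊛ r)) (:ev f) (go k f r)
  where
  go : ∀ {n} k (f r : V n) → (f ⊖ᵥ k ⊛ r) ⊖ᵥ f ≡ combine ((ℤ.- k , :ev r , :0) ∷ [])
  go k [] [] = refl
  go k (x ∷ f) (y ∷ r) = cong₂ _∷_ (step x k y) (go k f r)
    where
    step : ∀ (x k y : ℤ) → (x ℤ.- k ℤ.* y) ℤ.- x ≡ (ℤ.- k) ℤ.* (y ℤ.- 0ℤ) ℤ.+ 0ℤ
    step = solve-∀

Distinct : Vec Z3 5 → F → F → Set
Distinct g f h = ev f g ≢ ev h g

module Resolve {P Q K : Z3 → Set} (S : System P Q K) (p q : Z3) (g : Vec Z3 5) where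
  open System S

  At : (Z3 → Set) → Z3 → F → Set
  At X c f = X (c ⊞ ev f g)

  c : Z3
  c = p ⊞ q

  Primitive : F → Set
  Primitive z = ∀ k → 2 ℕ.≤ k → ¬ Multiple k (ev z g)

  Nonzero : F → Set
  Nonzero z = ev z g ≢ o

  half : ∀ {x y} z → K x → K y → x ⊞ y ≡ + 2 ∙ z → K z
  half {x} {y} z kx ky e = convex ((1 , x) ∷ (1 , y) ∷ []) z (kx ∷ ky ∷ []) (s≤s z≤n)
    (trans (sym e) (vec≡ (x ∷ y ∷ []) (var zero :+ var (suc zero)) (+ 1 :* var zero :+ (+ 1 :* var (suc zero) :+ :0)) refl))

  addIfNew-known : ∀ {f fs} → At K c f → All (At K c) fs → All (At K c) (addIfNew f fs)
  addIfNew-known {f} {fs} k ks with any? (f ≟ᵥ_) fs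
  ... | yes _ = ks
  ... | no _ = k ∷ ks

  sums-known : ∀ {as bs} → All (At P p) as → All (At Q q) bs → All (At K c) (sums as bs)
  sums-known [] qs = []
  sums-known {a ∷ as} {bs} (pa ∷ ps) qs = go qs
    where
    rest : All (At K c) (sums as bs)
    rest = sums-known ps qs
    go : ∀ {bs'} → All (At Q q) bs' → All (At K c) (List.foldr (λ b → addIfNew (a ⊕ᵥ b)) (sums as bs) bs')
    go [] = rest
    go {b ∷ bs'} (qb ∷ qs') = addIfNew-known {a ⊕ᵥ b} {List.foldr (λ b → addIfNew (a ⊕ᵥ b)) (sums as bs) bs'}
      (subst K (vec≡ (p ∷ q ∷ ev a g ∷ ev b g ∷ []) ((w0 :+ w2) :+ (w1 :+ w3)) ((w0 :+ w1) :+ (w2 :+ w3)) refl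
                 ▷ cong (c ⊞_) (sym (ev-⊕ a b g))) (sum pa qb)) (go qs')
      where
      w0 w1 w2 w3 : Expr 4
      w0 = var zero
      w1 = var (suc zero)
      w2 = var (suc (suc zero))
      w3 = var (suc (suc (suc zero)))
      infixl 4 _▷_
      _▷_ : ∀ {x y z : Z3} → x ≡ y → y ≡ z → x ≡ z
      _▷_ = trans

  addHalf-known : ∀ {f h fs} → At K c f → At K c h → All (At K c) fs → All (At K c) (addHalf f h fs)
  addHalf-known {f} {h} {fs} kf kh ks with divides? 2 (f ⊕ᵥ h)
  ... | no _ = ks
  ... | yes d = addIfNew-known {Vec.map (_/ℕ 2) (f ⊕ᵥ h)} (half _ kf kh
      (lin≡ (c ∷ ev f g ∷ ev h g ∷ proj₁ m ∷ []) ((+ 1 , w1 :+ w2 , + 2 :* w3) ∷ [])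
        (trans (sym (ev-⊕ f h g)) (proj₂ m) ∷ [])
        ((w0 :+ w1) :+ (w0 :+ w2)) (+ 2 :* (w0 :+ w3)) refl)) ks
    where
    m = ev-divides 2 (f ⊕ᵥ h) g d
    w0 w1 w2 w3 : Expr 4
    w0 = var zero
    w1 = var (suc zero)
    w2 = var (suc (suc zero))
    w3 = var (suc (suc (suc zero)))

  halves-known : ∀ {fs} → All (At K c) fs → All (At K c) (halves fs)
  halves-known {fs} ks = go ks
    where
    inner : ∀ {f hs acc} → At K c f → All (At K c) hs → All (At K c) acc → All (At K c) (List.foldr (addHalf f) acc hs)
    inner kf [] ka = ka
    inner {f} {h ∷ hs} {acc} kf (kh ∷ khs) ka =
      addHalf-known {f} {h} {List.foldr (addHalf f) acc hs} kf kh (inner {f} {hs} {acc} kf khs ka)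
    go : ∀ {hs} → All (At K c) hs → All (At K c) (withHalves hs fs fs)
    go [] = ks
    go {h ∷ hs} (kh ∷ khs) = inner {h} {fs} {withHalves hs fs fs} kh ks (go khs)

  private
    cancel-base : ∀ b (f h : F) → (b ⊞ ev f g) ⊟ (b ⊞ ev h g) ≡ ev (f ⊖ᵥ h) g
    cancel-base b f h = trans (vec≡ (b ∷ ev f g ∷ ev h g ∷ []) ((var zero :+ var (suc zero)) :- (var zero :+ var (suc (suc zero))))
                          (var (suc zero) :- var (suc (suc zero))) refl) (sym (ev-⊖ f h g))
    uncancel : ∀ b (f h : F) → b ⊞ ev f g ≡ b ⊞ ev h g → ev f g ≡ ev h g
    uncancel b f h e = lin≡ (b ∷ ev f g ∷ ev h g ∷ []) ((+ 1 , var zero :+ var (suc zero) , var zero :+ var (suc (suc zero))) ∷ [])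
      (e ∷ []) (var (suc zero)) (var (suc (suc zero))) refl

  module Points {X : Z3 → Set} (one : LengthOne X) (b : Z3) where
    open LengthOne one

    differences-primitive : ∀ {fs} → All (At X b) fs → AllPairs (Distinct g) fs → All Primitive (differences fs)
    differences-primitive [] [] = []
    differences-primitive {f ∷ fs} (x ∷ xs) (d ∷ ds) = AllP.++⁺ (AllP.map⁺ (go xs d)) (differences-primitive xs ds)
      where
      go : ∀ {hs} → All (At X b) hs → All (Distinct g f) hs → All (λ h → Primitive (f ⊖ᵥ h)) hs
      go [] [] = []
      go {h ∷ _} (y ∷ ys) (e ∷ es) =
        (λ k 2≤k m → e (uncancel b f h (indivisible k 2≤k x y (proj₁ m , trans (cancel-base b f h) (proj₂ m)))))
        ∷ go ys es

    -- If the combination vanished, the points would be the corners of a parallelogram, which a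
    -- polytope of Minkowski length one does not contain.
    cross : ∀ (f h k l : F) → At X b f → At X b h → At X b k → At X b l →
            Distinct g f k → Distinct g h k → Nonzero (f ⊕ᵥ h ⊖ᵥ (k ⊕ᵥ l))
    cross f h k l xf xh xk xl f≢k h≢k e = contra (crossing xf xh xk xl balanced)
      where
      w0 w1 w2 w3 w4 : Expr 5
      w0 = var zero
      w1 = var (suc zero)
      w2 = var (suc (suc zero))
      w3 = var (suc (suc (suc zero)))
      w4 = var (suc (suc (suc (suc zero))))
      e' : (ev f g ⊞ ev h g) ⊟ (ev k g ⊞ ev l g) ≡ o
      e' = trans (sym (trans (ev-⊖ (f ⊕ᵥ h) (k ⊕ᵥ l) g) (cong₂ _⊟_ (ev-⊕ f h g) (ev-⊕ k l g)))) e
      balanced : (b ⊞ ev f g) ⊞ (b ⊞ ev h g) ≡ (b ⊞ ev k g) ⊞ (b ⊞ ev l g)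
      balanced = lin≡ (b ∷ ev f g ∷ ev h g ∷ ev k g ∷ ev l g ∷ []) ((+ 1 , (w1 :+ w2) :- (w3 :+ w4) , :0) ∷ [])
        (e' ∷ []) ((w0 :+ w1) :+ (w0 :+ w2)) ((w0 :+ w3) :+ (w0 :+ w4)) refl
      contra : b ⊞ ev f g ≡ b ⊞ ev k g ⊎ b ⊞ ev h g ≡ b ⊞ ev k g → ⊥
      contra (inj₁ eq) = f≢k (uncancel b f k eq)
      contra (inj₂ eq) = h≢k (uncancel b h k eq)

    crossings₄-nonzero : ∀ {f h k ls} → At X b f → At X b h → At X b k → All (At X b) ls →
      Distinct g f h → Distinct g f k → Distinct g h k →
      All (Distinct g f) ls → All (Distinct g h) ls → All (Distinct g k) ls →
      All Nonzero (crossings₄ f h k ls)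
    crossings₄-nonzero xf xh xk [] _ _ _ _ _ _ = []
    crossings₄-nonzero {f} {h} {k} {l ∷ _} xf xh xk (xl ∷ xs) fh fk hk (fl ∷ fls) (hl ∷ hls) (kl ∷ kls) =
      cross f h k l xf xh xk xl fk hk
      ∷ cross f k h l xf xk xh xl fh (λ e → hk (sym e))
      ∷ cross f l h k xf xl xh xk fh (λ e → hl (sym e))
      ∷ crossings₄-nonzero xf xh xk xs fh fk hk fls hls kls

    crossings₃-nonzero : ∀ {f h ks} → At X b f → At X b h → All (At X b) ks → Distinct g f h →
      All (Distinct g f) ks → All (Distinct g h) ks → AllPairs (Distinct g) ks →
      All Nonzero (crossings₃ f h ks)
    crossings₃-nonzero xf xh [] _ _ _ _ = []
    crossings₃-nonzero xf xh (xk ∷ xs) fh (fk ∷ fks) (hk ∷ hks) (kd ∷ ds) = AllP.++⁺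
      (crossings₄-nonzero xf xh xk xs fh fk hk fks hks kd) (crossings₃-nonzero xf xh xs fh fks hks ds)

    crossings₂-nonzero : ∀ {f hs} → At X b f → All (At X b) hs → All (Distinct g f) hs → AllPairs (Distinct g) hs →
      All Nonzero (crossings₂ f hs)
    crossings₂-nonzero xf [] _ _ = []
    crossings₂-nonzero xf (xh ∷ xs) (fh ∷ fhs) (hd ∷ ds) = AllP.++⁺
      (crossings₃-nonzero xf xh xs fh fhs hd ds) (crossings₂-nonzero xf xs fhs ds)

    crossings-nonzero : ∀ {fs} → All (At X b) fs → AllPairs (Distinct g) fs → All Nonzero (crossings fs)
    crossings-nonzero [] [] = []
    crossings-nonzero (x ∷ xs) (d ∷ ds) = AllP.++⁺ (crossings₂-nonzero x xs d ds) (crossings-nonzero xs ds)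

  collision-relation : ∀ {kn l} {R : F → Set} → All (At K c) kn → Multiple 3 (ev l g) → Collision kn l R →
                       ∃[ r ] (R r × ev r g ≡ o)
  collision-relation {kn} {l} ks (y , ly) col with find col
  ... | f , f∈ , col' with find col'
  ... | h , h∈ , d , r = f ⊖ᵥ h , r , trans (sym (cancel-base c f h)) (trans (cong (_⊟ (c ⊞ ev h g)) same) (⊟-self (c ⊞ ev h g)))
    where
    m = ev-divides 3 ((f ⊖ᵥ h) ⊖ᵥ l) g d
    same : c ⊞ ev f g ≡ c ⊞ ev h g
    same = triple (All.lookup ks f∈) (All.lookup ks h∈) (proj₁ m ⊞ y ,
      trans (cancel-base c f h) (lin≡ (ev (f ⊖ᵥ h) g ∷ ev l g ∷ proj₁ m ∷ y ∷ [])
        ((+ 1 , var zero :- var (suc zero) , + 3 :* var (suc (suc zero))) ∷ (+ 1 , var (suc zero) , + 3 :* var (suc (suc (suc zero)))) ∷ [])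
        (trans (sym (ev-⊖ (f ⊖ᵥ h) l g)) (proj₂ m) ∷ ly ∷ [])
        (var zero) (+ 3 :* (var (suc (suc zero)) :+ var (suc (suc (suc zero))))) refl))

  bad-primitive : ∀ {pd r} → All Primitive pd → ev r g ≡ o → ¬ Any (BadPrimitive r) pd
  bad-primitive {r = r} prims e bad with find bad
  ... | z , z∈ , bad' = case bad'
    where
    go : ∀ k .{{_ : NonZero k}} → 2 ℕ.≤ k → ¬ Imprimitive k r z
    go k 2≤k im with find im
    ... | m , _ , d = All.lookup prims z∈ k 2≤k
      (proj₁ dv , trans (sym (ev-⊖-relation (+ m) z r g e)) (proj₂ dv))
      where dv = ev-divides k (z ⊖ᵥ + m ⊛ r) g d
    case : ¬ BadPrimitive r z
    case (inj₁ b) = go 2 (s≤s (s≤s z≤n)) b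
    case (inj₂ (inj₁ b)) = go 3 (s≤s (s≤s z≤n)) b
    case (inj₂ (inj₂ b)) = go 5 (s≤s (s≤s z≤n)) b

  bad-nonzero : ∀ {nz r} → All Nonzero nz → ev r g ≡ o → ¬ Any (Proportional r) nz
  bad-nonzero nzs e bad with find bad
  ... | z , z∈ , pr = All.lookup nzs z∈ (ev-proportional g pr e)

  eliminate-ev : ∀ j r → ev r g ≡ o → ∀ f → ev (eliminate j r f) g ≡ ev f g
  eliminate-ev j r e f = ev-⊖-relation (lookup f j ℤ.* lookup r j) f r g e

  bad-ladder : ∀ {kn nz r} → All (At K c) kn → All Nonzero nz → ev r g ≡ o → ¬ BadLadder kn nz r
  bad-ladder {kn} {nz} {r} ks nzs e bad with find bad
  ... | j , _ , _ , lad with find lad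
  ... | x , x∈ , lad₁ with find lad₁
  ... | x' , x'∈ , d , nzd , lad₂ with find lad₂
  ... | y , y∈ , nzy , y'∈ = contra (ladder (proj₁ m) (look x∈) (look x'∈) (look y∈) (look y'∈)
                               (trans (cancel-base c x' x) (proj₂ m))
                               (trans (cancel-base c (y ⊕ᵥ (x' ⊖ᵥ x)) y) (trans (ev-⊖ (y ⊕ᵥ (x' ⊖ᵥ x)) y g)
                                 (trans (cong (_⊟ ev y g) (ev-⊕ y (x' ⊖ᵥ x) g))
                                 (trans (vec≡ (ev y g ∷ ev (x' ⊖ᵥ x) g ∷ []) ((var zero :+ var (suc zero)) :- var zero) (var (suc zero)) refl) (proj₂ m))))))
    where
    m = ev-divides 2 (x' ⊖ᵥ x) g d
    nzs' : All Nonzero (List.map (eliminate j r) nz)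
    nzs' = AllP.map⁺ (All.map (λ {f} n e' → n (trans (sym (eliminate-ev j r e f)) e')) nzs)
    look : ∀ {f} → f ∈ halves (List.map (eliminate j r) kn) → At K c f
    look f∈ = All.lookup (halves-known (AllP.map⁺ (All.map (λ {f} k → subst (λ t → K (c ⊞ t)) (sym (eliminate-ev j r e f)) k) ks))) f∈
    contra : proj₁ m ≡ o ⊎ c ⊞ ev x g ≡ c ⊞ ev y g → ⊥
    contra (inj₁ w≡o) = bad-nonzero nzs' (trans (proj₂ m) (trans (cong (+ 2 ∙_) w≡o) (∙-o (+ 2)))) nzd
    contra (inj₂ x≡y) = bad-nonzero nzs' (trans (sym (cancel-base c y x)) (trans (cong (λ t → t ⊟ (c ⊞ ev x g)) (sym x≡y)) (⊟-self (c ⊞ ev x g)))) nzy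

  resolved-sound : ∀ {kn pd nz res l} → All (At K c) kn → All Primitive pd → All Nonzero nz →
    Multiple 3 (ev l g) → Resolved kn pd nz res l → Any (λ r → ev r g ≡ o) res
  resolved-sound {kn} {pd} {nz} {res} {l} ks prims nzs m = go
    where
    prim⇒nonzero : ∀ {z} → Primitive z → Nonzero z
    prim⇒nonzero pr e = pr 2 (s≤s (s≤s z≤n)) (o , e)
    absurd : {R : F → Set} → (∀ r → ev r g ≡ o → ¬ R r) → ¬ Collision kn l R
    absurd {R} bad col = let (r , Rr , e) = collision-relation {R = R} ks m col in bad r e Rr
    listed : ∃[ r ] (r ∈ res × ev r g ≡ o) → Any (λ r → ev r g ≡ o) res
    listed (r , r∈ , e) = lose r∈ e
    go : Resolved kn pd nz res l → Any (λ r → ev r g ≡ o) res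
    go (inj₁ col) = ⊥-elim (absurd (λ r → bad-primitive prims) col)
    go (inj₂ (inj₁ col)) = ⊥-elim (absurd (λ r → bad-nonzero nzs) col)
    go (inj₂ (inj₂ (inj₁ col))) = listed (collision-relation {R = _∈ res} ks m col)
    go (inj₂ (inj₂ (inj₂ col))) = ⊥-elim (absurd (λ r → bad-ladder ks (AllP.++⁺ (All.map prim⇒nonzero prims) nzs)) col)

  record Valid (C : Config) : Set where
    open Config C
    field
      inP       : All (At P p) as
      inQ       : All (At Q q) bs
      distinctP : AllPairs (Distinct g) as
      distinctQ : AllPairs (Distinct g) bs
      nonzero   : All Nonzero extra

  module _ {C : Config} (v : Valid C) where
    open Config C
    open Valid v

    known-valid : All (At K c) (known C)
    known-valid = halves-known {sums as bs} (sums-known {as} {bs} inP inQ)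

    primitives-valid : All Primitive (primitives C)
    primitives-valid = AllP.++⁺ {xs = differences as} (Points.differences-primitive oneP p inP distinctP)
                                (Points.differences-primitive oneQ q inQ distinctQ)

    nonzeros-valid : All Nonzero (nonzeros C)
    nonzeros-valid = AllP.++⁺ {xs = extra} nonzero (AllP.++⁺ {xs = crossings as} (Points.crossings-nonzero oneP p inP distinctP)
                                                (Points.crossings-nonzero oneQ q inQ distinctQ))

    good-sound : ∀ {l} → Good (known C) (primitives C) (nonzeros C) res miss l → l ≢ 0ᵥ → Multiple 3 (ev l g) →
                 Any (λ r → ev r g ≡ o) res ⊎ Any (λ l → Multiple 3 (ev l g)) miss
    good-sound (inj₁ l≡0) l≢0 m = ⊥-elim (l≢0 l≡0)
    good-sound (inj₂ (inj₁ l∈)) l≢0 m = inj₂ (lose l∈ m)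
    good-sound (inj₂ (inj₂ r)) l≢0 m = inj₁ (resolved-sound known-valid primitives-valid nonzeros-valid m r)

    -- Four vectors of ℤ³ are dependent modulo 3, so one of the checked cases occurs.
    resolve : Checked C → Any (λ r → ev r g ≡ o) res ⊎ Any (λ l → Multiple 3 (ev l g)) miss
    resolve ch = finish (Mod3.dependent (Vec.removeAt g dropped))
      where
      insert-zero : ∀ {n} j (d : Vec (Fin 3) n) → Vec.insertAt (Vec.map (λ t → + toℕ t) d) j 0ℤ ≡ Vec.replicate (suc n) 0ℤ →
                    d ≡ Vec.replicate n zero
      insert-zero zero [] eq = refl
      insert-zero zero (zero ∷ d) eq = cong (zero ∷_) (insert-zero zero d (VecP.∷-injectiveʳ eq))
      insert-zero (suc j) (zero ∷ d) eq = cong (zero ∷_) (insert-zero j d (VecP.∷-injectiveʳ eq))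
      insert-ev : ∀ {n} j (f : V n) (g : Vec Z3 (suc n)) → ev (Vec.insertAt f j 0ℤ) g ≡ ev f (Vec.removeAt g j)
      insert-ev zero f (x ∷ g) = vec≡ (x ∷ ev f g ∷ []) (0ℤ :* var zero :+ var (suc zero)) (var (suc zero)) refl
      insert-ev (suc j) (k ∷ f) (x ∷ g@(_ ∷ _)) = cong (k ∙ x ⊞_) (insert-ev j f g)
      finish : ∃[ d ] (d ≢ Mod3.zeros × Multiple 3 (ev (Mod3.digits d) (Vec.removeAt g dropped))) →
               Any (λ r → ev r g ≡ o) res ⊎ Any (λ l → Multiple 3 (ev l g)) miss
      finish (d@(d₁ ∷ d₂ ∷ d₃ ∷ d₄ ∷ []) , d≢0 , m , e) =
        good-sound (ch d₁ d₂ d₃ d₄) (λ eq → d≢0 (insert-zero dropped d eq)) (m , trans (insert-ev dropped (Mod3.digits d) g) e)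

-- The configurations to be checked

last5 : Fin 5
last5 = suc (suc (suc (suc zero)))

c4 : ℤ → ℤ → ℤ → ℤ → F
c4 a b c d = a ∷ b ∷ c ∷ d ∷ 0ℤ ∷ []

negative : ℤ
negative = -[1+ 0 ]

-- The sign of a relation depends on the order in which the two colliding points are found.
± : F → List F
± r = r ∷ negative ⊛ r ∷ []

-- A dependence modulo three is determined only up to the unit 2.
miss₃ : F → List F
miss₃ l = l ∷ + 2 ⊛ l ∷ []

cfgA cfgC cfgC′ cfgD cfgE₀ cfgF : Config
-- Two triangles with edges u + y and u - y, where u (`i1`, `i2`) are the half sums and y (`i3`,
-- `i4`) the half differences of matched edges. The misses say that the corners of one triangle have
-- a sum divisible by three, or that the two sums are congruent.
cfgA = record
  { as = 0ᵥ ∷ i1 ⊕ᵥ i3 ∷ i2 ⊕ᵥ i4 ∷ []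
  ; bs = 0ᵥ ∷ i1 ⊖ᵥ i3 ∷ i2 ⊖ᵥ i4 ∷ []
  ; extra = i1 ∷ i2 ∷ i3 ∷ i4 ∷ i1 ⊖ᵥ i2 ∷ i3 ⊖ᵥ i4 ∷ []
  ; res = []
  ; miss = miss₃ (c4 (+ 0) (+ 0) (+ 1) (+ 1)) ++ miss₃ (c4 (+ 1) (+ 1) (+ 1) (+ 1)) ++ miss₃ (c4 (+ 1) (+ 1) (+ 2) (+ 2))
           -- Doubling the third vector gives entries 4, whose digit modulo three is 1; hence this
           -- separate entry.
           ++ c4 (+ 2) (+ 2) (+ 1) (+ 1) ∷ []
  ; dropped = last5 }

-- The twisted case: relative to p₁ the last point of P is (p₂ - p₁) + (q₄ - q₁) plus twice `i4`.
-- The first relation makes a triangle reflected, the second one is `Centre₃`.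
cfgC = record
  { as = 0ᵥ ∷ i1 ∷ i2 ∷ i1 ⊕ᵥ i3 ⊕ᵥ + 2 ⊛ i4 ∷ []
  ; bs = 0ᵥ ∷ i1 ∷ i2 ∷ i3 ∷ []
  ; extra = i1 ⊕ᵥ + 2 ⊛ i4 ∷ []
  ; res = ± (c4 (+ 0) (+ 0) (+ 1) (+ 1)) ++ ± (c4 (+ 1) -[1+ 1 ] (+ 1) (+ 1))
  ; miss = []
  ; dropped = last5 }

-- The twisted case with both remaining points of P. The vector `s` is p₂ - p₁ expressed by means of
-- `Centre₃`, which leaves four generators.
cfgC′ = record
  { as = 0ᵥ ∷ s ∷ i1 ∷ s ⊕ᵥ i2 ⊕ᵥ + 2 ⊛ i3 ∷ s ⊕ᵥ i1 ⊕ᵥ + 2 ⊛ i4 ∷ []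
  ; bs = 0ᵥ ∷ s ∷ i1 ∷ i2 ∷ []
  ; extra = s ⊕ᵥ + 2 ⊛ i3 ∷ s ⊕ᵥ i1 ⊕ᵥ + 2 ⊛ i4 ⊖ᵥ i2 ∷ []
  ; res = []
  ; miss = []
  ; dropped = last5 }
  where s = + 2 ⊛ i1 ⊖ᵥ i2 ⊖ᵥ i3

-- The points of Q lie in a plane modulo two; `i3` is half of q₁ + q₄ - q₂ - q₃, and `i4` is a - p₁.
-- Each of the four relations says that 2a is the sum of three of the points p₁, p₂, p₃, p₁ + q₄ -
-- q₁ minus the remaining one.
cfgD = record
  { as = 0ᵥ ∷ i1 ∷ i2 ∷ i4 ∷ []
  ; bs = 0ᵥ ∷ i1 ∷ i2 ∷ i1 ⊕ᵥ i2 ⊕ᵥ + 2 ⊛ i3 ∷ []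
  ; extra = i1 ⊕ᵥ i2 ⊕ᵥ + 2 ⊛ i3 ⊖ᵥ i4 ∷ []
  ; res = ± (c4 (+ 0) (+ 0) (+ 1) (+ 1)) ++ ± (c4 (+ 0) (+ 1) (+ 1) negative) ++ ± (c4 (+ 1) (+ 0) (+ 1) negative)
          ++ ± (c4 (+ 1) (+ 1) (+ 1) negative)
  ; miss = miss₃ (c4 (+ 1) (+ 1) (+ 1) (+ 1))
  ; dropped = last5 }

-- The point `c` is one of the four positions left by `cfgD`; the other remaining point of P differs
-- from it by `i1` modulo two.
cfgD′ : F → Config
cfgD′ c = record
  { as = 0ᵥ ∷ i1 ∷ i2 ∷ c ∷ c ⊕ᵥ i1 ⊕ᵥ + 2 ⊛ i4 ∷ []
  ; bs = 0ᵥ ∷ i1 ∷ i2 ∷ i1 ⊕ᵥ i2 ⊕ᵥ + 2 ⊛ i3 ∷ []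
  ; extra = []
  ; res = []
  ; miss = []
  ; dropped = last5 }

-- Four points are common to P and Q, and the fifth point of P is congruent to `i1 ⊕ᵥ i2` modulo
-- two. The surviving relation makes the fourth point the centroid of the other four.
cfgE₀ = record
  { as = 0ᵥ ∷ i1 ∷ i2 ∷ i3 ∷ i1 ⊕ᵥ i2 ⊕ᵥ + 2 ⊛ i4 ∷ []
  ; bs = 0ᵥ ∷ i1 ∷ i2 ∷ i3 ∷ []
  ; extra = []
  ; res = ± (c4 (+ 1) (+ 1) -[1+ 1 ] (+ 1))
  ; miss = []
  ; dropped = last5 }

-- The relations of `cfgD` return, now with q₄ matched by a point of P. They will give E with its
-- vertices relabelled, and the miss will give K₂.
cfgF = record
  { as = 0ᵥ ∷ i1 ∷ i2 ∷ b ∷ i4 ∷ []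
  ; bs = 0ᵥ ∷ i1 ∷ i2 ∷ b ∷ []
  ; extra = []
  ; res = ± (c4 (+ 0) (+ 0) (+ 1) (+ 1)) ++ ± (c4 (+ 0) (+ 1) (+ 1) negative) ++ ± (c4 (+ 1) (+ 0) (+ 1) negative)
          ++ ± (c4 (+ 1) (+ 1) (+ 1) negative)
  ; miss = miss₃ (c4 (+ 1) (+ 1) (+ 1) (+ 1))
  ; dropped = last5 }
  where b = i1 ⊕ᵥ i2 ⊕ᵥ + 2 ⊛ i3

checkA : Checked cfgA
checkA = toWitness {a? = checked? cfgA} _
checkC : Checked cfgC
checkC = toWitness {a? = checked? cfgC} _
checkC′ : Checked cfgC′
checkC′ = toWitness {a? = checked? cfgC′} _
checkD : Checked cfgD
checkD = toWitness {a? = checked? cfgD} _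
checkE₀ : Checked cfgE₀
checkE₀ = toWitness {a? = checked? cfgE₀} _
checkF : Checked cfgF
checkF = toWitness {a? = checked? cfgF} _
checkD₁ : Checked (cfgD′ (negative ⊛ i3))
checkD₁ = toWitness {a? = checked? (cfgD′ (negative ⊛ i3))} _
checkD₂ : Checked (cfgD′ (i2 ⊕ᵥ i3))
checkD₂ = toWitness {a? = checked? (cfgD′ (i2 ⊕ᵥ i3))} _
checkD₃ : Checked (cfgD′ (i1 ⊕ᵥ i3))
checkD₃ = toWitness {a? = checked? (cfgD′ (i1 ⊕ᵥ i3))} _
checkD₄ : Checked (cfgD′ (i1 ⊕ᵥ i2 ⊕ᵥ i3))
checkD₄ = toWitness {a? = checked? (cfgD′ (i1 ⊕ᵥ i2 ⊕ᵥ i3))} _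

module _ {n : ℕ} where
  v₀ : Expr (1 ℕ.+ n)
  v₀ = var zero
  v₁ : Expr (2 ℕ.+ n)
  v₁ = var (suc zero)
  v₂ : Expr (3 ℕ.+ n)
  v₂ = var (suc (suc zero))
  v₃ : Expr (4 ℕ.+ n)
  v₃ = var (suc (suc (suc zero)))
  v₄ : Expr (5 ℕ.+ n)
  v₄ = var (suc (suc (suc (suc zero))))
  v₅ : Expr (6 ℕ.+ n)
  v₅ = var (suc (suc (suc (suc (suc zero)))))
  v₆ : Expr (7 ℕ.+ n)
  v₆ = var (suc (suc (suc (suc (suc (suc zero))))))
  v₇ : Expr (8 ℕ.+ n)
  v₇ = var (suc (suc (suc (suc (suc (suc (suc zero)))))))
  v₈ : Expr (9 ℕ.+ n)
  v₈ = var (suc (suc (suc (suc (suc (suc (suc (suc zero))))))))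
  v₉ : Expr (10 ℕ.+ n)
  v₉ = var (suc (suc (suc (suc (suc (suc (suc (suc (suc zero)))))))))
  v₁₀ : Expr (11 ℕ.+ n)
  v₁₀ = var (suc (suc (suc (suc (suc (suc (suc (suc (suc (suc zero))))))))))
  v₁₁ : Expr (12 ℕ.+ n)
  v₁₁ = var (suc (suc (suc (suc (suc (suc (suc (suc (suc (suc (suc zero)))))))))))
  v₁₂ : Expr (13 ℕ.+ n)
  v₁₂ = var (suc (suc (suc (suc (suc (suc (suc (suc (suc (suc (suc (suc zero))))))))))))

-1ℤ : ℤ
-1ℤ = -[1+ 0 ]

record Located (b : Z3) (g : Vec Z3 5) (f : F) (x : Z3) : Set where
  constructor located
  field position : x ≡ b ⊞ ev f g

locate : ∀ {b g x} (e : Expr 5) → x ≡ b ⊞ ⟦ e ⟧ g → Located b g (nf e) x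
locate {b} {g} e eq = located (trans eq (cong (b ⊞_) (nf-sound e g)))

located-in : ∀ {X : Z3 → Set} {b g fs xs} → Pointwise (Located b g) fs xs → All X xs → All (λ f → X (b ⊞ ev f g)) fs
located-in [] [] = []
located-in {X} (located l ∷ ls) (x ∷ xs) = subst X l x ∷ located-in ls xs

located-distinct : ∀ {b g fs xs} → Pointwise (Located b g) fs xs → AllPairs _≢_ xs → AllPairs (Distinct g) fs
located-distinct [] [] = []
located-distinct {b} {g} (located l ∷ ls) (d ∷ ds) = go ls d ∷ located-distinct ls ds
  where
  go : ∀ {fs xs} → Pointwise (Located b g) fs xs → All (_ ≢_) xs → All (Distinct g _) fs
  go [] [] = []
  go (located l' ∷ ls') (n ∷ ns) = (λ e → n (trans l (trans (cong (b ⊞_) e) (sym l')))) ∷ go ls' ns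

module _ {P Q K : Z3 → Set} (S : System P Q K) where
  open System S

  valid : ∀ {C p q g xs ys} → Pointwise (Located p g) (Config.as C) xs → Pointwise (Located q g) (Config.bs C) ys →
          All P xs → All Q ys → AllPairs _≢_ xs → AllPairs _≢_ ys → All (λ z → ev z g ≢ o) (Config.extra C) →
          Resolve.Valid S p q g C
  valid la lb ps qs dp dq nz = record
    { inP = located-in la ps ; inQ = located-in lb qs
    ; distinctP = located-distinct la dp ; distinctQ = located-distinct lb dq ; nonzero = nz }

-- Triangles of P and Q with edges congruent modulo two

Even : Z3 → Set
Even = Multiple 2

-- Half sums and half differences of corresponding edges are then lattice vectors.
record Matched (p₁ p₂ p₃ q₁ q₂ q₃ : Z3) : Set where
  constructor matched
  field
    even₂ : Even ((p₂ ⊟ p₁) ⊟ (q₂ ⊟ q₁))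
    even₃ : Even ((p₃ ⊟ p₁) ⊟ (q₃ ⊟ q₁))

Different : Z3 → Z3 → Z3 → Set
Different a b c = a ≢ b × a ≢ c × b ≢ c

Same Opposite : Z3 → Z3 → Z3 → Z3 → Set
Same p p' q q' = p' ⊟ p ≡ q' ⊟ q
Opposite p p' q q' = p' ⊟ p ≡ q ⊟ q'

Translated : (p₁ p₂ p₃ q₁ q₂ q₃ : Z3) → Set
Translated p₁ p₂ p₃ q₁ q₂ q₃ = Same p₁ p₂ q₁ q₂ × Same p₁ p₃ q₁ q₃

-- The triangle then has a lattice point as its centroid.
Centred : Z3 → Z3 → Z3 → Set
Centred a b c = Multiple 3 (a ⊞ b ⊞ c)

Congruent : (p₁ p₂ p₃ q₁ q₂ q₃ : Z3) → Set
Congruent p₁ p₂ p₃ q₁ q₂ q₃ = Multiple 3 ((p₁ ⊞ p₂ ⊞ p₃) ⊟ (q₁ ⊞ q₂ ⊞ q₃))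

rotate : ∀ {p₁ p₂ p₃ q₁ q₂ q₃} → Matched p₁ p₂ p₃ q₁ q₂ q₃ → Matched p₁ p₃ p₂ q₁ q₃ q₂
rotate (matched e₂ e₃) = matched e₃ e₂

rebase : ∀ {p₁ p₂ p₃ q₁ q₂ q₃} → Matched p₁ p₂ p₃ q₁ q₂ q₃ → Matched p₂ p₃ p₁ q₂ q₃ q₁
rebase {p₁} {p₂} {p₃} {q₁} {q₂} {q₃} (matched (y₂ , e₂) (y₃ , e₃)) = matched
  (y₃ ⊟ y₂ , lin≡ G ((+ 1 , (v₂ :- v₀) :- (v₅ :- v₃) , + 2 :* v₇) ∷ (-1ℤ , (v₁ :- v₀) :- (v₄ :- v₃) , + 2 :* v₆) ∷ []) (e₃ ∷ e₂ ∷ [])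
     ((v₂ :- v₁) :- (v₅ :- v₄)) (+ 2 :* (v₇ :- v₆)) refl)
  (-1ℤ ∙ y₂ , lin≡ G ((-1ℤ , (v₁ :- v₀) :- (v₄ :- v₃) , + 2 :* v₆) ∷ []) (e₂ ∷ [])
     ((v₀ :- v₁) :- (v₃ :- v₄)) (+ 2 :* (-1ℤ :* v₆)) refl)
  where
  G : Vec Z3 8
  G = p₁ ∷ p₂ ∷ p₃ ∷ q₁ ∷ q₂ ∷ q₃ ∷ y₂ ∷ y₃ ∷ []

module _ {P Q K : Z3 → Set} (S : System P Q K) where
  open System S

  -- If p₂ - p₁ = q₂ - q₁ = d, the four points p₃ + q₁, p₁ + q₃, p₃ + q₂, p₂ + q₃ span 2v and d.
  extend : ∀ {p₁ p₂ p₃ q₁ q₂ q₃} → P p₁ → P p₂ → P p₃ → Q q₁ → Q q₂ → Q q₃ → q₁ ≢ q₂ →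
           Matched p₁ p₂ p₃ q₁ q₂ q₃ → Same p₁ p₂ q₁ q₂ → Translated p₁ p₂ p₃ q₁ q₂ q₃
  extend {p₁} {p₂} {p₃} {q₁} {q₂} {q₃} P₁ P₂ P₃ Q₁ Q₂ Q₃ q₁≢q₂ (matched _ (y , e₃)) same = same , finish
    (ladder y (sum P₁ Q₃) (sum P₃ Q₁) (sum P₂ Q₃) (sum P₃ Q₂)
      (lin≡ G ((+ 1 , (v₂ :- v₀) :- (v₅ :- v₃) , + 2 :* v₆) ∷ []) (e₃ ∷ []) ((v₂ :+ v₃) :- (v₀ :+ v₅)) (+ 2 :* v₆) refl)
      (lin≡ G ((+ 1 , (v₂ :- v₀) :- (v₅ :- v₃) , + 2 :* v₆) ∷ (-1ℤ , v₁ :- v₀ , v₄ :- v₃) ∷ []) (e₃ ∷ same ∷ [])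
        ((v₂ :+ v₄) :- (v₁ :+ v₅)) (+ 2 :* v₆) refl))
    where
    G : Vec Z3 7
    G = p₁ ∷ p₂ ∷ p₃ ∷ q₁ ∷ q₂ ∷ q₃ ∷ y ∷ []
    finish : y ≡ o ⊎ p₁ ⊞ q₃ ≡ p₂ ⊞ q₃ → Same p₁ p₃ q₁ q₃
    finish (inj₁ y≡o) = lin≡ G ((+ 1 , (v₂ :- v₀) :- (v₅ :- v₃) , + 2 :* v₆) ∷ (+ 2 , v₆ , :0) ∷ []) (e₃ ∷ y≡o ∷ [])
      (v₂ :- v₀) (v₅ :- v₃) refl
    finish (inj₂ e) = ⊥-elim (q₁≢q₂ (lin≡ G ((+ 1 , v₁ :- v₀ , v₄ :- v₃) ∷ (+ 1 , v₀ :+ v₅ , v₁ :+ v₅) ∷ []) (same ∷ e ∷ [])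
      v₃ v₄ refl))

  -- A vanishing half difference of edges leads to a translation, a vanishing half sum to opposite
  -- edges; the last three outcomes are the dependences left by `cfgA`.
  data Outcome (p₁ p₂ p₃ q₁ q₂ q₃ : Z3) : Set where
    translated : Translated p₁ p₂ p₃ q₁ q₂ q₃ → Outcome p₁ p₂ p₃ q₁ q₂ q₃
    opposite₁₂ : Opposite p₁ p₂ q₁ q₂ → Outcome p₁ p₂ p₃ q₁ q₂ q₃
    opposite₁₃ : Opposite p₁ p₃ q₁ q₃ → Outcome p₁ p₂ p₃ q₁ q₂ q₃
    opposite₂₃ : Opposite p₂ p₃ q₂ q₃ → Outcome p₁ p₂ p₃ q₁ q₂ q₃
    centredP   : Centred p₁ p₂ p₃ → Outcome p₁ p₂ p₃ q₁ q₂ q₃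
    centredQ   : Centred q₁ q₂ q₃ → Outcome p₁ p₂ p₃ q₁ q₂ q₃
    congruent  : Congruent p₁ p₂ p₃ q₁ q₂ q₃ → Outcome p₁ p₂ p₃ q₁ q₂ q₃

  compare : ∀ {p₁ p₂ p₃ q₁ q₂ q₃} → P p₁ → P p₂ → P p₃ → Q q₁ → Q q₂ → Q q₃ →
            Different p₁ p₂ p₃ → Different q₁ q₂ q₃ → Matched p₁ p₂ p₃ q₁ q₂ q₃ → Outcome p₁ p₂ p₃ q₁ q₂ q₃
  compare {p₁} {p₂} {p₃} {q₁} {q₂} {q₃} P₁ P₂ P₃ Q₁ Q₂ Q₃ (p₁≢p₂ , p₁≢p₃ , p₂≢p₃) (q₁≢q₂ , q₁≢q₃ , q₂≢q₃)
          M@(matched (y₂ , e₂) (y₃ , e₃)) = decide (y₂ ≟³ o) (y₃ ≟³ o) (y₂ ⊟ y₃ ≟³ o) (u₂ ≟³ o) (u₃ ≟³ o) (u₂ ⊟ u₃ ≟³ o)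
    where
    u₂ u₃ : Z3
    -- Since p₂ - p₁ exceeds q₂ - q₁ by twice y₂, the two edges are u₂ + y₂ and u₂ - y₂.
    u₂ = (p₂ ⊟ p₁) ⊟ y₂
    u₃ = (p₃ ⊟ p₁) ⊟ y₃
    g : Vec Z3 5
    g = u₂ ∷ u₃ ∷ y₂ ∷ y₃ ∷ o ∷ []
    G : Vec Z3 9
    G = p₁ ∷ p₂ ∷ p₃ ∷ q₁ ∷ q₂ ∷ q₃ ∷ y₂ ∷ y₃ ∷ o ∷ []
    :u₂ :u₃ : Expr 9
    :u₂ = (v₁ :- v₀) :- v₆
    :u₃ = (v₂ :- v₀) :- v₇
    by : ∀ k₂ k₃ (a b : Expr 9) →
         nf a ⊖ᵥ nf b ≡ combine ((k₂ , (v₁ :- v₀) :- (v₄ :- v₃) , + 2 :* v₆) ∷ (k₃ , (v₂ :- v₀) :- (v₅ :- v₃) , + 2 :* v₇) ∷ []) →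
         ⟦ a ⟧ G ≡ ⟦ b ⟧ G
    by k₂ k₃ a b = lin≡ G ((k₂ , (v₁ :- v₀) :- (v₄ :- v₃) , + 2 :* v₆) ∷ (k₃ , (v₂ :- v₀) :- (v₅ :- v₃) , + 2 :* v₇) ∷ [])
      (e₂ ∷ e₃ ∷ []) a b
    with3 : (x : Expr 9) → ⟦ x ⟧ G ≡ o → ∀ k₂ k₃ k (a b : Expr 9) →
         nf a ⊖ᵥ nf b ≡ combine ((k₂ , (v₁ :- v₀) :- (v₄ :- v₃) , + 2 :* v₆) ∷ (k₃ , (v₂ :- v₀) :- (v₅ :- v₃) , + 2 :* v₇) ∷ (k , x , :0) ∷ []) →
         ⟦ a ⟧ G ≡ ⟦ b ⟧ G
    with3 x z k₂ k₃ k a b = lin≡ G ((k₂ , (v₁ :- v₀) :- (v₄ :- v₃) , + 2 :* v₆) ∷ (k₃ , (v₂ :- v₀) :- (v₅ :- v₃) , + 2 :* v₇) ∷ (k , x , :0) ∷ [])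
      (e₂ ∷ e₃ ∷ z ∷ []) a b
    C-valid : y₂ ≢ o → y₃ ≢ o → y₂ ⊟ y₃ ≢ o → u₂ ≢ o → u₃ ≢ o → u₂ ⊟ u₃ ≢ o → Resolve.Valid S p₁ q₁ g cfgA
    C-valid n₁ n₂ n₃ n₄ n₅ n₆ = valid S {cfgA}
      (locate :0 (by (+ 0) (+ 0) v₀ (v₀ :+ :0) refl)
        ∷ locate (v₀ :+ v₂) (by (+ 0) (+ 0) v₁ (v₀ :+ (:u₂ :+ v₆)) refl)
        ∷ locate (v₁ :+ v₃) (by (+ 0) (+ 0) v₂ (v₀ :+ (:u₃ :+ v₇)) refl) ∷ [])
      (locate :0 (by (+ 0) (+ 0) v₃ (v₃ :+ :0) refl)
        ∷ locate (v₀ :- v₂) (by -1ℤ (+ 0) v₄ (v₃ :+ (:u₂ :- v₆)) refl)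
        ∷ locate (v₁ :- v₃) (by (+ 0) -1ℤ v₅ (v₃ :+ (:u₃ :- v₇)) refl) ∷ [])
      (P₁ ∷ P₂ ∷ P₃ ∷ []) (Q₁ ∷ Q₂ ∷ Q₃ ∷ [])
      ((p₁≢p₂ ∷ p₁≢p₃ ∷ []) ∷ (p₂≢p₃ ∷ []) ∷ [] ∷ []) ((q₁≢q₂ ∷ q₁≢q₃ ∷ []) ∷ (q₂≢q₃ ∷ []) ∷ [] ∷ [])
      (unev v₀ n₄ ∷ unev v₁ n₅ ∷ unev v₂ n₁ ∷ unev v₃ n₂ ∷ unev (v₀ :- v₁) n₆ ∷ unev (v₂ :- v₃) n₃ ∷ [])
      where
      unev : (e : Expr 5) → ⟦ e ⟧ g ≢ o → ev (nf e) g ≢ o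
      unev e n z = n (trans (nf-sound e g) z)
    misses : Any (λ r → ev r g ≡ o) [] ⊎ Any (λ l → Multiple 3 (ev l g)) (Config.miss cfgA) → Outcome p₁ p₂ p₃ q₁ q₂ q₃
    misses (inj₂ m) = go m
      where
      read : (e : Expr 5) → Multiple 3 (ev (nf e) g) → ∃[ y ] ⟦ e ⟧ g ≡ + 3 ∙ y
      read e (y , eq) = y , trans (nf-sound e g) eq
      H : Z3 → Vec Z3 9
      H y = p₁ ∷ p₂ ∷ p₃ ∷ q₁ ∷ q₂ ∷ q₃ ∷ y₂ ∷ y₃ ∷ y ∷ []
      solve : ∀ y (x : Expr 9) → ⟦ x ⟧ (H y) ≡ + 3 ∙ y → ∀ k₂ k₃ k (a b : Expr 9) →
         nf a ⊖ᵥ nf b ≡ combine ((k₂ , (v₁ :- v₀) :- (v₄ :- v₃) , + 2 :* v₆) ∷ (k₃ , (v₂ :- v₀) :- (v₅ :- v₃) , + 2 :* v₇)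
           ∷ (k , x , + 3 :* v₈) ∷ []) →
         ⟦ a ⟧ (H y) ≡ ⟦ b ⟧ (H y)
      solve y x z k₂ k₃ k a b = lin≡ (H y) ((k₂ , (v₁ :- v₀) :- (v₄ :- v₃) , + 2 :* v₆) ∷ (k₃ , (v₂ :- v₀) :- (v₅ :- v₃) , + 2 :* v₇)
           ∷ (k , x , + 3 :* v₈) ∷ []) (e₂ ∷ e₃ ∷ z ∷ []) a b
      Σp Σq : Expr 9
      Σp = v₀ :+ v₁ :+ v₂
      Σq = v₃ :+ v₄ :+ v₅
      go : Any (λ l → Multiple 3 (ev l g)) (Config.miss cfgA) → Outcome p₁ p₂ p₃ q₁ q₂ q₃
      go (here m) = let (y , e) = read (v₂ :+ v₃) m in congruent (+ 2 ∙ y ⊞ p₁ ⊟ q₁ ,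
        solve y (v₆ :+ v₇) e (+ 1) (+ 1) (+ 2) (Σp :- Σq) (+ 3 :* (+ 2 :* v₈ :+ v₀ :- v₃)) refl)
      go (there (here m)) = let (y , e) = read (+ 2 :* (v₂ :+ v₃)) m in congruent (y ⊞ p₁ ⊟ q₁ ,
        solve y (+ 2 :* (v₆ :+ v₇)) e (+ 1) (+ 1) (+ 1) (Σp :- Σq) (+ 3 :* (v₈ :+ v₀ :- v₃)) refl)
      go (there (there (here m))) = let (y , e) = read (v₀ :+ v₁ :+ v₂ :+ v₃) m in centredP (y ⊞ p₁ ,
        solve y (:u₂ :+ :u₃ :+ v₆ :+ v₇) e (+ 0) (+ 0) (+ 1) Σp (+ 3 :* (v₈ :+ v₀)) refl)
      go (there (there (there (here m)))) = let (y , e) = read (+ 2 :* (v₀ :+ v₁ :+ v₂ :+ v₃)) m in centredP (p₂ ⊞ p₃ ⊟ p₁ ⊟ y ,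
        solve y (+ 2 :* (:u₂ :+ :u₃ :+ v₆ :+ v₇)) e (+ 0) (+ 0) -1ℤ Σp (+ 3 :* (v₁ :+ v₂ :- v₀ :- v₈)) refl)
      go (there (there (there (there (here m))))) = let (y , e) = read (v₀ :+ v₁ :+ + 2 :* v₂ :+ + 2 :* v₃) m in
        centredQ (y ⊟ y₂ ⊟ y₃ ⊞ q₁ ,
        solve y (:u₂ :+ :u₃ :+ + 2 :* v₆ :+ + 2 :* v₇) e -1ℤ -1ℤ (+ 1) Σq (+ 3 :* (v₈ :- v₆ :- v₇ :+ v₃)) refl)
      go (there (there (there (there (there (here m)))))) = let (y , e) = read (+ 2 :* (v₀ :+ v₁ :+ + 2 :* v₂ :+ + 2 :* v₃)) m in
        centredQ (u₂ ⊞ u₃ ⊞ (y₂ ⊞ y₃) ⊟ y ⊞ q₁ ,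
        solve y (+ 2 :* (:u₂ :+ :u₃ :+ + 2 :* v₆ :+ + 2 :* v₇)) e -1ℤ -1ℤ -1ℤ Σq (+ 3 :* (:u₂ :+ :u₃ :+ (v₆ :+ v₇) :- v₈ :+ v₃)) refl)
      go (there (there (there (there (there (there (here m))))))) = let (y , e) = read (+ 2 :* v₀ :+ + 2 :* v₁ :+ v₂ :+ v₃) m in
        centredQ (u₂ ⊞ u₃ ⊟ y ⊞ q₁ ,
        solve y (+ 2 :* :u₂ :+ + 2 :* :u₃ :+ v₆ :+ v₇) e -1ℤ -1ℤ -1ℤ Σq (+ 3 :* (:u₂ :+ :u₃ :- v₈ :+ v₃)) refl)
    decide : Dec (y₂ ≡ o) → Dec (y₃ ≡ o) → Dec (y₂ ⊟ y₃ ≡ o) → Dec (u₂ ≡ o) → Dec (u₃ ≡ o) → Dec (u₂ ⊟ u₃ ≡ o) →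
             Outcome p₁ p₂ p₃ q₁ q₂ q₃
    decide (yes z) _ _ _ _ _ = translated (extend P₁ P₂ P₃ Q₁ Q₂ Q₃ q₁≢q₂ M
      (with3 v₆ z (+ 1) (+ 0) (+ 2) (v₁ :- v₀) (v₄ :- v₃) refl))
    decide _ (yes z) _ _ _ _ = let (s , t) = extend P₁ P₃ P₂ Q₁ Q₃ Q₂ q₁≢q₃ (rotate M) (with3 v₇ z (+ 0) (+ 1) (+ 2) (v₂ :- v₀) (v₅ :- v₃) refl)
      in translated (t , s)
    decide _ _ (yes z) _ _ _ = let (s , t) = extend P₂ P₃ P₁ Q₂ Q₃ Q₁ q₂≢q₃ (rebase M)
                                               (with3 (v₆ :- v₇) z -1ℤ (+ 1) -[1+ 1 ] (v₂ :- v₁) (v₅ :- v₄) refl)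
      in translated (lin≡ G ((-1ℤ , v₀ :- v₁ , v₃ :- v₄) ∷ []) (t ∷ []) (v₁ :- v₀) (v₄ :- v₃) refl
           , lin≡ G ((-1ℤ , v₀ :- v₁ , v₃ :- v₄) ∷ (+ 1 , v₂ :- v₁ , v₅ :- v₄) ∷ []) (t ∷ s ∷ []) (v₂ :- v₀) (v₅ :- v₃) refl)
    decide _ _ _ (yes z) _ _ = opposite₁₂ (with3 :u₂ z -1ℤ (+ 0) (+ 2) (v₁ :- v₀) (v₃ :- v₄) refl)
    decide _ _ _ _ (yes z) _ = opposite₁₃ (with3 :u₃ z (+ 0) -1ℤ (+ 2) (v₂ :- v₀) (v₃ :- v₅) refl)
    decide _ _ _ _ _ (yes z) = opposite₂₃ (with3 (:u₂ :- :u₃) z (+ 1) -1ℤ -[1+ 1 ] (v₂ :- v₁) (v₄ :- v₅) refl)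
    decide (no n₁) (no n₂) (no n₃) (no n₄) (no n₅) (no n₆) =
      misses (Resolve.resolve S p₁ q₁ g (C-valid n₁ n₂ n₃ n₄ n₅ n₆) checkA)

-- A common triangle

record Common (P Q : Z3 → Set) : Set where
  field
    p₁ p₂ p₃ q₁ q₂ q₃ : Z3
    P₁ : P p₁
    P₂ : P p₂
    P₃ : P p₃
    Q₁ : Q q₁
    Q₂ : Q q₂
    Q₃ : Q q₃
    differentP : Different p₁ p₂ p₃
    differentQ : Different q₁ q₂ q₃
    same : Translated p₁ p₂ p₃ q₁ q₂ q₃

swap-common : ∀ {P Q} → Common P Q → Common Q P
swap-common C = record
  { P₁ = Q₁ ; P₂ = Q₂ ; P₃ = Q₃ ; Q₁ = P₁ ; Q₂ = P₂ ; Q₃ = P₃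
  ; differentP = differentQ ; differentQ = differentP ; same = sym (proj₁ same) , sym (proj₂ same) }
  where open Common C

module _ {P Q K : Z3 → Set} (S : System P Q K) where
  open System S
  module OP = LengthOne oneP
  module OQ = LengthOne oneQ

  2≤2 : 2 ℕ.≤ 2
  2≤2 = s≤s (s≤s z≤n)
  2≤3 : 2 ℕ.≤ 3
  2≤3 = s≤s (s≤s z≤n)

  even⇒≢ : ∀ {p p' q q'} → Q q → Q q' → q ≢ q' → Even ((p' ⊟ p) ⊟ (q' ⊟ q)) → p ≢ p'
  even⇒≢ {p} {p'} {q} {q'} Qq Qq' q≢q' (y , e) refl = q≢q' (OQ.indivisible 2 2≤2 Qq Qq'
    (y , lin≡ (p ∷ q ∷ q' ∷ y ∷ []) ((+ 1 , (v₀ :- v₀) :- (v₂ :- v₁) , + 2 :* v₃) ∷ []) (e ∷ []) (v₁ :- v₂) (+ 2 :* v₃) refl))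

  matched-different : ∀ {p₁ p₂ p₃ q₁ q₂ q₃} → Q q₁ → Q q₂ → Q q₃ → Different q₁ q₂ q₃ →
                      Matched p₁ p₂ p₃ q₁ q₂ q₃ → Different p₁ p₂ p₃
  matched-different Q₁ Q₂ Q₃ (n₁₂ , n₁₃ , n₂₃) M =
    even⇒≢ Q₁ Q₂ n₁₂ (Matched.even₂ M) , even⇒≢ Q₁ Q₃ n₁₃ (Matched.even₃ M) ,
    even⇒≢ Q₂ Q₃ n₂₃ (Matched.even₂ (rebase M))

  extend-common : ∀ {p₁ p₂ p₃ q₁ q₂ q₃} → P p₁ → P p₂ → P p₃ → Q q₁ → Q q₂ → Q q₃ → Different q₁ q₂ q₃ →
                  Matched p₁ p₂ p₃ q₁ q₂ q₃ → Same p₁ p₂ q₁ q₂ → Common P Q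
  extend-common P₁ P₂ P₃ Q₁ Q₂ Q₃ d M s = record
    { P₁ = P₁ ; P₂ = P₂ ; P₃ = P₃ ; Q₁ = Q₁ ; Q₂ = Q₂ ; Q₃ = Q₃
    ; differentP = matched-different Q₁ Q₂ Q₃ d M ; differentQ = d
    ; same = extend S P₁ P₂ P₃ Q₁ Q₂ Q₃ (proj₁ d) M s }

  permute₁₃₂ : ∀ {a b c : Z3} → Different a b c → Different a c b
  permute₁₃₂ (ab , ac , bc) = ac , ab , (λ e → bc (sym e))
  permute₂₃₁ : ∀ {a b c : Z3} → Different a b c → Different b c a
  permute₂₃₁ (ab , ac , bc) = bc , (λ e → ab (sym e)) , (λ e → ac (sym e))

  -- The four ways to match a triangle y with three of the four points x, whose sum is even.
  record Quad (x₁ x₂ x₃ x₄ y₁ y₂ y₃ : Z3) : Set where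
    field
      m₁ : Matched x₁ x₂ x₃ y₁ y₂ y₃
      m₂ : Matched x₂ x₁ x₄ y₁ y₂ y₃
      m₃ : Matched x₃ x₄ x₁ y₁ y₂ y₃
      m₄ : Matched x₄ x₃ x₂ y₁ y₂ y₃

  -- Modulo two the points x form a coset of the plane spanned by the edges of y, and the triangle y
  -- can be read off starting from each of them.
  mkQuad : ∀ {x₁ x₂ x₃ x₄ y₁ y₂ y₃} → Matched x₁ x₂ x₃ y₁ y₂ y₃ → Even ((x₁ ⊞ x₄) ⊟ (x₂ ⊞ x₃)) → Quad x₁ x₂ x₃ x₄ y₁ y₂ y₃
  mkQuad {x₁} {x₂} {x₃} {x₄} {y₁} {y₂} {y₃} (matched (a , e₂) (b , e₃)) (c , e) = record
    { m₁ = matched (a , e₂) (b , e₃)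
    ; m₂ = matched (a ⊟ (x₂ ⊟ x₁) , by (+ 1) (+ 0) (+ 0) ((v₀ :- v₁) :- (v₅ :- v₄)) (+ 2 :* (v₇ :- (v₁ :- v₀))) refl)
                   (b ⊞ c , by (+ 0) (+ 1) (+ 1) ((v₃ :- v₁) :- (v₆ :- v₄)) (+ 2 :* (v₈ :+ v₉)) refl)
    ; m₃ = matched (a ⊞ c , by (+ 1) (+ 0) (+ 1) ((v₃ :- v₂) :- (v₅ :- v₄)) (+ 2 :* (v₇ :+ v₉)) refl)
                   (b ⊟ (x₃ ⊟ x₁) , by (+ 0) (+ 1) (+ 0) ((v₀ :- v₂) :- (v₆ :- v₄)) (+ 2 :* (v₈ :- (v₂ :- v₀))) refl)
    ; m₄ = matched (a ⊟ c ⊞ (x₁ ⊟ x₂) , by (+ 1) (+ 0) -1ℤ ((v₂ :- v₃) :- (v₅ :- v₄)) (+ 2 :* (v₇ :- v₉ :+ (v₀ :- v₁))) refl)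
                   (b ⊟ c ⊞ (x₁ ⊟ x₃) , by (+ 0) (+ 1) -1ℤ ((v₁ :- v₃) :- (v₆ :- v₄)) (+ 2 :* (v₈ :- v₉ :+ (v₀ :- v₂))) refl) }
    where
    G : Vec Z3 10
    G = x₁ ∷ x₂ ∷ x₃ ∷ x₄ ∷ y₁ ∷ y₂ ∷ y₃ ∷ a ∷ b ∷ c ∷ []
    by : ∀ k₂ k₃ k (l r : Expr 10) → nf l ⊖ᵥ nf r ≡ combine ((k₂ , (v₁ :- v₀) :- (v₅ :- v₄) , + 2 :* v₇)
           ∷ (k₃ , (v₂ :- v₀) :- (v₆ :- v₄) , + 2 :* v₈) ∷ (k , (v₀ :+ v₃) :- (v₁ :+ v₂) , + 2 :* v₉) ∷ []) → ⟦ l ⟧ G ≡ ⟦ r ⟧ G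
    by k₂ k₃ k l r = lin≡ G ((k₂ , (v₁ :- v₀) :- (v₅ :- v₄) , + 2 :* v₇)
           ∷ (k₃ , (v₂ :- v₀) :- (v₆ :- v₄) , + 2 :* v₈) ∷ (k , (v₀ :+ v₃) :- (v₁ :+ v₂) , + 2 :* v₉) ∷ []) (e₂ ∷ e₃ ∷ e ∷ []) l r

  congruent-sums : ∀ a b c d → Multiple 3 (a ⊟ c) → Multiple 3 (b ⊟ c) → d ≡ a ⊟ b → Multiple 3 d
  congruent-sums a b c _ (y , e) (z , f) refl = y ⊟ z , lin≡ (a ∷ b ∷ c ∷ y ∷ z ∷ [])
    ((+ 1 , v₀ :- v₂ , + 3 :* v₃) ∷ (-1ℤ , v₁ :- v₂ , + 3 :* v₄) ∷ []) (e ∷ f ∷ []) (v₀ :- v₁) (+ 3 :* (v₃ :- v₄)) refl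

  module _ {y₁ y₂ y₃ : Z3} (Y₁ : Q y₁) (Y₂ : Q y₂) (Y₃ : Q y₃) (d : Different y₁ y₂ y₃) (nc : ¬ Centred y₁ y₂ y₃) where

    Σy : Z3
    Σy = y₁ ⊞ y₂ ⊞ y₃

    -- Either alternative fixes the residue of the sum modulo three; `⊟ o` gives both the shape that
    -- `congruent-sums` compares.
    Exception : Z3 → Z3 → Z3 → Set
    Exception x₁ x₂ x₃ = Multiple 3 ((x₁ ⊞ x₂ ⊞ x₃) ⊟ o) ⊎ Multiple 3 ((x₁ ⊞ x₂ ⊞ x₃) ⊟ Σy)

    -- An opposite edge becomes a translated one when read from its other end, and there the fourth
    -- point completes it to a common triangle.
    quad-step : ∀ {x₁ x₂ x₃ x₄} → P x₁ → P x₂ → P x₃ → P x₄ → Quad x₁ x₂ x₃ x₄ y₁ y₂ y₃ → Common P Q ⊎ Exception x₁ x₂ x₃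
    quad-step {x₁} {x₂} {x₃} {x₄} X₁ X₂ X₃ X₄ q = go (compare S X₁ X₂ X₃ Y₁ Y₂ Y₃ (matched-different Y₁ Y₂ Y₃ d m₁) d m₁)
      where
      open Quad q
      G : Vec Z3 7
      G = x₁ ∷ x₂ ∷ x₃ ∷ x₄ ∷ y₁ ∷ y₂ ∷ y₃ ∷ []
      go : Outcome S x₁ x₂ x₃ y₁ y₂ y₃ → Common P Q ⊎ Exception x₁ x₂ x₃
      go (translated t) = inj₁ (extend-common X₁ X₂ X₃ Y₁ Y₂ Y₃ d m₁ (proj₁ t))
      go (opposite₁₂ e) = inj₁ (extend-common X₂ X₁ X₄ Y₁ Y₂ Y₃ d m₂
        (lin≡ G ((-1ℤ , v₁ :- v₀ , v₄ :- v₅) ∷ []) (e ∷ []) (v₀ :- v₁) (v₅ :- v₄) refl))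
      go (opposite₁₃ e) = inj₁ (extend-common X₃ X₁ X₄ Y₁ Y₃ Y₂ (permute₁₃₂ d) (rotate m₃)
        (lin≡ G ((-1ℤ , v₂ :- v₀ , v₄ :- v₆) ∷ []) (e ∷ []) (v₀ :- v₂) (v₆ :- v₄) refl))
      go (opposite₂₃ e) = inj₁ (extend-common X₃ X₂ X₄ Y₂ Y₃ Y₁ (permute₂₃₁ d) (rebase m₄)
        (lin≡ G ((-1ℤ , v₂ :- v₁ , v₅ :- v₆) ∷ []) (e ∷ []) (v₁ :- v₂) (v₆ :- v₅) refl))
      go (centredP (y , e)) = inj₂ (inj₁ (y , trans (vec≡ (x₁ ⊞ x₂ ⊞ x₃ ∷ []) (v₀ :- :0) v₀ refl) e))
      go (centredQ c) = ⊥-elim (nc c)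
      go (congruent c) = inj₂ (inj₂ c)

    -- Three triples of the quad compete for two exceptional residues. Two triples with the same
    -- residue would make two points of P congruent modulo three.
    quad-common : ∀ {x₁ x₂ x₃ x₄} → P x₁ → P x₂ → P x₃ → P x₄ → Quad x₁ x₂ x₃ x₄ y₁ y₂ y₃ → Common P Q
    quad-common {x₁} {x₂} {x₃} {x₄} X₁ X₂ X₃ X₄ q = go
      (quad-step X₁ X₂ X₃ X₄ q)
      (quad-step X₂ X₁ X₄ X₃ (record { m₁ = m₂ ; m₂ = m₁ ; m₃ = m₄ ; m₄ = m₃ }))
      (quad-step X₃ X₄ X₁ X₂ (record { m₁ = m₃ ; m₂ = m₄ ; m₃ = m₁ ; m₄ = m₂ }))
      where
      open Quad q
      G : Vec Z3 4
      G = x₁ ∷ x₂ ∷ x₃ ∷ x₄ ∷ []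
      d₁ = matched-different Y₁ Y₂ Y₃ d m₁
      d₂ = matched-different Y₁ Y₂ Y₃ d m₂
      d₃ = matched-different Y₁ Y₂ Y₃ d m₃
      clash₁₂ : ∀ c → Multiple 3 ((x₁ ⊞ x₂ ⊞ x₃) ⊟ c) → Multiple 3 ((x₂ ⊞ x₁ ⊞ x₄) ⊟ c) → ⊥
      clash₁₂ c a b = proj₁ d₃ (OP.indivisible 3 2≤3 X₃ X₄ (congruent-sums (x₁ ⊞ x₂ ⊞ x₃) (x₂ ⊞ x₁ ⊞ x₄) c (x₃ ⊟ x₄) a b
        (vec≡ G (v₂ :- v₃) ((v₀ :+ v₁ :+ v₂) :- (v₁ :+ v₀ :+ v₃)) refl)))
      clash₁₃ : ∀ c → Multiple 3 ((x₁ ⊞ x₂ ⊞ x₃) ⊟ c) → Multiple 3 ((x₃ ⊞ x₄ ⊞ x₁) ⊟ c) → ⊥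
      clash₁₃ c a b = proj₁ (proj₂ d₂) (OP.indivisible 3 2≤3 X₂ X₄ (congruent-sums (x₁ ⊞ x₂ ⊞ x₃) (x₃ ⊞ x₄ ⊞ x₁) c (x₂ ⊟ x₄) a b
        (vec≡ G (v₁ :- v₃) ((v₀ :+ v₁ :+ v₂) :- (v₂ :+ v₃ :+ v₀)) refl)))
      clash₂₃ : ∀ c → Multiple 3 ((x₂ ⊞ x₁ ⊞ x₄) ⊟ c) → Multiple 3 ((x₃ ⊞ x₄ ⊞ x₁) ⊟ c) → ⊥
      clash₂₃ c a b = proj₂ (proj₂ d₁) (OP.indivisible 3 2≤3 X₂ X₃ (congruent-sums (x₂ ⊞ x₁ ⊞ x₄) (x₃ ⊞ x₄ ⊞ x₁) c (x₂ ⊟ x₃) a b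
        (vec≡ G (v₁ :- v₂) ((v₁ :+ v₀ :+ v₃) :- (v₂ :+ v₃ :+ v₀)) refl)))
      go : Common P Q ⊎ Exception x₁ x₂ x₃ → Common P Q ⊎ Exception x₂ x₁ x₄ → Common P Q ⊎ Exception x₃ x₄ x₁ → Common P Q
      go (inj₁ c) _ _ = c
      go _ (inj₁ c) _ = c
      go _ _ (inj₁ c) = c
      go (inj₂ (inj₁ a)) (inj₂ (inj₁ b)) _ = ⊥-elim (clash₁₂ o a b)
      go (inj₂ (inj₂ a)) (inj₂ (inj₂ b)) _ = ⊥-elim (clash₁₂ Σy a b)
      go (inj₂ (inj₁ a)) _ (inj₂ (inj₁ b)) = ⊥-elim (clash₁₃ o a b)
      go (inj₂ (inj₂ a)) _ (inj₂ (inj₂ b)) = ⊥-elim (clash₁₃ Σy a b)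
      go _ (inj₂ (inj₁ a)) (inj₂ (inj₁ b)) = ⊥-elim (clash₂₃ o a b)
      go _ (inj₂ (inj₂ a)) (inj₂ (inj₂ b)) = ⊥-elim (clash₂₃ Σy a b)

  -- The edges of the closed path q₀ q₁ q₃ q₂ are realised modulo two by vectors from the single
  -- point y of P; at each corner of the path two of them match a triangle of Q.
  record Crown (q₀ q₁ q₂ q₃ y x₁ x₂ x₃ x₄ : Z3) : Set where
    field
      m₁ : Matched y x₁ x₂ q₀ q₁ q₂
      m₂ : Matched y x₁ x₃ q₁ q₀ q₃
      m₃ : Matched y x₂ x₄ q₂ q₀ q₃
      m₄ : Matched y x₃ x₄ q₃ q₁ q₂

  module _ {q₀ q₁ q₂ q₃ : Z3} (Q₀ : Q q₀) (Q₁ : Q q₁) (Q₂ : Q q₂) (Q₃ : Q q₃)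
           (n₀₁ : q₀ ≢ q₁) (n₀₂ : q₀ ≢ q₂) (n₁₂ : q₁ ≢ q₂) (n₀₃ : q₀ ≢ q₃) (n₁₃ : q₁ ≢ q₃) (n₂₃ : q₂ ≢ q₃)
           (nc : ∀ {a b c} → Q a → Q b → Q c → Different a b c → ¬ Centred a b c)
           {y x₁ x₂ x₃ x₄ : Z3} (Y : P y) (X₁ : P x₁) (X₂ : P x₂) (X₃ : P x₃) (X₄ : P x₄) where

    -- An opposite edge at y is a translated edge when seen from the neighbouring corner. A lattice
    -- centroid of the triangle in P completes it to a quad.
    crown-step : Crown q₀ q₁ q₂ q₃ y x₁ x₂ x₃ x₄ → Common P Q ⊎ Opposite x₁ x₂ q₁ q₂ ⊎ Congruent y x₁ x₂ q₀ q₁ q₂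
    crown-step cr = go (compare S Y X₁ X₂ Q₀ Q₁ Q₂ (matched-different Q₀ Q₁ Q₂ d m₁) d m₁)
      where
      open Crown cr
      d : Different q₀ q₁ q₂
      d = n₀₁ , n₀₂ , n₁₂
      go : Outcome S y x₁ x₂ q₀ q₁ q₂ → Common P Q ⊎ Opposite x₁ x₂ q₁ q₂ ⊎ Congruent y x₁ x₂ q₀ q₁ q₂
      go (translated t) = inj₁ (extend-common Y X₁ X₂ Q₀ Q₁ Q₂ d m₁ (proj₁ t))
      go (opposite₁₂ e) = inj₁ (extend-common Y X₁ X₃ Q₁ Q₀ Q₃ ((λ e → n₀₁ (sym e)) , n₁₃ , n₀₃) m₂ e)
      go (opposite₁₃ e) = inj₁ (extend-common Y X₂ X₄ Q₂ Q₀ Q₃ ((λ e → n₀₂ (sym e)) , n₂₃ , n₀₃) m₃ e)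
      go (opposite₂₃ e) = inj₂ (inj₁ e)
      go (centredP (c , e)) = inj₁ (quad-common Q₀ Q₁ Q₂ d (nc Q₀ Q₁ Q₂ d) Y X₁ X₂ C
          (mkQuad m₁ (y ⊟ c , lin≡ (y ∷ x₁ ∷ x₂ ∷ c ∷ []) ((-1ℤ , v₀ :+ v₁ :+ v₂ , + 3 :* v₃) ∷ []) (e ∷ [])
            ((v₀ :+ v₃) :- (v₁ :+ v₂)) (+ 2 :* (v₀ :- v₃)) refl)))
        where
        C : P c
        C = OP.convex ((1 , y) ∷ (1 , x₁) ∷ (1 , x₂) ∷ []) c (Y ∷ X₁ ∷ X₂ ∷ []) (s≤s z≤n)
          (lin≡ (y ∷ x₁ ∷ x₂ ∷ c ∷ []) ((-1ℤ , v₀ :+ v₁ :+ v₂ , + 3 :* v₃) ∷ []) (e ∷ [])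
            (+ 3 :* v₃) (+ 1 :* v₀ :+ (+ 1 :* v₁ :+ (+ 1 :* v₂ :+ :0))) refl)
      go (centredQ c) = ⊥-elim (nc Q₀ Q₁ Q₂ d c)
      go (congruent c) = inj₂ (inj₂ c)

    -- The congruence is an equality of points of P + Q, which turns the parity hypothesis into r ≡
    -- r' modulo two.
    clash : ∀ {x x' q q' r r'} → P x → P x' → Q q → Q q' → Q r → Q r' → r ≢ r' →
            Multiple 3 ((x ⊞ q') ⊟ (x' ⊞ q)) → Even (((x ⊟ x') ⊟ (q ⊟ q')) ⊟ (r ⊟ r')) → ⊥
    clash {x} {x'} {q} {q'} {r} {r'} X X' Qq Qq' R R' r≢r' m (z , e) = r≢r' (OQ.indivisible 2 2≤2 R R' (-1ℤ ∙ z ,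
      lin≡ (x ∷ x' ∷ q ∷ q' ∷ r ∷ r' ∷ z ∷ []) ((-1ℤ , ((v₀ :- v₁) :- (v₂ :- v₃)) :- (v₄ :- v₅) , + 2 :* v₆) ∷ (+ 1 , v₀ :+ v₃ , v₁ :+ v₂) ∷ [])
        (e ∷ triple (sum X Qq') (sum X' Qq) m ∷ []) (v₄ :- v₅) (+ 2 :* (-1ℤ :* v₆)) refl))

multiple? : ∀ m z → Dec (Multiple m z)
multiple? m (a , b , c) = map′ to from ((+ m Div.∣? a) ×-dec ((+ m Div.∣? b) ×-dec (+ m Div.∣? c)))
  where
  to : _ → Multiple m (a , b , c)
  to (divides x e , divides y f , divides z g) = (x , y , z) ,
    z3≡ (trans e (ℤP.*-comm x (+ m))) (trans f (ℤP.*-comm y (+ m))) (trans g (ℤP.*-comm z (+ m)))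
  from : Multiple m (a , b , c) → _
  from ((x , y , z) , e) = divides x (trans (cong proj₁ e) (ℤP.*-comm (+ m) x)) ,
    divides y (trans (cong (λ t → proj₁ (proj₂ t)) e) (ℤP.*-comm (+ m) y)) ,
    divides z (trans (cong (λ t → proj₂ (proj₂ t)) e) (ℤP.*-comm (+ m) z))

unique-length : ∀ {A : Set} {xs ys : List A} → AllPairs _≢_ xs → (∀ {x} → x ∈ xs → x ∈ ys) → length xs ℕ.≤ length ys
unique-length [] _ = z≤n
unique-length {xs = x ∷ xs} {ys} (x∉ ∷ u) sub with MemP.∈-∃++ (sub (here refl))
... | as , bs , refl = subst (suc (length xs) ℕ.≤_) (sym (trans (len as) refl)) (s≤s (unique-length u sub'))
  where
  len : ∀ as → length (as ++ x ∷ bs) ≡ suc (length (as ++ bs))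
  len [] = refl
  len (_ ∷ as) = cong suc (len as)
  sub' : ∀ {y} → y ∈ xs → y ∈ as ++ bs
  sub' {y} y∈ with MemP.∈-++⁻ as (sub (there y∈))
  ... | inj₁ y∈as = MemP.∈-++⁺ˡ y∈as
  ... | inj₂ (here refl) = ⊥-elim (All.lookup x∉ y∈ refl)
  ... | inj₂ (there y∈bs) = MemP.∈-++⁺ʳ as y∈bs

module _ {P Q K : Z3 → Set} (S : System P Q K) where
  open System S

  -- Opposite edges at two opposite corners would give a parallelogram in P, and congruent sums at
  -- two adjacent corners are excluded by `clash`. So some corner yields a common triangle.
  crown-common : ∀ {q₀ q₁ q₂ q₃ y x₁ x₂ x₃ x₄} → Q q₀ → Q q₁ → Q q₂ → Q q₃ →
    q₀ ≢ q₁ → q₀ ≢ q₂ → q₁ ≢ q₂ → q₀ ≢ q₃ → q₁ ≢ q₃ → q₂ ≢ q₃ →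
    (∀ {a b c} → Q a → Q b → Q c → Different a b c → ¬ Centred a b c) →
    P y → P x₁ → P x₂ → P x₃ → P x₄ → Crown S q₀ q₁ q₂ q₃ y x₁ x₂ x₃ x₄ → Common P Q
  crown-common {q₀} {q₁} {q₂} {q₃} {y} {x₁} {x₂} {x₃} {x₄} Q₀ Q₁ Q₂ Q₃ n₀₁ n₀₂ n₁₂ n₀₃ n₁₃ n₂₃ nc Y X₁ X₂ X₃ X₄ cr = go
    (crown-step S Q₀ Q₁ Q₂ Q₃ n₀₁ n₀₂ n₁₂ n₀₃ n₁₃ n₂₃ nc Y X₁ X₂ X₃ X₄ cr)
    (crown-step S Q₁ Q₀ Q₃ Q₂ (≢-sym n₀₁) n₁₃ n₀₃ n₁₂ n₀₂ (≢-sym n₂₃) nc Y X₁ X₃ X₂ X₄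
      (record { m₁ = m₂ ; m₂ = m₁ ; m₃ = m₄ ; m₄ = m₃ }))
    (crown-step S Q₂ Q₀ Q₃ Q₁ (≢-sym n₀₂) n₂₃ n₀₃ (≢-sym n₁₂) n₀₁ (≢-sym n₁₃) nc Y X₂ X₄ X₁ X₃
      (record { m₁ = m₃ ; m₂ = rotate m₁ ; m₃ = rotate m₄ ; m₄ = m₂ }))
    (crown-step S Q₃ Q₁ Q₂ Q₀ (≢-sym n₁₃) (≢-sym n₂₃) n₁₂ (≢-sym n₀₃) (≢-sym n₀₁) (≢-sym n₀₂) nc Y X₃ X₄ X₁ X₂
      (record { m₁ = m₄ ; m₂ = rotate m₂ ; m₃ = rotate m₃ ; m₄ = m₁ }))
    where
    open Crown cr
    G : Vec Z3 9
    G = y ∷ x₁ ∷ x₂ ∷ x₃ ∷ x₄ ∷ q₀ ∷ q₁ ∷ q₂ ∷ q₃ ∷ []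
    x₁≢x₂ : x₁ ≢ x₂
    x₁≢x₂ = proj₂ (proj₂ (matched-different S Q₀ Q₁ Q₂ (n₀₁ , n₀₂ , n₁₂) m₁))
    x₁≢x₃ : x₁ ≢ x₃
    x₁≢x₃ = proj₂ (proj₂ (matched-different S Q₁ Q₀ Q₃ (≢-sym n₀₁ , n₁₃ , n₀₃) m₂))
    parallel : x₂ ⊞ x₃ ≡ x₁ ⊞ x₄ → ⊥
    parallel e = contra (LengthOne.crossing oneP X₂ X₃ X₁ X₄ e)
      where contra : x₂ ≡ x₁ ⊎ x₃ ≡ x₁ → ⊥
            contra (inj₁ e') = x₁≢x₂ (sym e')
            contra (inj₂ e') = x₁≢x₃ (sym e')
    apart : ∀ {x x' q q' r r' a b A B} → P x → P x' → Q q → Q q' → Q r → Q r' → r ≢ r' →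
      (x ⊞ q') ⊟ (x' ⊞ q) ≡ a ⊟ b → Multiple 3 a → Multiple 3 b →
      ((x ⊟ x') ⊟ (q ⊟ q')) ⊟ (r ⊟ r') ≡ A ⊟ B → Even A → Even B → ⊥
    apart {a = a} {b} {A} {B} X X' Qq Qq' R R' r≢r' e (α , ea) (β , eb) f (γ , eA) (δ , eB) =
      clash S Q₀ Q₁ Q₂ Q₃ n₀₁ n₀₂ n₁₂ n₀₃ n₁₃ n₂₃ nc Y X₁ X₂ X₃ X₄ X X' Qq Qq' R R' r≢r'
        (α ⊟ β , trans e (trans (cong₂ _⊟_ ea eb) (∙-⊟ (+ 3) α β)))
        (γ ⊟ δ , trans f (trans (cong₂ _⊟_ eA eB) (∙-⊟ (+ 2) γ δ)))
    go : Common P Q ⊎ Opposite x₁ x₂ q₁ q₂ ⊎ Congruent y x₁ x₂ q₀ q₁ q₂ →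
         Common P Q ⊎ Opposite x₁ x₃ q₀ q₃ ⊎ Congruent y x₁ x₃ q₁ q₀ q₃ →
         Common P Q ⊎ Opposite x₂ x₄ q₀ q₃ ⊎ Congruent y x₂ x₄ q₂ q₀ q₃ →
         Common P Q ⊎ Opposite x₃ x₄ q₁ q₂ ⊎ Congruent y x₃ x₄ q₃ q₁ q₂ → Common P Q
    go (inj₁ c) _ _ _ = c
    go _ (inj₁ c) _ _ = c
    go _ _ (inj₁ c) _ = c
    go _ _ _ (inj₁ c) = c
    go (inj₂ (inj₁ e)) _ _ (inj₂ (inj₁ f)) = ⊥-elim (parallel
      (lin≡ G ((+ 1 , v₂ :- v₁ , v₆ :- v₇) ∷ (-1ℤ , v₄ :- v₃ , v₆ :- v₇) ∷ []) (e ∷ f ∷ []) (v₂ :+ v₃) (v₁ :+ v₄) refl))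
    go _ (inj₂ (inj₁ e)) (inj₂ (inj₁ f)) _ = ⊥-elim (parallel
      (lin≡ G ((+ 1 , v₃ :- v₁ , v₅ :- v₈) ∷ (-1ℤ , v₄ :- v₂ , v₅ :- v₈) ∷ []) (e ∷ f ∷ []) (v₂ :+ v₃) (v₁ :+ v₄) refl))
    go (inj₂ (inj₂ a)) (inj₂ (inj₂ b)) _ _ = ⊥-elim (apart X₂ X₃ Q₂ Q₃ Q₁ Q₀ (≢-sym n₀₁)
      (vec≡ G ((v₂ :+ v₈) :- (v₃ :+ v₇)) (((v₀ :+ v₁ :+ v₂) :- (v₅ :+ v₆ :+ v₇)) :- ((v₀ :+ v₁ :+ v₃) :- (v₆ :+ v₅ :+ v₈))) refl) a b
      (vec≡ G (((v₂ :- v₃) :- (v₇ :- v₈)) :- (v₆ :- v₅)) (((v₂ :- v₀) :- (v₇ :- v₅)) :- ((v₃ :- v₀) :- (v₈ :- v₆))) refl)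
      (Matched.even₃ m₁) (Matched.even₃ m₂))
    go (inj₂ (inj₂ a)) _ (inj₂ (inj₂ b)) _ = ⊥-elim (apart X₁ X₄ Q₁ Q₃ Q₂ Q₀ (≢-sym n₀₂)
      (vec≡ G ((v₁ :+ v₈) :- (v₄ :+ v₆)) (((v₀ :+ v₁ :+ v₂) :- (v₅ :+ v₆ :+ v₇)) :- ((v₀ :+ v₂ :+ v₄) :- (v₇ :+ v₅ :+ v₈))) refl) a b
      (vec≡ G (((v₁ :- v₄) :- (v₆ :- v₈)) :- (v₇ :- v₅)) (((v₁ :- v₀) :- (v₆ :- v₅)) :- ((v₄ :- v₀) :- (v₈ :- v₇))) refl)
      (Matched.even₂ m₁) (Matched.even₃ m₃))
    go _ (inj₂ (inj₂ b)) _ (inj₂ (inj₂ a)) = ⊥-elim (apart X₄ X₁ Q₂ Q₀ Q₁ Q₃ n₁₃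
      (vec≡ G ((v₄ :+ v₅) :- (v₁ :+ v₇)) (((v₀ :+ v₃ :+ v₄) :- (v₈ :+ v₆ :+ v₇)) :- ((v₀ :+ v₁ :+ v₃) :- (v₆ :+ v₅ :+ v₈))) refl) a b
      (vec≡ G (((v₄ :- v₁) :- (v₇ :- v₅)) :- (v₆ :- v₈)) (((v₄ :- v₀) :- (v₇ :- v₈)) :- ((v₁ :- v₀) :- (v₅ :- v₆))) refl)
      (Matched.even₃ m₄) (Matched.even₂ m₂))
    go _ _ (inj₂ (inj₂ b)) (inj₂ (inj₂ a)) = ⊥-elim (apart X₃ X₂ Q₁ Q₀ Q₂ Q₃ n₂₃
      (vec≡ G ((v₃ :+ v₅) :- (v₂ :+ v₆)) (((v₀ :+ v₃ :+ v₄) :- (v₈ :+ v₆ :+ v₇)) :- ((v₀ :+ v₂ :+ v₄) :- (v₇ :+ v₅ :+ v₈))) refl) a b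
      (vec≡ G (((v₃ :- v₂) :- (v₆ :- v₅)) :- (v₇ :- v₈)) (((v₃ :- v₀) :- (v₆ :- v₈)) :- ((v₂ :- v₀) :- (v₅ :- v₇))) refl)
      (Matched.even₂ m₄) (Matched.even₂ m₃))

-- Points of Q in a plane modulo two

data Span (s t z : Z3) : Set where
  h₀ : Even z → Span s t z
  h₁ : Even (z ⊟ s) → Span s t z
  h₂ : Even (z ⊟ t) → Span s t z
  h₃ : Even (z ⊟ (s ⊞ t)) → Span s t z

span? : ∀ s t z → Dec (Span s t z)
span? s t z with multiple? 2 z | multiple? 2 (z ⊟ s) | multiple? 2 (z ⊟ t) | multiple? 2 (z ⊟ (s ⊞ t))
... | yes e | _ | _ | _ = yes (h₀ e)
... | no _ | yes e | _ | _ = yes (h₁ e)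
... | no _ | no _ | yes e | _ = yes (h₂ e)
... | no _ | no _ | no _ | yes e = yes (h₃ e)
... | no a | no b | no c | no d = no λ { (h₀ e) → a e ; (h₁ e) → b e ; (h₂ e) → c e ; (h₃ e) → d e }

absorb : ∀ {s t} (a b : Fin 2) u k y → ev (+ toℕ a ∷ + toℕ b ∷ []) (s ∷ t ∷ []) ⊞ (u ⊞ + 2 ∙ k) ≡ + 2 ∙ y → Span s t u
absorb {s} {t} a b u k y e = go a b e
  where
  G : Vec Z3 5
  G = s ∷ t ∷ u ∷ k ∷ y ∷ []
  go : ∀ a b → ev (+ toℕ a ∷ + toℕ b ∷ []) (s ∷ t ∷ []) ⊞ (u ⊞ + 2 ∙ k) ≡ + 2 ∙ y → Span s t u
  go zero zero e = h₀ (y ⊟ k , lin≡ G ((+ 1 , (+ 0 :* v₀ :+ (+ 0 :* v₁ :+ :0)) :+ (v₂ :+ + 2 :* v₃) , + 2 :* v₄) ∷ []) (e ∷ [])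
    v₂ (+ 2 :* (v₄ :- v₃)) refl)
  go (suc zero) zero e = h₁ (y ⊟ k ⊟ s , lin≡ G ((+ 1 , (+ 1 :* v₀ :+ (+ 0 :* v₁ :+ :0)) :+ (v₂ :+ + 2 :* v₃) , + 2 :* v₄) ∷ []) (e ∷ [])
    (v₂ :- v₀) (+ 2 :* (v₄ :- v₃ :- v₀)) refl)
  go zero (suc zero) e = h₂ (y ⊟ k ⊟ t , lin≡ G ((+ 1 , (+ 0 :* v₀ :+ (+ 1 :* v₁ :+ :0)) :+ (v₂ :+ + 2 :* v₃) , + 2 :* v₄) ∷ []) (e ∷ [])
    (v₂ :- v₁) (+ 2 :* (v₄ :- v₃ :- v₁)) refl)
  go (suc zero) (suc zero) e = h₃ (y ⊟ k ⊟ s ⊟ t , lin≡ G ((+ 1 , (+ 1 :* v₀ :+ (+ 1 :* v₁ :+ :0)) :+ (v₂ :+ + 2 :* v₃) , + 2 :* v₄) ∷ []) (e ∷ [])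
    (v₂ :- (v₀ :+ v₁)) (+ 2 :* (v₄ :- v₃ :- v₀ :- v₁)) refl)

-- Modulo two the plane of s and t has index two, so there is only one coset outside it.
same-coset : ∀ {s t g z} → ¬ Even s → ¬ Even t → ¬ Even (s ⊟ t) → ¬ Span s t g → ¬ Span s t z → Span s t (z ⊟ g)
same-coset {s} {t} {g} {z} ¬s ¬t ¬st ¬g ¬z = finish (Mod2.dependent (s ∷ t ∷ g ∷ z ∷ []))
  where
  split : ∀ a b c e y → ev (Mod2.digits (a ∷ b ∷ c ∷ e ∷ [])) (s ∷ t ∷ g ∷ z ∷ []) ≡ + 2 ∙ y →
          ev (+ toℕ a ∷ + toℕ b ∷ []) (s ∷ t ∷ []) ⊞ (+ toℕ c ∙ g ⊞ + toℕ e ∙ z) ≡ + 2 ∙ y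
  split a b c e y eq = trans (vec≡ (+ toℕ a ∙ s ∷ + toℕ b ∙ t ∷ + toℕ c ∙ g ∷ + toℕ e ∙ z ∷ [])
    ((v₀ :+ (v₁ :+ :0)) :+ (v₂ :+ v₃)) (v₀ :+ (v₁ :+ (v₂ :+ (v₃ :+ :0)))) refl) eq
  rewr : ∀ a b c e y u k → + toℕ c ∙ g ⊞ + toℕ e ∙ z ≡ u ⊞ + 2 ∙ k →
         ev (Mod2.digits (a ∷ b ∷ c ∷ e ∷ [])) (s ∷ t ∷ g ∷ z ∷ []) ≡ + 2 ∙ y → Span s t u
  rewr a b c e y u k r eq = absorb a b u k y
    (trans (cong (ev (+ toℕ a ∷ + toℕ b ∷ []) (s ∷ t ∷ []) ⊞_) (sym r)) (split a b c e y eq))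
  G : Vec Z3 2
  G = g ∷ z ∷ []
  go : ∀ a b c e y → (a ∷ b ∷ c ∷ e ∷ []) ≢ Mod2.zeros → ev (Mod2.digits (a ∷ b ∷ c ∷ e ∷ [])) (s ∷ t ∷ g ∷ z ∷ []) ≡ + 2 ∙ y → Span s t (z ⊟ g)
  go zero zero zero zero y n e = ⊥-elim (n refl)
  go (suc zero) zero zero zero y n e = ⊥-elim (¬s (y , trans (vec≡ (s ∷ t ∷ g ∷ z ∷ []) v₀ (:ev (Mod2.digits (suc zero ∷ zero ∷ zero ∷ zero ∷ []))) refl) e))
  go zero (suc zero) zero zero y n e = ⊥-elim (¬t (y , trans (vec≡ (s ∷ t ∷ g ∷ z ∷ []) v₁ (:ev (Mod2.digits (zero ∷ suc zero ∷ zero ∷ zero ∷ []))) refl) e))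
  go (suc zero) (suc zero) zero zero y n e = ⊥-elim (¬st (y ⊟ t ,
    lin≡ (s ∷ t ∷ g ∷ z ∷ y ∷ []) ((+ 1 , + 1 :* v₀ :+ (+ 1 :* v₁ :+ (+ 0 :* v₂ :+ (+ 0 :* v₃ :+ :0))) , + 2 :* v₄) ∷ []) (e ∷ [])
      (v₀ :- v₁) (+ 2 :* (v₄ :- v₁)) refl))
  go a b (suc zero) zero y n e = ⊥-elim (¬g (rewr a b (suc zero) zero y g o (vec≡ G (+ 1 :* v₀ :+ + 0 :* v₁) (v₀ :+ + 2 :* :0) refl) e))
  go a b zero (suc zero) y n e = ⊥-elim (¬z (rewr a b zero (suc zero) y z o (vec≡ G (+ 0 :* v₀ :+ + 1 :* v₁) (v₁ :+ + 2 :* :0) refl) e))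
  go a b (suc zero) (suc zero) y n e = rewr a b (suc zero) (suc zero) y (z ⊟ g) g (vec≡ G (+ 1 :* v₀ :+ + 1 :* v₁) ((v₁ :- v₀) :+ + 2 :* v₀) refl) e
  finish : ∃[ d ] (d ≢ Mod2.zeros × Multiple 2 (ev (Mod2.digits d) (s ∷ t ∷ g ∷ z ∷ []))) → Span s t (z ⊟ g)
  finish (a ∷ b ∷ c ∷ e ∷ [] , n , y , eq) = go a b c e y n eq

module _ {P Q K : Z3 → Set} (S : System P Q K) where
  open System S

  -- The roles are exchanged: the points of Q form a quad over a triangle of P. If this triangle has
  -- a lattice centroid, the centroid replaces its third corner, and the new triangle is not
  -- centred.
  plane-common : ∀ {x₁ x₂ x₃ y₁ y₂ y₃ y₄} → P x₁ → P x₂ → P x₃ → Different x₁ x₂ x₃ → Q y₁ → Q y₂ → Q y₃ → Q y₄ →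
    Even ((y₁ ⊞ y₄) ⊟ (y₂ ⊞ y₃)) → Even ((x₂ ⊟ x₁) ⊟ (y₂ ⊟ y₁)) → Even ((x₃ ⊟ x₁) ⊟ (y₃ ⊟ y₁)) → Common P Q
  plane-common {x₁} {x₂} {x₃} {y₁} {y₂} {y₃} {y₄} X₁ X₂ X₃ d@(n₁₂ , n₁₃ , n₂₃) Y₁ Y₂ Y₃ Y₄ (c , e) (a , f) (b , h) =
    go (multiple? 3 (x₁ ⊞ x₂ ⊞ x₃))
    where
    neg : ∀ x x' y y' a → (x' ⊟ x) ⊟ (y' ⊟ y) ≡ + 2 ∙ a → (y' ⊟ y) ⊟ (x' ⊟ x) ≡ + 2 ∙ (-1ℤ ∙ a)
    neg x x' y y' a e = lin≡ (x ∷ x' ∷ y ∷ y' ∷ a ∷ []) ((-1ℤ , (v₁ :- v₀) :- (v₃ :- v₂) , + 2 :* v₄) ∷ []) (e ∷ [])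
      ((v₃ :- v₂) :- (v₁ :- v₀)) (+ 2 :* (-1ℤ :* v₄)) refl
    go : Dec (Centred x₁ x₂ x₃) → Common P Q
    go (no nc) = swap-common (quad-common (swap S) X₁ X₂ X₃ d nc Y₁ Y₂ Y₃ Y₄
      (mkQuad (swap S) (matched (-1ℤ ∙ a , neg x₁ x₂ y₁ y₂ a f) (-1ℤ ∙ b , neg x₁ x₃ y₁ y₃ b h)) (c , e)))
    go (yes (z , k)) = swap-common (quad-common (swap S) X₁ X₂ Z (n₁₂ , n₁z , n₂z) nc Y₁ Y₂ Y₄ Y₃
      (mkQuad (swap S) (matched (-1ℤ ∙ a , neg x₁ x₂ y₁ y₂ a f) (c ⊟ a ⊟ b ⊞ z ⊟ x₁ , l₁))
        (y₁ ⊟ y₂ ⊟ c , lin≡ G ((-1ℤ , (v₃ :+ v₆) :- (v₄ :+ v₅) , + 2 :* v₈) ∷ []) (e ∷ []) ((v₃ :+ v₅) :- (v₄ :+ v₆)) (+ 2 :* (v₃ :- v₄ :- v₈)) refl)))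
      where
      G : Vec Z3 12
      G = x₁ ∷ x₂ ∷ x₃ ∷ y₁ ∷ y₂ ∷ y₃ ∷ y₄ ∷ z ∷ c ∷ a ∷ b ∷ o ∷ []
      l₁ : (y₄ ⊟ y₁) ⊟ (z ⊟ x₁) ≡ + 2 ∙ (c ⊟ a ⊟ b ⊞ z ⊟ x₁)
      l₁ = lin≡ G ((+ 1 , (v₃ :+ v₆) :- (v₄ :+ v₅) , + 2 :* v₈) ∷ (-1ℤ , (v₁ :- v₀) :- (v₄ :- v₃) , + 2 :* v₉)
          ∷ (-1ℤ , (v₂ :- v₀) :- (v₅ :- v₃) , + 2 :* v₁₀) ∷ (+ 1 , v₀ :+ v₁ :+ v₂ , + 3 :* v₇) ∷ []) (e ∷ f ∷ h ∷ k ∷ [])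
        ((v₆ :- v₃) :- (v₇ :- v₀)) (+ 2 :* (v₈ :- v₉ :- v₁₀ :+ v₇ :- v₀)) refl
      Z : P z
      Z = LengthOne.convex oneP ((1 , x₁) ∷ (1 , x₂) ∷ (1 , x₃) ∷ []) z (X₁ ∷ X₂ ∷ X₃ ∷ []) (s≤s z≤n)
          (lin≡ G ((-1ℤ , v₀ :+ v₁ :+ v₂ , + 3 :* v₇) ∷ []) (k ∷ []) (+ 3 :* v₇) (+ 1 :* v₀ :+ (+ 1 :* v₁ :+ (+ 1 :* v₂ :+ :0))) refl)
      apart : ∀ {u v} → P u → P v → u ≢ v → Multiple 2 (u ⊟ v) → ⊥
      apart U V u≢v m = u≢v (LengthOne.indivisible oneP 2 (s≤s (s≤s z≤n)) U V m)
      with-eq : ∀ {u} → z ≡ u → x₁ ⊞ x₂ ⊞ x₃ ≡ + 3 ∙ u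
      with-eq refl = k
      n₁z : x₁ ≢ z
      n₁z q = apart X₂ X₃ n₂₃ (x₁ ⊟ x₃ , lin≡ G ((+ 1 , v₀ :+ v₁ :+ v₂ , + 3 :* v₀) ∷ []) (with-eq (sym q) ∷ []) (v₁ :- v₂) (+ 2 :* (v₀ :- v₂)) refl)
      n₂z : x₂ ≢ z
      n₂z q = apart X₁ X₃ n₁₃ (x₂ ⊟ x₃ , lin≡ G ((+ 1 , v₀ :+ v₁ :+ v₂ , + 3 :* v₁) ∷ []) (with-eq (sym q) ∷ []) (v₀ :- v₂) (+ 2 :* (v₁ :- v₂)) refl)
      nc : ¬ Centred x₁ x₂ z
      nc (w , q) = apart X₁ X₂ n₁₂ (x₃ ⊟ x₂ , lin≡ G ((+ 1 , v₀ :+ v₁ :+ v₂ , + 3 :* v₂) ∷ []) (with-eq (sym x₃≡z) ∷ [])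
                     (v₀ :- v₁) (+ 2 :* (v₂ :- v₁)) refl)
        where
        x₃≡z : x₃ ≡ z
        x₃≡z = LengthOne.indivisible oneP 3 (s≤s (s≤s z≤n)) X₃ Z (z ⊟ w , lin≡ (x₁ ∷ x₂ ∷ x₃ ∷ z ∷ w ∷ [])
          ((+ 1 , v₀ :+ v₁ :+ v₂ , + 3 :* v₃) ∷ (-1ℤ , v₀ :+ v₁ :+ v₃ , + 3 :* v₄) ∷ []) (k ∷ q ∷ []) (v₂ :- v₃) (+ 3 :* (v₃ :- v₄)) refl)

  -- The plane spanned modulo two by the edges of Q has two cosets, so three of the five points of P
  -- lie in the same one.
  common-plane : ∀ {q₁ q₂ q₃ q₄ a₁ a₂ a₃ a₄ a₅} → All Q (q₁ ∷ q₂ ∷ q₃ ∷ q₄ ∷ []) → AllPairs _≢_ (q₁ ∷ q₂ ∷ q₃ ∷ q₄ ∷ []) →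
    Even ((q₁ ⊞ q₄) ⊟ (q₂ ⊞ q₃)) → All P (a₁ ∷ a₂ ∷ a₃ ∷ a₄ ∷ a₅ ∷ []) → AllPairs _≢_ (a₁ ∷ a₂ ∷ a₃ ∷ a₄ ∷ a₅ ∷ []) → Common P Q
  common-plane {q₁} {q₂} {q₃} {q₄} {a₁} {a₂} {a₃} {a₄} {a₅} (Q₁ ∷ Q₂ ∷ Q₃ ∷ Q₄ ∷ []) ((n₁₂ ∷ n₁₃ ∷ n₁₄ ∷ []) ∷ (n₂₃ ∷ n₂₄ ∷ []) ∷ (n₃₄ ∷ []) ∷ [] ∷ [])
    (c , e) (A₁ ∷ A₂ ∷ A₃ ∷ A₄ ∷ A₅ ∷ []) ((d₁₂ ∷ d₁₃ ∷ d₁₄ ∷ d₁₅ ∷ []) ∷ (d₂₃ ∷ d₂₄ ∷ d₂₅ ∷ []) ∷ (d₃₄ ∷ d₃₅ ∷ []) ∷ (d₄₅ ∷ []) ∷ [] ∷ []) =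
    go (span? s t (a₂ ⊟ a₁)) (span? s t (a₃ ⊟ a₁)) (span? s t (a₄ ⊟ a₁)) (span? s t (a₅ ⊟ a₁))
    where
    s t : Z3
    s = q₂ ⊟ q₁
    t = q₃ ⊟ q₁
    odd : ∀ {u v} → Q u → Q v → u ≢ v → ¬ Even (v ⊟ u)
    odd U V n m = n (sym (LengthOne.indivisible oneQ 2 (s≤s (s≤s z≤n)) V U m))
    oddP : ∀ {u v} → P u → P v → u ≢ v → ¬ Even (v ⊟ u)
    oddP U V n m = n (sym (LengthOne.indivisible oneP 2 (s≤s (s≤s z≤n)) V U m))
    coset : ∀ {g z} → ¬ Span s t g → ¬ Span s t z → Span s t (z ⊟ g)
    coset = same-coset (odd Q₁ Q₂ n₁₂) (odd Q₁ Q₃ n₁₃)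
      (λ m → odd Q₃ Q₂ (λ eq → n₂₃ (sym eq)) (subst Even (vec≡ (q₁ ∷ q₂ ∷ q₃ ∷ []) ((v₁ :- v₀) :- (v₂ :- v₀)) (v₁ :- v₂) refl) m))
    tri : ∀ {x₁ x₂ x₃} → P x₁ → P x₂ → P x₃ → x₁ ≢ x₂ → x₁ ≢ x₃ → x₂ ≢ x₃ → Span s t (x₂ ⊟ x₁) → Span s t (x₃ ⊟ x₁) → Common P Q
    tri {x₁} {x₂} {x₃} X₁ X₂ X₃ d e' f = split
      where
      G : Vec Z3 8
      G = x₁ ∷ x₂ ∷ x₃ ∷ q₁ ∷ q₂ ∷ q₃ ∷ q₄ ∷ c ∷ []
      rel : Eqn 8
      rel = (-1ℤ , (v₃ :+ v₆) :- (v₄ :+ v₅) , + 2 :* v₇)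
      s₃₂ : Even ((q₁ ⊞ q₄) ⊟ (q₃ ⊞ q₂))
      s₃₂ = c , trans (vec≡ G ((v₃ :+ v₆) :- (v₅ :+ v₄)) ((v₃ :+ v₆) :- (v₄ :+ v₅)) refl) e
      s₂₄ : Even ((q₁ ⊞ q₃) ⊟ (q₂ ⊞ q₄))
      s₂₄ = q₁ ⊟ q₂ ⊟ c , lin≡ G (rel ∷ []) (e ∷ []) ((v₃ :+ v₅) :- (v₄ :+ v₆)) (+ 2 :* (v₃ :- v₄ :- v₇)) refl
      s₄₂ : Even ((q₁ ⊞ q₃) ⊟ (q₄ ⊞ q₂))
      s₄₂ = q₁ ⊟ q₂ ⊟ c , lin≡ G (rel ∷ []) (e ∷ []) ((v₃ :+ v₅) :- (v₆ :+ v₄)) (+ 2 :* (v₃ :- v₄ :- v₇)) refl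
      s₃₄ : Even ((q₁ ⊞ q₂) ⊟ (q₃ ⊞ q₄))
      s₃₄ = q₁ ⊟ q₃ ⊟ c , lin≡ G (rel ∷ []) (e ∷ []) ((v₃ :+ v₄) :- (v₅ :+ v₆)) (+ 2 :* (v₃ :- v₅ :- v₇)) refl
      s₄₃ : Even ((q₁ ⊞ q₂) ⊟ (q₄ ⊞ q₃))
      s₄₃ = q₁ ⊟ q₃ ⊟ c , lin≡ G (rel ∷ []) (e ∷ []) ((v₃ :+ v₄) :- (v₆ :+ v₅)) (+ 2 :* (v₃ :- v₅ :- v₇)) refl
      fourth : ∀ x x' → Even ((x' ⊟ x) ⊟ (s ⊞ t)) → Even ((x' ⊟ x) ⊟ (q₄ ⊟ q₁))
      fourth x x' (y , h) = y ⊟ c , lin≡ (x ∷ x' ∷ y ∷ q₁ ∷ q₂ ∷ q₃ ∷ q₄ ∷ c ∷ [])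
        ((-1ℤ , (v₃ :+ v₆) :- (v₄ :+ v₅) , + 2 :* v₇) ∷ (+ 1 , (v₁ :- v₀) :- ((v₄ :- v₃) :+ (v₅ :- v₃)) , + 2 :* v₂) ∷ []) (e ∷ h ∷ [])
        ((v₁ :- v₀) :- (v₆ :- v₃)) (+ 2 :* (v₂ :- v₇)) refl
      same : ∀ u → Even ((x₂ ⊟ x₁) ⊟ u) → Even ((x₃ ⊟ x₁) ⊟ u) → ⊥
      same u (y , h) (z , k) = oddP X₂ X₃ f (z ⊟ y , lin≡ (x₁ ∷ x₂ ∷ x₃ ∷ u ∷ y ∷ z ∷ [])
        ((-1ℤ , (v₁ :- v₀) :- v₃ , + 2 :* v₄) ∷ (+ 1 , (v₂ :- v₀) :- v₃ , + 2 :* v₅) ∷ []) (h ∷ k ∷ []) (v₂ :- v₁) (+ 2 :* (v₅ :- v₄)) refl)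
      use : ∀ {y₂ y₃ y₄} → Q y₂ → Q y₃ → Q y₄ → Even ((q₁ ⊞ y₄) ⊟ (y₂ ⊞ y₃)) → Even ((x₂ ⊟ x₁) ⊟ (y₂ ⊟ q₁)) →
            Even ((x₃ ⊟ x₁) ⊟ (y₃ ⊟ q₁)) → Common P Q
      use Y₂ Y₃ Y₄ = plane-common X₁ X₂ X₃ (d , e' , f) Q₁ Y₂ Y₃ Y₄
      split : Span s t (x₂ ⊟ x₁) → Span s t (x₃ ⊟ x₁) → Common P Q
      split (h₀ m) _ = ⊥-elim (oddP X₁ X₂ d m)
      split _ (h₀ m) = ⊥-elim (oddP X₁ X₃ e' m)
      split (h₁ m) (h₁ k) = ⊥-elim (same s m k)
      split (h₂ m) (h₂ k) = ⊥-elim (same t m k)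
      split (h₃ m) (h₃ k) = ⊥-elim (same (s ⊞ t) m k)
      split (h₁ m) (h₂ k) = use Q₂ Q₃ Q₄ (c , e) m k
      split (h₂ m) (h₁ k) = use Q₃ Q₂ Q₄ s₃₂ m k
      split (h₁ m) (h₃ k) = use Q₂ Q₄ Q₃ s₂₄ m (fourth x₁ x₃ k)
      split (h₃ m) (h₁ k) = use Q₄ Q₂ Q₃ s₄₂ (fourth x₁ x₂ m) k
      split (h₂ m) (h₃ k) = use Q₃ Q₄ Q₂ s₃₄ m (fourth x₁ x₃ k)
      split (h₃ m) (h₂ k) = use Q₄ Q₃ Q₂ s₄₃ (fourth x₁ x₂ m) k
    outside : ∀ {x y z} → P x → P y → P z → x ≢ y → x ≢ z → y ≢ z →
              ¬ Span s t (x ⊟ a₁) → ¬ Span s t (y ⊟ a₁) → ¬ Span s t (z ⊟ a₁) → Common P Q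
    outside {x} {y} {z} X Y Z d e' f nx ny nz = tri X Y Z d e' f (rel x y (coset nx ny)) (rel x z (coset nx nz))
      where
      rel : ∀ x y → Span s t ((y ⊟ a₁) ⊟ (x ⊟ a₁)) → Span s t (y ⊟ x)
      rel x y = subst (Span s t) (vec≡ (x ∷ y ∷ a₁ ∷ []) ((v₁ :- v₂) :- (v₀ :- v₂)) (v₁ :- v₀) refl)
    go : Dec (Span s t (a₂ ⊟ a₁)) → Dec (Span s t (a₃ ⊟ a₁)) → Dec (Span s t (a₄ ⊟ a₁)) → Dec (Span s t (a₅ ⊟ a₁)) → Common P Q
    go (yes h) (yes k) _ _ = tri A₁ A₂ A₃ d₁₂ d₁₃ d₂₃ h k
    go (yes h) _ (yes k) _ = tri A₁ A₂ A₄ d₁₂ d₁₄ d₂₄ h k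
    go (yes h) _ _ (yes k) = tri A₁ A₂ A₅ d₁₂ d₁₅ d₂₅ h k
    go _ (yes h) (yes k) _ = tri A₁ A₃ A₄ d₁₃ d₁₄ d₃₄ h k
    go _ (yes h) _ (yes k) = tri A₁ A₃ A₅ d₁₃ d₁₅ d₃₅ h k
    go _ _ (yes h) (yes k) = tri A₁ A₄ A₅ d₁₄ d₁₅ d₄₅ h k
    go (no a) (no b) (no f) _ = outside A₂ A₃ A₄ d₂₃ d₂₄ d₃₄ a b f
    go (no a) (no b) _ (no f) = outside A₂ A₃ A₅ d₂₃ d₂₅ d₃₅ a b f
    go (no a) _ (no b) (no f) = outside A₂ A₄ A₅ d₂₄ d₂₅ d₄₅ a b f
    go _ (no a) (no b) (no f) = outside A₃ A₄ A₅ d₃₄ d₃₅ d₄₅ a b f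

-- Points of Q independent modulo two

Class : Set
Class = Vec (Fin 2) 3

bits : ∀ {n} → Vec (Fin 2) n → V n
bits = Vec.map (λ d → + toℕ d)

class : V 3 → Class
class = Mod2.reduce

-- The points of Q relative to the first one, in the basis of their differences.
code : Fin 4 → V 3
code zero = + 0 ∷ + 0 ∷ + 0 ∷ []
code (suc zero) = + 1 ∷ + 0 ∷ + 0 ∷ []
code (suc (suc zero)) = + 0 ∷ + 1 ∷ + 0 ∷ []
code (suc (suc (suc zero))) = + 0 ∷ + 0 ∷ + 1 ∷ []

classStep : Class → Fin 4 → Fin 4 → V 3
classStep v a b = bits v ⊕ᵥ code b ⊖ᵥ code a

-- Classes of the points of a quad over the triangle a, b, c.
record QuadPlan (X : Class → Set) (a b c : Fin 4) (v : Class) : Set where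
  constructor quadPlan
  field
    distinct : a ≢ b × a ≢ c × b ≢ c
    members  : X v × X (class (classStep v a b)) × X (class (classStep v a c)) × X (class (classStep v a b ⊕ᵥ code c ⊖ᵥ code a))

-- Classes of the points of a crown over i, j, k, l.
record CrownPlan (X : Class → Set) (i j k l : Fin 4) (v : Class) : Set where
  constructor crownPlan
  field
    distinct : (i ≢ j × i ≢ k × j ≢ k) × (i ≢ l × j ≢ l × k ≢ l)
    members  : X v × X (class (classStep v i j)) × X (class (classStep v i k)) × X (class (classStep v j l)) × X (class (classStep v k l))

Plan : (Class → Set) → Set
Plan X = (∃[ a ] ∃[ b ] ∃[ c ] ∃[ x ] ∃[ y ] ∃[ z ] QuadPlan X a b c (x ∷ y ∷ z ∷ []))
       ⊎ (∃[ i ] ∃[ j ] ∃[ k ] ∃[ l ] ∃[ x ] ∃[ y ] ∃[ z ] CrownPlan X i j k l (x ∷ y ∷ z ∷ []))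

map-plan : ∀ {X Y} → (∀ {v} → X v → Y v) → Plan X → Plan Y
map-plan f (inj₁ (a , b , c , x , y , z , quadPlan d (m , n , p , q))) = inj₁ (a , b , c , x , y , z , quadPlan d (f m , f n , f p , f q))
map-plan f (inj₂ (i , j , k , l , x , y , z , crownPlan d (m , n , p , q , r))) =
  inj₂ (i , j , k , l , x , y , z , crownPlan d (f m , f n , f p , f q , f r))

plan? : ∀ {X} → (∀ v → Dec (X v)) → Dec (Plan X)
plan? X? =
  (FinP.any? λ a → FinP.any? λ b → FinP.any? λ c → FinP.any? λ x → FinP.any? λ y → FinP.any? λ z →
    map′ (λ { (d , m) → quadPlan d m }) (λ { (quadPlan d m) → d , m })
      ((¬? (a Fin.≟ b) ×-dec (¬? (a Fin.≟ c) ×-dec ¬? (b Fin.≟ c))) ×-dec (X? _ ×-dec (X? _ ×-dec (X? _ ×-dec X? _)))))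
  ⊎-dec
  (FinP.any? λ i → FinP.any? λ j → FinP.any? λ k → FinP.any? λ l → FinP.any? λ x → FinP.any? λ y → FinP.any? λ z →
    map′ (λ { (d , m) → crownPlan d m }) (λ { (crownPlan d m) → d , m })
      (((¬? (i Fin.≟ j) ×-dec (¬? (i Fin.≟ k) ×-dec ¬? (j Fin.≟ k))) ×-dec (¬? (i Fin.≟ l) ×-dec (¬? (j Fin.≟ l) ×-dec ¬? (k Fin.≟ l))))
        ×-dec (X? _ ×-dec (X? _ ×-dec (X? _ ×-dec (X? _ ×-dec X? _))))))

-- A set of classes is stored as eight bits, in the order of `classes`.
select : Vec (Fin 2) 8 → Class → Fin 2
select (a ∷ b ∷ c ∷ d ∷ e ∷ f ∷ g ∷ h ∷ []) (x ∷ y ∷ z ∷ []) = pick x (pick y (pick z a b) (pick z c d)) (pick y (pick z e f) (pick z g h))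
  where
  pick : Fin 2 → Fin 2 → Fin 2 → Fin 2
  pick zero p q = p
  pick (suc zero) p q = q

classes : List Class
classes = (zero ∷ zero ∷ zero ∷ []) ∷ (zero ∷ zero ∷ suc zero ∷ []) ∷ (zero ∷ suc zero ∷ zero ∷ []) ∷ (zero ∷ suc zero ∷ suc zero ∷ [])
  ∷ (suc zero ∷ zero ∷ zero ∷ []) ∷ (suc zero ∷ zero ∷ suc zero ∷ []) ∷ (suc zero ∷ suc zero ∷ zero ∷ []) ∷ (suc zero ∷ suc zero ∷ suc zero ∷ []) ∷ []

classes-complete : ∀ v → v ∈ classes
classes-complete (zero ∷ zero ∷ zero ∷ []) = here refl
classes-complete (zero ∷ zero ∷ suc zero ∷ []) = there (here refl)
classes-complete (zero ∷ suc zero ∷ zero ∷ []) = there (there (here refl))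
classes-complete (zero ∷ suc zero ∷ suc zero ∷ []) = there (there (there (here refl)))
classes-complete (suc zero ∷ zero ∷ zero ∷ []) = there (there (there (there (here refl))))
classes-complete (suc zero ∷ zero ∷ suc zero ∷ []) = there (there (there (there (there (here refl)))))
classes-complete (suc zero ∷ suc zero ∷ zero ∷ []) = there (there (there (there (there (there (here refl))))))
classes-complete (suc zero ∷ suc zero ∷ suc zero ∷ []) = there (there (there (there (there (there (there (here refl)))))))

weight : Vec (Fin 2) 8 → ℕ
weight u = ListAction.sum (List.map toℕ (List.map (select u) classes))

-- All 256 sets of classes are examined. Quads alone would not do: they fail when the three missing
-- classes lie in a plane that is parallel to no triangle of Q.
plan-exists : ∀ a b c d e f g h → let u = a ∷ b ∷ c ∷ d ∷ e ∷ f ∷ g ∷ h ∷ [] in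
              5 ℕ.≤ weight u → Plan (λ v → select u v ≡ suc zero)
plan-exists = toWitness {a? = FinP.all? λ a → FinP.all? λ b → FinP.all? λ c → FinP.all? λ d → FinP.all? λ e → FinP.all? λ f →
  FinP.all? λ g → FinP.all? λ h → (5 ℕ.≤? _) →-dec plan? (λ v → select (a ∷ b ∷ c ∷ d ∷ e ∷ f ∷ g ∷ h ∷ []) v Fin.≟ suc zero)} _

bit : ∀ {A : Set} → Dec A → Fin 2
bit (yes _) = suc zero
bit (no _) = zero

bit⇒ : ∀ {A : Set} (d : Dec A) → bit d ≡ suc zero → A
bit⇒ (yes a) _ = a

length-filter : ∀ {A : Set} {R : A → Set} (R? : ∀ x → Dec (R x)) xs →
                length (filter R? xs) ≡ ListAction.sum (List.map toℕ (List.map (λ x → bit (R? x)) xs))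
length-filter R? [] = refl
length-filter R? (x ∷ xs) with R? x
... | yes _ = cong suc (length-filter R? xs)
... | no _ = length-filter R? xs

plan-for : ∀ {R : Class → Set} (R? : ∀ v → Dec (R v)) → 5 ℕ.≤ length (filter R? classes) → Plan R
plan-for {R} R? le = map-plan (λ {v} → back v)
  (plan-exists (r (zero ∷ zero ∷ zero ∷ [])) (r (zero ∷ zero ∷ suc zero ∷ [])) (r (zero ∷ suc zero ∷ zero ∷ [])) (r (zero ∷ suc zero ∷ suc zero ∷ []))
    (r (suc zero ∷ zero ∷ zero ∷ [])) (r (suc zero ∷ zero ∷ suc zero ∷ [])) (r (suc zero ∷ suc zero ∷ zero ∷ [])) (r (suc zero ∷ suc zero ∷ suc zero ∷ []))
    (subst (5 ℕ.≤_) (length-filter R? classes) le))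
  where
  r : Class → Fin 2
  r v = bit (R? v)
  u : Vec (Fin 2) 8
  u = r (zero ∷ zero ∷ zero ∷ []) ∷ r (zero ∷ zero ∷ suc zero ∷ []) ∷ r (zero ∷ suc zero ∷ zero ∷ []) ∷ r (zero ∷ suc zero ∷ suc zero ∷ [])
    ∷ r (suc zero ∷ zero ∷ zero ∷ []) ∷ r (suc zero ∷ zero ∷ suc zero ∷ []) ∷ r (suc zero ∷ suc zero ∷ zero ∷ []) ∷ r (suc zero ∷ suc zero ∷ suc zero ∷ []) ∷ []
  select-r : ∀ v → select u v ≡ r v
  select-r (zero ∷ zero ∷ zero ∷ []) = refl
  select-r (zero ∷ zero ∷ suc zero ∷ []) = refl
  select-r (zero ∷ suc zero ∷ zero ∷ []) = refl
  select-r (zero ∷ suc zero ∷ suc zero ∷ []) = refl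
  select-r (suc zero ∷ zero ∷ zero ∷ []) = refl
  select-r (suc zero ∷ zero ∷ suc zero ∷ []) = refl
  select-r (suc zero ∷ suc zero ∷ zero ∷ []) = refl
  select-r (suc zero ∷ suc zero ∷ suc zero ∷ []) = refl
  back : ∀ v → select u v ≡ suc zero → R v
  back v e = bit⇒ (R? v) (trans (sym (select-r v)) e)

-- Modulo two this is the sum of all four codes or of two distinct ones, and neither vanishes.
codes-apart : ∀ a b c d → a ≢ b → a ≢ c → b ≢ c → class (code a ⊕ᵥ code b ⊕ᵥ code c ⊖ᵥ + 3 ⊛ code d) ≢ zero ∷ zero ∷ zero ∷ []
codes-apart = toWitness {a? = FinP.all? λ a → FinP.all? λ b → FinP.all? λ c → FinP.all? λ d →
  ¬? (a Fin.≟ b) →-dec (¬? (a Fin.≟ c) →-dec (¬? (b Fin.≟ c) →-dec ¬? (VecP.≡-dec Fin._≟_ _ _)))} _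

module _ {P Q K : Z3 → Set} (S : System P Q K) where
  open System S

  module Basis {q₁ q₂ q₃ q₄ : Z3} (qs : All Q (q₁ ∷ q₂ ∷ q₃ ∷ q₄ ∷ [])) (dq : AllPairs _≢_ (q₁ ∷ q₂ ∷ q₃ ∷ q₄ ∷ []))
    (odd : ¬ Even ((q₁ ⊞ q₄) ⊟ (q₂ ⊞ q₃))) where

    q : Fin 4 → Z3
    q = lookup (q₁ ∷ q₂ ∷ q₃ ∷ q₄ ∷ [])

    inQ : ∀ a → Q (q a)
    inQ zero = All.lookup qs (here refl)
    inQ (suc zero) = All.lookup qs (there (here refl))
    inQ (suc (suc zero)) = All.lookup qs (there (there (here refl)))
    inQ (suc (suc (suc zero))) = All.lookup qs (there (there (there (here refl))))

    base : Vec Z3 3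
    base = q₂ ⊟ q₁ ∷ q₃ ⊟ q₁ ∷ q₄ ⊟ q₁ ∷ []

    η : Fin 4 → Z3
    η a = ev (code a) base

    q-code : ∀ a → q a ≡ q₁ ⊞ η a
    q-code a = go a
      where
      G : Vec Z3 4
      G = q₁ ∷ q₂ ∷ q₃ ∷ q₄ ∷ []
      go : ∀ a → q a ≡ q₁ ⊞ η a
      go zero = vec≡ G v₀ (v₀ :+ (+ 0 :* (v₁ :- v₀) :+ (+ 0 :* (v₂ :- v₀) :+ (+ 0 :* (v₃ :- v₀) :+ :0)))) refl
      go (suc zero) = vec≡ G v₁ (v₀ :+ (+ 1 :* (v₁ :- v₀) :+ (+ 0 :* (v₂ :- v₀) :+ (+ 0 :* (v₃ :- v₀) :+ :0)))) refl
      go (suc (suc zero)) = vec≡ G v₂ (v₀ :+ (+ 0 :* (v₁ :- v₀) :+ (+ 1 :* (v₂ :- v₀) :+ (+ 0 :* (v₃ :- v₀) :+ :0)))) refl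
      go (suc (suc (suc zero))) = vec≡ G v₃ (v₀ :+ (+ 0 :* (v₁ :- v₀) :+ (+ 0 :* (v₂ :- v₀) :+ (+ 1 :* (v₃ :- v₀) :+ :0)))) refl

    -- A sum of one or two basis vectors is modulo two a difference of points of Q; the sum of all
    -- three is excluded by `odd`.
    independent : ∀ ε → ε ≢ zero ∷ zero ∷ zero ∷ [] → ¬ Even (ev (bits ε) base)
    independent = go dq qs
      where
      G : Z3 → Vec Z3 5
      G y = q₁ ∷ q₂ ∷ q₃ ∷ q₄ ∷ y ∷ []
      lhs : Class → Expr 5
      lhs (a ∷ b ∷ c ∷ []) = + toℕ a :* (v₁ :- v₀) :+ (+ toℕ b :* (v₂ :- v₀) :+ (+ toℕ c :* (v₃ :- v₀) :+ :0))
      ind : ∀ {u v} → Q u → Q v → u ≢ v → ¬ Multiple 2 (u ⊟ v)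
      ind U V n m = n (LengthOne.indivisible oneQ 2 (s≤s (s≤s z≤n)) U V m)
      go : AllPairs _≢_ (q₁ ∷ q₂ ∷ q₃ ∷ q₄ ∷ []) → All Q (q₁ ∷ q₂ ∷ q₃ ∷ q₄ ∷ []) →
           ∀ ε → ε ≢ zero ∷ zero ∷ zero ∷ [] → ¬ Even (ev (bits ε) base)
      go _ _ (zero ∷ zero ∷ zero ∷ []) n _ = n refl
      go ((n₁₂ ∷ n₁₃ ∷ n₁₄ ∷ []) ∷ (n₂₃ ∷ n₂₄ ∷ []) ∷ (n₃₄ ∷ []) ∷ [] ∷ []) (Q₁ ∷ Q₂ ∷ Q₃ ∷ Q₄ ∷ []) ε@(suc zero ∷ zero ∷ zero ∷ []) _ (y , e) =
        ind Q₁ Q₂ n₁₂ (-1ℤ ∙ y , lin≡ (G y) ((-1ℤ , lhs ε , + 2 :* v₄) ∷ []) (e ∷ []) (v₀ :- v₁) (+ 2 :* (-1ℤ :* v₄)) refl)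
      go ((n₁₂ ∷ n₁₃ ∷ n₁₄ ∷ []) ∷ (n₂₃ ∷ n₂₄ ∷ []) ∷ (n₃₄ ∷ []) ∷ [] ∷ []) (Q₁ ∷ Q₂ ∷ Q₃ ∷ Q₄ ∷ []) ε@(zero ∷ suc zero ∷ zero ∷ []) _ (y , e) =
        ind Q₁ Q₃ n₁₃ (-1ℤ ∙ y , lin≡ (G y) ((-1ℤ , lhs ε , + 2 :* v₄) ∷ []) (e ∷ []) (v₀ :- v₂) (+ 2 :* (-1ℤ :* v₄)) refl)
      go ((n₁₂ ∷ n₁₃ ∷ n₁₄ ∷ []) ∷ (n₂₃ ∷ n₂₄ ∷ []) ∷ (n₃₄ ∷ []) ∷ [] ∷ []) (Q₁ ∷ Q₂ ∷ Q₃ ∷ Q₄ ∷ []) ε@(zero ∷ zero ∷ suc zero ∷ []) _ (y , e) =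
        ind Q₁ Q₄ n₁₄ (-1ℤ ∙ y , lin≡ (G y) ((-1ℤ , lhs ε , + 2 :* v₄) ∷ []) (e ∷ []) (v₀ :- v₃) (+ 2 :* (-1ℤ :* v₄)) refl)
      go ((n₁₂ ∷ n₁₃ ∷ n₁₄ ∷ []) ∷ (n₂₃ ∷ n₂₄ ∷ []) ∷ (n₃₄ ∷ []) ∷ [] ∷ []) (Q₁ ∷ Q₂ ∷ Q₃ ∷ Q₄ ∷ []) ε@(suc zero ∷ suc zero ∷ zero ∷ []) _ (y , e) =
        ind Q₂ Q₃ n₂₃ (y ⊞ q₁ ⊟ q₃ , lin≡ (G y) ((+ 1 , lhs ε , + 2 :* v₄) ∷ []) (e ∷ []) (v₁ :- v₂) (+ 2 :* (v₄ :+ v₀ :- v₂)) refl)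
      go ((n₁₂ ∷ n₁₃ ∷ n₁₄ ∷ []) ∷ (n₂₃ ∷ n₂₄ ∷ []) ∷ (n₃₄ ∷ []) ∷ [] ∷ []) (Q₁ ∷ Q₂ ∷ Q₃ ∷ Q₄ ∷ []) ε@(suc zero ∷ zero ∷ suc zero ∷ []) _ (y , e) =
        ind Q₂ Q₄ n₂₄ (y ⊞ q₁ ⊟ q₄ , lin≡ (G y) ((+ 1 , lhs ε , + 2 :* v₄) ∷ []) (e ∷ []) (v₁ :- v₃) (+ 2 :* (v₄ :+ v₀ :- v₃)) refl)
      go ((n₁₂ ∷ n₁₃ ∷ n₁₄ ∷ []) ∷ (n₂₃ ∷ n₂₄ ∷ []) ∷ (n₃₄ ∷ []) ∷ [] ∷ []) (Q₁ ∷ Q₂ ∷ Q₃ ∷ Q₄ ∷ []) ε@(zero ∷ suc zero ∷ suc zero ∷ []) _ (y , e) =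
        ind Q₃ Q₄ n₃₄ (y ⊞ q₁ ⊟ q₄ , lin≡ (G y) ((+ 1 , lhs ε , + 2 :* v₄) ∷ []) (e ∷ []) (v₂ :- v₃) (+ 2 :* (v₄ :+ v₀ :- v₃)) refl)
      go _ _ ε@(suc zero ∷ suc zero ∷ suc zero ∷ []) _ (y , e) =
        odd (y ⊞ + 2 ∙ q₁ ⊟ q₂ ⊟ q₃ , lin≡ (G y) ((+ 1 , lhs ε , + 2 :* v₄) ∷ []) (e ∷ [])
          ((v₀ :+ v₃) :- (v₁ :+ v₂)) (+ 2 :* (v₄ :+ + 2 :* v₀ :- v₁ :- v₂)) refl)

    -- Four vectors are dependent modulo two, and by `independent` the dependence involves z.
    classify : ∀ z → ∃[ ε ] Even (z ⊟ ev (bits ε) base)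
    classify z = finish (Mod2.dependent (base₁ ∷ base₂ ∷ base₃ ∷ z ∷ []))
      where
      base₁ base₂ base₃ : Z3
      base₁ = q₂ ⊟ q₁
      base₂ = q₃ ⊟ q₁
      base₃ = q₄ ⊟ q₁
      G : Class → Vec Z3 4
      G (a ∷ b ∷ c ∷ []) = + toℕ a ∙ base₁ ∷ + toℕ b ∙ base₂ ∷ + toℕ c ∙ base₃ ∷ z ∷ []
      go : ∀ a b c e y → (a ∷ b ∷ c ∷ e ∷ []) ≢ Mod2.zeros → ev (Mod2.digits (a ∷ b ∷ c ∷ e ∷ [])) (base₁ ∷ base₂ ∷ base₃ ∷ z ∷ []) ≡ + 2 ∙ y →
           ∃[ ε ] Even (z ⊟ ev (bits ε) base)
      go a b c zero y n e = ⊥-elim (independent (a ∷ b ∷ c ∷ []) (λ { refl → n refl })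
        (y , trans (vec≡ (G (a ∷ b ∷ c ∷ [])) (v₀ :+ (v₁ :+ (v₂ :+ :0))) (v₀ :+ (v₁ :+ (v₂ :+ (+ 0 :* v₃ :+ :0)))) refl) e))
      go a b c (suc zero) y n e = (a ∷ b ∷ c ∷ []) , y ⊟ ev (bits (a ∷ b ∷ c ∷ [])) base ,
        lin≡ (+ toℕ a ∙ base₁ ∷ + toℕ b ∙ base₂ ∷ + toℕ c ∙ base₃ ∷ z ∷ y ∷ [])
          ((+ 1 , v₀ :+ (v₁ :+ (v₂ :+ (+ 1 :* v₃ :+ :0))) , + 2 :* v₄) ∷ []) (e ∷ [])
          (v₃ :- (v₀ :+ (v₁ :+ (v₂ :+ :0)))) (+ 2 :* (v₄ :- (v₀ :+ (v₁ :+ (v₂ :+ :0))))) refl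
      finish : ∃[ d ] (d ≢ Mod2.zeros × Multiple 2 (ev (Mod2.digits d) (base₁ ∷ base₂ ∷ base₃ ∷ z ∷ []))) → ∃[ ε ] Even (z ⊟ ev (bits ε) base)
      finish (a ∷ b ∷ c ∷ e ∷ [] , n , y , eq) = go a b c e y n eq

    InClass : V 3 → Z3 → Set
    InClass f x = Even ((x ⊟ q₁) ⊟ ev f base)

    unreduce : ∀ f x → InClass (bits (class f)) x → InClass f x
    unreduce f x (y , e) = go (Mod2.reduce-ev f)
      where
      go : ∃[ h ] (bits (class f) ≡ f ⊖ᵥ + 2 ⊛ h) → InClass f x
      go (h , eq) = y ⊟ ev h base , lin≡ ((x ⊟ q₁) ∷ ev (bits (class f)) base ∷ y ∷ ev f base ∷ ev h base ∷ [])
        ((+ 1 , v₀ :- v₁ , + 2 :* v₂) ∷ (+ 1 , v₁ , v₃ :- + 2 :* v₄) ∷ [])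
        (e ∷ trans (cong (λ k → ev k base) eq) (trans (ev-⊖ f (+ 2 ⊛ h) base) (cong (ev f base ⊟_) (ev-⊛ (+ 2) h base))) ∷ [])
        (v₀ :- v₃) (+ 2 :* (v₂ :- v₄)) refl

    Only : Set
    Only = ∀ {z} → Q z → z ∈ q₁ ∷ q₂ ∷ q₃ ∷ q₄ ∷ []

    -- By convexity the centroid would be one of the four points of Q, and the resulting relation
    -- between codes fails modulo two.
    no-centroid : Only → ∀ {a b c} → Q a → Q b → Q c → Different a b c → ¬ Centred a b c
    no-centroid onlyQ {a} {b} {c} A B C (ab , ac , bc) (d , e) = go (index (onlyQ A)) (index (onlyQ B)) (index (onlyQ C)) (index (onlyQ D))
      where
      D : Q d
      D = LengthOne.convex oneQ ((1 , a) ∷ (1 , b) ∷ (1 , c) ∷ []) d (A ∷ B ∷ C ∷ []) (s≤s z≤n)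
          (lin≡ (a ∷ b ∷ c ∷ d ∷ []) ((-1ℤ , v₀ :+ v₁ :+ v₂ , + 3 :* v₃) ∷ []) (e ∷ []) (+ 3 :* v₃) (+ 1 :* v₀ :+ (+ 1 :* v₁ :+ (+ 1 :* v₂ :+ :0))) refl)
      index : ∀ {z} → z ∈ q₁ ∷ q₂ ∷ q₃ ∷ q₄ ∷ [] → ∃[ i ] z ≡ q i
      index (here e) = zero , e
      index (there (here e)) = suc zero , e
      index (there (there (here e))) = suc (suc zero) , e
      index (there (there (there (here e)))) = suc (suc (suc zero)) , e
      go : ∃[ i ] a ≡ q i → ∃[ i ] b ≡ q i → ∃[ i ] c ≡ q i → ∃[ i ] d ≡ q i → ⊥
      go (i , ei) (j , ej) (k , ek) (l , el) = independent (class f) (codes-apart i j k l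
          (λ { refl → ab (trans ei (sym ej)) }) (λ { refl → ac (trans ei (sym ek)) }) (λ { refl → bc (trans ej (sym ek)) }))
          (even (Mod2.reduce-ev f))
        where
        f : V 3
        f = code i ⊕ᵥ code j ⊕ᵥ code k ⊖ᵥ + 3 ⊛ code l
        zero-sum : ev f base ≡ o
        zero-sum = trans (ev-⊖ (code i ⊕ᵥ code j ⊕ᵥ code k) (+ 3 ⊛ code l) base)
          (trans (cong₂ _⊟_ (trans (ev-⊕ (code i ⊕ᵥ code j) (code k) base) (cong (_⊞ η k) (ev-⊕ (code i) (code j) base))) (ev-⊛ (+ 3) (code l) base))
          (lin≡ (q₁ ∷ η i ∷ η j ∷ η k ∷ η l ∷ [])
            ((+ 1 , (v₀ :+ v₁) :+ (v₀ :+ v₂) :+ (v₀ :+ v₃) , + 3 :* (v₀ :+ v₄)) ∷ [])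
            (trans (cong₂ _⊞_ (cong₂ _⊞_ (code≡ i a ei) (code≡ j b ej)) (code≡ k c ek)) (trans e (cong (+ 3 ∙_) (sym (code≡ l d el)))) ∷ [])
            (v₁ :+ v₂ :+ v₃ :- + 3 :* v₄) :0 refl))
          where
          code≡ : ∀ i a → a ≡ q i → q₁ ⊞ η i ≡ a
          code≡ i a e = trans (sym (q-code i)) (sym e)
        even : ∃[ h ] (bits (class f) ≡ f ⊖ᵥ + 2 ⊛ h) → Even (ev (bits (class f)) base)
        even (h , eq) = -1ℤ ∙ ev h base , trans (cong (λ t → ev t base) eq) (trans (ev-⊖ f (+ 2 ⊛ h) base)
          (trans (cong₂ _⊟_ zero-sum (ev-⊛ (+ 2) h base)) (vec≡ (ev h base ∷ []) (:0 :- + 2 :* v₀) (+ 2 :* (-1ℤ :* v₀)) refl)))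

    Member : Class → Set
    Member v = ∃[ x ] (P x × InClass (bits v) x)

    distinct-codes : ∀ a b → a ≢ b → q a ≢ q b
    distinct-codes a b = go dq a b
      where
      go : AllPairs _≢_ (q₁ ∷ q₂ ∷ q₃ ∷ q₄ ∷ []) → ∀ a b → a ≢ b → q a ≢ q b
      go _ zero zero n = ⊥-elim (n refl)
      go _ (suc zero) (suc zero) n = ⊥-elim (n refl)
      go _ (suc (suc zero)) (suc (suc zero)) n = ⊥-elim (n refl)
      go _ (suc (suc (suc zero))) (suc (suc (suc zero))) n = ⊥-elim (n refl)
      go ((n ∷ _) ∷ _) zero (suc zero) _ = n
      go ((_ ∷ n ∷ _) ∷ _) zero (suc (suc zero)) _ = n
      go ((_ ∷ _ ∷ n ∷ _) ∷ _) zero (suc (suc (suc zero))) _ = n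
      go ((n ∷ _) ∷ _) (suc zero) zero _ e = n (sym e)
      go (_ ∷ (n ∷ _) ∷ _) (suc zero) (suc (suc zero)) _ = n
      go (_ ∷ (_ ∷ n ∷ _) ∷ _) (suc zero) (suc (suc (suc zero))) _ = n
      go ((_ ∷ n ∷ _) ∷ _) (suc (suc zero)) zero _ e = n (sym e)
      go (_ ∷ (n ∷ _) ∷ _) (suc (suc zero)) (suc zero) _ e = n (sym e)
      go (_ ∷ _ ∷ (n ∷ _) ∷ _) (suc (suc zero)) (suc (suc (suc zero))) _ = n
      go ((_ ∷ _ ∷ n ∷ _) ∷ _) (suc (suc (suc zero))) zero _ e = n (sym e)
      go (_ ∷ (_ ∷ n ∷ _) ∷ _) (suc (suc (suc zero))) (suc zero) _ e = n (sym e)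
      go (_ ∷ _ ∷ (n ∷ _) ∷ _) (suc (suc (suc zero))) (suc (suc zero)) _ e = n (sym e)

    at-classStep : ∀ v a b x → InClass (bits (class (classStep v a b))) x → Even ((x ⊟ q₁) ⊟ (ev (bits v) base ⊞ η b ⊟ η a))
    at-classStep v a b x m = subst (λ t → Even ((x ⊟ q₁) ⊟ t))
      (trans (ev-⊖ (bits v ⊕ᵥ code b) (code a) base) (cong (_⊟ η a) (ev-⊕ (bits v) (code b) base))) (unreduce (classStep v a b) x m)

    -- A plan speaks of classes only; points of P chosen in these classes form an actual quad or
    -- crown.
    realise : Only → Plan Member → Common P Q
    realise only (inj₁ (a , b , c , v₁' , v₂' , v₃' , quadPlan (ab , ac , bc) ((x₁ , X₁ , y₁ , e₁) , (x₂ , X₂ , m₂) , (x₃ , X₃ , m₃) , (x₄ , X₄ , m₄)))) =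
      quad-common S (inQ a) (inQ b) (inQ c) d (no-centroid only (inQ a) (inQ b) (inQ c) d) X₁ X₂ X₃ X₄
        (mkQuad S (matched (y₂ ⊟ y₁ , matches x₂ (q-code a) (q-code b) r₂) (y₃ ⊟ y₁ , matches x₃ (q-code a) (q-code c) r₃))
          (y₁ ⊞ y₄ ⊟ y₂ ⊟ y₃ ,
            lin≡ (x₁ ∷ x₂ ∷ x₃ ∷ x₄ ∷ q₁ ∷ Vv ∷ η a ∷ η b ∷ η c ∷ y₁ ∷ y₂ ∷ y₃ ∷ y₄ ∷ [])
              ((+ 1 , (v₀ :- v₄) :- v₅ , + 2 :* v₉) ∷ (-1ℤ , (v₁ :- v₄) :- (v₅ :+ v₇ :- v₆) , + 2 :* v₁₀)
                ∷ (-1ℤ , (v₂ :- v₄) :- (v₅ :+ v₈ :- v₆) , + 2 :* v₁₁) ∷ (+ 1 , (v₃ :- v₄) :- (v₅ :+ v₇ :- v₆ :+ v₈ :- v₆) , + 2 :* v₁₂) ∷ [])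
              (e₁ ∷ r₂ ∷ r₃ ∷ r₄ ∷ []) ((v₀ :+ v₃) :- (v₁ :+ v₂)) (+ 2 :* (v₉ :+ v₁₂ :- v₁₀ :- v₁₁)) refl))
      where
      v : Class
      v = v₁' ∷ v₂' ∷ v₃' ∷ []
      Vv : Z3
      Vv = ev (bits v) base
      d : Different (q a) (q b) (q c)
      d = distinct-codes a b ab , distinct-codes a c ac , distinct-codes b c bc
      s₂ = at-classStep v a b x₂ m₂
      s₃ = at-classStep v a c x₃ m₃
      s₄ : Even ((x₄ ⊟ q₁) ⊟ (Vv ⊞ η b ⊟ η a ⊞ η c ⊟ η a))
      s₄ = subst (λ t → Even ((x₄ ⊟ q₁) ⊟ t))
        (trans (ev-⊖ (classStep v a b ⊕ᵥ code c) (code a) base) (cong (_⊟ η a) (trans (ev-⊕ (classStep v a b) (code c) base) (cong (_⊞ η c)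
          (trans (ev-⊖ (bits v ⊕ᵥ code b) (code a) base) (cong (_⊟ η a) (ev-⊕ (bits v) (code b) base)))))))
        (unreduce (classStep v a b ⊕ᵥ code c ⊖ᵥ code a) x₄ m₄)
      y₂ = proj₁ s₂
      y₃ = proj₁ s₃
      y₄ = proj₁ s₄
      r₂ = proj₂ s₂
      r₃ = proj₂ s₃
      r₄ = proj₂ s₄
      matches : ∀ x {qa qb ηa ηb y} → qa ≡ q₁ ⊞ ηa → qb ≡ q₁ ⊞ ηb → (x ⊟ q₁) ⊟ (Vv ⊞ ηb ⊟ ηa) ≡ + 2 ∙ y →
                (x ⊟ x₁) ⊟ (qb ⊟ qa) ≡ + 2 ∙ (y ⊟ y₁)
      matches x {ηa = ηa} {ηb} {y} refl refl e = lin≡ (x₁ ∷ x ∷ q₁ ∷ Vv ∷ ηa ∷ ηb ∷ y₁ ∷ y ∷ [])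
        ((-1ℤ , (v₀ :- v₂) :- v₃ , + 2 :* v₆) ∷ (+ 1 , (v₁ :- v₂) :- (v₃ :+ v₅ :- v₄) , + 2 :* v₇) ∷ []) (e₁ ∷ e ∷ [])
        ((v₁ :- v₀) :- ((v₂ :+ v₅) :- (v₂ :+ v₄))) (+ 2 :* (v₇ :- v₆)) refl
    realise only (inj₂ (i , j , k , l , v₁' , v₂' , v₃' , crownPlan ((ij , ik , jk) , (il , jl , kl))
        ((y , Y , z , e) , (x₁ , X₁ , m₁) , (x₂ , X₂ , m₂) , (x₃ , X₃ , m₃) , (x₄ , X₄ , m₄)))) =
      crown-common S (inQ i) (inQ j) (inQ k) (inQ l) (distinct-codes i j ij) (distinct-codes i k ik) (distinct-codes j k jk)
        (distinct-codes i l il) (distinct-codes j l jl) (distinct-codes k l kl) (no-centroid only) Y X₁ X₂ X₃ X₄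
        (record { m₁ = matched (f i j x₁ m₁) (f i k x₂ m₂)
                ; m₂ = matched (flip i j x₁ (f i j x₁ m₁)) (f j l x₃ m₃)
                ; m₃ = matched (flip i k x₂ (f i k x₂ m₂)) (f k l x₄ m₄)
                ; m₄ = matched (flip j l x₃ (f j l x₃ m₃)) (flip k l x₄ (f k l x₄ m₄)) })
      where
      v : Class
      v = v₁' ∷ v₂' ∷ v₃' ∷ []
      Vv : Z3
      Vv = ev (bits v) base
      f : ∀ a b x → InClass (bits (class (classStep v a b))) x → Even ((x ⊟ y) ⊟ (q b ⊟ q a))
      f a b x m = go (at-classStep v a b x m)
        where
        go : Even ((x ⊟ q₁) ⊟ (Vv ⊞ η b ⊟ η a)) → Even ((x ⊟ y) ⊟ (q b ⊟ q a))
        go (w , h) = w ⊟ z , trans (cong ((x ⊟ y) ⊟_) (cong₂ _⊟_ (q-code b) (q-code a)))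
          (lin≡ (y ∷ x ∷ q₁ ∷ Vv ∷ η a ∷ η b ∷ z ∷ w ∷ [])
            ((-1ℤ , (v₀ :- v₂) :- v₃ , + 2 :* v₆) ∷ (+ 1 , (v₁ :- v₂) :- (v₃ :+ v₅ :- v₄) , + 2 :* v₇) ∷ []) (e ∷ h ∷ [])
            ((v₁ :- v₀) :- ((v₂ :+ v₅) :- (v₂ :+ v₄))) (+ 2 :* (v₇ :- v₆)) refl)
      flip : ∀ a b x → Even ((x ⊟ y) ⊟ (q b ⊟ q a)) → Even ((x ⊟ y) ⊟ (q a ⊟ q b))
      flip a b x (w , h) = w ⊞ q b ⊟ q a , lin≡ (x ∷ y ∷ q a ∷ q b ∷ w ∷ []) ((+ 1 , (v₀ :- v₁) :- (v₃ :- v₂) , + 2 :* v₄) ∷ []) (h ∷ [])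
        ((v₀ :- v₁) :- (v₂ :- v₃)) (+ 2 :* (v₄ :+ v₃ :- v₂)) refl

    -- Distinct points of P lie in distinct classes modulo two, so five classes are occupied.
    common-classified : Only → (cls : Z3 → Class) → (∀ x → InClass (bits (cls x)) x) →
      ∀ {as} → All P as → AllPairs _≢_ as → length as ≡ 5 → Common P Q
    common-classified only cls in-cls {as} ps dp len = realise only (map-plan {X = Reached} {Y = Member} member (plan-for reached? bound))
      where
      cs : List Class
      cs = List.map cls as
      Reached : Class → Set
      Reached v = Any (_≡ v) cs
      reached? : ∀ v → Dec (Reached v)
      reached? v = any? (λ c → VecP.≡-dec Fin._≟_ c v) cs
      length-map : ∀ as → length (List.map cls as) ≡ length as
      length-map [] = refl
      length-map (_ ∷ as) = cong suc (length-map as)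
      member : ∀ {v} → Any (_≡ v) cs → Member v
      member {v} m = found (find (AnyP.map⁻ m))
        where
        found : ∃[ x ] (x ∈ as × cls x ≡ v) → Member v
        found (x , x∈ , eq) = x , All.lookup ps x∈ , subst (λ t → InClass (bits t) x) eq (in-cls x)
      unique : AllPairs _≢_ cs
      unique = AllPairsP.map⁺ (go ps dp)
        where
        apart : ∀ {x y} → P x → P y → x ≢ y → cls x ≢ cls y
        apart {x} {y} X Y n e = n (LengthOne.indivisible oneP 2 (s≤s (s≤s z≤n)) X Y (proj₁ c ⊟ proj₁ d ,
          lin≡ (x ∷ y ∷ q₁ ∷ ev (bits (cls y)) base ∷ proj₁ c ∷ proj₁ d ∷ [])
            ((+ 1 , (v₀ :- v₂) :- v₃ , + 2 :* v₄) ∷ (-1ℤ , (v₁ :- v₂) :- v₃ , + 2 :* v₅) ∷ []) (proj₂ c ∷ proj₂ d ∷ [])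
            (v₀ :- v₁) (+ 2 :* (v₄ :- v₅)) refl))
          where
          c : InClass (bits (cls y)) x
          c = subst (λ t → InClass (bits t) x) e (in-cls x)
          d : InClass (bits (cls y)) y
          d = in-cls y
        go : ∀ {as} → All P as → AllPairs _≢_ as → AllPairs (λ x y → cls x ≢ cls y) as
        go [] [] = []
        go {x ∷ _} (X ∷ Xs) (n ∷ ns) = row X Xs n ∷ go Xs ns
          where
          row : ∀ {x bs} → P x → All P bs → All (x ≢_) bs → All (λ y → cls x ≢ cls y) bs
          row X [] [] = []
          row X (Y ∷ Ys) (m ∷ ms) = apart X Y m ∷ row X Ys ms
      covered : ∀ {c} → c ∈ cs → c ∈ filter reached? classes
      covered {c} c∈ = MemP.∈-filter⁺ reached? (classes-complete c) (Any.map sym c∈)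
      bound : 5 ℕ.≤ length (filter reached? classes)
      bound = ℕP.≤-trans (ℕP.≤-reflexive (sym (trans (length-map as) len))) (unique-length unique covered)

    common-basis : Only → ∀ {as} → All P as → AllPairs _≢_ as → length as ≡ 5 → Common P Q
    common-basis only = common-classified only (λ x → proj₁ (classify (x ⊟ q₁))) (λ x → proj₂ (classify (x ⊟ q₁)))

  common : ∀ {q₁ q₂ q₃ q₄ a₁ a₂ a₃ a₄ a₅} → All Q (q₁ ∷ q₂ ∷ q₃ ∷ q₄ ∷ []) → AllPairs _≢_ (q₁ ∷ q₂ ∷ q₃ ∷ q₄ ∷ []) →
    (∀ {z} → Q z → z ∈ q₁ ∷ q₂ ∷ q₃ ∷ q₄ ∷ []) → All P (a₁ ∷ a₂ ∷ a₃ ∷ a₄ ∷ a₅ ∷ []) → AllPairs _≢_ (a₁ ∷ a₂ ∷ a₃ ∷ a₄ ∷ a₅ ∷ []) → Common P Q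
  common {q₁} {q₂} {q₃} {q₄} qs dq onlyQ ps dp = go (multiple? 2 ((q₁ ⊞ q₄) ⊟ (q₂ ⊞ q₃)))
    where
    go : Dec (Even ((q₁ ⊞ q₄) ⊟ (q₂ ⊞ q₃))) → Common P Q
    go (yes e) = common-plane S qs dq e ps dp
    go (no odd) = Basis.common-basis qs dq odd onlyQ ps dp refl

-- Q as P without a point

module _ {P Q K : Z3 → Set} (S : System P Q K) where
  open System S

  -- A common triangle with the remaining points a, a' of P and q₄ of Q, where neither a nor a'
  -- matches q₄ modulo two. The aim is to show that this cannot occur.
  record Setup (p₁ p₂ p₃ q₁ q₂ q₃ q₄ a a' : Z3) : Set where
    field
      inP : All P (p₁ ∷ p₂ ∷ p₃ ∷ a ∷ a' ∷ [])
      inQ : All Q (q₁ ∷ q₂ ∷ q₃ ∷ q₄ ∷ [])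
      dP  : AllPairs _≢_ (p₁ ∷ p₂ ∷ p₃ ∷ a ∷ a' ∷ [])
      dQ  : AllPairs _≢_ (q₁ ∷ q₂ ∷ q₃ ∷ q₄ ∷ [])
      same₂ : Same p₁ p₂ q₁ q₂
      same₃ : Same p₁ p₃ q₁ q₃
      un  : ¬ Even ((a ⊟ p₁) ⊟ (q₄ ⊟ q₁))
      un' : ¬ Even ((a' ⊟ p₁) ⊟ (q₄ ⊟ q₁))

  swapA : ∀ {p₁ p₂ p₃ q₁ q₂ q₃ q₄ a a'} → Setup p₁ p₂ p₃ q₁ q₂ q₃ q₄ a a' → Setup p₁ p₂ p₃ q₁ q₂ q₃ q₄ a' a
  swapA s = record { inP = sw inP ; inQ = inQ ; dP = swd dP ; dQ = dQ ; same₂ = same₂ ; same₃ = same₃ ; un = un' ; un' = un }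
    where
    open Setup s
    sw : ∀ {x y z u v} → All P (x ∷ y ∷ z ∷ u ∷ v ∷ []) → All P (x ∷ y ∷ z ∷ v ∷ u ∷ [])
    sw (x ∷ y ∷ z ∷ u ∷ v ∷ []) = x ∷ y ∷ z ∷ v ∷ u ∷ []
    swd : ∀ {x y z u v : Z3} → AllPairs _≢_ (x ∷ y ∷ z ∷ u ∷ v ∷ []) → AllPairs _≢_ (x ∷ y ∷ z ∷ v ∷ u ∷ [])
    swd ((a ∷ b ∷ c ∷ d ∷ []) ∷ (e ∷ f ∷ g ∷ []) ∷ (h ∷ i ∷ []) ∷ (j ∷ []) ∷ [] ∷ []) =
      (a ∷ b ∷ d ∷ c ∷ []) ∷ (e ∷ g ∷ f ∷ []) ∷ (i ∷ h ∷ []) ∷ (≢-sym j ∷ []) ∷ [] ∷ []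

  swap₂₃ : ∀ {p₁ p₂ p₃ q₁ q₂ q₃ q₄ a a'} → Setup p₁ p₂ p₃ q₁ q₂ q₃ q₄ a a' → Setup p₁ p₃ p₂ q₁ q₃ q₂ q₄ a a'
  swap₂₃ s = record { inP = sw inP ; inQ = swq inQ ; dP = swd dP ; dQ = swdq dQ ; same₂ = same₃ ; same₃ = same₂ ; un = un ; un' = un' }
    where
    open Setup s
    sw : ∀ {x y z u v} → All P (x ∷ y ∷ z ∷ u ∷ v ∷ []) → All P (x ∷ z ∷ y ∷ u ∷ v ∷ [])
    sw (x ∷ y ∷ z ∷ u ∷ v ∷ []) = x ∷ z ∷ y ∷ u ∷ v ∷ []
    swq : ∀ {x y z u} → All Q (x ∷ y ∷ z ∷ u ∷ []) → All Q (x ∷ z ∷ y ∷ u ∷ [])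
    swq (x ∷ y ∷ z ∷ u ∷ []) = x ∷ z ∷ y ∷ u ∷ []
    swd : ∀ {x y z u v : Z3} → AllPairs _≢_ (x ∷ y ∷ z ∷ u ∷ v ∷ []) → AllPairs _≢_ (x ∷ z ∷ y ∷ u ∷ v ∷ [])
    swd ((a ∷ b ∷ c ∷ d ∷ []) ∷ (e ∷ f ∷ g ∷ []) ∷ (h ∷ i ∷ []) ∷ (j ∷ []) ∷ [] ∷ []) =
      (b ∷ a ∷ c ∷ d ∷ []) ∷ (≢-sym e ∷ h ∷ i ∷ []) ∷ (f ∷ g ∷ []) ∷ (j ∷ []) ∷ [] ∷ []
    swdq : ∀ {x y z u : Z3} → AllPairs _≢_ (x ∷ y ∷ z ∷ u ∷ []) → AllPairs _≢_ (x ∷ z ∷ y ∷ u ∷ [])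
    swdq ((a ∷ b ∷ c ∷ []) ∷ (e ∷ f ∷ []) ∷ (h ∷ []) ∷ [] ∷ []) = (b ∷ a ∷ c ∷ []) ∷ (≢-sym e ∷ h ∷ []) ∷ (f ∷ []) ∷ [] ∷ []

  swap₁₂ : ∀ {p₁ p₂ p₃ q₁ q₂ q₃ q₄ a a'} → Setup p₁ p₂ p₃ q₁ q₂ q₃ q₄ a a' → Setup p₂ p₁ p₃ q₂ q₁ q₃ q₄ a a'
  swap₁₂ {p₁} {p₂} {p₃} {q₁} {q₂} {q₃} {q₄} {a} {a'} s = record
    { inP = sw inP ; inQ = swq inQ ; dP = swd dP ; dQ = swdq dQ
    ; same₂ = lin≡ G ((-1ℤ , v₁ :- v₀ , v₄ :- v₃) ∷ []) (same₂ ∷ []) (v₀ :- v₁) (v₃ :- v₄) refl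
    ; same₃ = lin≡ G ((-1ℤ , v₁ :- v₀ , v₄ :- v₃) ∷ (+ 1 , v₂ :- v₀ , v₅ :- v₃) ∷ []) (same₂ ∷ same₃ ∷ []) (v₂ :- v₁) (v₅ :- v₄) refl
    ; un = λ m → un (subst Even (lin≡ G ((-1ℤ , v₁ :- v₀ , v₄ :- v₃) ∷ []) (same₂ ∷ []) ((v₇ :- v₁) :- (v₆ :- v₄)) ((v₇ :- v₀) :- (v₆ :- v₃)) refl) m)
    ; un' = λ m → un' (subst Even (lin≡ G ((-1ℤ , v₁ :- v₀ , v₄ :- v₃) ∷ []) (same₂ ∷ []) ((v₈ :- v₁) :- (v₆ :- v₄)) ((v₈ :- v₀) :- (v₆ :- v₃)) refl) m) }
    where
    open Setup s
    G : Vec Z3 9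
    G = p₁ ∷ p₂ ∷ p₃ ∷ q₁ ∷ q₂ ∷ q₃ ∷ q₄ ∷ a ∷ a' ∷ []
    sw : ∀ {x y z u v} → All P (x ∷ y ∷ z ∷ u ∷ v ∷ []) → All P (y ∷ x ∷ z ∷ u ∷ v ∷ [])
    sw (x ∷ y ∷ z ∷ u ∷ v ∷ []) = y ∷ x ∷ z ∷ u ∷ v ∷ []
    swq : ∀ {x y z u} → All Q (x ∷ y ∷ z ∷ u ∷ []) → All Q (y ∷ x ∷ z ∷ u ∷ [])
    swq (x ∷ y ∷ z ∷ u ∷ []) = y ∷ x ∷ z ∷ u ∷ []
    swd : ∀ {x y z u v : Z3} → AllPairs _≢_ (x ∷ y ∷ z ∷ u ∷ v ∷ []) → AllPairs _≢_ (y ∷ x ∷ z ∷ u ∷ v ∷ [])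
    swd ((a ∷ b ∷ c ∷ d ∷ []) ∷ (e ∷ f ∷ g ∷ []) ∷ (h ∷ i ∷ []) ∷ (j ∷ []) ∷ [] ∷ []) =
      (≢-sym a ∷ e ∷ f ∷ g ∷ []) ∷ (b ∷ c ∷ d ∷ []) ∷ (h ∷ i ∷ []) ∷ (j ∷ []) ∷ [] ∷ []
    swdq : ∀ {x y z u : Z3} → AllPairs _≢_ (x ∷ y ∷ z ∷ u ∷ []) → AllPairs _≢_ (y ∷ x ∷ z ∷ u ∷ [])
    swdq ((a ∷ b ∷ c ∷ []) ∷ (e ∷ f ∷ []) ∷ (h ∷ []) ∷ [] ∷ []) = (≢-sym a ∷ e ∷ f ∷ []) ∷ (b ∷ c ∷ []) ∷ (h ∷ []) ∷ [] ∷ []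

  oddP : ∀ {u v} → P u → P v → u ≢ v → ¬ Even (u ⊟ v)
  oddP U V n m = n (LengthOne.indivisible oneP 2 (s≤s (s≤s z≤n)) U V m)
  -- A triangle and its reflection add up to a hexagon, and a hexagon is the sum of three segments,
  -- whose directions here add up to zero.
  no-reflection : ∀ {p₁ p₂ p₃ q₁ q₂ q₃} → P p₁ → P p₂ → P p₃ → Q q₁ → Q q₂ → Q q₃ → Different p₁ p₂ p₃ →
                  Opposite p₁ p₂ q₁ q₂ → ¬ Opposite p₁ p₃ q₁ q₃
  no-reflection {p₁} {p₂} {p₃} {q₁} {q₂} {q₃} P₁ P₂ P₃ Q₁ Q₂ Q₃ (n₁₂ , n₁₃ , n₂₃) e f = contra
    (box {p₁ ⊞ q₁} (p₂ ⊟ p₁) (q₃ ⊟ q₁) (p₃ ⊟ p₂)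
      (sum P₁ Q₁)
      (at P₂ Q₁ (vec≡ G (v₁ :+ v₃) ((v₀ :+ v₃) :+ (v₁ :- v₀)) refl))
      (at P₁ Q₃ (vec≡ G (v₀ :+ v₅) ((v₀ :+ v₃) :+ (v₅ :- v₃)) refl))
      (at P₃ Q₂ (by -1ℤ (+ 0) (v₂ :+ v₄) ((v₀ :+ v₃) :+ (v₂ :- v₁)) refl))
      (at P₂ Q₃ (vec≡ G (v₁ :+ v₅) ((v₀ :+ v₃) :+ ((v₁ :- v₀) :+ (v₅ :- v₃))) refl))
      (at P₃ Q₁ (vec≡ G (v₂ :+ v₃) ((v₀ :+ v₃) :+ ((v₁ :- v₀) :+ (v₂ :- v₁))) refl))
      (at P₁ Q₂ (by -1ℤ (+ 1) (v₀ :+ v₄) ((v₀ :+ v₃) :+ ((v₅ :- v₃) :+ (v₂ :- v₁))) refl))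
      (at P₁ Q₁ (by (+ 0) (+ 1) (v₀ :+ v₃) ((v₀ :+ v₃) :+ ((v₁ :- v₀) :+ ((v₅ :- v₃) :+ (v₂ :- v₁)))) refl)))
    where
    G : Vec Z3 6
    G = p₁ ∷ p₂ ∷ p₃ ∷ q₁ ∷ q₂ ∷ q₃ ∷ []
    at : ∀ {x y z} → P x → Q y → x ⊞ y ≡ z → K z
    at X Y eq = subst K eq (sum X Y)
    by : ∀ k l (a b : Expr 6) → nf a ⊖ᵥ nf b ≡ combine ((ℤ.- k , v₁ :- v₀ , v₃ :- v₄) ∷ (ℤ.- l , v₂ :- v₀ , v₃ :- v₅) ∷ []) → ⟦ a ⟧ G ≡ ⟦ b ⟧ G
    by k l a b = lin≡ G ((ℤ.- k , v₁ :- v₀ , v₃ :- v₄) ∷ (ℤ.- l , v₂ :- v₀ , v₃ :- v₅) ∷ []) (e ∷ f ∷ []) a b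
    contra : p₂ ⊟ p₁ ≡ o ⊎ q₃ ⊟ q₁ ≡ o ⊎ p₃ ⊟ p₂ ≡ o → ⊥
    contra (inj₁ z) = n₁₂ (sym (⊟≡o⇒≡ z))
    contra (inj₂ (inj₁ z)) = n₁₃ (lin≡ G ((-1ℤ , v₂ :- v₀ , v₃ :- v₅) ∷ (+ 1 , v₅ :- v₃ , :0) ∷ []) (f ∷ z ∷ []) v₀ v₂ refl)
    contra (inj₂ (inj₂ z)) = n₂₃ (sym (⊟≡o⇒≡ z))

  module Odd {p₁ p₂ p₃ q₁ q₂ q₃ q₄ a a' : Z3} (st : Setup p₁ p₂ p₃ q₁ q₂ q₃ q₄ a a') where
    open Setup st
    H : Z3 → Vec Z3 9
    H y = p₁ ∷ p₂ ∷ p₃ ∷ q₁ ∷ q₂ ∷ q₃ ∷ q₄ ∷ a ∷ y ∷ []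

    -- If a - p₁ = q₄ - q₂ modulo 2, then a, p₂ and the translate of q₄ add up to four times p₃.
    Twisted : Set
    Twisted = Even ((a ⊟ p₁) ⊟ (q₄ ⊟ q₂))

    Centre₃ : Set
    Centre₃ = (a ⊟ p₁) ⊞ (p₂ ⊟ p₁) ⊞ (q₄ ⊟ q₁) ≡ + 4 ∙ (p₃ ⊟ p₁)

    twisted-centre : Twisted → Centre₃
    twisted-centre (y , e) = finish (Resolve.resolve S p₁ q₁ g C-valid checkC)
      where
      y' : Z3
      y' = y ⊟ (p₂ ⊟ p₁)
      g : Vec Z3 5
      g = p₂ ⊟ p₁ ∷ p₃ ⊟ p₁ ∷ q₄ ⊟ q₁ ∷ y' ∷ o ∷ []
      by : ∀ k l m (u v : Expr 9) → nf u ⊖ᵥ nf v ≡ combine ((k , v₁ :- v₀ , v₄ :- v₃) ∷ (l , v₂ :- v₀ , v₅ :- v₃) ∷ (m , (v₇ :- v₀) :- (v₆ :- v₄) , + 2 :* v₈) ∷ []) → ⟦ u ⟧ (H y) ≡ ⟦ v ⟧ (H y)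
      by k l m u v = lin≡ (H y) ((k , v₁ :- v₀ , v₄ :- v₃) ∷ (l , v₂ :- v₀ , v₅ :- v₃) ∷ (m , (v₇ :- v₀) :- (v₆ :- v₄) , + 2 :* v₈) ∷ []) (same₂ ∷ same₃ ∷ e ∷ []) u v
      by' : ∀ (x : Expr 9) → ⟦ x ⟧ (H y) ≡ o → ∀ k m n (u v : Expr 9) → nf u ⊖ᵥ nf v ≡ combine ((k , v₁ :- v₀ , v₄ :- v₃) ∷ (m , (v₇ :- v₀) :- (v₆ :- v₄) , + 2 :* v₈) ∷ (n , x , :0) ∷ []) → ⟦ u ⟧ (H y) ≡ ⟦ v ⟧ (H y)
      by' x z k m n u v = lin≡ (H y) ((k , v₁ :- v₀ , v₄ :- v₃) ∷ (m , (v₇ :- v₀) :- (v₆ :- v₄) , + 2 :* v₈) ∷ (n , x , :0) ∷ []) (same₂ ∷ e ∷ z ∷ []) u v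
      C-valid : Resolve.Valid S p₁ q₁ g cfgC
      C-valid = go inP inQ dP dQ
        where
        go : All P (p₁ ∷ p₂ ∷ p₃ ∷ a ∷ a' ∷ []) → All Q (q₁ ∷ q₂ ∷ q₃ ∷ q₄ ∷ []) → AllPairs _≢_ (p₁ ∷ p₂ ∷ p₃ ∷ a ∷ a' ∷ []) →
             AllPairs _≢_ (q₁ ∷ q₂ ∷ q₃ ∷ q₄ ∷ []) → Resolve.Valid S p₁ q₁ g cfgC
        go (P₁ ∷ P₂ ∷ P₃ ∷ A ∷ _ ∷ []) qs ((n₁₂ ∷ n₁₃ ∷ n₁a ∷ _) ∷ (n₂₃ ∷ n₂a ∷ _) ∷ (n₃a ∷ _) ∷ _) dq = valid S {cfgC}
          (locate :0 (by (+ 0) (+ 0) (+ 0) v₀ (v₀ :+ :0) refl)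
            ∷ locate v₀ (by (+ 0) (+ 0) (+ 0) v₁ (v₀ :+ (v₁ :- v₀)) refl)
            ∷ locate v₁ (by (+ 0) (+ 0) (+ 0) v₂ (v₀ :+ (v₂ :- v₀)) refl)
            ∷ locate (v₀ :+ v₂ :+ + 2 :* v₃) (by (+ 1) (+ 0) (+ 1) v₇ (v₀ :+ ((v₁ :- v₀) :+ (v₆ :- v₃) :+ + 2 :* (v₈ :- (v₁ :- v₀)))) refl) ∷ [])
          (locate :0 (by (+ 0) (+ 0) (+ 0) v₃ (v₃ :+ :0) refl)
            ∷ locate v₀ (by -1ℤ (+ 0) (+ 0) v₄ (v₃ :+ (v₁ :- v₀)) refl)
            ∷ locate v₁ (by (+ 0) -1ℤ (+ 0) v₅ (v₃ :+ (v₂ :- v₀)) refl)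
            ∷ locate v₂ (by (+ 0) (+ 0) (+ 0) v₆ (v₃ :+ (v₆ :- v₃)) refl) ∷ [])
          (P₁ ∷ P₂ ∷ P₃ ∷ A ∷ []) qs
          ((n₁₂ ∷ n₁₃ ∷ n₁a ∷ []) ∷ (n₂₃ ∷ n₂a ∷ []) ∷ (n₃a ∷ []) ∷ [] ∷ []) dq
          ((λ z → un (o , by' ((v₁ :- v₀) :+ + 2 :* (v₈ :- (v₁ :- v₀))) (trans (nf-sound (v₀ :+ + 2 :* v₃) g) z) (+ 1) (+ 1) (+ 1)
              ((v₇ :- v₀) :- (v₆ :- v₃)) (+ 2 :* :0) refl)) ∷ [])
      -- Here p₁ p₂ a would be a reflection of the triangle q₂ q₁ q₄.
      reflect : ∀ (k : ℤ) → ⟦ k :* (v₂ :+ v₃) ⟧ g ≡ o → .{{ℤ.NonZero k}} → ⊥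
      reflect k z = go inP inQ dP
        where
        z' : (q₄ ⊟ q₁) ⊞ (y ⊟ (p₂ ⊟ p₁)) ≡ o
        z' = ∙-cancel k (trans z (sym (∙-o k)))
        go : All P (p₁ ∷ p₂ ∷ p₃ ∷ a ∷ a' ∷ []) → All Q (q₁ ∷ q₂ ∷ q₃ ∷ q₄ ∷ []) → AllPairs _≢_ (p₁ ∷ p₂ ∷ p₃ ∷ a ∷ a' ∷ []) → ⊥
        go (P₁ ∷ P₂ ∷ P₃ ∷ A ∷ _ ∷ []) (Q₁ ∷ Q₂ ∷ Q₃ ∷ Q₄ ∷ []) ((n₁₂ ∷ n₁₃ ∷ n₁a ∷ _) ∷ (n₂₃ ∷ n₂a ∷ _) ∷ (n₃a ∷ _) ∷ _) =
          no-reflection P₁ P₂ A Q₂ Q₁ Q₄ (n₁₂ , n₁a , n₂a) same₂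
            (by' ((v₆ :- v₃) :+ (v₈ :- (v₁ :- v₀))) z' (+ 2) (+ 1) (+ 2) (v₇ :- v₀) (v₄ :- v₆) refl)
      centre : ∀ (k : ℤ) → ⟦ k :* (v₀ :+ -[1+ 1 ] :* v₁ :+ v₂ :+ v₃) ⟧ g ≡ o → .{{ℤ.NonZero k}} → Centre₃
      centre k z = by' ((v₁ :- v₀) :+ -[1+ 1 ] :* (v₂ :- v₀) :+ (v₆ :- v₃) :+ (v₈ :- (v₁ :- v₀)))
          (∙-cancel k (trans z (sym (∙-o k)))) (+ 1) (+ 1) (+ 2)
          ((v₇ :- v₀) :+ (v₁ :- v₀) :+ (v₆ :- v₃)) (+ 4 :* (v₂ :- v₀)) refl
      finish : Any (λ r → ev r g ≡ o) (Config.res cfgC) ⊎ Any (λ l → Multiple 3 (ev l g)) [] → Centre₃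
      finish (inj₁ (here z)) = ⊥-elim (reflect (+ 1) (trans (nf-sound (+ 1 :* (v₂ :+ v₃)) g) z))
      finish (inj₁ (there (here z))) = ⊥-elim (reflect -1ℤ (trans (nf-sound (-1ℤ :* (v₂ :+ v₃)) g) z))
      finish (inj₁ (there (there (here z)))) = centre (+ 1) (trans (nf-sound (+ 1 :* (v₀ :+ -[1+ 1 ] :* v₁ :+ v₂ :+ v₃)) g) z)
      finish (inj₁ (there (there (there (here z))))) = centre -1ℤ (trans (nf-sound (-1ℤ :* (v₀ :+ -[1+ 1 ] :* v₁ :+ v₂ :+ v₃)) g) z)

module _ {P Q K : Z3 → Set} (S : System P Q K) where
  open System S

  -- Four points that are distinct modulo two lie in an affine plane exactly if their sum is even.
  Plane : Z3 → Z3 → Z3 → Z3 → Set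
  Plane q₁ q₂ q₃ q₄ = Even ((q₁ ⊞ q₄) ⊟ (q₂ ⊞ q₃))

  plane₁₂ : ∀ q₁ q₂ q₃ q₄ → Plane q₁ q₂ q₃ q₄ → Plane q₂ q₁ q₃ q₄
  plane₁₂ q₁ q₂ q₃ q₄ (y , e) = y ⊞ q₂ ⊟ q₁ , lin≡ (q₁ ∷ q₂ ∷ q₃ ∷ q₄ ∷ y ∷ []) ((+ 1 , (v₀ :+ v₃) :- (v₁ :+ v₂) , + 2 :* v₄) ∷ []) (e ∷ [])
    ((v₁ :+ v₃) :- (v₀ :+ v₂)) (+ 2 :* (v₄ :+ v₁ :- v₀)) refl
  plane₂₃ : ∀ q₁ q₂ q₃ q₄ → Plane q₁ q₂ q₃ q₄ → Plane q₁ q₃ q₂ q₄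
  plane₂₃ q₁ q₂ q₃ q₄ (y , e) = y , trans (vec≡ (q₁ ∷ q₂ ∷ q₃ ∷ q₄ ∷ []) ((v₀ :+ v₃) :- (v₂ :+ v₁)) ((v₀ :+ v₃) :- (v₁ :+ v₂)) refl) e

  module _ {p₁ p₂ p₃ q₁ q₂ q₃ q₄ a a' : Z3} (st : Setup S p₁ p₂ p₃ q₁ q₂ q₃ q₄ a a') where
    open Setup st

    -- `Centre₃` expresses p₂ through the other vectors. Four generators are left, and each of their
    -- dependences modulo three is contradictory.
    coset-absurd : Odd.Centre₃ S st → ¬ Even ((a' ⊟ p₁) ⊟ ((p₂ ⊟ p₁) ⊞ (p₃ ⊟ p₁)))
    coset-absurd c (z , e) = finish (Resolve.resolve S p₁ q₁ g (C-valid inP inQ dP dQ) checkC′)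
      where
      g : Vec Z3 5
      g = p₃ ⊟ p₁ ∷ q₄ ⊟ q₁ ∷ (a ⊟ p₁) ⊟ + 2 ∙ (p₃ ⊟ p₁) ∷ z ∷ o ∷ []
      H : Vec Z3 10
      H = p₁ ∷ p₂ ∷ p₃ ∷ q₁ ∷ q₂ ∷ q₃ ∷ q₄ ∷ a ∷ a' ∷ z ∷ []
      es : ℤ → ℤ → ℤ → ℤ → List (Eqn 10)
      es k l m n = (k , v₁ :- v₀ , v₄ :- v₃) ∷ (l , v₂ :- v₀ , v₅ :- v₃) ∷ (m , (v₇ :- v₀) :+ (v₁ :- v₀) :+ (v₆ :- v₃) , + 4 :* (v₂ :- v₀))
                 ∷ (n , (v₈ :- v₀) :- ((v₁ :- v₀) :+ (v₂ :- v₀)) , + 2 :* v₉) ∷ []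
      by : ∀ k l m n (u v : Expr 10) → nf u ⊖ᵥ nf v ≡ combine (es k l m n) → ⟦ u ⟧ H ≡ ⟦ v ⟧ H
      by k l m n u v = lin≡ H (es k l m n) (same₂ ∷ same₃ ∷ c ∷ e ∷ []) u v
      :s : Expr 5
      :s = + 2 :* v₀ :- v₁ :- v₂
      Hs Hy : Expr 10
      Hy = (v₇ :- v₀) :- + 2 :* (v₂ :- v₀)
      Hs = + 2 :* (v₂ :- v₀) :- (v₆ :- v₃) :- Hy
      C-valid : All P (p₁ ∷ p₂ ∷ p₃ ∷ a ∷ a' ∷ []) → All Q (q₁ ∷ q₂ ∷ q₃ ∷ q₄ ∷ []) → AllPairs _≢_ (p₁ ∷ p₂ ∷ p₃ ∷ a ∷ a' ∷ []) →
                AllPairs _≢_ (q₁ ∷ q₂ ∷ q₃ ∷ q₄ ∷ []) → Resolve.Valid S p₁ q₁ g cfgC′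
      C-valid ps qs dp dq = valid S {cfgC′}
        (locate :0 (by (+ 0) (+ 0) (+ 0) (+ 0) v₀ (v₀ :+ :0) refl)
          ∷ locate :s (by (+ 0) (+ 0) (+ 1) (+ 0) v₁ (v₀ :+ Hs) refl)
          ∷ locate v₀ (by (+ 0) (+ 0) (+ 0) (+ 0) v₂ (v₀ :+ (v₂ :- v₀)) refl)
          ∷ locate (:s :+ v₁ :+ + 2 :* v₂) (by (+ 0) (+ 0) (+ 0) (+ 0) v₇ (v₀ :+ (Hs :+ (v₆ :- v₃) :+ + 2 :* Hy)) refl)
          ∷ locate (:s :+ v₀ :+ + 2 :* v₃) (by (+ 0) (+ 0) (+ 1) (+ 1) v₈ (v₀ :+ (Hs :+ (v₂ :- v₀) :+ + 2 :* v₉)) refl) ∷ [])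
        (locate :0 (by (+ 0) (+ 0) (+ 0) (+ 0) v₃ (v₃ :+ :0) refl)
          ∷ locate :s (by -1ℤ (+ 0) (+ 1) (+ 0) v₄ (v₃ :+ Hs) refl)
          ∷ locate v₀ (by (+ 0) -1ℤ (+ 0) (+ 0) v₅ (v₃ :+ (v₂ :- v₀)) refl)
          ∷ locate v₁ (by (+ 0) (+ 0) (+ 0) (+ 0) v₆ (v₃ :+ (v₆ :- v₃)) refl) ∷ [])
        ps qs dp dq
        ((λ w → un (o , lin≡ H ((+ 1 , Hs :+ + 2 :* Hy , :0) ∷ []) (trans (nf-sound (:s :+ + 2 :* v₂) g) w ∷ [])
              ((v₇ :- v₀) :- (v₆ :- v₃)) (+ 2 :* :0) refl))
         ∷ (λ w → un' (o , lin≡ H ((+ 1 , Hs :+ (v₂ :- v₀) :+ + 2 :* v₉ :- (v₆ :- v₃) , :0) ∷ es (+ 0) (+ 0) (+ 1) (+ 1))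
              (trans (nf-sound (:s :+ v₀ :+ + 2 :* v₃ :- v₁) g) w ∷ same₂ ∷ same₃ ∷ c ∷ e ∷ [])
              ((v₈ :- v₀) :- (v₆ :- v₃)) (+ 2 :* :0) refl)) ∷ [])
      finish : Any (λ r → ev r g ≡ o) [] ⊎ Any (λ l → Multiple 3 (ev l g)) [] → ⊥
      finish (inj₁ ())
      finish (inj₂ ())

    module PlaneCase (pl : Plane q₁ q₂ q₃ q₄) where
      x : Z3
      x = proj₁ pl

      -- The position of a forced by collisions modulo 3.
      Position : Set
      Position = ∃[ i ] (a ≡ p₁ ⊞ ⟦ position i ⟧ (p₂ ⊟ p₁ ∷ p₃ ⊟ p₁ ∷ x ∷ []))
        where
        position : Fin 4 → Expr 3
        position zero = -1ℤ :* v₂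
        position (suc zero) = v₁ :+ v₂
        position (suc (suc zero)) = v₀ :+ v₂
        position (suc (suc (suc zero))) = v₀ :+ v₁ :+ v₂

      -- Doubled, this says that three divides 2a plus the sum of p₁, p₂, p₃ and the translate of
      -- q₄.
      Miss : Set
      Miss = Multiple 3 ((p₂ ⊟ p₁) ⊞ (p₃ ⊟ p₁) ⊞ x ⊞ (a ⊟ p₁))

      outcome : Position ⊎ Miss
      outcome = finish (Resolve.resolve S p₁ q₁ g (D-valid inP inQ dP dQ) checkD)
        where
        g : Vec Z3 5
        g = p₂ ⊟ p₁ ∷ p₃ ⊟ p₁ ∷ x ∷ a ⊟ p₁ ∷ o ∷ []
        H : Vec Z3 9
        H = p₁ ∷ p₂ ∷ p₃ ∷ q₁ ∷ q₂ ∷ q₃ ∷ q₄ ∷ a ∷ x ∷ []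
        es : ℤ → ℤ → ℤ → List (Eqn 9)
        es k l m = (k , v₁ :- v₀ , v₄ :- v₃) ∷ (l , v₂ :- v₀ , v₅ :- v₃) ∷ (m , (v₃ :+ v₆) :- (v₄ :+ v₅) , + 2 :* v₈) ∷ []
        by : ∀ k l m (u v : Expr 9) → nf u ⊖ᵥ nf v ≡ combine (es k l m) → ⟦ u ⟧ H ≡ ⟦ v ⟧ H
        by k l m u v = lin≡ H (es k l m) (same₂ ∷ same₃ ∷ proj₂ pl ∷ []) u v
        D-valid : All P (p₁ ∷ p₂ ∷ p₃ ∷ a ∷ a' ∷ []) → All Q (q₁ ∷ q₂ ∷ q₃ ∷ q₄ ∷ []) → AllPairs _≢_ (p₁ ∷ p₂ ∷ p₃ ∷ a ∷ a' ∷ []) →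
                  AllPairs _≢_ (q₁ ∷ q₂ ∷ q₃ ∷ q₄ ∷ []) → Resolve.Valid S p₁ q₁ g cfgD
        D-valid (P₁ ∷ P₂ ∷ P₃ ∷ A ∷ _ ∷ []) qs ((n₁₂ ∷ n₁₃ ∷ n₁a ∷ _) ∷ (n₂₃ ∷ n₂a ∷ _) ∷ (n₃a ∷ _) ∷ _) dq = valid S {cfgD}
          (locate :0 (by (+ 0) (+ 0) (+ 0) v₀ (v₀ :+ :0) refl)
            ∷ locate v₀ (by (+ 0) (+ 0) (+ 0) v₁ (v₀ :+ (v₁ :- v₀)) refl)
            ∷ locate v₁ (by (+ 0) (+ 0) (+ 0) v₂ (v₀ :+ (v₂ :- v₀)) refl)
            ∷ locate v₃ (by (+ 0) (+ 0) (+ 0) v₇ (v₀ :+ (v₇ :- v₀)) refl) ∷ [])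
          (locate :0 (by (+ 0) (+ 0) (+ 0) v₃ (v₃ :+ :0) refl)
            ∷ locate v₀ (by -1ℤ (+ 0) (+ 0) v₄ (v₃ :+ (v₁ :- v₀)) refl)
            ∷ locate v₁ (by (+ 0) -1ℤ (+ 0) v₅ (v₃ :+ (v₂ :- v₀)) refl)
            ∷ locate (v₀ :+ v₁ :+ + 2 :* v₂) (by -1ℤ -1ℤ (+ 1) v₆ (v₃ :+ ((v₁ :- v₀) :+ (v₂ :- v₀) :+ + 2 :* v₈)) refl) ∷ [])
          (P₁ ∷ P₂ ∷ P₃ ∷ A ∷ []) qs
          ((n₁₂ ∷ n₁₃ ∷ n₁a ∷ []) ∷ (n₂₃ ∷ n₂a ∷ []) ∷ (n₃a ∷ []) ∷ [] ∷ []) dq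
          ((λ z → un (o , lin≡ H ((-1ℤ , (v₁ :- v₀) :+ (v₂ :- v₀) :+ + 2 :* v₈ :- (v₇ :- v₀) , :0) ∷ es (+ 1) (+ 1) -1ℤ)
              (trans (nf-sound (v₀ :+ v₁ :+ + 2 :* v₂ :- v₃) g) z ∷ same₂ ∷ same₃ ∷ proj₂ pl ∷ [])
              ((v₇ :- v₀) :- (v₆ :- v₃)) (+ 2 :* :0) refl)) ∷ [])
        place : (e : Expr 4) (k : ℤ) .{{_ : ℤ.NonZero k}} → ⟦ k :* e ⟧ (p₂ ⊟ p₁ ∷ p₃ ⊟ p₁ ∷ x ∷ a ⊟ p₁ ∷ []) ≡ o →
                ⟦ e ⟧ (p₂ ⊟ p₁ ∷ p₃ ⊟ p₁ ∷ x ∷ a ⊟ p₁ ∷ []) ≡ o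
        place e k z = ∙-cancel k (trans z (sym (∙-o k)))
        I : Vec Z3 5
        I = p₁ ∷ p₂ ∷ p₃ ∷ x ∷ a ∷ []
        at₀ : ∀ k .{{_ : ℤ.NonZero k}} → ⟦ k :* (v₂ :+ v₃) ⟧ g ≡ o → Position
        at₀ k z = zero , lin≡ I ((+ 1 , v₃ :+ (v₄ :- v₀) , :0) ∷ []) (place (v₂ :+ v₃) k z ∷ []) v₄ (v₀ :+ (-1ℤ :* v₃)) refl
        at₁ : ∀ k .{{_ : ℤ.NonZero k}} → ⟦ k :* (v₁ :+ v₂ :+ -1ℤ :* v₃) ⟧ g ≡ o → Position
        at₁ k z = suc zero , lin≡ I ((-1ℤ , (v₂ :- v₀) :+ v₃ :+ -1ℤ :* (v₄ :- v₀) , :0) ∷ []) (place (v₁ :+ v₂ :+ -1ℤ :* v₃) k z ∷ []) v₄ (v₀ :+ ((v₂ :- v₀) :+ v₃)) refl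
        at₂ : ∀ k .{{_ : ℤ.NonZero k}} → ⟦ k :* (v₀ :+ v₂ :+ -1ℤ :* v₃) ⟧ g ≡ o → Position
        at₂ k z = suc (suc zero) , lin≡ I ((-1ℤ , (v₁ :- v₀) :+ v₃ :+ -1ℤ :* (v₄ :- v₀) , :0) ∷ []) (place (v₀ :+ v₂ :+ -1ℤ :* v₃) k z ∷ []) v₄ (v₀ :+ ((v₁ :- v₀) :+ v₃)) refl
        at₃ : ∀ k .{{_ : ℤ.NonZero k}} → ⟦ k :* (v₀ :+ v₁ :+ v₂ :+ -1ℤ :* v₃) ⟧ g ≡ o → Position
        at₃ k z = suc (suc (suc zero)) , lin≡ I ((-1ℤ , (v₁ :- v₀) :+ (v₂ :- v₀) :+ v₃ :+ -1ℤ :* (v₄ :- v₀) , :0) ∷ []) (place (v₀ :+ v₁ :+ v₂ :+ -1ℤ :* v₃) k z ∷ [])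
          v₄ (v₀ :+ ((v₁ :- v₀) :+ (v₂ :- v₀) :+ v₃)) refl
        un-nf : (e : Expr 5) → ev (nf e) g ≡ o → ⟦ e ⟧ g ≡ o
        un-nf e z = trans (nf-sound e g) z
        finish : Any (λ r → ev r g ≡ o) (Config.res cfgD) ⊎ Any (λ l → Multiple 3 (ev l g)) (Config.miss cfgD) → Position ⊎ Miss
        finish (inj₁ (here z)) = inj₁ (at₀ (+ 1) (un-nf (+ 1 :* (v₂ :+ v₃)) z))
        finish (inj₁ (there (here z))) = inj₁ (at₀ -1ℤ (un-nf (-1ℤ :* (v₂ :+ v₃)) z))
        finish (inj₁ (there (there (here z)))) = inj₁ (at₁ (+ 1) (un-nf (+ 1 :* (v₁ :+ v₂ :+ -1ℤ :* v₃)) z))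
        finish (inj₁ (there (there (there (here z))))) = inj₁ (at₁ -1ℤ (un-nf (-1ℤ :* (v₁ :+ v₂ :+ -1ℤ :* v₃)) z))
        finish (inj₁ (there (there (there (there (here z)))))) = inj₁ (at₂ (+ 1) (un-nf (+ 1 :* (v₀ :+ v₂ :+ -1ℤ :* v₃)) z))
        finish (inj₁ (there (there (there (there (there (here z))))))) = inj₁ (at₂ -1ℤ (un-nf (-1ℤ :* (v₀ :+ v₂ :+ -1ℤ :* v₃)) z))
        finish (inj₁ (there (there (there (there (there (there (here z)))))))) = inj₁ (at₃ (+ 1) (un-nf (+ 1 :* (v₀ :+ v₁ :+ v₂ :+ -1ℤ :* v₃)) z))
        finish (inj₁ (there (there (there (there (there (there (there (here z))))))))) = inj₁ (at₃ -1ℤ (un-nf (-1ℤ :* (v₀ :+ v₁ :+ v₂ :+ -1ℤ :* v₃)) z))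
        finish (inj₂ (here (y , z))) = inj₂ (y , trans (nf-sound (v₀ :+ v₁ :+ v₂ :+ v₃) g) z)
        finish (inj₂ (there (here (y , z)))) = inj₂ (w ⊟ y , lin≡ (w ∷ y ∷ []) ((-1ℤ , + 2 :* v₀ , + 3 :* v₁) ∷ [])
            (trans (nf-sound (+ 2 :* (v₀ :+ v₁ :+ v₂ :+ v₃)) g) z ∷ []) v₀ (+ 3 :* (v₀ :- v₁)) refl)
          where w = (p₂ ⊟ p₁) ⊞ (p₃ ⊟ p₁) ⊞ x ⊞ (a ⊟ p₁)

      -- Once a is placed, a' is known up to an even vector 2y; `e` describes the place of a
      -- independently of y.
      pair-absurd : ∀ (e : Expr 5) → Checked (cfgD′ (nf e)) → (∀ y → a ≡ p₁ ⊞ ⟦ e ⟧ (p₂ ⊟ p₁ ∷ p₃ ⊟ p₁ ∷ x ∷ y ∷ o ∷ [])) →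
                    ¬ Even ((a' ⊟ a) ⊟ (p₂ ⊟ p₁))
      pair-absurd e ch loc (y , eq) = finish (Resolve.resolve S p₁ q₁ g
        (valid S {cfgD′ (nf e)}
          (locate :0 (by (+ 0) (+ 0) (+ 0) v₀ (v₀ :+ :0) refl)
            ∷ locate v₀ (by (+ 0) (+ 0) (+ 0) v₁ (v₀ :+ (v₁ :- v₀)) refl)
            ∷ locate v₁ (by (+ 0) (+ 0) (+ 0) v₂ (v₀ :+ (v₂ :- v₀)) refl)
            ∷ locate e (loc y)
            ∷ locate (e :+ v₀ :+ + 2 :* v₃) (lin≡ (p₁ ∷ p₂ ∷ a ∷ a' ∷ y ∷ ⟦ e ⟧ g ∷ [])
                ((+ 1 , (v₃ :- v₂) :- (v₁ :- v₀) , + 2 :* v₄) ∷ (+ 1 , v₂ , v₀ :+ v₅) ∷ []) (eq ∷ loc y ∷ []) v₃ (v₀ :+ (v₅ :+ (v₁ :- v₀) :+ + 2 :* v₄)) refl) ∷ [])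
          (locate :0 (by (+ 0) (+ 0) (+ 0) v₃ (v₃ :+ :0) refl)
            ∷ locate v₀ (by -1ℤ (+ 0) (+ 0) v₄ (v₃ :+ (v₁ :- v₀)) refl)
            ∷ locate v₁ (by (+ 0) -1ℤ (+ 0) v₅ (v₃ :+ (v₂ :- v₀)) refl)
            ∷ locate (v₀ :+ v₁ :+ + 2 :* v₂) (by -1ℤ -1ℤ (+ 1) v₆ (v₃ :+ ((v₁ :- v₀) :+ (v₂ :- v₀) :+ + 2 :* v₇)) refl) ∷ [])
          inP inQ dP dQ []) ch)
        where
        g : Vec Z3 5
        g = p₂ ⊟ p₁ ∷ p₃ ⊟ p₁ ∷ x ∷ y ∷ o ∷ []
        H : Vec Z3 8
        H = p₁ ∷ p₂ ∷ p₃ ∷ q₁ ∷ q₂ ∷ q₃ ∷ q₄ ∷ x ∷ []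
        es : ℤ → ℤ → ℤ → List (Eqn 8)
        es k l m = (k , v₁ :- v₀ , v₄ :- v₃) ∷ (l , v₂ :- v₀ , v₅ :- v₃) ∷ (m , (v₃ :+ v₆) :- (v₄ :+ v₅) , + 2 :* v₇) ∷ []
        by : ∀ k l m (u v : Expr 8) → nf u ⊖ᵥ nf v ≡ combine (es k l m) → ⟦ u ⟧ H ≡ ⟦ v ⟧ H
        by k l m u v = lin≡ H (es k l m) (same₂ ∷ same₃ ∷ proj₂ pl ∷ []) u v
        finish : Any (λ r → ev r g ≡ o) [] ⊎ Any (λ l → Multiple 3 (ev l g)) [] → ⊥
        finish (inj₁ ())
        finish (inj₂ ())

      placed-absurd : Position → ¬ Even ((a' ⊟ a) ⊟ (p₂ ⊟ p₁))
      placed-absurd (zero , e) = pair-absurd (-1ℤ :* v₂) checkD₁ (λ y → e)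
      placed-absurd (suc zero , e) = pair-absurd (v₁ :+ v₂) checkD₂ (λ y → e)
      placed-absurd (suc (suc zero) , e) = pair-absurd (v₀ :+ v₂) checkD₃ (λ y → e)
      placed-absurd (suc (suc (suc zero)) , e) = pair-absurd (v₀ :+ v₁ :+ v₂) checkD₄ (λ y → e)

module _ {P Q K : Z3 → Set} (S : System P Q K) where
  open System S

  -- If a or a' has a definite position, `placed-absurd` applies; if both are misses, their
  -- difference is divisible by three.
  plane-pair : ∀ {p₁ p₂ p₃ q₁ q₂ q₃ q₄ a a'} → Setup S p₁ p₂ p₃ q₁ q₂ q₃ q₄ a a' → Plane S q₁ q₂ q₃ q₄ →
               ¬ Even ((a' ⊟ a) ⊟ (p₂ ⊟ p₁))
  plane-pair {p₁} {p₂} {p₃} {a = a} {a'} st pl (y , e) = go (PlaneCase.outcome S st pl) (PlaneCase.outcome S (swapA S st) pl) (Setup.inP st) (Setup.dP st)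
    where
    x : Z3
    x = proj₁ pl
    go : PlaneCase.Position S st pl ⊎ PlaneCase.Miss S st pl → PlaneCase.Position S (swapA S st) pl ⊎ PlaneCase.Miss S (swapA S st) pl →
         All P (p₁ ∷ p₂ ∷ p₃ ∷ a ∷ a' ∷ []) → AllPairs _≢_ (p₁ ∷ p₂ ∷ p₃ ∷ a ∷ a' ∷ []) → ⊥
    go (inj₁ r) _ _ _ = PlaneCase.placed-absurd S st pl r (y , e)
    go _ (inj₁ r) _ _ = PlaneCase.placed-absurd S (swapA S st) pl r (-1ℤ ∙ (y ⊞ (p₂ ⊟ p₁)) ,
      lin≡ (p₁ ∷ p₂ ∷ a ∷ a' ∷ y ∷ []) ((-1ℤ , (v₃ :- v₂) :- (v₁ :- v₀) , + 2 :* v₄) ∷ []) (e ∷ [])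
        ((v₂ :- v₃) :- (v₁ :- v₀)) (+ 2 :* (-1ℤ :* (v₄ :+ (v₁ :- v₀)))) refl)
    go (inj₂ (u , f)) (inj₂ (w , h)) (_ ∷ _ ∷ _ ∷ A ∷ A' ∷ []) (_ ∷ _ ∷ _ ∷ (n ∷ []) ∷ _) =
      n (LengthOne.indivisible oneP 3 (s≤s (s≤s z≤n)) A A' (u ⊟ w , lin≡ (p₁ ∷ p₂ ∷ p₃ ∷ x ∷ a ∷ a' ∷ u ∷ w ∷ [])
        ((+ 1 , (v₁ :- v₀) :+ (v₂ :- v₀) :+ v₃ :+ (v₄ :- v₀) , + 3 :* v₆) ∷ (-1ℤ , (v₁ :- v₀) :+ (v₂ :- v₀) :+ v₃ :+ (v₅ :- v₀) , + 3 :* v₇) ∷ [])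
        (f ∷ h ∷ []) (v₄ :- v₅) (+ 3 :* (v₆ :- v₇)) refl))

  -- Modulo two both a and a' lie outside the plane, so their difference lies in it, and a
  -- permutation of p₁, p₂, p₃ brings the difference into the class of p₂ - p₁.
  plane-absurd : ∀ {p₁ p₂ p₃ q₁ q₂ q₃ q₄ a a'} → Setup S p₁ p₂ p₃ q₁ q₂ q₃ q₄ a a' → ¬ Plane S q₁ q₂ q₃ q₄
  plane-absurd {p₁} {p₂} {p₃} {q₁} {q₂} {q₃} {q₄} {a} {a'} st pl@(c , ec) = go inP dP
    where
    open Setup st
    s t : Z3
    s = p₂ ⊟ p₁
    t = p₃ ⊟ p₁
    module _ (P₁ : P p₁) (P₂ : P p₂) (P₃ : P p₃) (n₁₂ : p₁ ≢ p₂) (n₁₃ : p₁ ≢ p₃) (n₂₃ : p₂ ≢ p₃) where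
      outside : ∀ {a} → P a → p₁ ≢ a → p₂ ≢ a → p₃ ≢ a → ¬ Even ((a ⊟ p₁) ⊟ (q₄ ⊟ q₁)) → ¬ Span s t (a ⊟ p₁)
      outside A n₁ n₂ n₃ un (h₀ m) = oddP S A P₁ (≢-sym n₁) m
      outside {a} A n₁ n₂ n₃ un (h₁ m) = oddP S A P₂ (≢-sym n₂) (subst Even (vec≡ (a ∷ p₁ ∷ p₂ ∷ []) ((v₀ :- v₁) :- (v₂ :- v₁)) (v₀ :- v₂) refl) m)
      outside {a} A n₁ n₂ n₃ un (h₂ m) = oddP S A P₃ (≢-sym n₃) (subst Even (vec≡ (a ∷ p₁ ∷ p₃ ∷ []) ((v₀ :- v₁) :- (v₂ :- v₁)) (v₀ :- v₂) refl) m)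
      outside {a} A n₁ n₂ n₃ un (h₃ (y , e)) = un (y ⊟ c , lin≡ (p₁ ∷ p₂ ∷ p₃ ∷ q₁ ∷ q₂ ∷ q₃ ∷ q₄ ∷ a ∷ c ∷ y ∷ [])
        ((+ 1 , v₁ :- v₀ , v₄ :- v₃) ∷ (+ 1 , v₂ :- v₀ , v₅ :- v₃) ∷ (-1ℤ , (v₃ :+ v₆) :- (v₄ :+ v₅) , + 2 :* v₈)
          ∷ (+ 1 , (v₇ :- v₀) :- ((v₁ :- v₀) :+ (v₂ :- v₀)) , + 2 :* v₉) ∷ []) (same₂ ∷ same₃ ∷ ec ∷ e ∷ [])
        ((v₇ :- v₀) :- (v₆ :- v₃)) (+ 2 :* (v₉ :- v₈)) refl)
      same-side : ¬ Span s t (a ⊟ p₁) → ¬ Span s t (a' ⊟ p₁) → Span s t ((a' ⊟ p₁) ⊟ (a ⊟ p₁))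
      same-side = same-coset (oddP S P₂ P₁ (≢-sym n₁₂)) (oddP S P₃ P₁ (≢-sym n₁₃))
        (λ m → oddP S P₂ P₃ n₂₃ (subst Even (vec≡ (p₁ ∷ p₂ ∷ p₃ ∷ []) ((v₁ :- v₀) :- (v₂ :- v₀)) (v₁ :- v₂) refl) m))
    drop : ∀ u → Even (((a' ⊟ p₁) ⊟ (a ⊟ p₁)) ⊟ u) → Even ((a' ⊟ a) ⊟ u)
    drop u = subst Even (vec≡ (p₁ ∷ a ∷ a' ∷ u ∷ []) (((v₂ :- v₀) :- (v₁ :- v₀)) :- v₃) ((v₂ :- v₁) :- v₃) refl)
    pair : P a → P a' → a ≢ a' → ¬ Span s t ((a' ⊟ p₁) ⊟ (a ⊟ p₁))
    pair A A' n (h₀ m) = oddP S A' A (≢-sym n) (subst Even (vec≡ (p₁ ∷ a ∷ a' ∷ []) ((v₂ :- v₀) :- (v₁ :- v₀)) (v₂ :- v₁) refl) m)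
    pair A A' n (h₁ m) = plane-pair st pl (drop s m)
    pair A A' n (h₂ m) = plane-pair (swap₂₃ S st) (plane₂₃ S q₁ q₂ q₃ q₄ pl) (drop t m)
    pair A A' n (h₃ (y , e)) = plane-pair (swap₂₃ S (swap₁₂ S st)) (plane₂₃ S q₂ q₁ q₃ q₄ (plane₁₂ S q₁ q₂ q₃ q₄ pl)) (y ⊞ s ,
      lin≡ (p₁ ∷ p₂ ∷ p₃ ∷ a ∷ a' ∷ y ∷ []) ((+ 1 , ((v₄ :- v₀) :- (v₃ :- v₀)) :- ((v₁ :- v₀) :+ (v₂ :- v₀)) , + 2 :* v₅) ∷ []) (e ∷ [])
        ((v₄ :- v₃) :- (v₂ :- v₁)) (+ 2 :* (v₅ :+ (v₁ :- v₀))) refl)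
    go : All P (p₁ ∷ p₂ ∷ p₃ ∷ a ∷ a' ∷ []) → AllPairs _≢_ (p₁ ∷ p₂ ∷ p₃ ∷ a ∷ a' ∷ []) → ⊥
    go (P₁ ∷ P₂ ∷ P₃ ∷ A ∷ A' ∷ []) ((n₁₂ ∷ n₁₃ ∷ n₁a ∷ n₁a' ∷ []) ∷ (n₂₃ ∷ n₂a ∷ n₂a' ∷ []) ∷ (n₃a ∷ n₃a' ∷ []) ∷ (n ∷ []) ∷ [] ∷ []) =
      pair A A' n (same-side P₁ P₂ P₃ n₁₂ n₁₃ n₂₃ (outside P₁ P₂ P₃ n₁₂ n₁₃ n₂₃ A n₁a n₂a n₃a un)
                                                   (outside P₁ P₂ P₃ n₁₂ n₁₃ n₂₃ A' n₁a' n₂a' n₃a' un'))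

  -- Of the eight classes modulo two, a avoids those of p₁, p₂, p₃ and of the translate of q₄; these
  -- four remain.
  data Shape (p₁ p₂ p₃ q₁ q₂ q₃ q₄ a : Z3) : Set where
    coset  : Even ((a ⊟ p₁) ⊟ ((p₂ ⊟ p₁) ⊞ (p₃ ⊟ p₁))) → Shape p₁ p₂ p₃ q₁ q₂ q₃ q₄ a
    twist₁₂ : Even ((a ⊟ p₁) ⊟ (q₄ ⊟ q₂)) → Shape p₁ p₂ p₃ q₁ q₂ q₃ q₄ a
    twist₁₃ : Even ((a ⊟ p₁) ⊟ (q₄ ⊟ q₃)) → Shape p₁ p₂ p₃ q₁ q₂ q₃ q₄ a
    twist₂₃ : Even ((a ⊟ p₂) ⊟ (q₄ ⊟ q₃)) → Shape p₁ p₂ p₃ q₁ q₂ q₃ q₄ a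

  shape : ∀ {p₁ p₂ p₃ q₁ q₂ q₃ q₄ a a'} → Setup S p₁ p₂ p₃ q₁ q₂ q₃ q₄ a a' → ¬ Plane S q₁ q₂ q₃ q₄ → Shape p₁ p₂ p₃ q₁ q₂ q₃ q₄ a
  shape {p₁} {p₂} {p₃} {q₁} {q₂} {q₃} {q₄} {a} {a'} st odd = go inP dP (Basis.classify S inQ dQ odd (a ⊟ p₁))
    where
    open Setup st
    base : Vec Z3 3
    base = q₂ ⊟ q₁ ∷ q₃ ⊟ q₁ ∷ q₄ ⊟ q₁ ∷ []
    go : All P (p₁ ∷ p₂ ∷ p₃ ∷ a ∷ a' ∷ []) → AllPairs _≢_ (p₁ ∷ p₂ ∷ p₃ ∷ a ∷ a' ∷ []) →
         ∃[ ε ] Even ((a ⊟ p₁) ⊟ ev (bits ε) base) → Shape p₁ p₂ p₃ q₁ q₂ q₃ q₄ a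
    go (P₁ ∷ P₂ ∷ P₃ ∷ A ∷ _ ∷ []) ((n₁₂ ∷ n₁₃ ∷ n₁a ∷ _) ∷ (n₂₃ ∷ n₂a ∷ _) ∷ (n₃a ∷ _) ∷ _) (ε , y , e) = case ε e
      where
      G : Vec Z3 9
      G = p₁ ∷ p₂ ∷ p₃ ∷ q₁ ∷ q₂ ∷ q₃ ∷ q₄ ∷ a ∷ y ∷ []
      rhs : Class → Expr 9
      rhs (i ∷ j ∷ k ∷ []) = + toℕ i :* (v₄ :- v₃) :+ (+ toℕ j :* (v₅ :- v₃) :+ (+ toℕ k :* (v₆ :- v₃) :+ :0))
      by : ∀ (ε : Class) → (a ⊟ p₁) ⊟ ⟦ rhs ε ⟧ G ≡ + 2 ∙ y → ∀ k l (u v : Expr 9) →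
           nf u ⊖ᵥ nf v ≡ combine ((+ 1 , (v₇ :- v₀) :- rhs ε , + 2 :* v₈) ∷ (k , v₁ :- v₀ , v₄ :- v₃) ∷ (l , v₂ :- v₀ , v₅ :- v₃) ∷ []) → ⟦ u ⟧ G ≡ ⟦ v ⟧ G
      by ε e k l u v = lin≡ G ((+ 1 , (v₇ :- v₀) :- rhs ε , + 2 :* v₈) ∷ (k , v₁ :- v₀ , v₄ :- v₃) ∷ (l , v₂ :- v₀ , v₅ :- v₃) ∷ []) (e ∷ same₂ ∷ same₃ ∷ []) u v
      case : ∀ ε → (a ⊟ p₁) ⊟ ev (bits ε) base ≡ + 2 ∙ y → Shape p₁ p₂ p₃ q₁ q₂ q₃ q₄ a
      case ε@(zero ∷ zero ∷ zero ∷ []) e = ⊥-elim (oddP S A P₁ (≢-sym n₁a) (y , by ε e (+ 0) (+ 0) (v₇ :- v₀) (+ 2 :* v₈) refl))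
      case ε@(suc zero ∷ zero ∷ zero ∷ []) e = ⊥-elim (oddP S A P₂ (≢-sym n₂a) (y , by ε e -1ℤ (+ 0) (v₇ :- v₁) (+ 2 :* v₈) refl))
      case ε@(zero ∷ suc zero ∷ zero ∷ []) e = ⊥-elim (oddP S A P₃ (≢-sym n₃a) (y , by ε e (+ 0) -1ℤ (v₇ :- v₂) (+ 2 :* v₈) refl))
      case ε@(zero ∷ zero ∷ suc zero ∷ []) e = ⊥-elim (un (y , by ε e (+ 0) (+ 0) ((v₇ :- v₀) :- (v₆ :- v₃)) (+ 2 :* v₈) refl))
      case ε@(suc zero ∷ suc zero ∷ zero ∷ []) e = coset (y , by ε e -1ℤ -1ℤ ((v₇ :- v₀) :- ((v₁ :- v₀) :+ (v₂ :- v₀))) (+ 2 :* v₈) refl)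
      case ε@(suc zero ∷ zero ∷ suc zero ∷ []) e = twist₁₂ (y ⊞ (q₂ ⊟ q₁) , by ε e (+ 0) (+ 0) ((v₇ :- v₀) :- (v₆ :- v₄)) (+ 2 :* (v₈ :+ (v₄ :- v₃))) refl)
      case ε@(zero ∷ suc zero ∷ suc zero ∷ []) e = twist₁₃ (y ⊞ (q₃ ⊟ q₁) , by ε e (+ 0) (+ 0) ((v₇ :- v₀) :- (v₆ :- v₅)) (+ 2 :* (v₈ :+ (v₅ :- v₃))) refl)
      case ε@(suc zero ∷ suc zero ∷ suc zero ∷ []) e = twist₂₃ (y ⊞ (q₃ ⊟ q₁) , by ε e -1ℤ (+ 0) ((v₇ :- v₁) :- (v₆ :- v₅)) (+ 2 :* (v₈ :+ (v₅ :- v₃))) refl)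

  -- If a' is twisted along another edge, the difference of the two centre relations makes a - a'
  -- divisible by five.
  twisted-absurd : ∀ {p₁ p₂ p₃ q₁ q₂ q₃ q₄ a a'} (st : Setup S p₁ p₂ p₃ q₁ q₂ q₃ q₄ a a') → ¬ Plane S q₁ q₂ q₃ q₄ → ¬ Even ((a ⊟ p₁) ⊟ (q₄ ⊟ q₂))
  twisted-absurd {p₁} {p₂} {p₃} {q₁} {q₂} {q₃} {q₄} {a} {a'} st odd tw = go (shape (swapA S st) odd) inP dP
    where
    open Setup st
    G : Vec Z3 9
    G = p₁ ∷ p₂ ∷ p₃ ∷ q₁ ∷ q₂ ∷ q₃ ∷ q₄ ∷ a ∷ a' ∷ []
    centre : Odd.Centre₃ S st
    centre = Odd.twisted-centre S st tw
    go : Shape p₁ p₂ p₃ q₁ q₂ q₃ q₄ a' → All P (p₁ ∷ p₂ ∷ p₃ ∷ a ∷ a' ∷ []) → AllPairs _≢_ (p₁ ∷ p₂ ∷ p₃ ∷ a ∷ a' ∷ []) → ⊥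
    go (coset m) _ _ = coset-absurd S st centre m
    go (twist₁₂ (y , e)) (_ ∷ _ ∷ _ ∷ A ∷ A' ∷ []) (_ ∷ _ ∷ _ ∷ (n ∷ []) ∷ _) = oddP S A A' n (proj₁ tw ⊟ y ,
      lin≡ (p₁ ∷ q₂ ∷ q₄ ∷ a ∷ a' ∷ proj₁ tw ∷ y ∷ []) ((+ 1 , (v₃ :- v₀) :- (v₂ :- v₁) , + 2 :* v₅) ∷ (-1ℤ , (v₄ :- v₀) :- (v₂ :- v₁) , + 2 :* v₆) ∷ [])
        (proj₂ tw ∷ e ∷ []) (v₃ :- v₄) (+ 2 :* (v₅ :- v₆)) refl)
    go (twist₁₃ m) (_ ∷ _ ∷ _ ∷ A ∷ A' ∷ []) (_ ∷ _ ∷ _ ∷ (n ∷ []) ∷ _) = n (LengthOne.indivisible oneP 5 (s≤s (s≤s z≤n)) A A' (p₃ ⊟ p₂ ,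
      lin≡ G ((+ 1 , (v₇ :- v₀) :+ (v₁ :- v₀) :+ (v₆ :- v₃) , + 4 :* (v₂ :- v₀)) ∷ (-1ℤ , (v₈ :- v₀) :+ (v₂ :- v₀) :+ (v₆ :- v₃) , + 4 :* (v₁ :- v₀)) ∷ [])
        (centre ∷ Odd.twisted-centre S (swap₂₃ S (swapA S st)) m ∷ []) (v₇ :- v₈) (+ 5 :* (v₂ :- v₁)) refl))
    go (twist₂₃ m) (_ ∷ _ ∷ _ ∷ A ∷ A' ∷ []) (_ ∷ _ ∷ _ ∷ (n ∷ []) ∷ _) = n (LengthOne.indivisible oneP 5 (s≤s (s≤s z≤n)) A A' (p₃ ⊟ p₁ ,
      lin≡ G ((+ 1 , (v₇ :- v₀) :+ (v₁ :- v₀) :+ (v₆ :- v₃) , + 4 :* (v₂ :- v₀)) ∷ (-1ℤ , (v₈ :- v₁) :+ (v₂ :- v₁) :+ (v₆ :- v₄) , + 4 :* (v₀ :- v₁))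
          ∷ (+ 1 , v₁ :- v₀ , v₄ :- v₃) ∷ [])
        (centre ∷ Odd.twisted-centre S (swap₂₃ S (swap₁₂ S (swapA S st))) m ∷ same₂ ∷ []) (v₇ :- v₈) (+ 5 :* (v₂ :- v₀)) refl))

  -- By symmetry neither point is twisted, and two points in the one class left are congruent modulo
  -- two.
  basis-absurd : ∀ {p₁ p₂ p₃ q₁ q₂ q₃ q₄ a a'} → Setup S p₁ p₂ p₃ q₁ q₂ q₃ q₄ a a' → ¬ ¬ Plane S q₁ q₂ q₃ q₄
  basis-absurd {p₁} {p₂} {p₃} {q₁} {q₂} {q₃} {q₄} {a} {a'} st odd = go (shape st odd) (shape (swapA S st) odd) (Setup.inP st) (Setup.dP st)
    where
    odd₂₃ : ¬ Plane S q₁ q₃ q₂ q₄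
    odd₂₃ m = odd (plane₂₃ S q₁ q₃ q₂ q₄ m)
    odd₁₂₃ : ¬ Plane S q₂ q₃ q₁ q₄
    odd₁₂₃ m = odd (plane₁₂ S q₂ q₁ q₃ q₄ (plane₂₃ S q₂ q₃ q₁ q₄ m))
    go : Shape p₁ p₂ p₃ q₁ q₂ q₃ q₄ a → Shape p₁ p₂ p₃ q₁ q₂ q₃ q₄ a' → All P (p₁ ∷ p₂ ∷ p₃ ∷ a ∷ a' ∷ []) → AllPairs _≢_ (p₁ ∷ p₂ ∷ p₃ ∷ a ∷ a' ∷ []) → ⊥
    go (twist₁₂ m) _ _ _ = twisted-absurd st odd m
    go (twist₁₃ m) _ _ _ = twisted-absurd (swap₂₃ S st) odd₂₃ m
    go (twist₂₃ m) _ _ _ = twisted-absurd (swap₂₃ S (swap₁₂ S st)) odd₁₂₃ m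
    go _ (twist₁₂ m) _ _ = twisted-absurd (swapA S st) odd m
    go _ (twist₁₃ m) _ _ = twisted-absurd (swap₂₃ S (swapA S st)) odd₂₃ m
    go _ (twist₂₃ m) _ _ = twisted-absurd (swap₂₃ S (swap₁₂ S (swapA S st))) odd₁₂₃ m
    go (coset (y , e)) (coset (z , f)) (_ ∷ _ ∷ _ ∷ A ∷ A' ∷ []) (_ ∷ _ ∷ _ ∷ (n ∷ []) ∷ _) = oddP S A A' n (y ⊟ z ,
      lin≡ (p₁ ∷ p₂ ∷ p₃ ∷ a ∷ a' ∷ y ∷ z ∷ []) ((+ 1 , (v₃ :- v₀) :- ((v₁ :- v₀) :+ (v₂ :- v₀)) , + 2 :* v₅) ∷ (-1ℤ , (v₄ :- v₀) :- ((v₁ :- v₀) :+ (v₂ :- v₀)) , + 2 :* v₆) ∷ [])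
        (e ∷ f ∷ []) (v₃ :- v₄) (+ 2 :* (v₅ :- v₆)) refl)

  setup-absurd : ∀ {p₁ p₂ p₃ q₁ q₂ q₃ q₄ a a'} → Setup S p₁ p₂ p₃ q₁ q₂ q₃ q₄ a a' → ⊥
  setup-absurd st = basis-absurd st (plane-absurd st)

  -- Up to translation Q is obtained from P by removing the point a.
  record Inside (p₁ p₂ p₃ p₄ a q₁ q₂ q₃ q₄ : Z3) : Set where
    field
      inP : All P (p₁ ∷ p₂ ∷ p₃ ∷ p₄ ∷ a ∷ [])
      inQ : All Q (q₁ ∷ q₂ ∷ q₃ ∷ q₄ ∷ [])
      dP  : AllPairs _≢_ (p₁ ∷ p₂ ∷ p₃ ∷ p₄ ∷ a ∷ [])
      dQ  : AllPairs _≢_ (q₁ ∷ q₂ ∷ q₃ ∷ q₄ ∷ [])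
      same₂ : Same p₁ p₂ q₁ q₂
      same₃ : Same p₁ p₃ q₁ q₃
      same₄ : Same p₁ p₄ q₁ q₄

  -- If a or a' matches q₄ modulo two, `extend` turns the match into a translation; otherwise the
  -- data form a `Setup`.
  inside : ∀ {p₁ p₂ p₃ q₁ q₂ q₃ q₄ a a'} → All P (p₁ ∷ p₂ ∷ p₃ ∷ a ∷ a' ∷ []) → All Q (q₁ ∷ q₂ ∷ q₃ ∷ q₄ ∷ []) →
    AllPairs _≢_ (p₁ ∷ p₂ ∷ p₃ ∷ a ∷ a' ∷ []) → AllPairs _≢_ (q₁ ∷ q₂ ∷ q₃ ∷ q₄ ∷ []) → Same p₁ p₂ q₁ q₂ → Same p₁ p₃ q₁ q₃ →
    Inside p₁ p₂ p₃ a a' q₁ q₂ q₃ q₄ ⊎ Inside p₁ p₂ p₃ a' a q₁ q₂ q₃ q₄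
  inside {p₁} {p₂} {p₃} {q₁} {q₂} {q₃} {q₄} {a} {a'} ps@(P₁ ∷ P₂ ∷ P₃ ∷ A ∷ A' ∷ []) qs@(Q₁ ∷ Q₂ ∷ Q₃ ∷ Q₄ ∷ []) dp@((n₁₂ ∷ n₁₃ ∷ n₁a ∷ n₁a' ∷ []) ∷ (n₂₃ ∷ n₂a ∷ n₂a' ∷ []) ∷ (n₃a ∷ n₃a' ∷ []) ∷ (n ∷ []) ∷ [] ∷ [])
    dq@((m₁₂ ∷ m₁₃ ∷ m₁₄ ∷ []) ∷ (m₂₃ ∷ m₂₄ ∷ []) ∷ (m₃₄ ∷ []) ∷ [] ∷ []) same₂ same₃ =
    go (multiple? 2 ((a ⊟ p₁) ⊟ (q₄ ⊟ q₁))) (multiple? 2 ((a' ⊟ p₁) ⊟ (q₄ ⊟ q₁)))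
    where
    matching : ∀ {a} → P a → Even ((a ⊟ p₁) ⊟ (q₄ ⊟ q₁)) → Same p₁ a q₁ q₄
    matching {a} A m = proj₂ (extend S P₁ P₂ A Q₁ Q₂ Q₄ m₁₂ (matched (o , lin≡ (p₁ ∷ p₂ ∷ q₁ ∷ q₂ ∷ []) ((+ 1 , v₁ :- v₀ , v₃ :- v₂) ∷ []) (same₂ ∷ [])
      ((v₁ :- v₀) :- (v₃ :- v₂)) (+ 2 :* :0) refl) m) same₂)
    go : Dec (Even ((a ⊟ p₁) ⊟ (q₄ ⊟ q₁))) → Dec (Even ((a' ⊟ p₁) ⊟ (q₄ ⊟ q₁))) → _
    go (yes m) _ = inj₁ record { inP = ps ; inQ = qs ; dP = dp ; dQ = dq ; same₂ = same₂ ; same₃ = same₃ ; same₄ = matching A m }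
    go _ (yes m) = inj₂ record { inP = P₁ ∷ P₂ ∷ P₃ ∷ A' ∷ A ∷ [] ; inQ = qs
      ; dP = (n₁₂ ∷ n₁₃ ∷ n₁a' ∷ n₁a ∷ []) ∷ (n₂₃ ∷ n₂a' ∷ n₂a ∷ []) ∷ (n₃a' ∷ n₃a ∷ []) ∷ (≢-sym n ∷ []) ∷ [] ∷ []
      ; dQ = dq ; same₂ = same₂ ; same₃ = same₃ ; same₄ = matching A' m }
    go (no un) (no un') = ⊥-elim (setup-absurd (record { inP = ps ; inQ = qs ; dP = dp ; dQ = dq ; same₂ = same₂ ; same₃ = same₃ ; un = un ; un' = un' }))

-- The position of the removed point

-- The relations of E, K₂ and K₁ when a is the vertex 0 of E, the vertex - e₁ - e₂ - e₃ of K₂, or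
-- any vertex of K₁. In the last two cases p₄ is the interior point.
data Kind (p₁ p₂ p₃ p₄ a : Z3) : Set where
  kindE  : p₁ ⊞ p₂ ⊞ p₃ ≡ p₄ ⊞ + 2 ∙ a → Kind p₁ p₂ p₃ p₄ a
  kindK₂ : + 2 ∙ a ⊞ (p₁ ⊞ p₂ ⊞ p₃) ≡ + 5 ∙ p₄ → Kind p₁ p₂ p₃ p₄ a
  kindK₁ : a ⊞ (p₁ ⊞ p₂ ⊞ p₃) ≡ + 4 ∙ p₄ → Kind p₁ p₂ p₃ p₄ a

module _ {P Q K : Z3 → Set} (S : System P Q K) where
  open System S

  record Classified : Set where
    field
      {p₁ p₂ p₃ p₄ a q₁ q₂ q₃ q₄} : Z3
      removed : Inside S p₁ p₂ p₃ p₄ a q₁ q₂ q₃ q₄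
      kind    : Kind p₁ p₂ p₃ p₄ a

  σ₁₂ : ∀ {p₁ p₂ p₃ p₄ a q₁ q₂ q₃ q₄} → Inside S p₁ p₂ p₃ p₄ a q₁ q₂ q₃ q₄ → Inside S p₂ p₁ p₃ p₄ a q₂ q₁ q₃ q₄
  σ₁₂ {p₁} {p₂} {p₃} {p₄} {a} {q₁} {q₂} {q₃} {q₄} I = record { inP = sw inP ; inQ = swq inQ ; dP = swd dP ; dQ = swdq dQ
    ; same₂ = lin≡ G ((-1ℤ , v₁ :- v₀ , v₅ :- v₄) ∷ []) (same₂ ∷ []) (v₀ :- v₁) (v₄ :- v₅) refl
    ; same₃ = lin≡ G ((-1ℤ , v₁ :- v₀ , v₅ :- v₄) ∷ (+ 1 , v₂ :- v₀ , v₆ :- v₄) ∷ []) (same₂ ∷ same₃ ∷ []) (v₂ :- v₁) (v₆ :- v₅) refl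
    ; same₄ = lin≡ G ((-1ℤ , v₁ :- v₀ , v₅ :- v₄) ∷ (+ 1 , v₃ :- v₀ , v₇ :- v₄) ∷ []) (same₂ ∷ same₄ ∷ []) (v₃ :- v₁) (v₇ :- v₅) refl }
    where
    open Inside I
    G : Vec Z3 8
    G = p₁ ∷ p₂ ∷ p₃ ∷ p₄ ∷ q₁ ∷ q₂ ∷ q₃ ∷ q₄ ∷ []
    sw : ∀ {x y z u v} → All P (x ∷ y ∷ z ∷ u ∷ v ∷ []) → All P (y ∷ x ∷ z ∷ u ∷ v ∷ [])
    sw (x ∷ y ∷ z) = y ∷ x ∷ z
    swq : ∀ {x y z u} → All Q (x ∷ y ∷ z ∷ u ∷ []) → All Q (y ∷ x ∷ z ∷ u ∷ [])
    swq (x ∷ y ∷ z) = y ∷ x ∷ z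
    swd : ∀ {x y z u v : Z3} → AllPairs _≢_ (x ∷ y ∷ z ∷ u ∷ v ∷ []) → AllPairs _≢_ (y ∷ x ∷ z ∷ u ∷ v ∷ [])
    swd ((a ∷ b) ∷ c ∷ d) = (≢-sym a ∷ c) ∷ b ∷ d
    swdq : ∀ {x y z u : Z3} → AllPairs _≢_ (x ∷ y ∷ z ∷ u ∷ []) → AllPairs _≢_ (y ∷ x ∷ z ∷ u ∷ [])
    swdq ((a ∷ b) ∷ c ∷ d) = (≢-sym a ∷ c) ∷ b ∷ d

  σ₂₃ : ∀ {p₁ p₂ p₃ p₄ a q₁ q₂ q₃ q₄} → Inside S p₁ p₂ p₃ p₄ a q₁ q₂ q₃ q₄ → Inside S p₁ p₃ p₂ p₄ a q₁ q₃ q₂ q₄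
  σ₂₃ I = record { inP = sw inP ; inQ = swq inQ ; dP = swd dP ; dQ = swdq dQ ; same₂ = same₃ ; same₃ = same₂ ; same₄ = same₄ }
    where
    open Inside I
    sw : ∀ {x y z u v} → All P (x ∷ y ∷ z ∷ u ∷ v ∷ []) → All P (x ∷ z ∷ y ∷ u ∷ v ∷ [])
    sw (x ∷ y ∷ z ∷ u) = x ∷ z ∷ y ∷ u
    swq : ∀ {x y z u} → All Q (x ∷ y ∷ z ∷ u ∷ []) → All Q (x ∷ z ∷ y ∷ u ∷ [])
    swq (x ∷ y ∷ z ∷ u) = x ∷ z ∷ y ∷ u
    swd : ∀ {x y z u v : Z3} → AllPairs _≢_ (x ∷ y ∷ z ∷ u ∷ v ∷ []) → AllPairs _≢_ (x ∷ z ∷ y ∷ u ∷ v ∷ [])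
    swd ((a ∷ b ∷ c) ∷ (d ∷ e) ∷ f ∷ g) = (b ∷ a ∷ c) ∷ (≢-sym d ∷ f) ∷ e ∷ g
    swdq : ∀ {x y z u : Z3} → AllPairs _≢_ (x ∷ y ∷ z ∷ u ∷ []) → AllPairs _≢_ (x ∷ z ∷ y ∷ u ∷ [])
    swdq ((a ∷ b ∷ c) ∷ (d ∷ e) ∷ f ∷ g) = (b ∷ a ∷ c) ∷ (≢-sym d ∷ f) ∷ e ∷ g

  σ₃₄ : ∀ {p₁ p₂ p₃ p₄ a q₁ q₂ q₃ q₄} → Inside S p₁ p₂ p₃ p₄ a q₁ q₂ q₃ q₄ → Inside S p₁ p₂ p₄ p₃ a q₁ q₂ q₄ q₃
  σ₃₄ I = record { inP = sw inP ; inQ = swq inQ ; dP = swd dP ; dQ = swdq dQ ; same₂ = same₂ ; same₃ = same₄ ; same₄ = same₃ }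
    where
    open Inside I
    sw : ∀ {x y z u v} → All P (x ∷ y ∷ z ∷ u ∷ v ∷ []) → All P (x ∷ y ∷ u ∷ z ∷ v ∷ [])
    sw (x ∷ y ∷ z ∷ u ∷ v) = x ∷ y ∷ u ∷ z ∷ v
    swq : ∀ {x y z u} → All Q (x ∷ y ∷ z ∷ u ∷ []) → All Q (x ∷ y ∷ u ∷ z ∷ [])
    swq (x ∷ y ∷ z ∷ u ∷ v) = x ∷ y ∷ u ∷ z ∷ v
    swd : ∀ {x y z u v : Z3} → AllPairs _≢_ (x ∷ y ∷ z ∷ u ∷ v ∷ []) → AllPairs _≢_ (x ∷ y ∷ u ∷ z ∷ v ∷ [])
    swd ((a ∷ b ∷ c ∷ d) ∷ (e ∷ f ∷ g) ∷ (h ∷ i) ∷ j ∷ k) = (a ∷ c ∷ b ∷ d) ∷ (f ∷ e ∷ g) ∷ (≢-sym h ∷ j) ∷ i ∷ k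
    swdq : ∀ {x y z u : Z3} → AllPairs _≢_ (x ∷ y ∷ z ∷ u ∷ []) → AllPairs _≢_ (x ∷ y ∷ u ∷ z ∷ [])
    swdq ((a ∷ b ∷ c ∷ d) ∷ (e ∷ f ∷ g) ∷ (h ∷ i) ∷ j ∷ k) = (a ∷ c ∷ b ∷ d) ∷ (f ∷ e ∷ g) ∷ (≢-sym h ∷ j) ∷ i ∷ k

  module _ {p₁ p₂ p₃ p₄ a q₁ q₂ q₃ q₄ : Z3} (I : Inside S p₁ p₂ p₃ p₄ a q₁ q₂ q₃ q₄) where
    open Inside I

    basis-kind : Even ((a ⊟ p₁) ⊟ ((p₂ ⊟ p₁) ⊞ (p₃ ⊟ p₁))) → a ⊞ (p₁ ⊞ p₂ ⊞ p₃) ≡ + 4 ∙ p₄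
    basis-kind (y , e) = finish (Resolve.resolve S p₁ q₁ g valid-E checkE₀)
      where
      g : Vec Z3 5
      g = p₂ ⊟ p₁ ∷ p₃ ⊟ p₁ ∷ p₄ ⊟ p₁ ∷ y ∷ o ∷ []
      H : Vec Z3 10
      H = p₁ ∷ p₂ ∷ p₃ ∷ p₄ ∷ a ∷ q₁ ∷ q₂ ∷ q₃ ∷ q₄ ∷ y ∷ []
      es : ℤ → ℤ → ℤ → ℤ → List (Eqn 10)
      es k l m n = (k , v₁ :- v₀ , v₆ :- v₅) ∷ (l , v₂ :- v₀ , v₇ :- v₅) ∷ (m , v₃ :- v₀ , v₈ :- v₅)
                 ∷ (n , (v₄ :- v₀) :- ((v₁ :- v₀) :+ (v₂ :- v₀)) , + 2 :* v₉) ∷ []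
      by : ∀ k l m n (u v : Expr 10) → nf u ⊖ᵥ nf v ≡ combine (es k l m n) → ⟦ u ⟧ H ≡ ⟦ v ⟧ H
      by k l m n u v = lin≡ H (es k l m n) (same₂ ∷ same₃ ∷ same₄ ∷ e ∷ []) u v
      valid-E : Resolve.Valid S p₁ q₁ g cfgE₀
      valid-E = valid S {cfgE₀}
        (locate :0 (by (+ 0) (+ 0) (+ 0) (+ 0) v₀ (v₀ :+ :0) refl)
          ∷ locate v₀ (by (+ 0) (+ 0) (+ 0) (+ 0) v₁ (v₀ :+ (v₁ :- v₀)) refl)
          ∷ locate v₁ (by (+ 0) (+ 0) (+ 0) (+ 0) v₂ (v₀ :+ (v₂ :- v₀)) refl)
          ∷ locate v₂ (by (+ 0) (+ 0) (+ 0) (+ 0) v₃ (v₀ :+ (v₃ :- v₀)) refl)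
          ∷ locate (v₀ :+ v₁ :+ + 2 :* v₃) (by (+ 0) (+ 0) (+ 0) (+ 1) v₄ (v₀ :+ ((v₁ :- v₀) :+ (v₂ :- v₀) :+ + 2 :* v₉)) refl) ∷ [])
        (locate :0 (by (+ 0) (+ 0) (+ 0) (+ 0) v₅ (v₅ :+ :0) refl)
          ∷ locate v₀ (by -1ℤ (+ 0) (+ 0) (+ 0) v₆ (v₅ :+ (v₁ :- v₀)) refl)
          ∷ locate v₁ (by (+ 0) -1ℤ (+ 0) (+ 0) v₇ (v₅ :+ (v₂ :- v₀)) refl)
          ∷ locate v₂ (by (+ 0) (+ 0) -1ℤ (+ 0) v₈ (v₅ :+ (v₃ :- v₀)) refl) ∷ [])
        inP inQ dP dQ []
      use : ∀ k .{{_ : ℤ.NonZero k}} → ⟦ k :* (v₀ :+ v₁ :+ -[1+ 1 ] :* v₂ :+ v₃) ⟧ g ≡ o → a ⊞ (p₁ ⊞ p₂ ⊞ p₃) ≡ + 4 ∙ p₄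
      use k z = lin≡ H ((+ 1 , (v₄ :- v₀) :- ((v₁ :- v₀) :+ (v₂ :- v₀)) , + 2 :* v₉) ∷ (+ 2 , (v₁ :- v₀) :+ (v₂ :- v₀) :+ -[1+ 1 ] :* (v₃ :- v₀) :+ v₉ , :0) ∷ [])
        (e ∷ ∙-cancel k (trans z (sym (∙-o k))) ∷ []) (v₄ :+ (v₀ :+ v₁ :+ v₂)) (+ 4 :* v₃) refl
      finish : Any (λ r → ev r g ≡ o) (Config.res cfgE₀) ⊎ Any (λ l → Multiple 3 (ev l g)) [] → a ⊞ (p₁ ⊞ p₂ ⊞ p₃) ≡ + 4 ∙ p₄
      finish (inj₁ (here z)) = use (+ 1) (trans (nf-sound (+ 1 :* (v₀ :+ v₁ :+ -[1+ 1 ] :* v₂ :+ v₃)) g) z)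
      finish (inj₁ (there (here z))) = use -1ℤ (trans (nf-sound (-1ℤ :* (v₀ :+ v₁ :+ -[1+ 1 ] :* v₂ :+ v₃)) g) z)

  other : ∀ {p₁ p₂ p₃ p₄ a q₁ q₂ q₃ q₄} (I : Inside S p₁ p₂ p₃ p₄ a q₁ q₂ q₃ q₄) → Even ((a ⊟ p₁) ⊟ ((p₂ ⊟ p₁) ⊞ (p₃ ⊟ p₁))) → Classified
  other I e = record { removed = I ; kind = kindK₁ (basis-kind I e) }

  module _ {p₁ p₂ p₃ p₄ a q₁ q₂ q₃ q₄ : Z3} (I : Inside S p₁ p₂ p₃ p₄ a q₁ q₂ q₃ q₄) where
    open Inside I

    σ₁₃₄₂ : Inside S p₁ p₃ p₄ p₂ a q₁ q₃ q₄ q₂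
    σ₁₃₄₂ = σ₃₄ (σ₂₃ I)
    σ₂₃₄₁ : Inside S p₂ p₃ p₄ p₁ a q₂ q₃ q₄ q₁
    σ₂₃₄₁ = σ₃₄ (σ₂₃ (σ₁₂ I))

    G : Vec Z3 5
    G = p₁ ∷ p₂ ∷ p₃ ∷ p₄ ∷ a ∷ []

    -- The exact positions are the relation of E with p₁, ..., p₄ permuted. The surviving miss makes
    -- a weighted mean of the five points integral, and convexity puts it into P.
    plane-kind : Plane S q₁ q₂ q₃ q₄ → (∀ {z} → P z → z ∈ p₁ ∷ p₂ ∷ p₃ ∷ p₄ ∷ a ∷ []) → (∀ {z} → Q z → z ∈ q₁ ∷ q₂ ∷ q₃ ∷ q₄ ∷ []) → Classified
    plane-kind (x , ex) onlyP onlyQ = finish (Resolve.resolve S p₁ q₁ g valid-F checkF)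
      where
      g : Vec Z3 5
      g = p₂ ⊟ p₁ ∷ p₃ ⊟ p₁ ∷ x ∷ a ⊟ p₁ ∷ o ∷ []
      H : Z3 → Vec Z3 11
      H y = p₁ ∷ p₂ ∷ p₃ ∷ p₄ ∷ a ∷ q₁ ∷ q₂ ∷ q₃ ∷ q₄ ∷ x ∷ y ∷ []
      es : ℤ → ℤ → ℤ → ℤ → List (Eqn 11)
      es k l m n = (k , v₁ :- v₀ , v₆ :- v₅) ∷ (l , v₂ :- v₀ , v₇ :- v₅) ∷ (m , v₃ :- v₀ , v₈ :- v₅) ∷ (n , (v₅ :+ v₈) :- (v₆ :+ v₇) , + 2 :* v₉) ∷ []
      by : ∀ k l m n (u v : Expr 11) → nf u ⊖ᵥ nf v ≡ combine (es k l m n) → ⟦ u ⟧ (H o) ≡ ⟦ v ⟧ (H o)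
      by k l m n u v = lin≡ (H o) (es k l m n) (same₂ ∷ same₃ ∷ same₄ ∷ ex ∷ []) u v
      by+ : ∀ y k l m n (j : ℤ) (s t u v : Expr 11) → ⟦ s ⟧ (H y) ≡ ⟦ t ⟧ (H y) → nf u ⊖ᵥ nf v ≡ combine ((j , s , t) ∷ es k l m n) → ⟦ u ⟧ (H y) ≡ ⟦ v ⟧ (H y)
      by+ y k l m n j s t u v eq = lin≡ (H y) ((j , s , t) ∷ es k l m n) (eq ∷ same₂ ∷ same₃ ∷ same₄ ∷ ex ∷ []) u v
      :b : Expr 11
      :b = (v₁ :- v₀) :+ (v₂ :- v₀) :+ + 2 :* v₉
      valid-F : Resolve.Valid S p₁ q₁ g cfgF
      valid-F = valid S {cfgF}
        (locate :0 (by (+ 0) (+ 0) (+ 0) (+ 0) v₀ (v₀ :+ :0) refl)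
          ∷ locate v₀ (by (+ 0) (+ 0) (+ 0) (+ 0) v₁ (v₀ :+ (v₁ :- v₀)) refl)
          ∷ locate v₁ (by (+ 0) (+ 0) (+ 0) (+ 0) v₂ (v₀ :+ (v₂ :- v₀)) refl)
          ∷ locate (v₀ :+ v₁ :+ + 2 :* v₂) (by -1ℤ -1ℤ (+ 1) (+ 1) v₃ (v₀ :+ :b) refl)
          ∷ locate v₃ (by (+ 0) (+ 0) (+ 0) (+ 0) v₄ (v₀ :+ (v₄ :- v₀)) refl) ∷ [])
        (locate :0 (by (+ 0) (+ 0) (+ 0) (+ 0) v₅ (v₅ :+ :0) refl)
          ∷ locate v₀ (by -1ℤ (+ 0) (+ 0) (+ 0) v₆ (v₅ :+ (v₁ :- v₀)) refl)
          ∷ locate v₁ (by (+ 0) -1ℤ (+ 0) (+ 0) v₇ (v₅ :+ (v₂ :- v₀)) refl)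
          ∷ locate (v₀ :+ v₁ :+ + 2 :* v₂) (by -1ℤ -1ℤ (+ 0) (+ 1) v₈ (v₅ :+ :b) refl) ∷ [])
        inP inQ dP dQ []
      zeroed : ∀ k .{{_ : ℤ.NonZero k}} (e : Expr 5) → ev (nf (k :* e)) g ≡ o → ⟦ e ⟧ g ≡ o
      zeroed k e z = ∙-cancel k (trans (trans (nf-sound (k :* e) g) z) (sym (∙-o k)))
      E₀ E₁ E₂ E₃ : Expr 5
      E₀ = v₂ :+ v₃
      E₁ = v₁ :+ v₂ :+ -1ℤ :* v₃
      E₂ = v₀ :+ v₂ :+ -1ℤ :* v₃
      E₃ = v₀ :+ v₁ :+ v₂ :+ -1ℤ :* v₃
      at₀ : ⟦ E₀ ⟧ g ≡ o → Classified
      at₀ z = record { removed = I ; kind = kindE (by+ o (+ 1) (+ 1) -1ℤ -1ℤ -[1+ 1 ] (v₉ :+ (v₄ :- v₀)) :0 (v₀ :+ v₁ :+ v₂) (v₃ :+ + 2 :* v₄) z refl) }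
      at₁ : ⟦ E₁ ⟧ g ≡ o → Classified
      at₁ z = record { removed = σ₁₃₄₂ ; kind = kindE (by+ o -1ℤ -1ℤ (+ 1) (+ 1) (+ 2) ((v₂ :- v₀) :+ v₉ :+ -1ℤ :* (v₄ :- v₀)) :0 (v₀ :+ v₂ :+ v₃) (v₁ :+ + 2 :* v₄) z refl) }
      at₂ : ⟦ E₂ ⟧ g ≡ o → Classified
      at₂ z = record { removed = σ₃₄ I ; kind = kindE (by+ o -1ℤ -1ℤ (+ 1) (+ 1) (+ 2) ((v₁ :- v₀) :+ v₉ :+ -1ℤ :* (v₄ :- v₀)) :0 (v₀ :+ v₁ :+ v₃) (v₂ :+ + 2 :* v₄) z refl) }
      at₃ : ⟦ E₃ ⟧ g ≡ o → Classified
      at₃ z = record { removed = σ₂₃₄₁ ; kind = kindE (by+ o -1ℤ -1ℤ (+ 1) (+ 1) (+ 2) ((v₁ :- v₀) :+ (v₂ :- v₀) :+ v₉ :+ -1ℤ :* (v₄ :- v₀)) :0 (v₁ :+ v₂ :+ v₃) (v₀ :+ + 2 :* v₄) z refl) }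
      -- The point (2a + p₁ + p₂ + p₃ + p₄) / 6 of P.
      sixth : ∀ y → + 2 ∙ a ⊞ (p₁ ⊞ p₂ ⊞ p₃ ⊞ p₄) ≡ + 6 ∙ y → Classified
      sixth y e = go (onlyP (member inP))
        where
        member : All P (p₁ ∷ p₂ ∷ p₃ ∷ p₄ ∷ a ∷ []) → P y
        member (P₁ ∷ P₂ ∷ P₃ ∷ P₄ ∷ A ∷ []) = LengthOne.convex oneP ((2 , a) ∷ (1 , p₁) ∷ (1 , p₂) ∷ (1 , p₃) ∷ (1 , p₄) ∷ []) y (A ∷ P₁ ∷ P₂ ∷ P₃ ∷ P₄ ∷ []) (s≤s z≤n)
          (lin≡ (H y) ((-1ℤ , + 2 :* v₄ :+ (v₀ :+ v₁ :+ v₂ :+ v₃) , + 6 :* v₁₀) ∷ []) (e ∷ []) (+ 6 :* v₁₀)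
            (+ 2 :* v₄ :+ (+ 1 :* v₀ :+ (+ 1 :* v₁ :+ (+ 1 :* v₂ :+ (+ 1 :* v₃ :+ :0))))) refl)
        at : ∀ {z} → y ≡ z → + 2 ∙ a ⊞ (p₁ ⊞ p₂ ⊞ p₃ ⊞ p₄) ≡ + 6 ∙ z
        at refl = e
        -- In this case a is the centroid of p₁, ..., p₄, and its translate would be a fifth point
        -- of Q.
        centroid-absurd : y ≡ a → ⊥
        centroid-absurd q = outside (onlyQ (member-q inQ)) dP
          where
          z : Z3
          z = q₁ ⊞ (a ⊟ p₁)
          member-q : All Q (q₁ ∷ q₂ ∷ q₃ ∷ q₄ ∷ []) → Q z
          member-q (Q₁ ∷ Q₂ ∷ Q₃ ∷ Q₄ ∷ []) = LengthOne.convex oneQ ((1 , q₁) ∷ (1 , q₂) ∷ (1 , q₃) ∷ (1 , q₄) ∷ []) z (Q₁ ∷ Q₂ ∷ Q₃ ∷ Q₄ ∷ []) (s≤s z≤n)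
            (by+ o (+ 1) (+ 1) (+ 1) (+ 0) -1ℤ (+ 2 :* v₄ :+ (v₀ :+ v₁ :+ v₂ :+ v₃)) (+ 6 :* v₄) (+ 4 :* (v₅ :+ (v₄ :- v₀)))
              (+ 1 :* v₅ :+ (+ 1 :* v₆ :+ (+ 1 :* v₇ :+ (+ 1 :* v₈ :+ :0)))) (at q) refl)
          outside : z ∈ q₁ ∷ q₂ ∷ q₃ ∷ q₄ ∷ [] → AllPairs _≢_ (p₁ ∷ p₂ ∷ p₃ ∷ p₄ ∷ a ∷ []) → ⊥
          outside (here e') ((_ ∷ _ ∷ _ ∷ n ∷ []) ∷ _) = n (by+ o (+ 0) (+ 0) (+ 0) (+ 0) -1ℤ (v₅ :+ (v₄ :- v₀)) v₅ v₀ v₄ e' refl)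
          outside (there (here e')) (_ ∷ (_ ∷ _ ∷ n ∷ []) ∷ _) = n (by+ o (+ 1) (+ 0) (+ 0) (+ 0) -1ℤ (v₅ :+ (v₄ :- v₀)) v₆ v₁ v₄ e' refl)
          outside (there (there (here e'))) (_ ∷ _ ∷ (_ ∷ n ∷ []) ∷ _) = n (by+ o (+ 0) (+ 1) (+ 0) (+ 0) -1ℤ (v₅ :+ (v₄ :- v₀)) v₇ v₂ v₄ e' refl)
          outside (there (there (there (here e')))) (_ ∷ _ ∷ _ ∷ (n ∷ []) ∷ _) = n (by+ o (+ 0) (+ 0) (+ 1) (+ 0) -1ℤ (v₅ :+ (v₄ :- v₀)) v₈ v₃ v₄ e' refl)
        go : y ∈ p₁ ∷ p₂ ∷ p₃ ∷ p₄ ∷ a ∷ [] → Classified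
        go (here q) = record { removed = σ₂₃₄₁ ; kind = kindK₂ (lin≡ G ((+ 1 , + 2 :* v₄ :+ (v₀ :+ v₁ :+ v₂ :+ v₃) , + 6 :* v₀) ∷ []) (at q ∷ []) (+ 2 :* v₄ :+ (v₁ :+ v₂ :+ v₃)) (+ 5 :* v₀) refl) }
        go (there (here q)) = record { removed = σ₁₃₄₂ ; kind = kindK₂ (lin≡ G ((+ 1 , + 2 :* v₄ :+ (v₀ :+ v₁ :+ v₂ :+ v₃) , + 6 :* v₁) ∷ []) (at q ∷ []) (+ 2 :* v₄ :+ (v₀ :+ v₂ :+ v₃)) (+ 5 :* v₁) refl) }
        go (there (there (here q))) = record { removed = σ₃₄ I ; kind = kindK₂ (lin≡ G ((+ 1 , + 2 :* v₄ :+ (v₀ :+ v₁ :+ v₂ :+ v₃) , + 6 :* v₂) ∷ []) (at q ∷ []) (+ 2 :* v₄ :+ (v₀ :+ v₁ :+ v₃)) (+ 5 :* v₂) refl) }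
        go (there (there (there (here q)))) = record { removed = I ; kind = kindK₂ (lin≡ G ((+ 1 , + 2 :* v₄ :+ (v₀ :+ v₁ :+ v₂ :+ v₃) , + 6 :* v₃) ∷ []) (at q ∷ []) (+ 2 :* v₄ :+ (v₀ :+ v₁ :+ v₂)) (+ 5 :* v₃) refl) }
        go (there (there (there (there (here q))))) = ⊥-elim (centroid-absurd q)
      finish : Any (λ r → ev r g ≡ o) (Config.res cfgF) ⊎ Any (λ l → Multiple 3 (ev l g)) (Config.miss cfgF) → Classified
      finish (inj₁ (here z)) = at₀ (zeroed (+ 1) E₀ z)
      finish (inj₁ (there (here z))) = at₀ (zeroed -1ℤ E₀ z)
      finish (inj₁ (there (there (here z)))) = at₁ (zeroed (+ 1) E₁ z)
      finish (inj₁ (there (there (there (here z))))) = at₁ (zeroed -1ℤ E₁ z)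
      finish (inj₁ (there (there (there (there (here z)))))) = at₂ (zeroed (+ 1) E₂ z)
      finish (inj₁ (there (there (there (there (there (here z))))))) = at₂ (zeroed -1ℤ E₂ z)
      finish (inj₁ (there (there (there (there (there (there (here z)))))))) = at₃ (zeroed (+ 1) E₃ z)
      finish (inj₁ (there (there (there (there (there (there (there (here z))))))))) = at₃ (zeroed -1ℤ E₃ z)
      finish (inj₂ (here (y , z))) = sixth (p₁ ⊞ y)
        (by+ y -1ℤ -1ℤ (+ 1) (+ 1) (+ 2) ((v₁ :- v₀) :+ (v₂ :- v₀) :+ v₉ :+ (v₄ :- v₀)) (+ 3 :* v₁₀) (+ 2 :* v₄ :+ (v₀ :+ v₁ :+ v₂ :+ v₃)) (+ 6 :* (v₀ :+ v₁₀))
          (trans (nf-sound (v₀ :+ v₁ :+ v₂ :+ v₃) g) z) refl)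
      finish (inj₂ (there (here (y , z)))) = sixth (p₁ ⊞ (p₂ ⊟ p₁) ⊞ (p₃ ⊟ p₁) ⊞ x ⊞ (a ⊟ p₁) ⊟ y)
        (by+ y -1ℤ -1ℤ (+ 1) (+ 1) -[1+ 1 ] (+ 2 :* ((v₁ :- v₀) :+ (v₂ :- v₀) :+ v₉ :+ (v₄ :- v₀))) (+ 3 :* v₁₀) (+ 2 :* v₄ :+ (v₀ :+ v₁ :+ v₂ :+ v₃))
          (+ 6 :* (v₀ :+ (v₁ :- v₀) :+ (v₂ :- v₀) :+ v₉ :+ (v₄ :- v₀) :- v₁₀))
          (trans (nf-sound (+ 2 :* (v₀ :+ v₁ :+ v₂ :+ v₃)) g) z) refl)

    -- When Q is independent modulo two, a avoids the classes of p₁, ..., p₄. It is then congruent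
    -- to the sum of three of them, and relabelling leads to `basis-kind`.
    classified : (∀ {z} → P z → z ∈ p₁ ∷ p₂ ∷ p₃ ∷ p₄ ∷ a ∷ []) → (∀ {z} → Q z → z ∈ q₁ ∷ q₂ ∷ q₃ ∷ q₄ ∷ []) → Classified
    classified onlyP onlyQ = go (multiple? 2 ((q₁ ⊞ q₄) ⊟ (q₂ ⊞ q₃)))
      where
      go : Dec (Plane S q₁ q₂ q₃ q₄) → Classified
      go (yes pl) = plane-kind pl onlyP onlyQ
      go (no odd) = split inP dP (Basis.classify S inQ dQ odd (a ⊟ p₁))
        where
        base : Vec Z3 3
        base = q₂ ⊟ q₁ ∷ q₃ ⊟ q₁ ∷ q₄ ⊟ q₁ ∷ []
        split : All P (p₁ ∷ p₂ ∷ p₃ ∷ p₄ ∷ a ∷ []) → AllPairs _≢_ (p₁ ∷ p₂ ∷ p₃ ∷ p₄ ∷ a ∷ []) → ∃[ ε ] Even ((a ⊟ p₁) ⊟ ev (bits ε) base) → Classified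
        split (P₁ ∷ P₂ ∷ P₃ ∷ P₄ ∷ A ∷ []) ((_ ∷ _ ∷ _ ∷ n₁ ∷ []) ∷ (_ ∷ _ ∷ n₂ ∷ []) ∷ (_ ∷ n₃ ∷ []) ∷ (n₄ ∷ []) ∷ [] ∷ []) (ε , y , e) = case ε e
          where
          H : Vec Z3 10
          H = p₁ ∷ p₂ ∷ p₃ ∷ p₄ ∷ a ∷ q₁ ∷ q₂ ∷ q₃ ∷ q₄ ∷ y ∷ []
          rhs : Class → Expr 10
          rhs (i ∷ j ∷ k ∷ []) = + toℕ i :* (v₆ :- v₅) :+ (+ toℕ j :* (v₇ :- v₅) :+ (+ toℕ k :* (v₈ :- v₅) :+ :0))
          es : Class → ℤ → ℤ → ℤ → List (Eqn 10)
          es ε k l m = (+ 1 , (v₄ :- v₀) :- rhs ε , + 2 :* v₉) ∷ (k , v₁ :- v₀ , v₆ :- v₅) ∷ (l , v₂ :- v₀ , v₇ :- v₅) ∷ (m , v₃ :- v₀ , v₈ :- v₅) ∷ []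
          by : ∀ (ε : Class) → (a ⊟ p₁) ⊟ ⟦ rhs ε ⟧ H ≡ + 2 ∙ y → ∀ k l m (u v : Expr 10) → nf u ⊖ᵥ nf v ≡ combine (es ε k l m) → ⟦ u ⟧ H ≡ ⟦ v ⟧ H
          by ε e k l m u v = lin≡ H (es ε k l m) (e ∷ same₂ ∷ same₃ ∷ same₄ ∷ []) u v
          case : ∀ ε → (a ⊟ p₁) ⊟ ev (bits ε) base ≡ + 2 ∙ y → Classified
          case ε@(zero ∷ zero ∷ zero ∷ []) e = ⊥-elim (oddP S A P₁ (≢-sym n₁) (y , by ε e (+ 0) (+ 0) (+ 0) (v₄ :- v₀) (+ 2 :* v₉) refl))
          case ε@(suc zero ∷ zero ∷ zero ∷ []) e = ⊥-elim (oddP S A P₂ (≢-sym n₂) (y , by ε e -1ℤ (+ 0) (+ 0) (v₄ :- v₁) (+ 2 :* v₉) refl))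
          case ε@(zero ∷ suc zero ∷ zero ∷ []) e = ⊥-elim (oddP S A P₃ (≢-sym n₃) (y , by ε e (+ 0) -1ℤ (+ 0) (v₄ :- v₂) (+ 2 :* v₉) refl))
          case ε@(zero ∷ zero ∷ suc zero ∷ []) e = ⊥-elim (oddP S A P₄ (≢-sym n₄) (y , by ε e (+ 0) (+ 0) -1ℤ (v₄ :- v₃) (+ 2 :* v₉) refl))
          case ε@(suc zero ∷ suc zero ∷ zero ∷ []) e = other I (y , by ε e -1ℤ -1ℤ (+ 0) ((v₄ :- v₀) :- ((v₁ :- v₀) :+ (v₂ :- v₀))) (+ 2 :* v₉) refl)
          case ε@(suc zero ∷ zero ∷ suc zero ∷ []) e = other (σ₃₄ I) (y , by ε e -1ℤ (+ 0) -1ℤ ((v₄ :- v₀) :- ((v₁ :- v₀) :+ (v₃ :- v₀))) (+ 2 :* v₉) refl)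
          case ε@(zero ∷ suc zero ∷ suc zero ∷ []) e = other σ₁₃₄₂ (y , by ε e (+ 0) -1ℤ -1ℤ ((v₄ :- v₀) :- ((v₂ :- v₀) :+ (v₃ :- v₀))) (+ 2 :* v₉) refl)
          case ε@(suc zero ∷ suc zero ∷ suc zero ∷ []) e = other σ₂₃₄₁ (y ⊞ (p₂ ⊟ p₁) , by ε e -1ℤ -1ℤ -1ℤ ((v₄ :- v₁) :- ((v₂ :- v₁) :+ (v₃ :- v₁))) (+ 2 :* (v₉ :+ (v₁ :- v₀))) refl)

-- The lattice generated by P

dot : ∀ {n} → V n → V n → ℤ
dot [] [] = 0ℤ
dot (a ∷ f) (x ∷ ρ) = a ℤ.* x ℤ.+ dot f ρ

dot-⊕ : ∀ {n} (f h ρ : V n) → dot (f ⊕ᵥ h) ρ ≡ dot f ρ ℤ.+ dot h ρ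
dot-⊕ [] [] [] = refl
dot-⊕ (a ∷ f) (b ∷ h) (x ∷ ρ) = trans (cong (λ t → (a ℤ.+ b) ℤ.* x ℤ.+ t) (dot-⊕ f h ρ)) (go a b x (dot f ρ) (dot h ρ))
  where go : ∀ (a b x u v : ℤ) → (a ℤ.+ b) ℤ.* x ℤ.+ (u ℤ.+ v) ≡ (a ℤ.* x ℤ.+ u) ℤ.+ (b ℤ.* x ℤ.+ v)
        go = solve-∀

dot-⊛ : ∀ {n} k (f ρ : V n) → dot (k ⊛ f) ρ ≡ k ℤ.* dot f ρ
dot-⊛ k [] [] = sym (ℤP.*-zeroʳ k)
dot-⊛ k (a ∷ f) (x ∷ ρ) = trans (cong (λ t → k ℤ.* a ℤ.* x ℤ.+ t) (dot-⊛ k f ρ)) (go k a x (dot f ρ))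
  where go : ∀ (k a x u : ℤ) → k ℤ.* a ℤ.* x ℤ.+ k ℤ.* u ≡ k ℤ.* (a ℤ.* x ℤ.+ u)
        go = solve-∀

dot-0 : ∀ {n} (ρ : V n) → dot (Vec.replicate n 0ℤ) ρ ≡ 0ℤ
dot-0 [] = refl
dot-0 (x ∷ ρ) = trans (ℤP.+-identityˡ _) (dot-0 ρ)

∙-⊞ : ∀ k x y → k ∙ (x ⊞ y) ≡ k ∙ x ⊞ k ∙ y
∙-⊞ k (a , b , c) (a' , b' , c') = z3≡ (ℤP.*-distribˡ-+ k a a') (ℤP.*-distribˡ-+ k b b') (ℤP.*-distribˡ-+ k c c')

∙-assoc : ∀ k l x → (k ℤ.* l) ∙ x ≡ k ∙ (l ∙ x)
∙-assoc k l (a , b , c) = z3≡ (ℤP.*-assoc k l a) (ℤP.*-assoc k l b) (ℤP.*-assoc k l c)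

+-∙ : ∀ k l x → (k ℤ.+ l) ∙ x ≡ k ∙ x ⊞ l ∙ x
+-∙ k l (a , b , c) = z3≡ (ℤP.*-distribʳ-+ a k l) (ℤP.*-distribʳ-+ b k l) (ℤP.*-distribʳ-+ c k l)

0-∙ : ∀ x → 0ℤ ∙ x ≡ o
0-∙ (a , b , c) = refl

-- A linear form in the numerators r₁, r₂, r₃ and the denominator k of a rational vector.
Form : Set
Form = V 4

denominator : Form
denominator = + 0 ∷ + 0 ∷ + 0 ∷ + 1 ∷ []

Nonneg : V 4 → Form → Set
Nonneg ρ f = ∃[ n ] + n ≡ dot f ρ

nonneg-total : ∀ ρ f → Nonneg ρ f ⊎ Nonneg ρ (-1ℤ ⊛ f)
nonneg-total ρ f = go (dot f ρ) refl
  where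
  go : ∀ z → dot f ρ ≡ z → Nonneg ρ f ⊎ Nonneg ρ (-1ℤ ⊛ f)
  go (+ n) e = inj₁ (n , sym e)
  go -[1+ n ] e = inj₂ (suc n , sym (trans (dot-⊛ -1ℤ f ρ) (trans (cong (-1ℤ ℤ.*_) e) (ℤP.-1*i≡-i -[1+ n ]))))

-- A lattice point with its weight, a nonnegative combination of given linear forms.
Entry : Set
Entry = List ℕ × V 3

formOf : List ℕ → List Form → Form
formOf (n ∷ ns) (f ∷ fs) = + n ⊛ f ⊕ᵥ formOf ns fs
formOf _ _ = Vec.replicate 4 0ℤ

totalForm : List Form → List Entry → Form
totalForm fs [] = Vec.replicate 4 0ℤ
totalForm fs ((ns , _) ∷ es) = formOf ns fs ⊕ᵥ totalForm fs es

coordForms : List Form → List Entry → Vec Form 3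
coordForms fs [] = Vec.replicate 3 (Vec.replicate 4 0ℤ)
coordForms fs ((ns , p) ∷ es) = Vec.zipWith (λ c acc → c ⊛ formOf ns fs ⊕ᵥ acc) p (coordForms fs es)

-- The entries represent σ w + t with common denominator S k, where k w has the coordinates τ.
record Certificate (fs : List Form) (pts : List (V 3)) (τ : Vec Form 3) (σ : ℤ) (t : V 3) (S : ℕ) (es : List Entry) : Set where
  constructor certificate
  field
    points   : All (λ e → proj₂ e ∈ pts) es
    positive : 0 ℕ.< S
    totals   : totalForm fs es ≡ + S ⊛ denominator
    coords   : coordForms fs es ≡ Vec.zipWith (λ f c → + S ⊛ (σ ⊛ f ⊕ᵥ c ⊛ denominator)) τ t

certificate? : ∀ fs pts τ σ t S es → Dec (All (λ e → proj₂ e ∈ pts) es × 0 ℕ.< S × totalForm fs es ≡ + S ⊛ denominator ×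
  coordForms fs es ≡ Vec.zipWith (λ f c → + S ⊛ (σ ⊛ f ⊕ᵥ c ⊛ denominator)) τ t)
certificate? fs pts τ σ t S es = all? (λ e → any? (proj₂ e ≟ᵥ_) pts) es ×-dec ((0 ℕ.<? S) ×-dec ((_ ≟ᵥ _) ×-dec VecP.≡-dec _≟ᵥ_ _ _))

module Rational (D : Vec Z3 3) (w : Z3) (ρ : V 4) (k : ℕ) (0<k : 0 ℕ.< k) (τ : Vec Form 3) (denominator≡ : dot denominator ρ ≡ + k)
  (position : + k ∙ w ≡ ev (Vec.map (λ f → dot f ρ) τ) D) where

  natOf : ∀ ns {fs} → All (Nonneg ρ) fs → ∃[ m ] + m ≡ dot (formOf ns fs) ρ
  natOf [] _ = 0 , sym (dot-0 ρ)
  natOf (n ∷ ns) [] = 0 , sym (dot-0 ρ)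
  natOf (n ∷ ns) {f ∷ fs} ((l , e) ∷ ls) with natOf ns ls
  ... | m , e' = n ℕ.* l ℕ.+ m , trans (cong (ℤ._+ + m) (ℤP.pos-* n l)) (trans (cong₂ ℤ._+_ (trans (cong (+ n ℤ.*_) e) (sym (dot-⊛ (+ n) f ρ))) e')
      (sym (dot-⊕ (+ n ⊛ f) (formOf ns fs) ρ)))

  values : Vec Form 3 → V 3
  values = Vec.map (λ f → dot f ρ)

  weights : Z3 → ∀ {fs} → All (Nonneg ρ) fs → List Entry → List (ℕ × Z3)
  weights b nn = List.map (λ e → proj₁ (natOf (proj₁ e) nn) , b ⊞ ev (proj₂ e) D)

  weights-total : ∀ b {fs} (nn : All (Nonneg ρ) fs) es → + total (weights b nn es) ≡ dot (totalForm fs es) ρ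
  weights-total b nn [] = sym (dot-0 ρ)
  weights-total b {fs} nn ((ns , p) ∷ es) = trans (cong₂ ℤ._+_ (proj₂ (natOf ns nn)) (weights-total b nn es)) (sym (dot-⊕ (formOf ns fs) (totalForm fs es) ρ))

  values-step : ∀ {n} (L : Form) (p : V n) (acc : Vec Form n) →
                Vec.map (λ f → dot f ρ) (Vec.zipWith (λ c acc → c ⊛ L ⊕ᵥ acc) p acc) ≡ dot L ρ ⊛ p ⊕ᵥ Vec.map (λ f → dot f ρ) acc
  values-step L [] [] = refl
  values-step L (c ∷ p) (f ∷ acc) = cong₂ _∷_ (trans (dot-⊕ (c ⊛ L) f ρ) (cong (ℤ._+ dot f ρ) (trans (dot-⊛ c L ρ) (ℤP.*-comm c (dot L ρ))))) (values-step L p acc)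

  values-0 : values (Vec.replicate 3 (Vec.replicate 4 0ℤ)) ≡ Vec.replicate 3 0ℤ
  values-0 = cong₂ _∷_ (dot-0 ρ) (cong₂ _∷_ (dot-0 ρ) (cong₂ _∷_ (dot-0 ρ) refl))

  weights-sum : ∀ b {fs} (nn : All (Nonneg ρ) fs) es →
                weighted (weights b nn es) ≡ + total (weights b nn es) ∙ b ⊞ ev (values (coordForms fs es)) D
  weights-sum b nn [] = sym (trans (cong₂ _⊞_ (0-∙ b) (trans (cong (λ v → ev v D) values-0) (ev-0 D))) refl)
  weights-sum b {fs} nn ((ns , p) ∷ es) = begin
    + m ∙ (b ⊞ ev p D) ⊞ weighted ws                                 ≡⟨ cong₂ _⊞_ (∙-⊞ (+ m) b (ev p D)) (weights-sum b nn es) ⟩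
    (+ m ∙ b ⊞ + m ∙ ev p D) ⊞ (+ T ∙ b ⊞ ev (values cs) D)           ≡⟨ vec≡ (+ m ∙ b ∷ + m ∙ ev p D ∷ + T ∙ b ∷ ev (values cs) D ∷ []) ((v₀ :+ v₁) :+ (v₂ :+ v₃)) ((v₀ :+ v₂) :+ (v₁ :+ v₃)) refl ⟩
    (+ m ∙ b ⊞ + T ∙ b) ⊞ (+ m ∙ ev p D ⊞ ev (values cs) D)           ≡⟨ cong₂ _⊞_ (sym (+-∙ (+ m) (+ T) b)) (cong₂ _⊞_ (trans (cong (_∙ ev p D) (proj₂ (natOf ns nn))) (sym (ev-⊛ (dot L ρ) p D))) refl) ⟩
    + (m ℕ.+ T) ∙ b ⊞ (ev (dot L ρ ⊛ p) D ⊞ ev (values cs) D)         ≡⟨ cong (λ u → + (m ℕ.+ T) ∙ b ⊞ u) (trans (sym (ev-⊕ (dot L ρ ⊛ p) (values cs) D)) (cong (λ v → ev v D) (sym (values-step L p cs)))) ⟩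
    + (m ℕ.+ T) ∙ b ⊞ ev (values (coordForms fs ((ns , p) ∷ es))) D ∎
    where
    open ≡-Reasoning
    ws = weights b nn es
    m = proj₁ (natOf ns nn)
    T = total ws
    L = formOf ns fs
    cs = coordForms fs es

  values-target : ∀ {n} (S : ℕ) σ (τ : Vec Form n) (t : V n) →
    Vec.map (λ f → dot f ρ) (Vec.zipWith (λ f c → + S ⊛ (σ ⊛ f ⊕ᵥ c ⊛ denominator)) τ t) ≡ + S ⊛ (σ ⊛ Vec.map (λ f → dot f ρ) τ ⊕ᵥ + k ⊛ t)
  values-target S σ [] [] = refl
  values-target S σ (f ∷ τ) (c ∷ t) = cong₂ _∷_ (trans (dot-⊛ (+ S) (σ ⊛ f ⊕ᵥ c ⊛ denominator) ρ) (cong (+ S ℤ.*_)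
    (trans (dot-⊕ (σ ⊛ f) (c ⊛ denominator) ρ) (cong₂ ℤ._+_ (dot-⊛ σ f ρ) (trans (dot-⊛ c denominator ρ) (trans (cong (c ℤ.*_) denominator≡) (ℤP.*-comm c (+ k))))))))
    (values-target S σ τ t)

  -- At the actual numerators the weights are natural numbers, and the certificate becomes a convex
  -- combination of total weight S k.
  certified : ∀ {X fs pts σ t S es} b → Convex X → All (Nonneg ρ) fs → All (λ p → X (b ⊞ ev p D)) pts →
              Certificate fs pts τ σ t S es → X (b ⊞ (σ ∙ w ⊞ ev t D))
  certified {X} {fs} {pts} {σ} {t} {S} {es} b conv nn xs (certificate pe 0<S te ce) = conv ws (b ⊞ (σ ∙ w ⊞ ev t D)) (inX pe) 0<total (begin
      + total ws ∙ (b ⊞ (σ ∙ w ⊞ ev t D))                              ≡⟨ ∙-⊞ (+ total ws) b (σ ∙ w ⊞ ev t D) ⟩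
      + total ws ∙ b ⊞ + total ws ∙ (σ ∙ w ⊞ ev t D)                   ≡⟨ cong (λ u → + total ws ∙ b ⊞ u) (begin
          + total ws ∙ (σ ∙ w ⊞ ev t D)                    ≡⟨ cong (_∙ (σ ∙ w ⊞ ev t D)) total≡ ⟩
          (+ S ℤ.* + k) ∙ (σ ∙ w ⊞ ev t D)                 ≡⟨ ∙-assoc (+ S) (+ k) (σ ∙ w ⊞ ev t D) ⟩
          + S ∙ (+ k ∙ (σ ∙ w ⊞ ev t D))                   ≡⟨ cong (+ S ∙_) (trans (∙-⊞ (+ k) (σ ∙ w) (ev t D)) (cong₂ _⊞_ swap-scalars (sym (ev-⊛ (+ k) t D)))) ⟩
          + S ∙ (ev (σ ⊛ values τ) D ⊞ ev (+ k ⊛ t) D)     ≡⟨ cong (+ S ∙_) (ev-⊕ (σ ⊛ values τ) (+ k ⊛ t) D) ⟨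
          + S ∙ ev (σ ⊛ values τ ⊕ᵥ + k ⊛ t) D             ≡⟨ ev-⊛ (+ S) (σ ⊛ values τ ⊕ᵥ + k ⊛ t) D ⟨
          ev (+ S ⊛ (σ ⊛ values τ ⊕ᵥ + k ⊛ t)) D           ≡⟨ cong (λ v → ev v D) (trans (cong values ce) (values-target S σ τ t)) ⟨
          ev (values (coordForms fs es)) D ∎) ⟩
      + total ws ∙ b ⊞ ev (values (coordForms fs es)) D                ≡⟨ weights-sum b nn es ⟨
      weighted ws ∎)
    where
    open ≡-Reasoning
    ws = weights b nn es
    total≡ : + total ws ≡ + S ℤ.* + k
    total≡ = trans (weights-total b nn es) (trans (cong (λ f → dot f ρ) te) (trans (dot-⊛ (+ S) denominator ρ) (cong (+ S ℤ.*_) denominator≡)))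
    0<total : 0 ℕ.< total ws
    0<total = subst (0 ℕ.<_) (ℤP.+-injective (trans (ℤP.pos-* S k) (sym total≡))) (ℕP.*-mono-< 0<S 0<k)
    swap-scalars : + k ∙ (σ ∙ w) ≡ ev (σ ⊛ values τ) D
    swap-scalars = trans (sym (∙-assoc (+ k) σ w)) (trans (cong (_∙ w) (ℤP.*-comm (+ k) σ)) (trans (∙-assoc σ (+ k) w) (trans (cong (σ ∙_) position) (sym (ev-⊛ σ (values τ) D)))))
    inX : ∀ {es} → All (λ e → proj₂ e ∈ pts) es → All (λ u → X (proj₂ u)) (weights b nn es)
    inX [] = []
    inX (p ∷ ps) = All.lookup xs p ∷ inX ps

-- Independence modulo three and fractional parts

Independent₃ : Vec Z3 3 → Set
Independent₃ D = ∀ (d : Vec (Fin 3) 3) → d ≢ Vec.replicate 3 zero → ¬ Multiple 3 (ev (Vec.map (λ i → + toℕ i) d) D)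

module Independent (D : Vec Z3 3) (ind₃ : Independent₃ D) where

  divisible : ∀ c → Multiple 3 (ev c D) → ∃[ h ] c ≡ + 3 ⊛ h
  divisible c (y , e) = go (Mod3.reduce-ev c)
    where
    go : ∃[ h ] Vec.map (λ d → + toℕ d) (Mod3.reduce c) ≡ c ⊖ᵥ + 3 ⊛ h → ∃[ h ] c ≡ + 3 ⊛ h
    go (h , eq) = h , finish (VecP.≡-dec Fin._≟_ (Mod3.reduce c) (Vec.replicate 3 zero))
      where
      finish : Dec (Mod3.reduce c ≡ Vec.replicate 3 zero) → c ≡ + 3 ⊛ h
      finish (no n) = ⊥-elim (ind₃ (Mod3.reduce c) n (y ⊟ ev h D , trans (cong (λ v → ev v D) eq) (trans (ev-⊖ c (+ 3 ⊛ h) D)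
        (trans (cong₂ _⊟_ e (ev-⊛ (+ 3) h D)) (∙-⊟ (+ 3) y (ev h D))))))
      finish (yes z) = cancel c (+ 3 ⊛ h) (trans (sym eq) (cong (Vec.map (λ d → + toℕ d)) z))
        where
        cancel : ∀ {n} (u v : V n) → u ⊖ᵥ v ≡ Vec.map (λ d → + toℕ d) (Vec.replicate n (zero {2})) → u ≡ v
        cancel [] [] _ = refl
        cancel (a ∷ u) (b ∷ v) e = cong₂ _∷_ (ℤP.i-j≡0⇒i≡j a b (VecP.∷-injectiveˡ e)) (cancel u v (VecP.∷-injectiveʳ e))

  size : ∀ {n} → V n → ℕ
  size [] = 0
  size (a ∷ v) = ℤ.∣ a ∣ ℕ.+ size v

  size-0 : ∀ {n} (v : V n) → size v ≡ 0 → v ≡ Vec.replicate n 0ℤ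
  size-0 [] _ = refl
  size-0 (a ∷ v) e = cong₂ _∷_ (ℤP.∣i∣≡0⇒i≡0 (ℕP.m+n≡0⇒m≡0 ℤ.∣ a ∣ e)) (size-0 v (ℕP.m+n≡0⇒n≡0 ℤ.∣ a ∣ e))

  size-3 : ∀ {n} (v : V n) → size (+ 3 ⊛ v) ≡ 3 ℕ.* size v
  size-3 [] = refl
  size-3 (a ∷ v) = trans (cong₂ ℕ._+_ (ℤP.∣i*j∣≡∣i∣*∣j∣ (+ 3) a) (size-3 v)) (sym (ℕP.*-distribˡ-+ 3 ℤ.∣ a ∣ (size v)))

  -- Descent: a relation is divisible by three.
  independent : ∀ c → ev c D ≡ o → c ≡ Vec.replicate 3 0ℤ
  independent c = go (size c) c ℕP.≤-refl
    where
    go : ∀ n c → size c ℕ.≤ n → ev c D ≡ o → c ≡ Vec.replicate 3 0ℤ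
    go zero c le e = size-0 c (ℕP.n≤0⇒n≡0 le)
    go (suc n) c le e = descend (divisible c (o , e))
      where
      descend : ∃[ h ] c ≡ + 3 ⊛ h → c ≡ Vec.replicate 3 0ℤ
      descend (h , refl) = cong (+ 3 ⊛_) (go n h (smaller (size h) (subst (ℕ._≤ suc n) (size-3 h) le))
          (∙-cancel (+ 3) (trans (sym (ev-⊛ (+ 3) h D)) e)))
        where
        smaller : ∀ m → 3 ℕ.* m ℕ.≤ suc n → m ℕ.≤ n
        smaller zero _ = z≤n
        smaller (suc m) le = ℕP.≤-pred (ℕP.≤-trans (ℕP.≤-trans (ℕP.m≤m+n (suc (suc m)) (m ℕ.+ m ℕ.+ 1))
          (ℕP.≤-reflexive (arith m))) le)
          where
          open import Data.Nat.Tactic.RingSolver using () renaming (solve-∀ to solveℕ)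
          arith : ∀ m → suc (suc m) ℕ.+ (m ℕ.+ m ℕ.+ 1) ≡ 3 ℕ.* suc m
          arith = solveℕ

  injective : ∀ c c' → ev c D ≡ ev c' D → c ≡ c'
  injective c c' e = cancel c c' (independent (c ⊖ᵥ c') (trans (ev-⊖ c c' D) (trans (cong (_⊟ ev c' D) e) (⊟-self (ev c' D)))))
    where
    cancel : ∀ {n} (u v : V n) → u ⊖ᵥ v ≡ Vec.replicate n 0ℤ → u ≡ v
    cancel [] [] _ = refl
    cancel (a ∷ u) (b ∷ v) e = cong₂ _∷_ (ℤP.i-j≡0⇒i≡j a b (VecP.∷-injectiveˡ e)) (cancel u v (VecP.∷-injectiveʳ e))

  -- In a dependence of z and D modulo three the coefficient of z is nonzero by independence, hence
  -- a unit.
  residue₃ : ∀ z → ∃[ c ] Multiple 3 (z ⊟ ev c D)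
  residue₃ z = finish D ind₃ (Mod3.dependent (z ∷ D))
    where
    finish : ∀ D → Independent₃ D →
      ∃[ d ] (d ≢ Mod3.zeros × Multiple 3 (ev (Mod3.digits d) (z ∷ D))) → ∃[ c ] Multiple 3 (z ⊟ ev c D)
    finish D ind (zero ∷ d , n , y , e) = ⊥-elim (ind d (λ q → n (cong (zero ∷_) q)) (y , trans (vec≡ (z ∷ ev (Vec.map (λ i → + toℕ i) d) D ∷ []) v₁ (+ 0 :* v₀ :+ v₁) refl) e))
    finish D ind (suc zero ∷ d , n , y , e) = -1ℤ ⊛ c , y , trans (cong (z ⊟_) (ev-⊛ -1ℤ c D))
        (lin≡ (z ∷ ev c D ∷ y ∷ []) ((+ 1 , + 1 :* v₀ :+ v₁ , + 3 :* v₂) ∷ []) (e ∷ []) (v₀ :- -1ℤ :* v₁) (+ 3 :* v₂) refl)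
      where c = Vec.map (λ i → + toℕ i) d
    finish D ind (suc (suc zero) ∷ d , n , y , e) = c , z ⊟ y ,
        lin≡ (z ∷ ev c D ∷ y ∷ []) ((-1ℤ , + 2 :* v₀ :+ v₁ , + 3 :* v₂) ∷ []) (e ∷ []) (v₀ :- v₁) (+ 3 :* (v₀ :- v₂)) refl
      where c = Vec.map (λ i → + toℕ i) d

cramer : ∀ a z → ∀ b c → det3 a b c ∙ z ≡ det3 z b c ∙ a ⊞ (det3 a z c ∙ b ⊞ (det3 a b z ∙ c ⊞ o))
cramer (a₁ , a₂ , a₃) (z₁ , z₂ , z₃) (b₁ , b₂ , b₃) (c₁ , c₂ , c₃) = z3≡
  (go₁ a₁ a₂ a₃ z₁ z₂ z₃ b₁ b₂ b₃ c₁ c₂ c₃) (go₂ a₁ a₂ a₃ z₁ z₂ z₃ b₁ b₂ b₃ c₁ c₂ c₃) (go₃ a₁ a₂ a₃ z₁ z₂ z₃ b₁ b₂ b₃ c₁ c₂ c₃)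
  where
  go₁ : ∀ (a b c z y x d e f g h i : ℤ) →
    (a ℤ.* (e ℤ.* i ℤ.- f ℤ.* h) ℤ.- b ℤ.* (d ℤ.* i ℤ.- f ℤ.* g) ℤ.+ c ℤ.* (d ℤ.* h ℤ.- e ℤ.* g)) ℤ.* z ≡
    (z ℤ.* (e ℤ.* i ℤ.- f ℤ.* h) ℤ.- y ℤ.* (d ℤ.* i ℤ.- f ℤ.* g) ℤ.+ x ℤ.* (d ℤ.* h ℤ.- e ℤ.* g)) ℤ.* a ℤ.+
    ((a ℤ.* (y ℤ.* i ℤ.- x ℤ.* h) ℤ.- b ℤ.* (z ℤ.* i ℤ.- x ℤ.* g) ℤ.+ c ℤ.* (z ℤ.* h ℤ.- y ℤ.* g)) ℤ.* d ℤ.+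
    ((a ℤ.* (e ℤ.* x ℤ.- f ℤ.* y) ℤ.- b ℤ.* (d ℤ.* x ℤ.- f ℤ.* z) ℤ.+ c ℤ.* (d ℤ.* y ℤ.- e ℤ.* z)) ℤ.* g ℤ.+ + 0))
  go₁ = solve-∀
  go₂ : ∀ (a b c z y x d e f g h i : ℤ) →
    (a ℤ.* (e ℤ.* i ℤ.- f ℤ.* h) ℤ.- b ℤ.* (d ℤ.* i ℤ.- f ℤ.* g) ℤ.+ c ℤ.* (d ℤ.* h ℤ.- e ℤ.* g)) ℤ.* y ≡
    (z ℤ.* (e ℤ.* i ℤ.- f ℤ.* h) ℤ.- y ℤ.* (d ℤ.* i ℤ.- f ℤ.* g) ℤ.+ x ℤ.* (d ℤ.* h ℤ.- e ℤ.* g)) ℤ.* b ℤ.+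
    ((a ℤ.* (y ℤ.* i ℤ.- x ℤ.* h) ℤ.- b ℤ.* (z ℤ.* i ℤ.- x ℤ.* g) ℤ.+ c ℤ.* (z ℤ.* h ℤ.- y ℤ.* g)) ℤ.* e ℤ.+
    ((a ℤ.* (e ℤ.* x ℤ.- f ℤ.* y) ℤ.- b ℤ.* (d ℤ.* x ℤ.- f ℤ.* z) ℤ.+ c ℤ.* (d ℤ.* y ℤ.- e ℤ.* z)) ℤ.* h ℤ.+ + 0))
  go₂ = solve-∀
  go₃ : ∀ (a b c z y x d e f g h i : ℤ) →
    (a ℤ.* (e ℤ.* i ℤ.- f ℤ.* h) ℤ.- b ℤ.* (d ℤ.* i ℤ.- f ℤ.* g) ℤ.+ c ℤ.* (d ℤ.* h ℤ.- e ℤ.* g)) ℤ.* x ≡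
    (z ℤ.* (e ℤ.* i ℤ.- f ℤ.* h) ℤ.- y ℤ.* (d ℤ.* i ℤ.- f ℤ.* g) ℤ.+ x ℤ.* (d ℤ.* h ℤ.- e ℤ.* g)) ℤ.* c ℤ.+
    ((a ℤ.* (y ℤ.* i ℤ.- x ℤ.* h) ℤ.- b ℤ.* (z ℤ.* i ℤ.- x ℤ.* g) ℤ.+ c ℤ.* (z ℤ.* h ℤ.- y ℤ.* g)) ℤ.* f ℤ.+
    ((a ℤ.* (e ℤ.* x ℤ.- f ℤ.* y) ℤ.- b ℤ.* (d ℤ.* x ℤ.- f ℤ.* z) ℤ.+ c ℤ.* (d ℤ.* y ℤ.- e ℤ.* z)) ℤ.* i ℤ.+ + 0))
  go₃ = solve-∀

Formal : Vec Z3 3 → Z3 → Set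
Formal D w = ∃[ c ] w ≡ ev c D

-- If the determinant vanished, the coefficients in Cramer's identity would form a relation for
-- every z, so a × b would vanish. Its entries relate a and b in such a way that a would vanish too.
determinant≢0 : ∀ a b c → Independent₃ (a ∷ b ∷ c ∷ []) → det3 a b c ≢ 0ℤ
determinant≢0 a b c ind₃ det≡0 = 1≢0 (cong Vec.head (independent (+ 1 ∷ + 0 ∷ + 0 ∷ [])
    (trans (cong (λ t → ev (+ 1 ∷ + 0 ∷ + 0 ∷ []) (t ∷ b ∷ c ∷ [])) a≡o) (vec≡ (b ∷ c ∷ []) (+ 1 :* :0 :+ (+ 0 :* v₀ :+ (+ 0 :* v₁ :+ :0))) :0 refl))))
  where
  open Independent (a ∷ b ∷ c ∷ []) ind₃
  1≢0 : + 1 ≡ 0ℤ → ⊥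
  1≢0 ()
  cross : ∀ z → det3 a b z ≡ 0ℤ
  cross z = cong (λ v → Vec.head (Vec.tail (Vec.tail v))) (independent (det3 z b c ∷ det3 a z c ∷ det3 a b z ∷ [])
    (trans (sym (cramer a z b c)) (trans (cong (_∙ z) det≡0) (0-∙ z))))
  second : ∀ x y → ev (x ∷ ℤ.- y ∷ + 0 ∷ []) (a ∷ b ∷ c ∷ []) ≡ o → y ≡ 0ℤ
  second x y e = trans (sym (ℤP.neg-involutive y)) (cong ℤ.-_ (cong (λ v → Vec.head (Vec.tail v)) (independent (x ∷ ℤ.- y ∷ + 0 ∷ []) e)))
  a≡o : a ≡ o
  a≡o = go a b c second (cross e₁) (cross e₂) (cross e₃)
    where
    go : ∀ a b c → (∀ x y → ev (x ∷ ℤ.- y ∷ + 0 ∷ []) (a ∷ b ∷ c ∷ []) ≡ o → y ≡ 0ℤ) →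
         det3 a b e₁ ≡ 0ℤ → det3 a b e₂ ≡ 0ℤ → det3 a b e₃ ≡ 0ℤ → a ≡ o
    go (a₁ , a₂ , a₃) (b₁ , b₂ , b₃) (c₁ , c₂ , c₃) second X Y Z = z3≡
      (second b₁ a₁ (z3≡ (same b₁ a₁ c₁) (trans (z₁ a₁ a₂ a₃ b₁ b₂ b₃ c₂) (cong ℤ.-_ Z)) (trans (y₁ a₁ a₂ a₃ b₁ b₂ b₃ c₃) Y)))
      (second b₂ a₂ (z3≡ (trans (z₂ a₁ a₂ a₃ b₁ b₂ b₃ c₁) Z) (same b₂ a₂ c₂) (trans (x₂ a₁ a₂ a₃ b₁ b₂ b₃ c₃) (cong ℤ.-_ X))))
      (second b₃ a₃ (z3≡ (trans (y₃ a₁ a₂ a₃ b₁ b₂ b₃ c₁) (cong ℤ.-_ Y)) (trans (x₃ a₁ a₂ a₃ b₁ b₂ b₃ c₂) X) (same b₃ a₃ c₃)))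
      where
      same : ∀ (x y z : ℤ) → x ℤ.* y ℤ.+ (ℤ.- y ℤ.* x ℤ.+ (+ 0 ℤ.* z ℤ.+ + 0)) ≡ + 0
      same = solve-∀
      z₁ : ∀ (a b c d e f z : ℤ) → d ℤ.* b ℤ.+ (ℤ.- a ℤ.* e ℤ.+ (+ 0 ℤ.* z ℤ.+ + 0)) ≡
        ℤ.- (a ℤ.* (e ℤ.* + 1 ℤ.- f ℤ.* + 0) ℤ.- b ℤ.* (d ℤ.* + 1 ℤ.- f ℤ.* + 0) ℤ.+ c ℤ.* (d ℤ.* + 0 ℤ.- e ℤ.* + 0))
      z₁ = solve-∀
      z₂ : ∀ (a b c d e f z : ℤ) → e ℤ.* a ℤ.+ (ℤ.- b ℤ.* d ℤ.+ (+ 0 ℤ.* z ℤ.+ + 0)) ≡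
        a ℤ.* (e ℤ.* + 1 ℤ.- f ℤ.* + 0) ℤ.- b ℤ.* (d ℤ.* + 1 ℤ.- f ℤ.* + 0) ℤ.+ c ℤ.* (d ℤ.* + 0 ℤ.- e ℤ.* + 0)
      z₂ = solve-∀
      y₁ : ∀ (a b c d e f z : ℤ) → d ℤ.* c ℤ.+ (ℤ.- a ℤ.* f ℤ.+ (+ 0 ℤ.* z ℤ.+ + 0)) ≡
        a ℤ.* (e ℤ.* + 0 ℤ.- f ℤ.* + 1) ℤ.- b ℤ.* (d ℤ.* + 0 ℤ.- f ℤ.* + 0) ℤ.+ c ℤ.* (d ℤ.* + 1 ℤ.- e ℤ.* + 0)
      y₁ = solve-∀
      y₃ : ∀ (a b c d e f z : ℤ) → f ℤ.* a ℤ.+ (ℤ.- c ℤ.* d ℤ.+ (+ 0 ℤ.* z ℤ.+ + 0)) ≡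
        ℤ.- (a ℤ.* (e ℤ.* + 0 ℤ.- f ℤ.* + 1) ℤ.- b ℤ.* (d ℤ.* + 0 ℤ.- f ℤ.* + 0) ℤ.+ c ℤ.* (d ℤ.* + 1 ℤ.- e ℤ.* + 0))
      y₃ = solve-∀
      x₂ : ∀ (a b c d e f z : ℤ) → e ℤ.* c ℤ.+ (ℤ.- b ℤ.* f ℤ.+ (+ 0 ℤ.* z ℤ.+ + 0)) ≡
        ℤ.- (a ℤ.* (e ℤ.* + 0 ℤ.- f ℤ.* + 0) ℤ.- b ℤ.* (d ℤ.* + 0 ℤ.- f ℤ.* + 1) ℤ.+ c ℤ.* (d ℤ.* + 0 ℤ.- e ℤ.* + 1))
      x₂ = solve-∀
      x₃ : ∀ (a b c d e f z : ℤ) → f ℤ.* b ℤ.+ (ℤ.- c ℤ.* e ℤ.+ (+ 0 ℤ.* z ℤ.+ + 0)) ≡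
        a ℤ.* (e ℤ.* + 0 ℤ.- f ℤ.* + 0) ℤ.- b ℤ.* (d ℤ.* + 0 ℤ.- f ℤ.* + 1) ℤ.+ c ℤ.* (d ℤ.* + 0 ℤ.- e ℤ.* + 1)
      x₃ = solve-∀

-- The bounds are not strict, so that reflecting the cell in its centre preserves them.
record Fraction (D : Vec Z3 3) (w : Z3) : Set where
  field
    k r₁ r₂ r₃ : ℕ
    0<k  : 0 ℕ.< k
    r₁≤k : r₁ ℕ.≤ k
    r₂≤k : r₂ ℕ.≤ k
    r₃≤k : r₃ ℕ.≤ k
    fraction : + k ∙ w ≡ ev (+ r₁ ∷ + r₂ ∷ + r₃ ∷ []) D

fractional-part : ∀ a b c → Independent₃ (a ∷ b ∷ c ∷ []) → ∀ z → ∃[ q ] Fraction (a ∷ b ∷ c ∷ []) (z ⊟ ev q (a ∷ b ∷ c ∷ []))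
fractional-part a b c ind z = go (det3 a b c) (determinant≢0 a b c ind) (det3 z b c) (det3 a z c) (det3 a b z) (cramer a z b c)
  where
  D : Vec Z3 3
  D = a ∷ b ∷ c ∷ []
  positive : ∀ k .{{_ : NonZero k}} u v w → + k ∙ z ≡ ev (u ∷ v ∷ w ∷ []) D → ∃[ q ] Fraction D (z ⊟ ev q D)
  positive k u v w e = q , record { k = k ; r₁ = u %ℕ k ; r₂ = v %ℕ k ; r₃ = w %ℕ k ; 0<k = ℕP.n≢0⇒n>0 (ℕ.≢-nonZero⁻¹ k)
    ; r₁≤k = ℕP.<⇒≤ (n%ℕd<d u k) ; r₂≤k = ℕP.<⇒≤ (n%ℕd<d v k) ; r₃≤k = ℕP.<⇒≤ (n%ℕd<d w k)
    ; fraction = trans (sym (∙-⊟ (+ k) z (ev q D))) (trans (cong₂ _⊟_ e (sym (ev-⊛ (+ k) q D))) (trans (sym (ev-⊖ (u ∷ v ∷ w ∷ []) (+ k ⊛ q) D))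
        (cong (λ t → ev t D) remainders))) }
    where
    q : V 3
    q = u /ℕ k ∷ v /ℕ k ∷ w /ℕ k ∷ []
    remainders : (u ∷ v ∷ w ∷ []) ⊖ᵥ + k ⊛ q ≡ + (u %ℕ k) ∷ + (v %ℕ k) ∷ + (w %ℕ k) ∷ []
    remainders = cong₂ _∷_ (rem u) (cong₂ _∷_ (rem v) (cong₂ _∷_ (rem w) refl))
      where
      rem : ∀ u → u ℤ.- + k ℤ.* (u /ℕ k) ≡ + (u %ℕ k)
      rem u = trans (cong (λ t → t ℤ.- + k ℤ.* (u /ℕ k)) (a≡a%ℕn+[a/ℕn]*n u k)) (cancel (+ (u %ℕ k)) (u /ℕ k) (+ k))
        where
        cancel : ∀ (r q k : ℤ) → (r ℤ.+ q ℤ.* k) ℤ.- k ℤ.* q ≡ r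
        cancel = solve-∀
  go : ∀ d → d ≢ 0ℤ → ∀ u v w → d ∙ z ≡ ev (u ∷ v ∷ w ∷ []) D → ∃[ q ] Fraction D (z ⊟ ev q D)
  go (+ zero) n u v w e = ⊥-elim (n refl)
  go (+ suc k) n u v w e = positive (suc k) u v w e
  go -[1+ k ] n u v w e = positive (suc k) (-1ℤ ℤ.* u) (-1ℤ ℤ.* v) (-1ℤ ℤ.* w)
    (trans (trans (cong (_∙ z) (sym (ℤP.-1*i≡-i -[1+ k ]))) (trans (∙-assoc -1ℤ -[1+ k ] z) (cong (-1ℤ ∙_) e))) (sym (ev-⊛ -1ℤ (u ∷ v ∷ w ∷ []) D)))

-- Positions relative to the base points b of P and b' of Q.
record Frame {P Q K : Z3 → Set} (S : System P Q K) (D : Vec Z3 3) (ps qs : List (V 3)) : Set where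
  field
    b b'  : Z3
    inP   : All (λ p → P (b ⊞ ev p D)) ps
    inQ   : All (λ p → Q (b' ⊞ ev p D)) qs
    onlyP : ∀ {z} → P (b ⊞ z) → ∃[ p ] z ≡ ev p D
    ind₃  : Independent₃ D

-- `d` stands for the digits of w modulo three; some known translate of w or - w falls into the
-- class of a known point of the lattice.
Collides : List (V 3) → List (ℤ × V 3) → Vec (Fin 3) 3 → Set
Collides ks ts d = Any (λ u → Any (λ f → Divides 3 (proj₁ u ⊛ Vec.map (λ i → + toℕ i) d ⊕ᵥ proj₂ u ⊖ᵥ f)) ks) ts

collides? : ∀ ks ts → Dec (∀ x y z → Collides ks ts (x ∷ y ∷ z ∷ []))
collides? ks ts = FinP.all? λ x → FinP.all? λ y → FinP.all? λ z →
  any? (λ u → any? (λ f → divides? 3 (proj₁ u ⊛ Vec.map (λ i → + toℕ i) (x ∷ y ∷ z ∷ []) ⊕ᵥ proj₂ u ⊖ᵥ f)) ks) ts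

Unit : ℤ → Set
Unit σ = σ ≡ + 1 ⊎ σ ≡ -1ℤ

unit-formal : ∀ D w σ c → Unit σ → σ ∙ w ≡ ev c D → Formal D w
unit-formal D w σ c (inj₁ refl) e = c , trans (vec≡ (w ∷ []) v₀ (+ 1 :* v₀) refl) e
unit-formal D w σ c (inj₂ refl) e = -1ℤ ⊛ c , trans (vec≡ (w ∷ []) v₀ (-1ℤ :* (-1ℤ :* v₀)) refl) (trans (cong (-1ℤ ∙_) e) (sym (ev-⊛ -1ℤ c D)))

move : ∀ D w σ (t f : V 3) → σ ∙ w ⊞ ev t D ≡ ev f D → σ ∙ w ≡ ev (f ⊖ᵥ t) D
move D w σ t f e = trans (lin≡ (σ ∙ w ∷ ev t D ∷ ev f D ∷ []) ((+ 1 , v₀ :+ v₁ , v₂) ∷ []) (e ∷ []) v₀ (v₂ :- v₁) refl) (sym (ev-⊖ f t D))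

module Index {P Q K : Z3 → Set} {S : System P Q K} {D : Vec Z3 3} {ps qs : List (V 3)} (F : Frame S D ps qs) where
  open System S
  open Frame F

  sumPoints : List (V 3)
  sumPoints = List.concatMap (λ p → List.map (p ⊕ᵥ_) qs) ps

  InK : V 3 → Set
  InK f = K ((b ⊞ b') ⊞ ev f D)

  sums-in : All InK sumPoints
  sums-in = go inP
    where
    row : ∀ {p} {qs} → P (b ⊞ ev p D) → All (λ q → Q (b' ⊞ ev q D)) qs → All InK (List.map (p ⊕ᵥ_) qs)
    row P₁ [] = []
    row {p} {q ∷ _} P₁ (Q₁ ∷ Qs) = subst K (trans (vec≡ (b ∷ b' ∷ ev p D ∷ ev q D ∷ []) ((v₀ :+ v₂) :+ (v₁ :+ v₃)) ((v₀ :+ v₁) :+ (v₂ :+ v₃)) refl)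
      (cong ((b ⊞ b') ⊞_) (sym (ev-⊕ p q D)))) (sum P₁ Q₁) ∷ row P₁ Qs
    go : ∀ {ps} → All (λ p → P (b ⊞ ev p D)) ps → All InK (List.concatMap (λ p → List.map (p ⊕ᵥ_) qs) ps)
    go [] = []
    go (P₁ ∷ Ps) = AllP.++⁺ (row P₁ inQ) (go Ps)

  half-in : ∀ f h l → InK f → InK h → f ⊕ᵥ h ≡ + 2 ⊛ l → InK l
  half-in f h l kf kh e = convex ((1 , (b ⊞ b') ⊞ ev f D) ∷ (1 , (b ⊞ b') ⊞ ev h D) ∷ []) _ (kf ∷ kh ∷ []) (s≤s z≤n)
    (lin≡ ((b ⊞ b') ∷ ev f D ∷ ev h D ∷ ev l D ∷ []) ((-1ℤ , v₁ :+ v₂ , + 2 :* v₃) ∷ [])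
      (trans (sym (ev-⊕ f h D)) (trans (cong (λ t → ev t D) e) (ev-⊛ (+ 2) l D)) ∷ [])
      (+ 2 :* (v₀ :+ v₃)) (+ 1 :* (v₀ :+ v₁) :+ (+ 1 :* (v₀ :+ v₂) :+ :0)) refl)

  -- All points of P differ from the base point by combinations of D, so a translate of w or - w
  -- found in P gives w as such a combination.
  formal-P : ∀ w σ t → Unit σ → P (b ⊞ (σ ∙ w ⊞ ev t D)) → Formal D w
  formal-P w σ t u m = go (onlyP m)
    where
    go : ∃[ p ] σ ∙ w ⊞ ev t D ≡ ev p D → Formal D w
    go (p , e) = unit-formal D w σ (p ⊖ᵥ t) u (move D w σ t p e)

  -- Modulo three w agrees with a combination of D. By the finite check a translate of w or - w in K
  -- is congruent to one of `ks`, hence equal to it.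
  formal-K : ∀ {ks ts} w → All InK ks → All (λ u → Unit (proj₁ u) × K ((b ⊞ b') ⊞ (proj₁ u ∙ w ⊞ ev (proj₂ u) D))) ts →
             (∀ x y z → Collides ks ts (x ∷ y ∷ z ∷ [])) → Formal D w
  formal-K {ks} {ts} w inK inT col = start (Independent.residue₃ D ind₃ w)
    where
    start : ∃[ c ] Multiple 3 (w ⊟ ev c D) → Formal D w
    start (c , y , e) = reduced (Mod3.reduce c) (Mod3.reduce-ev c)
      where
      reduced : ∀ d → ∃[ h ] Vec.map (λ i → + toℕ i) d ≡ c ⊖ᵥ + 3 ⊛ h → Formal D w
      reduced d@(x₁ ∷ x₂ ∷ x₃ ∷ []) (h , eq) = collide (find (col x₁ x₂ x₃))
        where
        ρ : V 3
        ρ = Vec.map (λ i → + toℕ i) d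
        collide : ∃[ u ] (u ∈ ts × Any (λ f → Divides 3 (proj₁ u ⊛ ρ ⊕ᵥ proj₂ u ⊖ᵥ f)) ks) → Formal D w
        collide ((σ , t) , u∈ , a) = finish (find a) (All.lookup inT u∈)
          where
          finish : ∃[ f ] (f ∈ ks × Divides 3 (σ ⊛ ρ ⊕ᵥ t ⊖ᵥ f)) → Unit σ × K ((b ⊞ b') ⊞ (σ ∙ w ⊞ ev t D)) → Formal D w
          finish (f , f∈ , dv) (un , kt) = unit-formal D w σ (f ⊖ᵥ t) un (move D w σ t f
              (lin≡ ((b ⊞ b') ∷ (σ ∙ w ⊞ ev t D) ∷ ev f D ∷ []) ((+ 1 , v₀ :+ v₁ , v₀ :+ v₂) ∷ []) (triple kt (All.lookup inK f∈) (Y , eqn) ∷ []) v₁ v₂ refl))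
            where
            m = ev-divides 3 (σ ⊛ ρ ⊕ᵥ t ⊖ᵥ f) D dv
            Y : Z3
            Y = proj₁ m ⊞ σ ∙ (y ⊞ ev h D)
            residual : w ≡ ev ρ D ⊞ + 3 ∙ (y ⊞ ev h D)
            residual = lin≡ (w ∷ ev c D ∷ y ∷ ev h D ∷ ev ρ D ∷ []) ((+ 1 , v₀ :- v₁ , + 3 :* v₂) ∷ (-1ℤ , v₄ , v₁ :- + 3 :* v₃) ∷ [])
              (e ∷ trans (cong (λ q → ev q D) eq) (trans (ev-⊖ c (+ 3 ⊛ h) D) (cong (ev c D ⊟_) (ev-⊛ (+ 3) h D))) ∷ []) v₀ (v₄ :+ + 3 :* (v₂ :+ v₃)) refl
            spread : σ ∙ w ≡ ev (σ ⊛ ρ) D ⊞ + 3 ∙ (σ ∙ (y ⊞ ev h D))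
            spread = trans (cong (σ ∙_) residual) (trans (∙-⊞ σ (ev ρ D) (+ 3 ∙ (y ⊞ ev h D))) (cong₂ _⊞_ (sym (ev-⊛ σ ρ D))
              (trans (sym (∙-assoc σ (+ 3) (y ⊞ ev h D))) (trans (cong (_∙ (y ⊞ ev h D)) (ℤP.*-comm σ (+ 3))) (∙-assoc (+ 3) σ (y ⊞ ev h D))))))
            eqn : ((b ⊞ b') ⊞ (σ ∙ w ⊞ ev t D)) ⊟ ((b ⊞ b') ⊞ ev f D) ≡ + 3 ∙ Y
            eqn = lin≡ ((b ⊞ b') ∷ σ ∙ w ∷ ev t D ∷ ev f D ∷ ev (σ ⊛ ρ) D ∷ σ ∙ (y ⊞ ev h D) ∷ proj₁ m ∷ [])
              ((+ 1 , v₁ , v₄ :+ + 3 :* v₅) ∷ (+ 1 , (v₄ :+ v₂) :- v₃ , + 3 :* v₆) ∷ [])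
              (spread ∷ trans (sym (trans (ev-⊖ (σ ⊛ ρ ⊕ᵥ t) f D) (cong (_⊟ ev f D) (ev-⊕ (σ ⊛ ρ) t D)))) (proj₂ m) ∷ [])
              ((v₀ :+ (v₁ :+ v₂)) :- (v₀ :+ v₃)) (+ 3 :* (v₆ :+ v₅)) refl

module Cell {D₀ D : Vec Z3 3} {w : Z3} (fr : Fraction D₀ w) (τ : Vec Form 3)
  (coords : ∀ r₁ r₂ r₃ k → ev (r₁ ∷ r₂ ∷ r₃ ∷ []) D₀ ≡ ev (Vec.map (λ f → dot f (r₁ ∷ r₂ ∷ r₃ ∷ k ∷ [])) τ) D) where
  open Fraction fr

  ρ : V 4
  ρ = + r₁ ∷ + r₂ ∷ + r₃ ∷ + k ∷ []

  last : ∀ (a b c d : ℤ) → + 0 ℤ.* a ℤ.+ (+ 0 ℤ.* b ℤ.+ (+ 0 ℤ.* c ℤ.+ (+ 1 ℤ.* d ℤ.+ + 0))) ≡ d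
  last = solve-∀

  open Rational D w ρ k 0<k τ (last (+ r₁) (+ r₂) (+ r₃) (+ k)) (trans fraction (coords (+ r₁) (+ r₂) (+ r₃) (+ k))) public

fromCheck : ∀ fs pts τ σ t S es → True (certificate? fs pts τ σ t S es) → Certificate fs pts τ σ t S es
fromCheck fs pts τ σ t S es ok = let (a , b , c , d) = toWitness ok in certificate a b c d

-- Certificates for the cells of E, K₂ and K₁

identity : Vec Form 3
identity = (+ 1 ∷ + 0 ∷ + 0 ∷ + 0 ∷ []) ∷ (+ 0 ∷ + 1 ∷ + 0 ∷ + 0 ∷ []) ∷ (+ 0 ∷ + 0 ∷ + 1 ∷ + 0 ∷ []) ∷ []

sumsOf : List (V 3) → List (V 3) → List (V 3)
sumsOf ps qs = List.concatMap (λ p → List.map (p ⊕ᵥ_) qs) ps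

pointsE : List (V 3)
pointsE = (+ 0 ∷ + 0 ∷ + 0 ∷ []) ∷ (+ 1 ∷ + 0 ∷ + 0 ∷ []) ∷ (+ 0 ∷ + 1 ∷ + 0 ∷ []) ∷ (+ 0 ∷ + 0 ∷ + 1 ∷ []) ∷ (+ 1 ∷ + 1 ∷ + 1 ∷ []) ∷ []

pointsE′ : List (V 3)
pointsE′ = (+ 1 ∷ + 0 ∷ + 0 ∷ []) ∷ (+ 0 ∷ + 1 ∷ + 0 ∷ []) ∷ (+ 0 ∷ + 0 ∷ + 1 ∷ []) ∷ (+ 1 ∷ + 1 ∷ + 1 ∷ []) ∷ []

-- The facet of E through d₂, d₃ and d₁ + d₂ + d₃; for sorted coordinates this inequality alone puts
-- w into E.
fitE : Form
fitE = + 1 ∷ -[1+ 0 ] ∷ -[1+ 0 ] ∷ + 1 ∷ []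

-- This is `fitE` after the reflection of the cell, which takes r₁, r₂, r₃ to k - r₃, k - r₂, k -
-- r₁.
fitE′ : Form
fitE′ = + 1 ∷ + 1 ∷ -[1+ 0 ] ∷ + 0 ∷ []

slack : Form
slack = -[1+ 0 ] ∷ -[1+ 0 ] ∷ -[1+ 0 ] ∷ + 1 ∷ []

-- Up to sign, `slack` after the same reflection.
slack′ : Form
slack′ = -[1+ 0 ] ∷ -[1+ 0 ] ∷ -[1+ 0 ] ∷ + 2 ∷ []

-- The simplex 0 ≤ r₁ ≤ r₂ ≤ r₃ ≤ k, one of the six chambers of the cell.
sorted : List Form
sorted =
  (+ 1 ∷ + 0 ∷ + 0 ∷ + 0 ∷ [])
  ∷ (-[1+ 0 ] ∷ + 1 ∷ + 0 ∷ + 0 ∷ [])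
  ∷ (+ 0 ∷ -[1+ 0 ] ∷ + 1 ∷ + 0 ∷ [])
  ∷ (+ 0 ∷ + 0 ∷ -[1+ 0 ] ∷ + 1 ∷ []) ∷ []

-- The first four certificates put w or d₁ + d₂ + d₃ - w into P. The other six put translates of w
-- and - w into K when both fit forms are at most zero.
certE₁ : Certificate (fitE ∷ slack ∷ sorted) pointsE identity (+ 1) (+ 0 ∷ + 0 ∷ + 0 ∷ []) 1
  ( ((0 ∷ 1 ∷ []) , (+ 0 ∷ + 0 ∷ + 0 ∷ []))
    ∷ ((0 ∷ 0 ∷ 1 ∷ []) , (+ 1 ∷ + 0 ∷ + 0 ∷ []))
    ∷ ((0 ∷ 0 ∷ 1 ∷ 1 ∷ []) , (+ 0 ∷ + 1 ∷ + 0 ∷ []))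
    ∷ ((0 ∷ 0 ∷ 1 ∷ 1 ∷ 1 ∷ []) , (+ 0 ∷ + 0 ∷ + 1 ∷ [])) ∷ [] )
certE₁ = fromCheck _ _ _ _ _ _ _ _

certE₂ : Certificate (fitE ∷ -1ℤ ⊛ slack ∷ sorted) pointsE identity (+ 1) (+ 0 ∷ + 0 ∷ + 0 ∷ []) 2
  ( ((1 ∷ []) , (+ 1 ∷ + 0 ∷ + 0 ∷ []))
    ∷ ((1 ∷ 0 ∷ 0 ∷ 2 ∷ []) , (+ 0 ∷ + 1 ∷ + 0 ∷ []))
    ∷ ((1 ∷ 0 ∷ 0 ∷ 2 ∷ 2 ∷ []) , (+ 0 ∷ + 0 ∷ + 1 ∷ []))
    ∷ ((0 ∷ 1 ∷ []) , (+ 1 ∷ + 1 ∷ + 1 ∷ [])) ∷ [] )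
certE₂ = fromCheck _ _ _ _ _ _ _ _

certE₃ : Certificate (fitE′ ∷ slack′ ∷ sorted) pointsE identity (-[1+ 0 ]) (+ 1 ∷ + 1 ∷ + 1 ∷ []) 2
  ( ((1 ∷ 0 ∷ 0 ∷ 2 ∷ 2 ∷ []) , (+ 1 ∷ + 0 ∷ + 0 ∷ []))
    ∷ ((0 ∷ 0 ∷ 1 ∷ 0 ∷ 1 ∷ []) , (+ 0 ∷ + 1 ∷ + 0 ∷ []))
    ∷ ((1 ∷ []) , (+ 0 ∷ + 0 ∷ + 1 ∷ []))
    ∷ ((0 ∷ 1 ∷ []) , (+ 1 ∷ + 1 ∷ + 1 ∷ [])) ∷ [] )
certE₃ = fromCheck _ _ _ _ _ _ _ _

certE₄ : Certificate (fitE′ ∷ -1ℤ ⊛ slack′ ∷ sorted) pointsE identity (-[1+ 0 ]) (+ 1 ∷ + 1 ∷ + 1 ∷ []) 1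
  ( ((0 ∷ 1 ∷ []) , (+ 0 ∷ + 0 ∷ + 0 ∷ []))
    ∷ ((0 ∷ 0 ∷ 0 ∷ 1 ∷ 1 ∷ 1 ∷ []) , (+ 1 ∷ + 0 ∷ + 0 ∷ []))
    ∷ ((0 ∷ 0 ∷ 0 ∷ 0 ∷ 1 ∷ 1 ∷ []) , (+ 0 ∷ + 1 ∷ + 0 ∷ []))
    ∷ ((0 ∷ 0 ∷ 0 ∷ 0 ∷ 0 ∷ 1 ∷ []) , (+ 0 ∷ + 0 ∷ + 1 ∷ [])) ∷ [] )
certE₄ = fromCheck _ _ _ _ _ _ _ _

certE₅ : Certificate (-1ℤ ⊛ fitE ∷ -1ℤ ⊛ fitE′ ∷ sorted) (sumsOf pointsE pointsE′) identity (+ 1) (+ 0 ∷ + 0 ∷ + 0 ∷ []) 1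
  ( ((0 ∷ 1 ∷ 0 ∷ 0 ∷ 0 ∷ 1 ∷ []) , (+ 0 ∷ + 0 ∷ + 1 ∷ []))
    ∷ ((0 ∷ 0 ∷ 0 ∷ 0 ∷ 0 ∷ 1 ∷ []) , (+ 0 ∷ + 1 ∷ + 0 ∷ []))
    ∷ ((1 ∷ 0 ∷ 1 ∷ []) , (+ 0 ∷ + 1 ∷ + 1 ∷ []))
    ∷ ((0 ∷ 0 ∷ 1 ∷ []) , (+ 1 ∷ + 0 ∷ + 1 ∷ [])) ∷ [] )
certE₅ = fromCheck _ _ _ _ _ _ _ _

certE₆ : Certificate (-1ℤ ⊛ fitE ∷ -1ℤ ⊛ fitE′ ∷ sorted) (sumsOf pointsE pointsE′) identity (+ 1) (+ 1 ∷ + 0 ∷ + 0 ∷ []) 2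
  ( ((0 ∷ 2 ∷ 0 ∷ 0 ∷ 0 ∷ 2 ∷ []) , (+ 1 ∷ + 0 ∷ + 1 ∷ []))
    ∷ ((0 ∷ 0 ∷ 0 ∷ 1 ∷ 0 ∷ 1 ∷ []) , (+ 1 ∷ + 1 ∷ + 0 ∷ []))
    ∷ ((1 ∷ 0 ∷ 2 ∷ []) , (+ 1 ∷ + 1 ∷ + 2 ∷ []))
    ∷ ((0 ∷ 0 ∷ 2 ∷ []) , (+ 2 ∷ + 0 ∷ + 0 ∷ [])) ∷ [] )
certE₆ = fromCheck _ _ _ _ _ _ _ _

certE₇ : Certificate (-1ℤ ⊛ fitE ∷ -1ℤ ⊛ fitE′ ∷ sorted) (sumsOf pointsE pointsE′) identity (+ 1) (+ 1 ∷ + 1 ∷ + 0 ∷ []) 1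
  ( ((0 ∷ 0 ∷ 0 ∷ 0 ∷ 0 ∷ 1 ∷ []) , (+ 1 ∷ + 1 ∷ + 0 ∷ []))
    ∷ ((0 ∷ 1 ∷ []) , (+ 1 ∷ + 1 ∷ + 1 ∷ []))
    ∷ ((0 ∷ 0 ∷ 1 ∷ 1 ∷ []) , (+ 1 ∷ + 2 ∷ + 1 ∷ []))
    ∷ ((0 ∷ 0 ∷ 1 ∷ []) , (+ 2 ∷ + 1 ∷ + 1 ∷ [])) ∷ [] )
certE₇ = fromCheck _ _ _ _ _ _ _ _

certE₈ : Certificate (-1ℤ ⊛ fitE ∷ -1ℤ ⊛ fitE′ ∷ sorted) (sumsOf pointsE pointsE′) identity (-[1+ 0 ]) (+ 1 ∷ + 1 ∷ + 1 ∷ []) 1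
  ( ((0 ∷ 0 ∷ 1 ∷ []) , (+ 0 ∷ + 1 ∷ + 0 ∷ []))
    ∷ ((1 ∷ 0 ∷ 1 ∷ []) , (+ 1 ∷ + 0 ∷ + 0 ∷ []))
    ∷ ((0 ∷ 0 ∷ 0 ∷ 0 ∷ 0 ∷ 1 ∷ []) , (+ 1 ∷ + 0 ∷ + 1 ∷ []))
    ∷ ((0 ∷ 1 ∷ 0 ∷ 0 ∷ 0 ∷ 1 ∷ []) , (+ 1 ∷ + 1 ∷ + 0 ∷ [])) ∷ [] )
certE₈ = fromCheck _ _ _ _ _ _ _ _

certE₉ : Certificate (-1ℤ ⊛ fitE ∷ -1ℤ ⊛ fitE′ ∷ sorted) (sumsOf pointsE pointsE′) identity (-[1+ 0 ]) (+ 1 ∷ + 1 ∷ + 2 ∷ []) 1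
  ( ((0 ∷ 0 ∷ 1 ∷ []) , (+ 0 ∷ + 1 ∷ + 1 ∷ []))
    ∷ ((0 ∷ 0 ∷ 1 ∷ 1 ∷ []) , (+ 1 ∷ + 0 ∷ + 1 ∷ []))
    ∷ ((0 ∷ 1 ∷ []) , (+ 1 ∷ + 1 ∷ + 1 ∷ []))
    ∷ ((0 ∷ 0 ∷ 0 ∷ 0 ∷ 0 ∷ 1 ∷ []) , (+ 1 ∷ + 1 ∷ + 2 ∷ [])) ∷ [] )
certE₉ = fromCheck _ _ _ _ _ _ _ _

certEₐ : Certificate (-1ℤ ⊛ fitE ∷ -1ℤ ⊛ fitE′ ∷ sorted) (sumsOf pointsE pointsE′) identity (-[1+ 0 ]) (+ 1 ∷ + 2 ∷ + 2 ∷ []) 2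
  ( ((0 ∷ 0 ∷ 2 ∷ []) , (+ 0 ∷ + 2 ∷ + 0 ∷ []))
    ∷ ((1 ∷ []) , (+ 1 ∷ + 0 ∷ + 1 ∷ []))
    ∷ ((0 ∷ 0 ∷ 2 ∷ 0 ∷ 0 ∷ 2 ∷ []) , (+ 1 ∷ + 1 ∷ + 2 ∷ []))
    ∷ ((0 ∷ 2 ∷ 0 ∷ 1 ∷ 0 ∷ 1 ∷ []) , (+ 1 ∷ + 2 ∷ + 1 ∷ [])) ∷ [] )
certEₐ = fromCheck _ _ _ _ _ _ _ _

movesE : List (ℤ × V 3)
movesE = (+ 1 , (+ 0 ∷ + 0 ∷ + 0 ∷ [])) ∷ (+ 1 , (+ 1 ∷ + 0 ∷ + 0 ∷ [])) ∷ (+ 1 , (+ 1 ∷ + 1 ∷ + 0 ∷ [])) ∷ (-[1+ 0 ] , (+ 1 ∷ + 1 ∷ + 1 ∷ [])) ∷ (-[1+ 0 ] , (+ 1 ∷ + 1 ∷ + 2 ∷ [])) ∷ (-[1+ 0 ] , (+ 1 ∷ + 2 ∷ + 2 ∷ [])) ∷ []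

-- The basis is d₁, d₂, d₄, in which d₃ is - d₁ - d₂ - 2d₄.
pointsK₂ : List (V 3)
pointsK₂ = (+ 0 ∷ + 0 ∷ + 0 ∷ []) ∷ (+ 1 ∷ + 0 ∷ + 0 ∷ []) ∷ (+ 0 ∷ + 1 ∷ + 0 ∷ []) ∷ (-[1+ 0 ] ∷ -[1+ 0 ] ∷ -[1+ 1 ] ∷ []) ∷ (+ 0 ∷ + 0 ∷ + 1 ∷ []) ∷ []

pointsK₂′ : List (V 3)
pointsK₂′ = (+ 0 ∷ + 0 ∷ + 0 ∷ []) ∷ (+ 1 ∷ + 0 ∷ + 0 ∷ []) ∷ (+ 0 ∷ + 1 ∷ + 0 ∷ []) ∷ (-[1+ 0 ] ∷ -[1+ 0 ] ∷ -[1+ 1 ] ∷ []) ∷ []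

-- Coordinates of r₁ d₁ + r₂ d₂ + r₃ d₃ in the basis d₁, d₂, d₄. The cell is spanned by d₁, d₂, d₃,
-- which play symmetric roles but generate a sublattice of index two.
twisted : Vec Form 3
twisted = (+ 1 ∷ + 0 ∷ -[1+ 0 ] ∷ + 0 ∷ []) ∷ (+ 0 ∷ + 1 ∷ -[1+ 0 ] ∷ + 0 ∷ []) ∷ (+ 0 ∷ + 0 ∷ -[1+ 1 ] ∷ + 0 ∷ []) ∷ []

-- The half of the cell near the origin, up to the plane through the centre.
small : Form
small = -[1+ 1 ] ∷ -[1+ 1 ] ∷ -[1+ 1 ] ∷ + 3 ∷ []

-- In the near half of the cell, where `slack` is at most zero, `fitA`, `fitB` and `fitC` put d₂ +
-- d₃ - w, - d₄ - w and d₃ - w into P.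
fitA : Form
fitA = -[1+ 3 ] ∷ + 1 ∷ + 1 ∷ -[1+ 0 ] ∷ []

fitB : Form
fitB = + 1 ∷ + 1 ∷ -[1+ 3 ] ∷ + 2 ∷ []

fitC : Form
fitC = + 1 ∷ -[1+ 3 ] ∷ + 1 ∷ + 0 ∷ []

certK₂₁ : Certificate (slack ∷ sorted) pointsK₂ twisted (+ 1) (+ 0 ∷ + 0 ∷ + 0 ∷ []) 1
  ( ((1 ∷ []) , (+ 0 ∷ + 0 ∷ + 0 ∷ []))
    ∷ ((0 ∷ 1 ∷ []) , (+ 1 ∷ + 0 ∷ + 0 ∷ []))
    ∷ ((0 ∷ 1 ∷ 1 ∷ []) , (+ 0 ∷ + 1 ∷ + 0 ∷ []))
    ∷ ((0 ∷ 1 ∷ 1 ∷ 1 ∷ []) , (-[1+ 0 ] ∷ -[1+ 0 ] ∷ -[1+ 1 ] ∷ [])) ∷ [] )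
certK₂₁ = fromCheck _ _ _ _ _ _ _ _

certK₂₂ : Certificate (fitA ∷ -1ℤ ⊛ slack ∷ small ∷ sorted) pointsK₂ twisted (-[1+ 0 ]) (-[1+ 0 ] ∷ + 0 ∷ -[1+ 1 ] ∷ []) 10
  ( ((2 ∷ []) , (+ 1 ∷ + 0 ∷ + 0 ∷ []))
    ∷ ((7 ∷ 0 ∷ 5 ∷ 40 ∷ 0 ∷ 5 ∷ []) , (+ 0 ∷ + 1 ∷ + 0 ∷ []))
    ∷ ((0 ∷ 0 ∷ 0 ∷ 4 ∷ 2 ∷ 0 ∷ 8 ∷ []) , (-[1+ 0 ] ∷ -[1+ 0 ] ∷ -[1+ 1 ] ∷ []))
    ∷ ((0 ∷ 4 ∷ []) , (+ 0 ∷ + 0 ∷ + 1 ∷ [])) ∷ [] )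
certK₂₂ = fromCheck _ _ _ _ _ _ _ _

certK₂₃ : Certificate (fitB ∷ -1ℤ ⊛ slack ∷ small ∷ sorted) pointsK₂ twisted (-[1+ 0 ]) (+ 0 ∷ + 0 ∷ -[1+ 0 ] ∷ []) 5
  ( ((1 ∷ 0 ∷ 0 ∷ 0 ∷ 5 ∷ 5 ∷ []) , (+ 1 ∷ + 0 ∷ + 0 ∷ []))
    ∷ ((1 ∷ 0 ∷ 0 ∷ 0 ∷ 0 ∷ 5 ∷ []) , (+ 0 ∷ + 1 ∷ + 0 ∷ []))
    ∷ ((1 ∷ []) , (-[1+ 0 ] ∷ -[1+ 0 ] ∷ -[1+ 1 ] ∷ []))
    ∷ ((0 ∷ 4 ∷ 1 ∷ []) , (+ 0 ∷ + 0 ∷ + 1 ∷ [])) ∷ [] )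
certK₂₃ = fromCheck _ _ _ _ _ _ _ _

certK₂₄ : Certificate (fitC ∷ -1ℤ ⊛ slack ∷ small ∷ sorted) pointsK₂ twisted (-[1+ 0 ]) (-[1+ 0 ] ∷ -[1+ 0 ] ∷ -[1+ 1 ] ∷ []) 5
  ( ((1 ∷ 0 ∷ 0 ∷ 0 ∷ 5 ∷ []) , (+ 1 ∷ + 0 ∷ + 0 ∷ []))
    ∷ ((1 ∷ []) , (+ 0 ∷ + 1 ∷ + 0 ∷ []))
    ∷ ((0 ∷ 0 ∷ 1 ∷ 6 ∷ 3 ∷ 0 ∷ 2 ∷ []) , (-[1+ 0 ] ∷ -[1+ 0 ] ∷ -[1+ 1 ] ∷ []))
    ∷ ((0 ∷ 6 ∷ 2 ∷ []) , (+ 0 ∷ + 0 ∷ + 1 ∷ [])) ∷ [] )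
certK₂₄ = fromCheck _ _ _ _ _ _ _ _

certK₂₅ : Certificate (-1ℤ ⊛ fitA ∷ -1ℤ ⊛ fitB ∷ -1ℤ ⊛ fitC ∷ -1ℤ ⊛ slack ∷ small ∷ sorted) ((+ 0 ∷ + 0 ∷ -[1+ 0 ] ∷ []) ∷ sumsOf pointsK₂ pointsK₂′) twisted (+ 1) (+ 0 ∷ + 0 ∷ + 0 ∷ []) 60
  ( ((0 ∷ 3 ∷ []) , (-[1+ 1 ] ∷ -[1+ 1 ] ∷ -[1+ 3 ] ∷ []))
    ∷ ((0 ∷ 15 ∷ []) , (-[1+ 0 ] ∷ -[1+ 0 ] ∷ -[1+ 1 ] ∷ []))
    ∷ ((0 ∷ 0 ∷ 0 ∷ 0 ∷ 10 ∷ []) , (-[1+ 0 ] ∷ -[1+ 0 ] ∷ -[1+ 0 ] ∷ []))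
    ∷ ((12 ∷ 3 ∷ 0 ∷ 0 ∷ 2 ∷ 0 ∷ 60 ∷ []) , (-[1+ 0 ] ∷ + 0 ∷ -[1+ 1 ] ∷ []))
    ∷ ((15 ∷ 3 ∷ 3 ∷ 0 ∷ 2 ∷ []) , (+ 0 ∷ -[1+ 0 ] ∷ -[1+ 1 ] ∷ []))
    ∷ ((6 ∷ 0 ∷ 6 ∷ 0 ∷ 10 ∷ []) , (+ 0 ∷ + 0 ∷ + 0 ∷ []))
    ∷ ((3 ∷ 0 ∷ 3 ∷ []) , (+ 0 ∷ + 1 ∷ + 0 ∷ [])) ∷ [] )
certK₂₅ = fromCheck _ _ _ _ _ _ _ _

certK₂₆ : Certificate (-1ℤ ⊛ fitA ∷ -1ℤ ⊛ fitB ∷ -1ℤ ⊛ fitC ∷ -1ℤ ⊛ slack ∷ small ∷ sorted) ((+ 0 ∷ + 0 ∷ -[1+ 0 ] ∷ []) ∷ sumsOf pointsK₂ pointsK₂′) twisted (+ 1) (+ 0 ∷ + 0 ∷ + 1 ∷ []) 30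
  ( ((0 ∷ 0 ∷ 0 ∷ 6 ∷ []) , (-[1+ 1 ] ∷ -[1+ 1 ] ∷ -[1+ 3 ] ∷ []))
    ∷ ((0 ∷ 9 ∷ 0 ∷ 0 ∷ 12 ∷ 0 ∷ 15 ∷ []) , (-[1+ 0 ] ∷ -[1+ 0 ] ∷ -[1+ 0 ] ∷ []))
    ∷ ((0 ∷ 0 ∷ 0 ∷ 6 ∷ []) , (-[1+ 0 ] ∷ + 0 ∷ -[1+ 1 ] ∷ []))
    ∷ ((4 ∷ []) , (+ 0 ∷ -[1+ 0 ] ∷ -[1+ 1 ] ∷ []))
    ∷ ((10 ∷ []) , (+ 0 ∷ + 0 ∷ + 1 ∷ []))
    ∷ ((0 ∷ 1 ∷ 6 ∷ 0 ∷ 4 ∷ 0 ∷ 5 ∷ []) , (+ 0 ∷ + 1 ∷ + 1 ∷ [])) ∷ [] )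
certK₂₆ = fromCheck _ _ _ _ _ _ _ _

certK₂₇ : Certificate (-1ℤ ⊛ fitA ∷ -1ℤ ⊛ fitB ∷ -1ℤ ⊛ fitC ∷ -1ℤ ⊛ slack ∷ small ∷ sorted) ((+ 0 ∷ + 0 ∷ -[1+ 0 ] ∷ []) ∷ sumsOf pointsK₂ pointsK₂′) twisted (+ 1) (+ 1 ∷ + 1 ∷ + 2 ∷ []) 15
  ( ((0 ∷ 1 ∷ []) , (+ 0 ∷ -[1+ 0 ] ∷ -[1+ 1 ] ∷ []))
    ∷ ((0 ∷ 4 ∷ []) , (+ 0 ∷ + 0 ∷ + 0 ∷ []))
    ∷ ((0 ∷ 2 ∷ []) , (+ 0 ∷ + 1 ∷ + 0 ∷ []))
    ∷ ((0 ∷ 0 ∷ 0 ∷ 0 ∷ 4 ∷ 0 ∷ 5 ∷ []) , (+ 0 ∷ + 1 ∷ + 1 ∷ []))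
    ∷ ((2 ∷ 0 ∷ 3 ∷ []) , (+ 0 ∷ + 2 ∷ + 0 ∷ []))
    ∷ ((5 ∷ 0 ∷ 3 ∷ 0 ∷ 3 ∷ []) , (+ 1 ∷ + 0 ∷ + 1 ∷ []))
    ∷ ((1 ∷ []) , (+ 1 ∷ + 1 ∷ + 0 ∷ [])) ∷ [] )
certK₂₇ = fromCheck _ _ _ _ _ _ _ _

certK₂₈ : Certificate (-1ℤ ⊛ fitA ∷ -1ℤ ⊛ fitB ∷ -1ℤ ⊛ fitC ∷ -1ℤ ⊛ slack ∷ small ∷ sorted) ((+ 0 ∷ + 0 ∷ -[1+ 0 ] ∷ []) ∷ sumsOf pointsK₂ pointsK₂′) twisted (+ 1) (+ 1 ∷ + 0 ∷ + 1 ∷ []) 75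
  ( ((0 ∷ 0 ∷ 0 ∷ 0 ∷ 4 ∷ 0 ∷ 5 ∷ []) , (-[1+ 1 ] ∷ -[1+ 1 ] ∷ -[1+ 3 ] ∷ []))
    ∷ ((0 ∷ 4 ∷ 0 ∷ 0 ∷ 0 ∷ 0 ∷ 30 ∷ []) , (-[1+ 0 ] ∷ -[1+ 0 ] ∷ -[1+ 0 ] ∷ []))
    ∷ ((19 ∷ 22 ∷ 0 ∷ 0 ∷ 3 ∷ []) , (+ 0 ∷ -[1+ 0 ] ∷ -[1+ 1 ] ∷ []))
    ∷ ((0 ∷ 0 ∷ 15 ∷ []) , (+ 1 ∷ + 0 ∷ + 0 ∷ []))
    ∷ ((18 ∷ 8 ∷ 0 ∷ 0 ∷ 27 ∷ []) , (+ 1 ∷ + 0 ∷ + 1 ∷ []))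
    ∷ ((0 ∷ 0 ∷ 12 ∷ []) , (+ 1 ∷ + 1 ∷ + 0 ∷ []))
    ∷ ((4 ∷ []) , (+ 2 ∷ + 0 ∷ + 0 ∷ [])) ∷ [] )
certK₂₈ = fromCheck _ _ _ _ _ _ _ _

movesK₂ : List (ℤ × V 3)
movesK₂ = (+ 1 , (+ 0 ∷ + 0 ∷ + 0 ∷ [])) ∷ (+ 1 , (+ 0 ∷ + 0 ∷ + 1 ∷ [])) ∷ (+ 1 , (+ 1 ∷ + 1 ∷ + 2 ∷ [])) ∷ (+ 1 , (+ 1 ∷ + 0 ∷ + 1 ∷ [])) ∷ []

pointsK₁ : List (V 3)
pointsK₁ = (+ 0 ∷ + 0 ∷ + 0 ∷ []) ∷ (+ 1 ∷ + 0 ∷ + 0 ∷ []) ∷ (+ 0 ∷ + 1 ∷ + 0 ∷ []) ∷ (+ 0 ∷ + 0 ∷ + 1 ∷ []) ∷ (-[1+ 0 ] ∷ -[1+ 0 ] ∷ -[1+ 0 ] ∷ []) ∷ []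

pointsK₁′ : List (V 3)
pointsK₁′ = (+ 0 ∷ + 0 ∷ + 0 ∷ []) ∷ (+ 1 ∷ + 0 ∷ + 0 ∷ []) ∷ (+ 0 ∷ + 1 ∷ + 0 ∷ []) ∷ (+ 0 ∷ + 0 ∷ + 1 ∷ []) ∷ []

-- If a form `lo` is at most zero, w minus a corner of the chamber lies in P; if a form `hi` is, a
-- corner minus w does. Where all eight are nonnegative, w minus each of the four corners 0, d₃, d₂
-- + d₃, d₁ + d₂ + d₃ lies in K.
lo₁ : Form
lo₁ = + 1 ∷ + 1 ∷ + 1 ∷ -[1+ 0 ] ∷ []

hi₁ : Form
hi₁ = -[1+ 0 ] ∷ -[1+ 0 ] ∷ -[1+ 0 ] ∷ + 2 ∷ []

certP₁ : Certificate (-1ℤ ⊛ lo₁ ∷ sorted) pointsK₁ identity (+ 1) (+ 0 ∷ + 0 ∷ + 0 ∷ []) 1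
  ( ((1 ∷ []) , (+ 0 ∷ + 0 ∷ + 0 ∷ []))
    ∷ ((0 ∷ 1 ∷ []) , (+ 1 ∷ + 0 ∷ + 0 ∷ []))
    ∷ ((0 ∷ 1 ∷ 1 ∷ []) , (+ 0 ∷ + 1 ∷ + 0 ∷ []))
    ∷ ((0 ∷ 1 ∷ 1 ∷ 1 ∷ []) , (+ 0 ∷ + 0 ∷ + 1 ∷ [])) ∷ [] )
certP₁ = fromCheck _ _ _ _ _ _ _ _

certN₁ : Certificate (-1ℤ ⊛ hi₁ ∷ sorted) pointsK₁ identity (-[1+ 0 ]) (+ 1 ∷ + 1 ∷ + 1 ∷ []) 1
  ( ((1 ∷ []) , (+ 0 ∷ + 0 ∷ + 0 ∷ []))
    ∷ ((0 ∷ 0 ∷ 1 ∷ 1 ∷ 1 ∷ []) , (+ 1 ∷ + 0 ∷ + 0 ∷ []))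
    ∷ ((0 ∷ 0 ∷ 0 ∷ 1 ∷ 1 ∷ []) , (+ 0 ∷ + 1 ∷ + 0 ∷ []))
    ∷ ((0 ∷ 0 ∷ 0 ∷ 0 ∷ 1 ∷ []) , (+ 0 ∷ + 0 ∷ + 1 ∷ [])) ∷ [] )
certN₁ = fromCheck _ _ _ _ _ _ _ _

lo₂ : Form
lo₂ = + 1 ∷ + 1 ∷ -[1+ 2 ] ∷ + 2 ∷ []

hi₂ : Form
hi₂ = -[1+ 0 ] ∷ -[1+ 0 ] ∷ + 3 ∷ -[1+ 0 ] ∷ []

certP₂ : Certificate (-1ℤ ⊛ lo₂ ∷ sorted) pointsK₁ identity (+ 1) (+ 0 ∷ + 0 ∷ -[1+ 0 ] ∷ []) 4
  ( ((0 ∷ 3 ∷ 0 ∷ 1 ∷ 2 ∷ []) , (+ 1 ∷ + 0 ∷ + 0 ∷ []))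
    ∷ ((0 ∷ 3 ∷ 4 ∷ 1 ∷ 2 ∷ []) , (+ 0 ∷ + 1 ∷ + 0 ∷ []))
    ∷ ((1 ∷ []) , (+ 0 ∷ + 0 ∷ + 1 ∷ []))
    ∷ ((1 ∷ 0 ∷ 0 ∷ 0 ∷ 4 ∷ []) , (-[1+ 0 ] ∷ -[1+ 0 ] ∷ -[1+ 0 ] ∷ [])) ∷ [] )
certP₂ = fromCheck _ _ _ _ _ _ _ _

certN₂ : Certificate (-1ℤ ⊛ hi₂ ∷ sorted) pointsK₁ identity (-[1+ 0 ]) (+ 0 ∷ + 0 ∷ + 0 ∷ []) 1
  ( ((1 ∷ []) , (+ 0 ∷ + 0 ∷ + 0 ∷ []))
    ∷ ((0 ∷ 0 ∷ 1 ∷ 1 ∷ []) , (+ 1 ∷ + 0 ∷ + 0 ∷ []))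
    ∷ ((0 ∷ 0 ∷ 0 ∷ 1 ∷ []) , (+ 0 ∷ + 1 ∷ + 0 ∷ []))
    ∷ ((0 ∷ 1 ∷ 1 ∷ 1 ∷ []) , (-[1+ 0 ] ∷ -[1+ 0 ] ∷ -[1+ 0 ] ∷ [])) ∷ [] )
certN₂ = fromCheck _ _ _ _ _ _ _ _

lo₃ : Form
lo₃ = + 1 ∷ -[1+ 2 ] ∷ + 1 ∷ + 1 ∷ []

hi₃ : Form
hi₃ = -[1+ 0 ] ∷ + 3 ∷ -[1+ 0 ] ∷ + 0 ∷ []

certP₃ : Certificate (-1ℤ ⊛ lo₃ ∷ sorted) pointsK₁ identity (+ 1) (+ 0 ∷ -[1+ 0 ] ∷ -[1+ 0 ] ∷ []) 4
  ( ((0 ∷ 4 ∷ 1 ∷ 2 ∷ 3 ∷ []) , (+ 1 ∷ + 0 ∷ + 0 ∷ []))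
    ∷ ((1 ∷ []) , (+ 0 ∷ + 1 ∷ + 0 ∷ []))
    ∷ ((1 ∷ 0 ∷ 0 ∷ 4 ∷ []) , (+ 0 ∷ + 0 ∷ + 1 ∷ []))
    ∷ ((0 ∷ 0 ∷ 1 ∷ 2 ∷ 3 ∷ []) , (-[1+ 0 ] ∷ -[1+ 0 ] ∷ -[1+ 0 ] ∷ [])) ∷ [] )
certP₃ = fromCheck _ _ _ _ _ _ _ _

certN₃ : Certificate (-1ℤ ⊛ hi₃ ∷ sorted) pointsK₁ identity (-[1+ 0 ]) (+ 0 ∷ + 0 ∷ + 1 ∷ []) 1
  ( ((1 ∷ []) , (+ 0 ∷ + 0 ∷ + 0 ∷ []))
    ∷ ((0 ∷ 0 ∷ 1 ∷ []) , (+ 1 ∷ + 0 ∷ + 0 ∷ []))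
    ∷ ((0 ∷ 1 ∷ 1 ∷ 0 ∷ 1 ∷ []) , (+ 0 ∷ + 0 ∷ + 1 ∷ []))
    ∷ ((0 ∷ 1 ∷ 1 ∷ []) , (-[1+ 0 ] ∷ -[1+ 0 ] ∷ -[1+ 0 ] ∷ [])) ∷ [] )
certN₃ = fromCheck _ _ _ _ _ _ _ _

lo₄ : Form
lo₄ = -[1+ 2 ] ∷ + 1 ∷ + 1 ∷ + 0 ∷ []

hi₄ : Form
hi₄ = + 3 ∷ -[1+ 0 ] ∷ -[1+ 0 ] ∷ + 1 ∷ []

certP₄ : Certificate (-1ℤ ⊛ lo₄ ∷ sorted) pointsK₁ identity (+ 1) (-[1+ 0 ] ∷ -[1+ 0 ] ∷ -[1+ 0 ] ∷ []) 4
  ( ((1 ∷ []) , (+ 1 ∷ + 0 ∷ + 0 ∷ []))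
    ∷ ((1 ∷ 0 ∷ 4 ∷ []) , (+ 0 ∷ + 1 ∷ + 0 ∷ []))
    ∷ ((0 ∷ 1 ∷ 2 ∷ 3 ∷ []) , (+ 0 ∷ + 0 ∷ + 1 ∷ []))
    ∷ ((0 ∷ 1 ∷ 2 ∷ 3 ∷ 4 ∷ []) , (-[1+ 0 ] ∷ -[1+ 0 ] ∷ -[1+ 0 ] ∷ [])) ∷ [] )
certP₄ = fromCheck _ _ _ _ _ _ _ _

certN₄ : Certificate (-1ℤ ⊛ hi₄ ∷ sorted) pointsK₁ identity (-[1+ 0 ]) (+ 0 ∷ + 1 ∷ + 1 ∷ []) 1
  ( ((1 ∷ []) , (+ 0 ∷ + 0 ∷ + 0 ∷ []))
    ∷ ((0 ∷ 1 ∷ 0 ∷ 1 ∷ 1 ∷ []) , (+ 0 ∷ + 1 ∷ + 0 ∷ []))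
    ∷ ((0 ∷ 1 ∷ 0 ∷ 0 ∷ 1 ∷ []) , (+ 0 ∷ + 0 ∷ + 1 ∷ []))
    ∷ ((0 ∷ 1 ∷ []) , (-[1+ 0 ] ∷ -[1+ 0 ] ∷ -[1+ 0 ] ∷ [])) ∷ [] )
certN₄ = fromCheck _ _ _ _ _ _ _ _

bounds : List Form
bounds = lo₁ ∷ lo₂ ∷ lo₃ ∷ lo₄ ∷ hi₁ ∷ hi₂ ∷ hi₃ ∷ hi₄ ∷ sorted

certK₁ : Certificate bounds (sumsOf pointsK₁ pointsK₁′) identity (+ 1) (+ 0 ∷ + 0 ∷ + 0 ∷ []) 4
  ( ((0 ∷ 0 ∷ 0 ∷ 0 ∷ 1 ∷ []) , (-[1+ 0 ] ∷ + 0 ∷ -[1+ 0 ] ∷ []))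
    ∷ ((0 ∷ 0 ∷ 0 ∷ 0 ∷ 0 ∷ 1 ∷ []) , (+ 0 ∷ + 0 ∷ + 2 ∷ []))
    ∷ ((0 ∷ 1 ∷ 0 ∷ 1 ∷ []) , (+ 0 ∷ + 1 ∷ + 1 ∷ []))
    ∷ ((1 ∷ []) , (+ 0 ∷ + 2 ∷ + 0 ∷ []))
    ∷ ((1 ∷ 1 ∷ 1 ∷ []) , (+ 1 ∷ + 0 ∷ + 1 ∷ [])) ∷ [] )
certK₁ = fromCheck _ _ _ _ _ _ _ _

certK₂ : Certificate bounds (sumsOf pointsK₁ pointsK₁′) identity (+ 1) (+ 0 ∷ + 0 ∷ -[1+ 0 ] ∷ []) 8
  ( ((0 ∷ 0 ∷ 0 ∷ 0 ∷ 0 ∷ 0 ∷ 2 ∷ []) , (-[1+ 0 ] ∷ + 0 ∷ -[1+ 0 ] ∷ []))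
    ∷ ((0 ∷ 0 ∷ 2 ∷ 0 ∷ 2 ∷ []) , (+ 0 ∷ -[1+ 0 ] ∷ -[1+ 0 ] ∷ []))
    ∷ ((0 ∷ 0 ∷ 0 ∷ 0 ∷ 0 ∷ 1 ∷ []) , (+ 0 ∷ + 0 ∷ + 2 ∷ []))
    ∷ ((0 ∷ 0 ∷ 1 ∷ 1 ∷ 1 ∷ []) , (+ 0 ∷ + 2 ∷ + 0 ∷ []))
    ∷ ((4 ∷ 2 ∷ []) , (+ 1 ∷ + 1 ∷ + 0 ∷ [])) ∷ [] )
certK₂ = fromCheck _ _ _ _ _ _ _ _

certK₃ : Certificate bounds (sumsOf pointsK₁ pointsK₁′) identity (+ 1) (+ 0 ∷ -[1+ 0 ] ∷ -[1+ 0 ] ∷ []) 8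
  ( ((0 ∷ 0 ∷ 0 ∷ 2 ∷ []) , (-[1+ 0 ] ∷ -[1+ 0 ] ∷ + 0 ∷ []))
    ∷ ((1 ∷ 3 ∷ 3 ∷ 1 ∷ []) , (+ 0 ∷ -[1+ 0 ] ∷ -[1+ 0 ] ∷ []))
    ∷ ((2 ∷ 0 ∷ 2 ∷ []) , (+ 1 ∷ + 0 ∷ + 1 ∷ []))
    ∷ ((0 ∷ 0 ∷ 0 ∷ 0 ∷ 0 ∷ 0 ∷ 2 ∷ []) , (+ 1 ∷ + 1 ∷ + 0 ∷ [])) ∷ [] )
certK₃ = fromCheck _ _ _ _ _ _ _ _

certK₄ : Certificate bounds (sumsOf pointsK₁ pointsK₁′) identity (+ 1) (-[1+ 0 ] ∷ -[1+ 0 ] ∷ -[1+ 0 ] ∷ []) 4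
  ( ((0 ∷ 0 ∷ 1 ∷ 1 ∷ 1 ∷ []) , (-[1+ 0 ] ∷ -[1+ 0 ] ∷ + 0 ∷ []))
    ∷ ((1 ∷ 1 ∷ 0 ∷ 1 ∷ []) , (-[1+ 0 ] ∷ + 0 ∷ -[1+ 0 ] ∷ []))
    ∷ ((0 ∷ 0 ∷ 0 ∷ 0 ∷ 0 ∷ 0 ∷ 0 ∷ 1 ∷ []) , (+ 0 ∷ -[1+ 0 ] ∷ -[1+ 0 ] ∷ []))
    ∷ ((1 ∷ []) , (+ 0 ∷ + 0 ∷ + 2 ∷ [])) ∷ [] )
certK₄ = fromCheck _ _ _ _ _ _ _ _

-- With no relation and no miss allowed, every nontrivial dependence modulo three is contradictory;
-- the second half ensures that φ turns nonzero digits into a nontrivial one.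
Resolved₃ : Config → (Vec (Fin 3) 3 → F) → Set
Resolved₃ C φ = ∀ x y z → Good (known C) (primitives C) (nonzeros C) [] [] (φ (x ∷ y ∷ z ∷ []))
                        × (φ (x ∷ y ∷ z ∷ []) ≡ 0ᵥ → (x ∷ y ∷ z ∷ []) ≡ Vec.replicate 3 zero)

resolved₃? : ∀ C φ → Dec (Resolved₃ C φ)
resolved₃? C φ = go (known C) (primitives C) (nonzeros C)
  where
  go : ∀ kn pd nz → Dec (∀ x y z → Good kn pd nz [] [] (φ (x ∷ y ∷ z ∷ [])) × (φ (x ∷ y ∷ z ∷ []) ≡ 0ᵥ → (x ∷ y ∷ z ∷ []) ≡ Vec.replicate 3 zero))
  go kn pd nz = FinP.all? λ x → FinP.all? λ y → FinP.all? λ z → good? kn pd nz [] [] _ ×-dec ((_ ≟ᵥ _) →-dec VecP.≡-dec Fin._≟_ _ _)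

plain twist : Vec (Fin 3) 3 → F
plain (x ∷ y ∷ z ∷ []) = + toℕ x ∷ + toℕ y ∷ + toℕ z ∷ + 0 ∷ + 0 ∷ []
twist (x ∷ y ∷ z ∷ []) = + toℕ x ℤ.- + toℕ z ∷ + toℕ y ℤ.- + toℕ z ∷ -[1+ 1 ] ℤ.* + toℕ z ∷ + 0 ∷ + 0 ∷ []

pad : V 3 → F
pad (x ∷ y ∷ z ∷ []) = x ∷ y ∷ z ∷ + 0 ∷ + 0 ∷ []

configOf : List (V 3) → List (V 3) → Config
configOf ps qs = record { as = List.map pad ps ; bs = List.map pad qs ; extra = [] ; res = [] ; miss = [] ; dropped = last5 }

resolvedE : Resolved₃ (configOf pointsE pointsE′) plain
resolvedE = toWitness {a? = resolved₃? (configOf pointsE pointsE′) plain} _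

resolvedK₁ : Resolved₃ (configOf pointsK₁ pointsK₁′) plain
resolvedK₁ = toWitness {a? = resolved₃? (configOf pointsK₁ pointsK₁′) plain} _

resolvedK₂ : Resolved₃ (configOf pointsK₂ pointsK₂′) plain
resolvedK₂ = toWitness {a? = resolved₃? (configOf pointsK₂ pointsK₂′) plain} _

resolvedK₂′ : Resolved₃ (configOf pointsK₂ pointsK₂′) twist
resolvedK₂′ = toWitness {a? = resolved₃? (configOf pointsK₂ pointsK₂′) twist} _

difference-nat : ∀ {m n} → m ℕ.≤ n → + (n ℕ.∸ m) ≡ + n ℤ.- + m
difference-nat {m} {n} le = sym (trans (ℤP.m-n≡m⊖n n m) (ℤP.⊖-≥ le))

module _ {D₀ D : Vec Z3 3} {w : Z3} (fr : Fraction D₀ w) where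
  open Fraction fr

  numerators : V 4
  numerators = + r₁ ∷ + r₂ ∷ + r₃ ∷ + k ∷ []

  sorted-nonneg : r₁ ℕ.≤ r₂ → r₂ ℕ.≤ r₃ → All (Nonneg numerators) sorted
  sorted-nonneg le₁₂ le₂₃ = (r₁ , e₁′ (+ r₁) (+ r₂) (+ r₃) (+ k)) ∷ (r₂ ℕ.∸ r₁ , trans (difference-nat le₁₂) (e₂′ (+ r₁) (+ r₂) (+ r₃) (+ k)))
    ∷ (r₃ ℕ.∸ r₂ , trans (difference-nat le₂₃) (e₃′ (+ r₁) (+ r₂) (+ r₃) (+ k))) ∷ (k ℕ.∸ r₃ , trans (difference-nat r₃≤k) (e₄′ (+ r₁) (+ r₂) (+ r₃) (+ k))) ∷ []
    where
    e₁′ : ∀ (a b c d : ℤ) → a ≡ + 1 ℤ.* a ℤ.+ (+ 0 ℤ.* b ℤ.+ (+ 0 ℤ.* c ℤ.+ (+ 0 ℤ.* d ℤ.+ + 0)))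
    e₁′ = solve-∀
    e₂′ : ∀ (a b c d : ℤ) → b ℤ.- a ≡ -[1+ 0 ] ℤ.* a ℤ.+ (+ 1 ℤ.* b ℤ.+ (+ 0 ℤ.* c ℤ.+ (+ 0 ℤ.* d ℤ.+ + 0)))
    e₂′ = solve-∀
    e₃′ : ∀ (a b c d : ℤ) → c ℤ.- b ≡ + 0 ℤ.* a ℤ.+ (-[1+ 0 ] ℤ.* b ℤ.+ (+ 1 ℤ.* c ℤ.+ (+ 0 ℤ.* d ℤ.+ + 0)))
    e₃′ = solve-∀
    e₄′ : ∀ (a b c d : ℤ) → d ℤ.- c ≡ + 0 ℤ.* a ℤ.+ (+ 0 ℤ.* b ℤ.+ (-[1+ 0 ] ℤ.* c ℤ.+ (+ 1 ℤ.* d ℤ.+ + 0)))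
    e₄′ = solve-∀

identity-coords : ∀ D r₁ r₂ r₃ k → ev (r₁ ∷ r₂ ∷ r₃ ∷ []) D ≡ ev (Vec.map (λ f → dot f (r₁ ∷ r₂ ∷ r₃ ∷ k ∷ [])) identity) D
identity-coords D a b c d = cong (λ v → ev v D) (cong₂ _∷_ (g₁ a b c d) (cong₂ _∷_ (g₂ a b c d) (cong₂ _∷_ (g₃ a b c d) refl)))
  where
  g₁ : ∀ (a b c d : ℤ) → a ≡ + 1 ℤ.* a ℤ.+ (+ 0 ℤ.* b ℤ.+ (+ 0 ℤ.* c ℤ.+ (+ 0 ℤ.* d ℤ.+ + 0)))
  g₁ = solve-∀
  g₂ : ∀ (a b c d : ℤ) → b ≡ + 0 ℤ.* a ℤ.+ (+ 1 ℤ.* b ℤ.+ (+ 0 ℤ.* c ℤ.+ (+ 0 ℤ.* d ℤ.+ + 0)))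
  g₂ = solve-∀
  g₃ : ∀ (a b c d : ℤ) → c ≡ + 0 ℤ.* a ℤ.+ (+ 0 ℤ.* b ℤ.+ (+ 1 ℤ.* c ℤ.+ (+ 0 ℤ.* d ℤ.+ + 0)))
  g₃ = solve-∀

swap-fraction₁₂ : ∀ {a b c w} → Fraction (a ∷ b ∷ c ∷ []) w → Fraction (b ∷ a ∷ c ∷ []) w
swap-fraction₁₂ {a} {b} {c} fr = record { k = k ; r₁ = r₂ ; r₂ = r₁ ; r₃ = r₃ ; 0<k = 0<k ; r₁≤k = r₂≤k ; r₂≤k = r₁≤k ; r₃≤k = r₃≤k
  ; fraction = trans fraction (vec≡ (+ r₁ ∙ a ∷ + r₂ ∙ b ∷ + r₃ ∙ c ∷ []) (v₀ :+ (v₁ :+ (v₂ :+ :0))) (v₁ :+ (v₀ :+ (v₂ :+ :0))) refl) }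
  where open Fraction fr

swap-fraction₂₃ : ∀ {a b c w} → Fraction (a ∷ b ∷ c ∷ []) w → Fraction (a ∷ c ∷ b ∷ []) w
swap-fraction₂₃ {a} {b} {c} fr = record { k = k ; r₁ = r₁ ; r₂ = r₃ ; r₃ = r₂ ; 0<k = 0<k ; r₁≤k = r₁≤k ; r₂≤k = r₃≤k ; r₃≤k = r₂≤k
  ; fraction = trans fraction (vec≡ (+ r₁ ∙ a ∷ + r₂ ∙ b ∷ + r₃ ∙ c ∷ []) (v₀ :+ (v₁ :+ (v₂ :+ :0))) (v₀ :+ (v₂ :+ (v₁ :+ :0))) refl) }
  where open Fraction fr

-- Tools for showing that the differences of P generate the lattice

Generators : Set₁
Generators = Z3 → Z3 → Z3 → Set

-- The order of the numerators may be chosen when the statement is symmetric.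
sort : ∀ {R Gv : Generators} {w} →
  (∀ {a b c} → R a b c → R b a c) → (∀ {a b c} → R a b c → R a c b) →
  (∀ {a b c} → R a b c → Gv b a c → Gv a b c) → (∀ {a b c} → R a b c → Gv a c b → Gv a b c) →
  (∀ {a b c} → R a b c → (fr : Fraction (a ∷ b ∷ c ∷ []) w) → Fraction.r₁ fr ℕ.≤ Fraction.r₂ fr → Fraction.r₂ fr ℕ.≤ Fraction.r₃ fr → Gv a b c) →
  ∀ {a b c} → R a b c → Fraction (a ∷ b ∷ c ∷ []) w → Gv a b c
sort {R} {Gv} {w} R₁₂ R₂₃ Gv₁₂ Gv₂₃ core {a} {b} {c} R₀ fr = go (ℕP.≤-total r₁ r₂) (ℕP.≤-total r₂ r₃) (ℕP.≤-total r₁ r₃)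
  where
  open Fraction fr
  F₁₂ = swap-fraction₁₂ fr
  F₂₃ = swap-fraction₂₃ fr
  go : r₁ ℕ.≤ r₂ ⊎ r₂ ℕ.≤ r₁ → r₂ ℕ.≤ r₃ ⊎ r₃ ℕ.≤ r₂ → r₁ ℕ.≤ r₃ ⊎ r₃ ℕ.≤ r₁ → Gv a b c
  go (inj₁ x) (inj₁ y) _ = core R₀ fr x y
  go (inj₁ x) (inj₂ y) (inj₁ z) = Gv₂₃ R₀ (core (R₂₃ R₀) F₂₃ z y)
  go (inj₁ x) (inj₂ y) (inj₂ z) = Gv₂₃ R₀ (Gv₁₂ (R₂₃ R₀) (core (R₁₂ (R₂₃ R₀)) (swap-fraction₁₂ F₂₃) z x))
  go (inj₂ x) _ (inj₁ z) = Gv₁₂ R₀ (core (R₁₂ R₀) F₁₂ x z)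
  go (inj₂ x) (inj₁ y) (inj₂ z) = Gv₁₂ R₀ (Gv₂₃ (R₁₂ R₀) (core (R₂₃ (R₁₂ R₀)) (swap-fraction₂₃ F₁₂) y z))
  go (inj₂ x) (inj₂ y) (inj₂ z) = Gv₁₂ R₀ (Gv₂₃ (R₁₂ R₀) (Gv₁₂ (R₂₃ (R₁₂ R₀)) (core (R₁₂ (R₂₃ (R₁₂ R₀))) (swap-fraction₁₂ (swap-fraction₂₃ F₁₂)) y x)))

formal₁₂ : ∀ {a b c w} → Formal (b ∷ a ∷ c ∷ []) w → Formal (a ∷ b ∷ c ∷ []) w
formal₁₂ {a} {b} {c} (x ∷ y ∷ z ∷ [] , e) = (y ∷ x ∷ z ∷ []) , trans e (vec≡ (y ∙ a ∷ x ∙ b ∷ z ∙ c ∷ []) (v₁ :+ (v₀ :+ (v₂ :+ :0))) (v₀ :+ (v₁ :+ (v₂ :+ :0))) refl)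

formal₂₃ : ∀ {a b c w} → Formal (a ∷ c ∷ b ∷ []) w → Formal (a ∷ b ∷ c ∷ []) w
formal₂₃ {a} {b} {c} (x ∷ y ∷ z ∷ [] , e) = (x ∷ z ∷ y ∷ []) , trans e (vec≡ (x ∙ a ∷ z ∙ b ∷ y ∙ c ∷ []) (v₀ :+ (v₂ :+ (v₁ :+ :0))) (v₀ :+ (v₁ :+ (v₂ :+ :0))) refl)

last-first-All : ∀ {X : Z3 → Set} {a b c d e} → All X (a ∷ b ∷ c ∷ d ∷ e ∷ []) → All X (e ∷ a ∷ b ∷ c ∷ d ∷ [])
last-first-All (a ∷ b ∷ c ∷ d ∷ e ∷ []) = e ∷ a ∷ b ∷ c ∷ d ∷ []

last-first-Pairs : ∀ {a b c d e : Z3} → AllPairs _≢_ (a ∷ b ∷ c ∷ d ∷ e ∷ []) → AllPairs _≢_ (e ∷ a ∷ b ∷ c ∷ d ∷ [])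
last-first-Pairs ((ab ∷ ac ∷ ad ∷ ae ∷ []) ∷ (bc ∷ bd ∷ be ∷ []) ∷ (cd ∷ ce ∷ []) ∷ (de ∷ []) ∷ [] ∷ []) =
  (≢-sym ae ∷ ≢-sym be ∷ ≢-sym ce ∷ ≢-sym de ∷ []) ∷ (ab ∷ ac ∷ ad ∷ []) ∷ (bc ∷ bd ∷ []) ∷ (cd ∷ []) ∷ [] ∷ []

module _ {P Q K : Z3 → Set} (S : System P Q K) where
  open System S

  Full : Set
  Full = ∀ {xs} → All P xs → AllPairs _≢_ xs → length xs ≡ 5 → ∀ {z} → P z → z ∈ xs

  record Placement (D : Vec Z3 3) (ps qs : List (V 3)) : Set where
    field
      b b'  : Z3
      xs ys : List Z3
      atP : Pointwise (λ p x → x ≡ b ⊞ ev p D) ps xs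
      atQ : Pointwise (λ q y → y ≡ b' ⊞ ev q D) qs ys
      inP : All P xs
      inQ : All Q ys
      dP  : AllPairs _≢_ xs
      dQ  : AllPairs _≢_ ys
      five : length xs ≡ 5

  module _ {d₁ d₂ d₃ : Z3} {ps qs : List (V 3)} (pl : Placement (d₁ ∷ d₂ ∷ d₃ ∷ []) ps qs) where
    open Placement pl

    private
      D : Vec Z3 3
      D = d₁ ∷ d₂ ∷ d₃ ∷ []
      g : Vec Z3 5
      g = d₁ ∷ d₂ ∷ d₃ ∷ o ∷ o ∷ []

      pad-ev : ∀ p → ev (pad p) g ≡ ev p D
      pad-ev (x ∷ y ∷ z ∷ []) = vec≡ (x ∙ d₁ ∷ y ∙ d₂ ∷ z ∙ d₃ ∷ []) (v₀ :+ (v₁ :+ (v₂ :+ (+ 0 :* :0 :+ (+ 0 :* :0 :+ :0))))) (v₀ :+ (v₁ :+ (v₂ :+ :0))) refl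

      padded : ∀ c {fs zs} → Pointwise (λ p x → x ≡ c ⊞ ev p D) fs zs → Pointwise (Located c g) (List.map pad fs) zs
      padded c [] = []
      padded c {f ∷ _} (e ∷ es) = located (trans e (cong (c ⊞_) (sym (pad-ev f)))) ∷ padded c es

    placement-valid : Resolve.Valid S b b' g (configOf ps qs)
    placement-valid = valid S {configOf ps qs} {b} {b'} {g} (padded b atP) (padded b' atQ) inP inQ dP dQ []

    independent-from : ∀ {D'} (φ : Vec (Fin 3) 3 → F) → Resolved₃ (configOf ps qs) φ →
      (∀ d → ev (φ d) g ≡ ev (Vec.map (λ i → + toℕ i) d) D') → Independent₃ D'
    independent-from φ ch eq d@(x ∷ y ∷ z ∷ []) n (m , e) =
      impossible (Resolve.good-sound S b b' g placement-valid (proj₁ (ch x y z)) (λ e → n (proj₂ (ch x y z) e)) (m , trans (eq d) e))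
      where
      impossible : Any (λ r → ev r g ≡ o) [] ⊎ Any (λ l → Multiple 3 (ev l g)) [] → ⊥
      impossible (inj₁ ())
      impossible (inj₂ ())

    frame : Full → Resolved₃ (configOf ps qs) plain → Frame S D ps qs
    frame full ch = record { b = b ; b' = b' ; inP = moved b atP inP ; inQ = moved b' atQ inQ ; onlyP = λ {z} m → only z atP (full inP dP five m)
                           ; ind₃ = independent-from plain ch λ { d@(_ ∷ _ ∷ _ ∷ []) → pad-ev (Vec.map (λ i → + toℕ i) d) } }
      where
      moved : ∀ {X : Z3 → Set} c {fs zs} → Pointwise (λ p x → x ≡ c ⊞ ev p D) fs zs → All X zs → All (λ p → X (c ⊞ ev p D)) fs
      moved c [] [] = []
      moved {X} c (e ∷ es) (x ∷ xs) = subst X e x ∷ moved {X} c es xs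
      only : ∀ z {fs zs} → Pointwise (λ p x → x ≡ b ⊞ ev p D) fs zs → b ⊞ z ∈ zs → ∃[ p ] z ≡ ev p D
      only z {f ∷ _} (e ∷ es) (here q) = f , lin≡ (b ∷ z ∷ ev f D ∷ []) ((+ 1 , v₀ :+ v₁ , v₀ :+ v₂) ∷ []) (trans q e ∷ []) v₁ v₂ refl
      only z (e ∷ es) (there q) = only z es q

  placed : ∀ (x : Expr 3) D c {z} → z ≡ c ⊞ ⟦ x ⟧ D → z ≡ c ⊞ ev (nf x) D
  placed x D c e = trans e (cong (c ⊞_) (nf-sound x D))

  shift-formal : ∀ D q {z} → Formal D (z ⊟ ev q D) → Formal D z
  shift-formal D q {z} (c , e) = c ⊕ᵥ q , trans (lin≡ (z ∷ ev q D ∷ ev c D ∷ []) ((+ 1 , v₀ :- v₁ , v₂) ∷ []) (e ∷ []) v₀ (v₂ :+ v₁) refl) (sym (ev-⊕ c q D))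

  -- Generation of the lattice in type E

  module TypeE (full : Full) {p₄ a q₄ : Z3} where

    Data : Z3 → Z3 → Z3 → Set
    Data d₁ d₂ d₃ = ∃[ q₁ ] ∃[ q₂ ] ∃[ q₃ ] (Inside S (a ⊞ d₁) (a ⊞ d₂) (a ⊞ d₃) p₄ a q₁ q₂ q₃ q₄ × p₄ ≡ a ⊞ (d₁ ⊞ d₂ ⊞ d₃))

    data₁₂ : ∀ {d₁ d₂ d₃} → Data d₁ d₂ d₃ → Data d₂ d₁ d₃
    data₁₂ {d₁} {d₂} {d₃} (q₁ , q₂ , q₃ , I , e) = q₂ , q₁ , q₃ , σ₁₂ S I , trans e (vec≡ (a ∷ d₁ ∷ d₂ ∷ d₃ ∷ []) (v₀ :+ (v₁ :+ v₂ :+ v₃)) (v₀ :+ (v₂ :+ v₁ :+ v₃)) refl)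
    data₂₃ : ∀ {d₁ d₂ d₃} → Data d₁ d₂ d₃ → Data d₁ d₃ d₂
    data₂₃ {d₁} {d₂} {d₃} (q₁ , q₂ , q₃ , I , e) = q₁ , q₃ , q₂ , σ₂₃ S I , trans e (vec≡ (a ∷ d₁ ∷ d₂ ∷ d₃ ∷ []) (v₀ :+ (v₁ :+ v₂ :+ v₃)) (v₀ :+ (v₁ :+ v₃ :+ v₂)) refl)

    placement : ∀ {d₁ d₂ d₃} → Data d₁ d₂ d₃ → Placement (d₁ ∷ d₂ ∷ d₃ ∷ []) pointsE pointsE′
    placement {d₁} {d₂} {d₃} (q₁ , q₂ , q₃ , I , e) = record { b = a ; b' = q₁ ⊟ d₁
        ; atP = placed :0 D a (vec≡ (a ∷ []) v₀ (v₀ :+ :0) refl) ∷ placed v₀ D a refl ∷ placed v₁ D a refl ∷ placed v₂ D a refl ∷ placed (v₀ :+ v₁ :+ v₂) D a e ∷ []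
        ; atQ = placed v₀ D (q₁ ⊟ d₁) l₁ ∷ placed v₁ D (q₁ ⊟ d₁) l₂ ∷ placed v₂ D (q₁ ⊟ d₁) l₃ ∷ placed (v₀ :+ v₁ :+ v₂) D (q₁ ⊟ d₁) l₄ ∷ []
        ; inP = last-first-All inP ; inQ = inQ ; dP = last-first-Pairs dP ; dQ = dQ ; five = refl }
      where
      open Inside I
      D : Vec Z3 3
      D = d₁ ∷ d₂ ∷ d₃ ∷ []
      Gv : Vec Z3 9
      Gv = a ∷ d₁ ∷ d₂ ∷ d₃ ∷ q₁ ∷ q₂ ∷ q₃ ∷ q₄ ∷ p₄ ∷ []
      l₁ : q₁ ≡ (q₁ ⊟ d₁) ⊞ d₁
      l₁ = vec≡ Gv v₄ ((v₄ :- v₁) :+ v₁) refl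
      l₂ : q₂ ≡ (q₁ ⊟ d₁) ⊞ d₂
      l₂ = lin≡ Gv ((-1ℤ , (v₀ :+ v₂) :- (v₀ :+ v₁) , v₅ :- v₄) ∷ []) (same₂ ∷ []) v₅ ((v₄ :- v₁) :+ v₂) refl
      l₃ : q₃ ≡ (q₁ ⊟ d₁) ⊞ d₃
      l₃ = lin≡ Gv ((-1ℤ , (v₀ :+ v₃) :- (v₀ :+ v₁) , v₆ :- v₄) ∷ []) (same₃ ∷ []) v₆ ((v₄ :- v₁) :+ v₃) refl
      l₄ : q₄ ≡ (q₁ ⊟ d₁) ⊞ (d₁ ⊞ d₂ ⊞ d₃)
      l₄ = lin≡ Gv ((-1ℤ , v₈ :- (v₀ :+ v₁) , v₇ :- v₄) ∷ (+ 1 , v₈ , v₀ :+ (v₁ :+ v₂ :+ v₃)) ∷ []) (same₄ ∷ e ∷ []) v₇ ((v₄ :- v₁) :+ (v₁ :+ v₂ :+ v₃)) refl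

    Fr : ∀ {d₁ d₂ d₃} → Data d₁ d₂ d₃ → Frame S (d₁ ∷ d₂ ∷ d₃ ∷ []) pointsE pointsE′
    Fr R = frame (placement R) full resolvedE

    -- If w or its reflection lies in P, it belongs to the lattice of D. Otherwise six translates of
    -- w and - w lie in K, and one of them is congruent to a known point modulo three.
    core : ∀ {w d₁ d₂ d₃} → Data d₁ d₂ d₃ → (fr : Fraction (d₁ ∷ d₂ ∷ d₃ ∷ []) w) → Fraction.r₁ fr ℕ.≤ Fraction.r₂ fr → Fraction.r₂ fr ℕ.≤ Fraction.r₃ fr →
           Formal (d₁ ∷ d₂ ∷ d₃ ∷ []) w
    core {w} {d₁} {d₂} {d₃} R fr le₁ le₂ = go (nonneg-total ρ fitE) (nonneg-total ρ slack) (nonneg-total ρ fitE′) (nonneg-total ρ slack′)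
      where
      D : Vec Z3 3
      D = d₁ ∷ d₂ ∷ d₃ ∷ []
      open Cell {D} {D} fr identity (identity-coords D)
      open Index (Fr R)
      srt = sorted-nonneg {D} {D} fr le₁ le₂
      c : Z3
      c = Frame.b (Fr R) ⊞ Frame.b' (Fr R)
      inside-P : ∀ {fs σ t N es} → Unit σ → All (Nonneg ρ) fs → Certificate fs pointsE identity σ t N es → Formal D w
      inside-P {σ = σ} {t} un nn ce = formal-P w σ t un (certified {P} a (LengthOne.convex oneP) nn (Frame.inP (Fr R)) ce)
      inside-K : ∀ {fs σ t N es} → All (Nonneg ρ) fs → Certificate fs (sumsOf pointsE pointsE′) identity σ t N es → K (c ⊞ (σ ∙ w ⊞ ev t D))
      inside-K nn ce = certified {K} c convex nn sums-in ce
      go : Nonneg ρ fitE ⊎ Nonneg ρ (-1ℤ ⊛ fitE) → Nonneg ρ slack ⊎ Nonneg ρ (-1ℤ ⊛ slack) → Nonneg ρ fitE′ ⊎ Nonneg ρ (-1ℤ ⊛ fitE′) →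
           Nonneg ρ slack′ ⊎ Nonneg ρ (-1ℤ ⊛ slack′) → Formal D w
      go (inj₁ x) (inj₁ y) _ _ = inside-P (inj₁ refl) (x ∷ y ∷ srt) certE₁
      go (inj₁ x) (inj₂ y) _ _ = inside-P (inj₁ refl) (x ∷ y ∷ srt) certE₂
      go (inj₂ _) _ (inj₁ x) (inj₁ y) = inside-P (inj₂ refl) (x ∷ y ∷ srt) certE₃
      go (inj₂ _) _ (inj₁ x) (inj₂ y) = inside-P (inj₂ refl) (x ∷ y ∷ srt) certE₄
      go (inj₂ x) _ (inj₂ y) _ = formal-K {ks = sumsOf pointsE pointsE′} {ts = movesE} w sums-in
        ((inj₁ refl , inside-K nn certE₅) ∷ (inj₁ refl , inside-K nn certE₆) ∷ (inj₁ refl , inside-K nn certE₇)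
          ∷ (inj₂ refl , inside-K nn certE₈) ∷ (inj₂ refl , inside-K nn certE₉) ∷ (inj₂ refl , inside-K nn certEₐ) ∷ [])
        (toWitness {a? = collides? (sumsOf pointsE pointsE′) movesE} _)
        where nn = x ∷ y ∷ srt

    generates : ∀ {d₁ d₂ d₃} → Data d₁ d₂ d₃ → ∀ z → Formal (d₁ ∷ d₂ ∷ d₃ ∷ []) z
    generates {d₁} {d₂} {d₃} R z = finish (fractional-part d₁ d₂ d₃ (Frame.ind₃ (Fr R)) z)
      where
      D : Vec Z3 3
      D = d₁ ∷ d₂ ∷ d₃ ∷ []
      finish : ∃[ q ] Fraction D (z ⊟ ev q D) → Formal D z
      finish (q , fr) = shift-formal D q (sort {R = Data} {Gv = λ a b c → Formal (a ∷ b ∷ c ∷ []) (z ⊟ ev q D)} data₁₂ data₂₃ (λ _ → formal₁₂) (λ _ → formal₂₃) core R fr)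

fourth-first-All : ∀ {X : Z3 → Set} {a b c d es} → All X (a ∷ b ∷ c ∷ d ∷ es) → All X (d ∷ a ∷ b ∷ c ∷ es)
fourth-first-All (a ∷ b ∷ c ∷ d ∷ es) = d ∷ a ∷ b ∷ c ∷ es

fourth-first-Pairs : ∀ {a b c d : Z3} {es} → AllPairs _≢_ (a ∷ b ∷ c ∷ d ∷ es) → AllPairs _≢_ (d ∷ a ∷ b ∷ c ∷ es)
fourth-first-Pairs ((ab ∷ ac ∷ ad ∷ ae) ∷ (bc ∷ bd ∷ be) ∷ (cd ∷ ce) ∷ de ∷ es) =
  (≢-sym ad ∷ ≢-sym bd ∷ ≢-sym cd ∷ de) ∷ (ab ∷ ac ∷ ae) ∷ (bc ∷ be) ∷ ce ∷ es

-- Generation of the lattice in type K₂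

module TypeK₂ {P Q K : Z3 → Set} (S : System P Q K) (full : Full S) {p₄ q₄ d₄ : Z3} where
  open System S

  Data : Z3 → Z3 → Z3 → Set
  Data d₁ d₂ d₃ = ∃[ q₁ ] ∃[ q₂ ] ∃[ q₃ ] (Inside S (p₄ ⊞ d₁) (p₄ ⊞ d₂) (p₄ ⊞ d₃) p₄ (p₄ ⊞ d₄) q₁ q₂ q₃ q₄ × d₁ ⊞ d₂ ⊞ d₃ ⊞ + 2 ∙ d₄ ≡ o)

  data₁₂ : ∀ {d₁ d₂ d₃} → Data d₁ d₂ d₃ → Data d₂ d₁ d₃
  data₁₂ {d₁} {d₂} {d₃} (q₁ , q₂ , q₃ , I , e) = q₂ , q₁ , q₃ , σ₁₂ S I , trans (vec≡ (d₄ ∷ d₁ ∷ d₂ ∷ d₃ ∷ []) (v₂ :+ v₁ :+ v₃ :+ + 2 :* v₀) (v₁ :+ v₂ :+ v₃ :+ + 2 :* v₀) refl) e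

  data₂₃ : ∀ {d₁ d₂ d₃} → Data d₁ d₂ d₃ → Data d₁ d₃ d₂
  data₂₃ {d₁} {d₂} {d₃} (q₁ , q₂ , q₃ , I , e) = q₁ , q₃ , q₂ , σ₂₃ S I , trans (vec≡ (d₄ ∷ d₁ ∷ d₂ ∷ d₃ ∷ []) (v₁ :+ v₃ :+ v₂ :+ + 2 :* v₀) (v₁ :+ v₂ :+ v₃ :+ + 2 :* v₀) refl) e

  placement : ∀ {d₁ d₂ d₃} → Data d₁ d₂ d₃ → Placement S (d₁ ∷ d₂ ∷ d₄ ∷ []) pointsK₂ pointsK₂′
  placement {d₁} {d₂} {d₃} (q₁ , q₂ , q₃ , I , e) = record { b = p₄ ; b' = q₄
      ; atP = placed S :0 D p₄ l₀ ∷ placed S v₀ D p₄ refl ∷ placed S v₁ D p₄ refl ∷ placed S (-1ℤ :* (v₀ :+ v₁ :+ + 2 :* v₂)) D p₄ (cong (p₄ ⊞_) third) ∷ placed S v₂ D p₄ refl ∷ []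
      ; atQ = placed S :0 D q₄ (vec≡ (q₄ ∷ []) v₀ (v₀ :+ :0) refl) ∷ placed S v₀ D q₄ l₁ ∷ placed S v₁ D q₄ l₂ ∷ placed S (-1ℤ :* (v₀ :+ v₁ :+ + 2 :* v₂)) D q₄ (trans l₃ (cong (q₄ ⊞_) third)) ∷ []
      ; inP = fourth-first-All inP ; inQ = fourth-first-All inQ ; dP = fourth-first-Pairs dP ; dQ = fourth-first-Pairs dQ ; five = refl }
    where
    open Inside I
    D : Vec Z3 3
    D = d₁ ∷ d₂ ∷ d₄ ∷ []
    H : Vec Z3 9
    H = p₄ ∷ d₁ ∷ d₂ ∷ d₃ ∷ q₁ ∷ q₂ ∷ q₃ ∷ q₄ ∷ d₄ ∷ []
    third : d₃ ≡ -1ℤ ∙ (d₁ ⊞ d₂ ⊞ + 2 ∙ d₄)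
    third = lin≡ H ((+ 1 , v₁ :+ v₂ :+ v₃ :+ + 2 :* v₈ , :0) ∷ []) (e ∷ []) v₃ (-1ℤ :* (v₁ :+ v₂ :+ + 2 :* v₈)) refl
    l₀ : p₄ ≡ p₄ ⊞ o
    l₀ = vec≡ H v₀ (v₀ :+ :0) refl
    l₁ : q₁ ≡ q₄ ⊞ d₁
    l₁ = lin≡ H ((+ 1 , v₀ :- (v₀ :+ v₁) , v₇ :- v₄) ∷ []) (same₄ ∷ []) v₄ (v₇ :+ v₁) refl
    l₂ : q₂ ≡ q₄ ⊞ d₂
    l₂ = lin≡ H ((+ 1 , v₀ :- (v₀ :+ v₁) , v₇ :- v₄) ∷ (-1ℤ , (v₀ :+ v₂) :- (v₀ :+ v₁) , v₅ :- v₄) ∷ []) (same₄ ∷ same₂ ∷ []) v₅ (v₇ :+ v₂) refl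
    l₃ : q₃ ≡ q₄ ⊞ d₃
    l₃ = lin≡ H ((+ 1 , v₀ :- (v₀ :+ v₁) , v₇ :- v₄) ∷ (-1ℤ , (v₀ :+ v₃) :- (v₀ :+ v₁) , v₆ :- v₄) ∷ []) (same₄ ∷ same₃ ∷ []) v₆ (v₇ :+ v₃) refl

  Fr : ∀ {d₁ d₂ d₃} → Data d₁ d₂ d₃ → Frame S (d₁ ∷ d₂ ∷ d₄ ∷ []) pointsK₂ pointsK₂′
  Fr R = frame S (placement R) full resolvedK₂

  -- The relation eliminates d₃, so d₁, d₃, d₄ generate nothing beyond d₁, d₂, d₄.
  swapped₂₃ : ∀ {d₁ d₂ d₃ w} → Data d₁ d₂ d₃ → Formal (d₁ ∷ d₃ ∷ d₄ ∷ []) w → Formal (d₁ ∷ d₂ ∷ d₄ ∷ []) w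
  swapped₂₃ {d₁} {d₂} {d₃} {w} (_ , _ , _ , _ , e) (x ∷ y ∷ z ∷ [] , f) = (x ℤ.- y ∷ -1ℤ ℤ.* y ∷ z ℤ.- + 2 ℤ.* y ∷ []) , (begin
      w                                                            ≡⟨ f ⟩
      x ∙ d₁ ⊞ (y ∙ d₃ ⊞ (z ∙ d₄ ⊞ o))                              ≡⟨ cong (λ t → x ∙ d₁ ⊞ (y ∙ t ⊞ (z ∙ d₄ ⊞ o))) third ⟩
      x ∙ d₁ ⊞ (y ∙ (-1ℤ ∙ (d₁ ⊞ d₂ ⊞ + 2 ∙ d₄)) ⊞ (z ∙ d₄ ⊞ o))     ≡⟨ expand d₁ d₂ d₄ ⟩
      ev (x ℤ.- y ∷ -1ℤ ℤ.* y ∷ z ℤ.- + 2 ℤ.* y ∷ []) (d₁ ∷ d₂ ∷ d₄ ∷ []) ∎)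
    where
    open ≡-Reasoning
    third : d₃ ≡ -1ℤ ∙ (d₁ ⊞ d₂ ⊞ + 2 ∙ d₄)
    third = lin≡ (d₁ ∷ d₂ ∷ d₃ ∷ d₄ ∷ []) ((+ 1 , v₀ :+ v₁ :+ v₂ :+ + 2 :* v₃ , :0) ∷ []) (e ∷ []) v₂ (-1ℤ :* (v₀ :+ v₁ :+ + 2 :* v₃)) refl
    expand : ∀ a b c → x ∙ a ⊞ (y ∙ (-1ℤ ∙ (a ⊞ b ⊞ + 2 ∙ c)) ⊞ (z ∙ c ⊞ o)) ≡ ev (x ℤ.- y ∷ -1ℤ ℤ.* y ∷ z ℤ.- + 2 ℤ.* y ∷ []) (a ∷ b ∷ c ∷ [])
    expand (a , a' , a″) (b , b' , b″) (c , c' , c″) = z3≡ (go x y z a b c) (go x y z a' b' c') (go x y z a″ b″ c″)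
      where
      go : ∀ (x y z a b c : ℤ) → x ℤ.* a ℤ.+ (y ℤ.* (-[1+ 0 ] ℤ.* (a ℤ.+ b ℤ.+ + 2 ℤ.* c)) ℤ.+ (z ℤ.* c ℤ.+ + 0)) ≡
        (x ℤ.- y) ℤ.* a ℤ.+ (-[1+ 0 ] ℤ.* y ℤ.* b ℤ.+ ((z ℤ.- + 2 ℤ.* y) ℤ.* c ℤ.+ + 0))
      go = solve-∀

  twisted-coords : ∀ {d₁ d₂ d₃} → Data d₁ d₂ d₃ → ∀ r₁ r₂ r₃ k → ev (r₁ ∷ r₂ ∷ r₃ ∷ []) (d₁ ∷ d₂ ∷ d₃ ∷ []) ≡ ev (Vec.map (λ f → dot f (r₁ ∷ r₂ ∷ r₃ ∷ k ∷ [])) twisted) (d₁ ∷ d₂ ∷ d₄ ∷ [])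
  twisted-coords {d₁} {d₂} {d₃} (_ , _ , _ , _ , e) r₁ r₂ r₃ k = trans (cong (λ t → r₁ ∙ d₁ ⊞ (r₂ ∙ d₂ ⊞ (r₃ ∙ t ⊞ o))) third) (expand d₁ d₂ d₄)
    where
    third : d₃ ≡ -1ℤ ∙ (d₁ ⊞ d₂ ⊞ + 2 ∙ d₄)
    third = lin≡ (d₁ ∷ d₂ ∷ d₃ ∷ d₄ ∷ []) ((+ 1 , v₀ :+ v₁ :+ v₂ :+ + 2 :* v₃ , :0) ∷ []) (e ∷ []) v₂ (-1ℤ :* (v₀ :+ v₁ :+ + 2 :* v₃)) refl
    expand : ∀ a b c → r₁ ∙ a ⊞ (r₂ ∙ b ⊞ (r₃ ∙ (-1ℤ ∙ (a ⊞ b ⊞ + 2 ∙ c)) ⊞ o)) ≡ ev (Vec.map (λ f → dot f (r₁ ∷ r₂ ∷ r₃ ∷ k ∷ [])) twisted) (a ∷ b ∷ c ∷ [])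
    expand (a , a' , a″) (b , b' , b″) (c , c' , c″) = z3≡ (go r₁ r₂ r₃ k a b c) (go r₁ r₂ r₃ k a' b' c') (go r₁ r₂ r₃ k a″ b″ c″)
      where
      go : ∀ (x y z k a b c : ℤ) → x ℤ.* a ℤ.+ (y ℤ.* b ℤ.+ (z ℤ.* (-[1+ 0 ] ℤ.* (a ℤ.+ b ℤ.+ + 2 ℤ.* c)) ℤ.+ + 0)) ≡
        (+ 1 ℤ.* x ℤ.+ (+ 0 ℤ.* y ℤ.+ (-[1+ 0 ] ℤ.* z ℤ.+ (+ 0 ℤ.* k ℤ.+ + 0)))) ℤ.* a ℤ.+
        ((+ 0 ℤ.* x ℤ.+ (+ 1 ℤ.* y ℤ.+ (-[1+ 0 ] ℤ.* z ℤ.+ (+ 0 ℤ.* k ℤ.+ + 0)))) ℤ.* b ℤ.+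
        ((+ 0 ℤ.* x ℤ.+ (+ 0 ℤ.* y ℤ.+ (-[1+ 1 ] ℤ.* z ℤ.+ (+ 0 ℤ.* k ℤ.+ + 0)))) ℤ.* c ℤ.+ + 0))
      go = solve-∀

  -- Outside the simplex 0, d₁, d₂, d₃ three reflections of w are tried. If the forms put none of
  -- them into P, four translates of w lie in K.
  core-small : ∀ {w d₁ d₂ d₃} (R : Data d₁ d₂ d₃) (fr : Fraction (d₁ ∷ d₂ ∷ d₃ ∷ []) w) → Fraction.r₁ fr ℕ.≤ Fraction.r₂ fr → Fraction.r₂ fr ℕ.≤ Fraction.r₃ fr →
    Nonneg (+ Fraction.r₁ fr ∷ + Fraction.r₂ fr ∷ + Fraction.r₃ fr ∷ + Fraction.k fr ∷ []) small → Formal (d₁ ∷ d₂ ∷ d₄ ∷ []) w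
  core-small {w} {d₁} {d₂} {d₃} R fr le₁ le₂ sm = go (nonneg-total ρ slack) (nonneg-total ρ fitA) (nonneg-total ρ fitB) (nonneg-total ρ fitC)
    where
    D₀ D : Vec Z3 3
    D₀ = d₁ ∷ d₂ ∷ d₃ ∷ []
    D = d₁ ∷ d₂ ∷ d₄ ∷ []
    open Cell {D₀} {D} fr twisted (twisted-coords R)
    open Index (Fr R)
    srt = sorted-nonneg {D₀} {D} fr le₁ le₂
    ks : List (V 3)
    ks = (+ 0 ∷ + 0 ∷ -[1+ 0 ] ∷ []) ∷ sumsOf pointsK₂ pointsK₂′
    extended : All InK ks
    -- The extra point - d₄ is the midpoint of d₃ and d₁ + d₂.
    extended = half-in (-[1+ 0 ] ∷ -[1+ 0 ] ∷ -[1+ 1 ] ∷ []) (+ 1 ∷ + 1 ∷ + 0 ∷ []) (+ 0 ∷ + 0 ∷ -[1+ 0 ] ∷ [])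
      (All.lookup sums-in (toWitness {a? = any? ((-[1+ 0 ] ∷ -[1+ 0 ] ∷ -[1+ 1 ] ∷ []) ≟ᵥ_) (sumsOf pointsK₂ pointsK₂′)} _))
      (All.lookup sums-in (toWitness {a? = any? ((+ 1 ∷ + 1 ∷ + 0 ∷ []) ≟ᵥ_) (sumsOf pointsK₂ pointsK₂′)} _)) refl ∷ sums-in
    inside-P : ∀ {fs σ t N es} → Unit σ → All (Nonneg ρ) fs → Certificate fs pointsK₂ twisted σ t N es → Formal D w
    inside-P {σ = σ} {t} un nn ce = formal-P w σ t un (certified {P} p₄ (LengthOne.convex oneP) nn (Frame.inP (Fr R)) ce)
    inside-K : ∀ {fs σ t N es} → All (Nonneg ρ) fs → Certificate fs ks twisted σ t N es → K ((p₄ ⊞ q₄) ⊞ (σ ∙ w ⊞ ev t D))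
    inside-K nn ce = certified {K} (p₄ ⊞ q₄) convex nn extended ce
    go : Nonneg ρ slack ⊎ Nonneg ρ (-1ℤ ⊛ slack) → Nonneg ρ fitA ⊎ Nonneg ρ (-1ℤ ⊛ fitA) → Nonneg ρ fitB ⊎ Nonneg ρ (-1ℤ ⊛ fitB) →
         Nonneg ρ fitC ⊎ Nonneg ρ (-1ℤ ⊛ fitC) → Formal D w
    go (inj₁ s) _ _ _ = inside-P (inj₁ refl) (s ∷ srt) certK₂₁
    go (inj₂ s) (inj₁ x) _ _ = inside-P (inj₂ refl) (x ∷ s ∷ sm ∷ srt) certK₂₂
    go (inj₂ s) (inj₂ _) (inj₁ x) _ = inside-P (inj₂ refl) (x ∷ s ∷ sm ∷ srt) certK₂₃
    go (inj₂ s) (inj₂ _) (inj₂ _) (inj₁ x) = inside-P (inj₂ refl) (x ∷ s ∷ sm ∷ srt) certK₂₄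
    go (inj₂ s) (inj₂ x) (inj₂ y) (inj₂ z) = formal-K {ks = ks} {ts = movesK₂} w extended
      ((inj₁ refl , inside-K nn certK₂₅) ∷ (inj₁ refl , inside-K nn certK₂₆) ∷ (inj₁ refl , inside-K nn certK₂₇) ∷ (inj₁ refl , inside-K nn certK₂₈) ∷ [])
      (toWitness {a? = collides? ks movesK₂} _)
      where nn = x ∷ y ∷ z ∷ s ∷ sm ∷ srt

  -- A vector beyond the middle of the cell is reflected to d₁ + d₂ + d₃ − w.
  core : ∀ {w d₁ d₂ d₃} → Data d₁ d₂ d₃ → (fr : Fraction (d₁ ∷ d₂ ∷ d₃ ∷ []) w) → Fraction.r₁ fr ℕ.≤ Fraction.r₂ fr → Fraction.r₂ fr ℕ.≤ Fraction.r₃ fr →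
         Formal (d₁ ∷ d₂ ∷ d₄ ∷ []) w
  core {w} {d₁} {d₂} {d₃} R fr le₁ le₂ = go (nonneg-total (+ r₁ ∷ + r₂ ∷ + r₃ ∷ + k ∷ []) small)
    where
    open Fraction fr
    D : Vec Z3 3
    D = d₁ ∷ d₂ ∷ d₄ ∷ []
    w' : Z3
    w' = (d₃ ⊞ (d₂ ⊞ (d₁ ⊞ o))) ⊟ w
    complement : ∀ {r} → r ℕ.≤ k → + (k ℕ.∸ r) ≡ + k ℤ.- + r
    complement = difference-nat
    reflected : Fraction (d₃ ∷ d₂ ∷ d₁ ∷ []) w'
    reflected = record { k = k ; r₁ = k ℕ.∸ r₃ ; r₂ = k ℕ.∸ r₂ ; r₃ = k ℕ.∸ r₁ ; 0<k = 0<k ; r₁≤k = ℕP.m∸n≤m k r₃ ; r₂≤k = ℕP.m∸n≤m k r₂ ; r₃≤k = ℕP.m∸n≤m k r₁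
      ; fraction = trans (sym (∙-⊟ (+ k) (d₃ ⊞ (d₂ ⊞ (d₁ ⊞ o))) w)) (trans (cong (+ k ∙ (d₃ ⊞ (d₂ ⊞ (d₁ ⊞ o))) ⊟_) fraction)
          (trans (expand d₁ d₂ d₃) (cong (λ v → ev v (d₃ ∷ d₂ ∷ d₁ ∷ [])) (sym (cong₂ _∷_ (complement r₃≤k) (cong₂ _∷_ (complement r₂≤k) (cong (_∷ []) (complement r₁≤k)))))))) }
      where
      expand : ∀ a b c → + k ∙ (c ⊞ (b ⊞ (a ⊞ o))) ⊟ ev (+ r₁ ∷ + r₂ ∷ + r₃ ∷ []) (a ∷ b ∷ c ∷ []) ≡ ev (+ k ℤ.- + r₃ ∷ + k ℤ.- + r₂ ∷ + k ℤ.- + r₁ ∷ []) (c ∷ b ∷ a ∷ [])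
      expand (a , a' , a″) (b , b' , b″) (c , c' , c″) = z3≡ (step (+ k) (+ r₁) (+ r₂) (+ r₃) a b c) (step (+ k) (+ r₁) (+ r₂) (+ r₃) a' b' c') (step (+ k) (+ r₁) (+ r₂) (+ r₃) a″ b″ c″)
        where
        step : ∀ (k x y z a b c : ℤ) → k ℤ.* (c ℤ.+ (b ℤ.+ (a ℤ.+ + 0))) ℤ.- (x ℤ.* a ℤ.+ (y ℤ.* b ℤ.+ (z ℤ.* c ℤ.+ + 0))) ≡
          (k ℤ.- z) ℤ.* c ℤ.+ ((k ℤ.- y) ℤ.* b ℤ.+ ((k ℤ.- x) ℤ.* a ℤ.+ + 0))
        step = solve-∀
    numerators≡ : + (k ℕ.∸ r₃) ∷ + (k ℕ.∸ r₂) ∷ + (k ℕ.∸ r₁) ∷ + k ∷ [] ≡ (+ k ℤ.- + r₃) ∷ (+ k ℤ.- + r₂) ∷ (+ k ℤ.- + r₁) ∷ + k ∷ []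
    numerators≡ = cong₂ _∷_ (complement r₃≤k) (cong₂ _∷_ (complement r₂≤k) (cong (_∷ + k ∷ []) (complement r₁≤k)))
    mirror : Nonneg (+ r₁ ∷ + r₂ ∷ + r₃ ∷ + k ∷ []) (-1ℤ ⊛ small) → Nonneg (+ (k ℕ.∸ r₃) ∷ + (k ℕ.∸ r₂) ∷ + (k ℕ.∸ r₁) ∷ + k ∷ []) small
    mirror (n , e) = n , trans e (trans (step (+ k) (+ r₁) (+ r₂) (+ r₃)) (cong (dot small) (sym numerators≡)))
      where
      step : ∀ (k x y z : ℤ) → + 2 ℤ.* x ℤ.+ (+ 2 ℤ.* y ℤ.+ (+ 2 ℤ.* z ℤ.+ (-[1+ 2 ] ℤ.* k ℤ.+ + 0))) ≡
        -[1+ 1 ] ℤ.* (k ℤ.- z) ℤ.+ (-[1+ 1 ] ℤ.* (k ℤ.- y) ℤ.+ (-[1+ 1 ] ℤ.* (k ℤ.- x) ℤ.+ (+ 3 ℤ.* k ℤ.+ + 0)))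
      step = solve-∀
    go : _ ⊎ _ → Formal D w
    go (inj₁ sm) = core-small R fr le₁ le₂ sm
    -- Reflection reverses the order of the numerators, so d₁ and d₃ are exchanged, and exchanged
    -- back by three transpositions.
    go (inj₂ sm) = back (swapped₁₂ (swapped₂₃ (data₁₂ R) (swapped₁₂ {d₃} {d₂} (core-small (data₁₂ (data₂₃ (data₁₂ R))) reflected (ℕP.∸-monoʳ-≤ k le₂) (ℕP.∸-monoʳ-≤ k le₁) (mirror sm)))))
      where
      swapped₁₂ : ∀ {a b w} → Formal (a ∷ b ∷ d₄ ∷ []) w → Formal (b ∷ a ∷ d₄ ∷ []) w
      swapped₁₂ = formal₁₂
      back : Formal D w' → Formal D w
      back (c , e) = (+ 0 ∷ + 0 ∷ -[1+ 1 ] ∷ []) ⊖ᵥ c , trans (lin≡ (w ∷ d₁ ∷ d₂ ∷ d₃ ∷ d₄ ∷ ev c D ∷ [])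
          ((-1ℤ , (v₃ :+ (v₂ :+ (v₁ :+ :0))) :- v₀ , v₅) ∷ (+ 1 , v₁ :+ v₂ :+ v₃ :+ + 2 :* v₄ , :0) ∷ []) (e ∷ proj₂ (proj₂ (proj₂ (proj₂ R))) ∷ [])
          v₀ ((+ 0 :* v₁ :+ (+ 0 :* v₂ :+ (-[1+ 1 ] :* v₄ :+ :0))) :- v₅) refl) (sym (ev-⊖ (+ 0 ∷ + 0 ∷ -[1+ 1 ] ∷ []) c D))

  -- The cell is spanned by d₁, d₂, d₃ rather than by the basis d₁, d₂, d₄, so their independence
  -- modulo three is a check of its own.
  generates : ∀ {d₁ d₂ d₃} → Data d₁ d₂ d₃ → ∀ z → Formal (d₁ ∷ d₂ ∷ d₄ ∷ []) z
  generates {d₁} {d₂} {d₃} R z = finish (fractional-part d₁ d₂ d₃ (independent-from S (placement R) twist resolvedK₂′ twist-ev) z)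
    where
    D₀ D : Vec Z3 3
    D₀ = d₁ ∷ d₂ ∷ d₃ ∷ []
    D = d₁ ∷ d₂ ∷ d₄ ∷ []
    twist-ev : ∀ d → ev (twist d) (d₁ ∷ d₂ ∷ d₄ ∷ o ∷ o ∷ []) ≡ ev (Vec.map (λ i → + toℕ i) d) D₀
    twist-ev (x ∷ y ∷ z ∷ []) = sym (trans (twisted-coords R (+ toℕ x) (+ toℕ y) (+ toℕ z) (+ 0)) (expand d₁ d₂ d₄))
      where
      expand : ∀ a b c → ev (Vec.map (λ f → dot f (+ toℕ x ∷ + toℕ y ∷ + toℕ z ∷ + 0 ∷ [])) twisted) (a ∷ b ∷ c ∷ []) ≡ ev (twist (x ∷ y ∷ z ∷ [])) (a ∷ b ∷ c ∷ o ∷ o ∷ [])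
      expand (a , a' , a″) (b , b' , b″) (c , c' , c″) = z3≡ (go (+ toℕ x) (+ toℕ y) (+ toℕ z) a b c) (go (+ toℕ x) (+ toℕ y) (+ toℕ z) a' b' c') (go (+ toℕ x) (+ toℕ y) (+ toℕ z) a″ b″ c″)
        where
        go : ∀ (x y z a b c : ℤ) →
          (+ 1 ℤ.* x ℤ.+ (+ 0 ℤ.* y ℤ.+ (-[1+ 0 ] ℤ.* z ℤ.+ (+ 0 ℤ.* + 0 ℤ.+ + 0)))) ℤ.* a ℤ.+
          ((+ 0 ℤ.* x ℤ.+ (+ 1 ℤ.* y ℤ.+ (-[1+ 0 ] ℤ.* z ℤ.+ (+ 0 ℤ.* + 0 ℤ.+ + 0)))) ℤ.* b ℤ.+
          ((+ 0 ℤ.* x ℤ.+ (+ 0 ℤ.* y ℤ.+ (-[1+ 1 ] ℤ.* z ℤ.+ (+ 0 ℤ.* + 0 ℤ.+ + 0)))) ℤ.* c ℤ.+ + 0)) ≡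
          (x ℤ.- z) ℤ.* a ℤ.+ ((y ℤ.- z) ℤ.* b ℤ.+ (-[1+ 1 ] ℤ.* z ℤ.* c ℤ.+ (+ 0 ℤ.* + 0 ℤ.+ (+ 0 ℤ.* + 0 ℤ.+ + 0))))
        go = solve-∀
    finish : ∃[ q ] Fraction D₀ (z ⊟ ev q D₀) → Formal D z
    finish (q@(x ∷ y ∷ t ∷ []) , fr) = back (sort {R = Data} {Gv = λ a b c → Formal (a ∷ b ∷ d₄ ∷ []) (z ⊟ ev q D₀)} data₁₂ data₂₃ (λ _ → formal₁₂) swapped₂₃ core R fr)
      where
      back : Formal D (z ⊟ ev q D₀) → Formal D z
      back f = shift-formal S D (Vec.map (λ h → dot h (x ∷ y ∷ t ∷ + 0 ∷ [])) twisted) (subst (λ u → Formal D (z ⊟ u)) (twisted-coords R x y t (+ 0)) f)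

-- Generation of the lattice in type K₁

Separates : List (V 3) → Vec (Fin 2) 3 → Set
Separates ps ε = Any (λ p → Any (λ p' → p ≢ p' × Divides 2 ((p ⊖ᵥ p') ⊖ᵥ Vec.map (λ i → + toℕ i) ε)) ps) ps

separated? : ∀ ps → Dec (∀ x y z → (x ∷ y ∷ z ∷ []) ≡ Vec.replicate 3 zero ⊎ Separates ps (x ∷ y ∷ z ∷ []))
separated? ps = FinP.all? λ x → FinP.all? λ y → FinP.all? λ z → VecP.≡-dec Fin._≟_ _ _ ⊎-dec
  any? (λ p → any? (λ p' → ¬? (p ≟ᵥ p') ×-dec divides? 2 ((p ⊖ᵥ p') ⊖ᵥ Vec.map (λ i → + toℕ i) (x ∷ y ∷ z ∷ []))) ps) ps

residues : List (Vec (Fin 3) 3)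
residues = List.concatMap (λ x → List.concatMap (λ y → List.map (λ z → x ∷ y ∷ z ∷ []) (List.allFin 3)) (List.allFin 3)) (List.allFin 3)

all-residues : ∀ v → v ∈ residues
all-residues (x ∷ y ∷ z ∷ []) = toWitness {a? = FinP.all? λ x → FinP.all? λ y → FinP.all? λ z → any? (VecP.≡-dec Fin._≟_ (x ∷ y ∷ z ∷ [])) residues} _ x y z

formal-∙ : ∀ k {D x y} → y ≡ k ∙ x → Formal D x → Formal D y
formal-∙ k {D} e (c , f) = k ⊛ c , trans e (trans (cong (k ∙_) f) (sym (ev-⊛ k c D)))

formal-⊟ : ∀ {D x y} → Formal D x → Formal D y → Formal D (x ⊟ y)
formal-⊟ {D} (c , e) (c' , e') = c ⊖ᵥ c' , trans (cong₂ _⊟_ e e') (sym (ev-⊖ c c' D))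

-- Fourteen points: the twenty sums coincide in six pairs, one for every two of the four points
-- shared by P and Q.
formalPoints : List (V 3)
formalPoints = List.deduplicate _≟ᵥ_ (sumsOf pointsK₁ pointsK₁′)

module TypeK₁ {P Q K : Z3 → Set} (S : System P Q K) (full : Full S) {p₄ a q₄ : Z3} where
  open System S

  Data : Z3 → Z3 → Z3 → Set
  Data d₁ d₂ d₃ = ∃[ q₁ ] ∃[ q₂ ] ∃[ q₃ ] (Inside S (p₄ ⊞ d₁) (p₄ ⊞ d₂) (p₄ ⊞ d₃) p₄ a q₁ q₂ q₃ q₄ × a ≡ p₄ ⊞ -1ℤ ∙ (d₁ ⊞ d₂ ⊞ d₃))

  data₁₂ : ∀ {d₁ d₂ d₃} → Data d₁ d₂ d₃ → Data d₂ d₁ d₃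
  data₁₂ {d₁} {d₂} {d₃} (q₁ , q₂ , q₃ , I , e) = q₂ , q₁ , q₃ , σ₁₂ S I , trans e (vec≡ (p₄ ∷ d₁ ∷ d₂ ∷ d₃ ∷ []) (v₀ :+ -1ℤ :* (v₁ :+ v₂ :+ v₃)) (v₀ :+ -1ℤ :* (v₂ :+ v₁ :+ v₃)) refl)

  data₂₃ : ∀ {d₁ d₂ d₃} → Data d₁ d₂ d₃ → Data d₁ d₃ d₂
  data₂₃ {d₁} {d₂} {d₃} (q₁ , q₂ , q₃ , I , e) = q₁ , q₃ , q₂ , σ₂₃ S I , trans e (vec≡ (p₄ ∷ d₁ ∷ d₂ ∷ d₃ ∷ []) (v₀ :+ -1ℤ :* (v₁ :+ v₂ :+ v₃)) (v₀ :+ -1ℤ :* (v₁ :+ v₃ :+ v₂)) refl)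

  placement : ∀ {d₁ d₂ d₃} → Data d₁ d₂ d₃ → Placement S (d₁ ∷ d₂ ∷ d₃ ∷ []) pointsK₁ pointsK₁′
  placement {d₁} {d₂} {d₃} (q₁ , q₂ , q₃ , I , e) = record { b = p₄ ; b' = q₄
      ; atP = placed S :0 D p₄ (vec≡ H v₀ (v₀ :+ :0) refl) ∷ placed S v₀ D p₄ refl ∷ placed S v₁ D p₄ refl ∷ placed S v₂ D p₄ refl ∷ placed S (-1ℤ :* (v₀ :+ v₁ :+ v₂)) D p₄ e ∷ []
      ; atQ = placed S :0 D q₄ (vec≡ H v₇ (v₇ :+ :0) refl) ∷ placed S v₀ D q₄ l₁ ∷ placed S v₁ D q₄ l₂ ∷ placed S v₂ D q₄ l₃ ∷ []
      ; inP = fourth-first-All inP ; inQ = fourth-first-All inQ ; dP = fourth-first-Pairs dP ; dQ = fourth-first-Pairs dQ ; five = refl }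
    where
    open Inside I
    D : Vec Z3 3
    D = d₁ ∷ d₂ ∷ d₃ ∷ []
    H : Vec Z3 8
    H = p₄ ∷ d₁ ∷ d₂ ∷ d₃ ∷ q₁ ∷ q₂ ∷ q₃ ∷ q₄ ∷ []
    l₁ : q₁ ≡ q₄ ⊞ d₁
    l₁ = lin≡ H ((+ 1 , v₀ :- (v₀ :+ v₁) , v₇ :- v₄) ∷ []) (same₄ ∷ []) v₄ (v₇ :+ v₁) refl
    l₂ : q₂ ≡ q₄ ⊞ d₂
    l₂ = lin≡ H ((+ 1 , v₀ :- (v₀ :+ v₁) , v₇ :- v₄) ∷ (-1ℤ , (v₀ :+ v₂) :- (v₀ :+ v₁) , v₅ :- v₄) ∷ []) (same₄ ∷ same₂ ∷ []) v₅ (v₇ :+ v₂) refl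
    l₃ : q₃ ≡ q₄ ⊞ d₃
    l₃ = lin≡ H ((+ 1 , v₀ :- (v₀ :+ v₁) , v₇ :- v₄) ∷ (-1ℤ , (v₀ :+ v₃) :- (v₀ :+ v₁) , v₆ :- v₄) ∷ []) (same₄ ∷ same₃ ∷ []) v₆ (v₇ :+ v₃) refl

  Fr : ∀ {d₁ d₂ d₃} → Data d₁ d₂ d₃ → Frame S (d₁ ∷ d₂ ∷ d₃ ∷ []) pointsK₁ pointsK₁′
  Fr R = frame S (placement R) full resolvedK₁

  c : Z3
  c = p₄ ⊞ q₄

  -- Points of K in one class modulo the lattice generated by D.
  record Coset (D : Vec Z3 3) (n : ℕ) (w : Z3) : Set where
    field
      us     : List Z3
      size   : length us ≡ n
      apart  : AllPairs _≢_ us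
      formal : All (Formal D) us
      inK    : All (λ u → K (c ⊞ (w ⊞ u))) us

  coset-map : ∀ {D D' n w} → (∀ {u} → Formal D u → Formal D' u) → Coset D n w → Coset D' n w
  coset-map f C = record { us = us ; size = size ; apart = apart ; formal = All.map f formal ; inK = inK }
    where open Coset C

  coset-shift : ∀ {D n w} q → Coset D n (w ⊟ ev q D) → Coset D n w
  coset-shift {D} {n} {w} q C = record
    { us = List.map (_⊟ ev q D) us ; size = trans (ListP.length-map (_⊟ ev q D) us) size
    ; apart = AllPairsP.map⁺ (AllPairs.map (λ {u} {v} n e → n (lin≡ (u ∷ v ∷ ev q D ∷ []) ((+ 1 , v₀ :- v₂ , v₁ :- v₂) ∷ []) (e ∷ []) v₀ v₁ refl)) apart)
    ; formal = AllP.map⁺ (All.map (λ f → formal-⊟ f (q , refl)) formal)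
    ; inK = AllP.map⁺ (All.map (λ {u} → subst K (cong (c ⊞_) (vec≡ (w ∷ ev q D ∷ u ∷ []) ((v₀ :- v₁) :+ v₂) (v₀ :+ (v₂ :- v₁)) refl))) inK) }
    where open Coset C

  coset-from : ∀ {d₁ d₂ d₃ w} (R : Data d₁ d₂ d₃) ts → True (AllPairs.allPairs? (λ t t' → ¬? (t ≟ᵥ t')) ts) →
    All (λ t → K (c ⊞ (w ⊞ ev t (d₁ ∷ d₂ ∷ d₃ ∷ [])))) ts → Coset (d₁ ∷ d₂ ∷ d₃ ∷ []) (length ts) w
  coset-from {d₁} {d₂} {d₃} R ts ok ks = record
    { us = List.map (λ t → ev t D) ts ; size = ListP.length-map (λ t → ev t D) ts
    ; apart = AllPairsP.map⁺ (AllPairs.map (λ {t} {t'} n e → n (injective t t' e)) (toWitness ok))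
    ; formal = AllP.map⁺ (All.tabulate (λ {t} _ → t , refl)) ; inK = AllP.map⁺ ks }
    where
    D : Vec Z3 3
    D = d₁ ∷ d₂ ∷ d₃ ∷ []
    open Independent D (Frame.ind₃ (Fr R))

  FormalOrCoset : Z3 → Generators
  FormalOrCoset w a b c = Formal (a ∷ b ∷ c ∷ []) w ⊎ Coset (a ∷ b ∷ c ∷ []) 4 w

  swapped : ∀ {D D' w} → (∀ {u} → Formal D u → Formal D' u) → Formal D w ⊎ Coset D 4 w → Formal D' w ⊎ Coset D' 4 w
  swapped f (inj₁ x) = inj₁ (f x)
  swapped f (inj₂ C) = inj₂ (coset-map f C)

  -- Collisions as in the other types are replaced by counting: unless P already settles w, its
  -- class receives four points of K.
  core : ∀ {w d₁ d₂ d₃} → Data d₁ d₂ d₃ → (fr : Fraction (d₁ ∷ d₂ ∷ d₃ ∷ []) w) → Fraction.r₁ fr ℕ.≤ Fraction.r₂ fr → Fraction.r₂ fr ℕ.≤ Fraction.r₃ fr →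
         FormalOrCoset w d₁ d₂ d₃
  core {w} {d₁} {d₂} {d₃} R fr le₁ le₂ = go (total± lo₁) (total± lo₂) (total± lo₃) (total± lo₄) (total± hi₁) (total± hi₂) (total± hi₃) (total± hi₄)
    where
    D : Vec Z3 3
    D = d₁ ∷ d₂ ∷ d₃ ∷ []
    open Cell {D} {D} fr identity (identity-coords D)
    open Index (Fr R)
    srt = sorted-nonneg {D} {D} fr le₁ le₂
    Sign : Form → Set
    Sign f = Nonneg ρ f ⊎ Nonneg ρ (-1ℤ ⊛ f)
    total± : ∀ f → Sign f
    total± = nonneg-total ρ
    inside-P : ∀ {fs σ t N es} → Unit σ → All (Nonneg ρ) fs → Certificate fs pointsK₁ identity σ t N es → FormalOrCoset w d₁ d₂ d₃
    inside-P {σ = σ} {t} un nn ce = inj₁ (formal-P w σ t un (certified {P} p₄ (LengthOne.convex oneP) nn (Frame.inP (Fr R)) ce))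
    inside-K : ∀ {fs t N es} → All (Nonneg ρ) fs → Certificate fs (sumsOf pointsK₁ pointsK₁′) identity (+ 1) t N es → K (c ⊞ (w ⊞ ev t D))
    inside-K {t = t} nn ce = subst K (vec≡ (c ∷ w ∷ ev t D ∷ []) (v₀ :+ (+ 1 :* v₁ :+ v₂)) (v₀ :+ (v₁ :+ v₂)) refl) (certified {K} c convex nn sums-in ce)
    go : Sign lo₁ → Sign lo₂ → Sign lo₃ → Sign lo₄ → Sign hi₁ → Sign hi₂ → Sign hi₃ → Sign hi₄ → FormalOrCoset w d₁ d₂ d₃
    go (inj₂ x) _ _ _ _ _ _ _ = inside-P (inj₁ refl) (x ∷ srt) certP₁
    go _ (inj₂ x) _ _ _ _ _ _ = inside-P (inj₁ refl) (x ∷ srt) certP₂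
    go _ _ (inj₂ x) _ _ _ _ _ = inside-P (inj₁ refl) (x ∷ srt) certP₃
    go _ _ _ (inj₂ x) _ _ _ _ = inside-P (inj₁ refl) (x ∷ srt) certP₄
    go _ _ _ _ (inj₂ x) _ _ _ = inside-P (inj₂ refl) (x ∷ srt) certN₁
    go _ _ _ _ _ (inj₂ x) _ _ = inside-P (inj₂ refl) (x ∷ srt) certN₂
    go _ _ _ _ _ _ (inj₂ x) _ = inside-P (inj₂ refl) (x ∷ srt) certN₃
    go _ _ _ _ _ _ _ (inj₂ x) = inside-P (inj₂ refl) (x ∷ srt) certN₄
    go (inj₁ l₁) (inj₁ l₂) (inj₁ l₃) (inj₁ l₄) (inj₁ u₁) (inj₁ u₂) (inj₁ u₃) (inj₁ u₄) =
      inj₂ (coset-from R ((+ 0 ∷ + 0 ∷ + 0 ∷ []) ∷ (+ 0 ∷ + 0 ∷ -1ℤ ∷ []) ∷ (+ 0 ∷ -1ℤ ∷ -1ℤ ∷ []) ∷ (-1ℤ ∷ -1ℤ ∷ -1ℤ ∷ []) ∷ []) _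
        (inside-K nn certK₁ ∷ inside-K nn certK₂ ∷ inside-K nn certK₃ ∷ inside-K nn certK₄ ∷ []))
      where nn = l₁ ∷ l₂ ∷ l₃ ∷ l₄ ∷ u₁ ∷ u₂ ∷ u₃ ∷ u₄ ∷ srt

  module _ {d₁ d₂ d₃ : Z3} (R : Data d₁ d₂ d₃) where
    private
      D : Vec Z3 3
      D = d₁ ∷ d₂ ∷ d₃ ∷ []
    open Independent D (Frame.ind₃ (Fr R))

    representatives : ∀ w → ¬ Formal D w → Coset D 4 w
    representatives w n = start (fractional-part d₁ d₂ d₃ (Frame.ind₃ (Fr R)) w)
      where
      start : ∃[ q ] Fraction D (w ⊟ ev q D) → Coset D 4 w
      start (q , fr) = finish (sort {R = Data} {Gv = FormalOrCoset (w ⊟ ev q D)} data₁₂ data₂₃ (λ _ → swapped formal₁₂) (λ _ → swapped formal₂₃) core R fr)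
        where
        finish : FormalOrCoset (w ⊟ ev q D) d₁ d₂ d₃ → Coset D 4 w
        finish (inj₁ f) = ⊥-elim (n (shift-formal S D q f))
        finish (inj₂ C) = coset-shift q C

    -- Every nonzero class modulo two is a difference of two of the five points. If 2w were in the
    -- lattice and w not, two points of P would be congruent modulo two.
    half-formal : ∀ w → Formal D (+ 2 ∙ w) → Formal D w
    half-formal w (x , e) = start (Mod2.reduce x) (Mod2.reduce-ev x)
      where
      start : ∀ ε → ∃[ h ] Vec.map (λ i → + toℕ i) ε ≡ x ⊖ᵥ + 2 ⊛ h → Formal D w
      start ε@(i ∷ j ∷ k ∷ []) (h , eq) = finish (toWitness {a? = separated? pointsK₁} _ i j k)
        where
        η : V 3
        η = Vec.map (λ i → + toℕ i) ε
        double : + 2 ∙ (w ⊟ ev h D) ≡ ev η D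
        double = trans (sym (∙-⊟ (+ 2) w (ev h D))) (trans (cong₂ _⊟_ e (sym (ev-⊛ (+ 2) h D))) (trans (sym (ev-⊖ x (+ 2 ⊛ h) D)) (cong (λ v → ev v D) (sym eq))))
        finish : ε ≡ Vec.replicate 3 zero ⊎ Separates pointsK₁ ε → Formal D w
        finish (inj₁ z) = h , ⊟≡o⇒≡ {w} {ev h D} (∙-cancel (+ 2) (trans double (trans (cong (λ v → ev (Vec.map (λ i → + toℕ i) v) D) z) (trans (ev-0 D) (sym (∙-o (+ 2)))))))
        finish (inj₂ s) = first (find s)
          where
          first : ∃[ p ] (p ∈ pointsK₁ × Any (λ p' → p ≢ p' × Divides 2 ((p ⊖ᵥ p') ⊖ᵥ η)) pointsK₁) → Formal D w
          first (p , p∈ , s') = second (find s')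
            where
            second : ∃[ p' ] (p' ∈ pointsK₁ × p ≢ p' × Divides 2 ((p ⊖ᵥ p') ⊖ᵥ η)) → Formal D w
            second (p' , p'∈ , n , dv) = ⊥-elim (n (injective p p' (lin≡ (p₄ ∷ ev p D ∷ ev p' D ∷ []) ((+ 1 , v₀ :+ v₁ , v₀ :+ v₂) ∷ [])
                (LengthOne.indivisible oneP 2 (s≤s (s≤s z≤n)) (All.lookup (Frame.inP (Fr R)) p∈) (All.lookup (Frame.inP (Fr R)) p'∈) (proj₁ m ⊞ (w ⊟ ev h D) , even) ∷ []) v₁ v₂ refl)))
              where
              m = ev-divides 2 ((p ⊖ᵥ p') ⊖ᵥ η) D dv
              even : (p₄ ⊞ ev p D) ⊟ (p₄ ⊞ ev p' D) ≡ + 2 ∙ (proj₁ m ⊞ (w ⊟ ev h D))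
              even = lin≡ (p₄ ∷ ev p D ∷ ev p' D ∷ ev η D ∷ proj₁ m ∷ (w ⊟ ev h D) ∷ [])
                ((+ 1 , (v₁ :- v₂) :- v₃ , + 2 :* v₄) ∷ (-1ℤ , + 2 :* v₅ , v₃) ∷ [])
                (trans (sym (trans (ev-⊖ (p ⊖ᵥ p') η D) (cong (_⊟ ev η D) (ev-⊖ p p' D)))) (proj₂ m) ∷ double ∷ [])
                ((v₀ :+ v₁) :- (v₀ :+ v₂)) (+ 2 :* (v₄ :+ v₅)) refl

    third-formal : ∀ w → Formal D (+ 3 ∙ w) → Formal D w
    third-formal w (x , e) = finish (divisible x (w , sym e))
      where
      finish : ∃[ h ] x ≡ + 3 ⊛ h → Formal D w
      finish (h , eq) = h , ∙-cancel (+ 3) (trans e (trans (cong (λ v → ev v D) eq) (ev-⊛ (+ 3) h D)))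

    Block : Set
    Block = ∃[ w ] ∃[ n ] Coset D n w

    points : Block → List Z3
    points (w , _ , C) = List.map (λ u → c ⊞ (w ⊞ u)) (Coset.us C)

    points-in : ∀ B → All K (points B)
    points-in (w , _ , C) = AllP.map⁺ (Coset.inK C)

    points-apart : ∀ B → AllPairs _≢_ (points B)
    points-apart (w , _ , C) = AllPairsP.map⁺ (AllPairs.map (λ {u} {v} n e → n (lin≡ (c ∷ w ∷ u ∷ v ∷ []) ((+ 1 , v₀ :+ (v₁ :+ v₂) , v₀ :+ (v₁ :+ v₃)) ∷ []) (e ∷ []) v₂ v₃ refl)) (Coset.apart C))

    blocks-disjoint : ∀ B B' → ¬ Formal D (proj₁ B ⊟ proj₁ B') → All (λ x → All (x ≢_) (points B')) (points B)
    blocks-disjoint (w , _ , C) (w' , _ , C') n = AllP.map⁺ (All.map (λ {u} f → AllP.map⁺ (All.map (λ {v} f' e →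
      n (subst (Formal D) (lin≡ (c ∷ w ∷ w' ∷ u ∷ v ∷ []) ((-1ℤ , v₀ :+ (v₁ :+ v₃) , v₀ :+ (v₂ :+ v₄)) ∷ []) (e ∷ []) (v₄ :- v₃) (v₁ :- v₂) refl) (formal-⊟ f' f))) (Coset.formal C'))) (Coset.formal C))

    all-points : List Block → List Z3
    all-points = List.concatMap points

    all-in : ∀ Bs → All K (all-points Bs)
    all-in [] = []
    all-in (B ∷ Bs) = AllP.++⁺ (points-in B) (all-in Bs)

    all-apart : ∀ {Bs} → AllPairs (λ B B' → ¬ Formal D (proj₁ B ⊟ proj₁ B')) Bs → AllPairs _≢_ (all-points Bs)
    all-apart [] = []
    all-apart {B ∷ _} (n ∷ ns) = AllPairsP.++⁺ (points-apart B) (all-apart ns) (cross n)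
      where
      merge : ∀ {xs ys zs : List Z3} → All (λ x → All (x ≢_) ys) xs → All (λ x → All (x ≢_) zs) xs → All (λ x → All (x ≢_) (ys ++ zs)) xs
      merge [] [] = []
      merge (p ∷ ps) (q ∷ qs) = AllP.++⁺ p q ∷ merge ps qs
      cross : ∀ {Bs} → All (λ B' → ¬ Formal D (proj₁ B ⊟ proj₁ B')) Bs → All (λ x → All (x ≢_) (all-points Bs)) (points B)
      cross [] = All.tabulate (λ _ → [])
      cross {B' ∷ _} (n ∷ ns) = merge (blocks-disjoint B B' n) (cross ns)

    -- Distinct points of K have distinct residues modulo three, of which there are 27.
    few-points : ∀ {xs} → All K xs → AllPairs _≢_ xs → length xs ℕ.≤ 27
    few-points {xs} ks ds = subst (ℕ._≤ 27) (ListP.length-map residue xs) (unique-length (residues-apart ks ds) (λ {v} _ → all-residues v))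
      where
      residue : Z3 → Vec (Fin 3) 3
      residue x = Vec.tabulate (Mod3.residue x)
      same-point : ∀ x y → K x → K y → residue x ≡ residue y → x ≡ y
      same-point x y kx ky e = triple kx ky (Mod3.same-residue x y (λ i → trans (sym (VecP.lookup∘tabulate (Mod3.residue x) i)) (trans (cong (λ v → lookup v i) e) (VecP.lookup∘tabulate (Mod3.residue y) i))))
      residues-apart : ∀ {xs} → All K xs → AllPairs _≢_ xs → AllPairs _≢_ (List.map residue xs)
      residues-apart [] [] = []
      residues-apart {x ∷ _} (k ∷ ks) (d ∷ ds) = AllP.map⁺ (go ks d) ∷ residues-apart ks ds
        where
        go : ∀ {ys} → All K ys → All (x ≢_) ys → All (λ y → residue x ≢ residue y) ys
        go [] [] = []
        go {y ∷ _} (k' ∷ ks) (n ∷ ns) = (λ e → n (same-point x y k k' e)) ∷ go ks ns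

    -- For a fractional part, membership means that the denominator divides the numerators.
    -- Decidability removes the double negation in `nonformal-absurd`.
    formal? : ∀ w → Dec (Formal D w)
    formal? w = start (fractional-part d₁ d₂ d₃ (Frame.ind₃ (Fr R)) w)
      where
      start : ∃[ q ] Fraction D (w ⊟ ev q D) → Dec (Formal D w)
      start (q , fr) = map′ (shift-formal S D q) (λ f → formal-⊟ f (q , refl)) (map′ to from (multiple? k (+ r₁ , + r₂ , + r₃)))
        where
        open Fraction fr
        to : Multiple k (+ r₁ , + r₂ , + r₃) → Formal D (w ⊟ ev q D)
        to ((x , y , z) , e) = (x ∷ y ∷ z ∷ []) , ∙-cancel (+ k) {{ℕ.>-nonZero 0<k}} (trans fraction (trans (cong (λ v → ev v D) r≡) (ev-⊛ (+ k) (x ∷ y ∷ z ∷ []) D)))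
          where
          r≡ : (+ r₁ ∷ + r₂ ∷ + r₃ ∷ []) ≡ + k ⊛ (x ∷ y ∷ z ∷ [])
          r≡ = cong₂ _∷_ (cong proj₁ e) (cong₂ _∷_ (cong (λ t → proj₁ (proj₂ t)) e) (cong (λ t → proj₂ (proj₂ t) ∷ []) e))
        from : Formal D (w ⊟ ev q D) → Multiple k (+ r₁ , + r₂ , + r₃)
        from (h@(x ∷ y ∷ z ∷ []) , e) = (x , y , z) , back (injective (+ r₁ ∷ + r₂ ∷ + r₃ ∷ []) (+ k ⊛ h) (trans (sym fraction) (trans (cong (+ k ∙_) e) (sym (ev-⊛ (+ k) h D)))))
          where
          back : (+ r₁ ∷ + r₂ ∷ + r₃ ∷ []) ≡ + k ⊛ h → (+ r₁ , + r₂ , + r₃) ≡ + k ∙ (x , y , z)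
          back eq = z3≡ (VecP.∷-injectiveˡ eq) (VecP.∷-injectiveˡ (VecP.∷-injectiveʳ eq)) (VecP.∷-injectiveˡ (VecP.∷-injectiveʳ (VecP.∷-injectiveʳ eq)))

    -- The classes of 0, w, -w, 2w and -2w contain 14 + 4 · 4 points of K.
    nonformal-absurd : ∀ w → ¬ ¬ Formal D w
    nonformal-absurd w n = impossible (few-points (all-in Bs) (all-apart separate))
      where
      origin : Coset D 14 o
      origin = coset-from R formalPoints _ (All.map (λ {f} f∈ → subst K (vec≡ (c ∷ ev f D ∷ []) (v₀ :+ v₁) (v₀ :+ (:0 :+ v₁)) refl) (All.lookup (Index.sums-in (Fr R)) f∈))
        (toWitness {a? = all? (λ f → any? (f ≟ᵥ_) (sumsOf pointsK₁ pointsK₁′)) formalPoints} _))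
      -- None of w, 2w, 3w, 4w lies in the lattice, so the five classes are distinct.
      n₂ : ¬ Formal D (+ 2 ∙ w)
      n₂ f = n (half-formal w f)
      n₃ : ¬ Formal D (+ 3 ∙ w)
      n₃ f = n (third-formal w f)
      n₄ : ¬ Formal D (+ 4 ∙ w)
      n₄ f = n₂ (half-formal (+ 2 ∙ w) (subst (Formal D) (vec≡ (w ∷ []) (+ 4 :* v₀) (+ 2 :* (+ 2 :* v₀)) refl) f))
      apply : ∀ k {x y} → y ≡ k ∙ x → ¬ Formal D y → ¬ Formal D x
      apply k e n f = n (formal-∙ k e f)
      by : ∀ k (x y : Expr 1) → nf y ≡ nf (k :* x) → ¬ Formal D (⟦ y ⟧ (w ∷ [])) → ¬ Formal D (⟦ x ⟧ (w ∷ []))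
      by k x y e = apply k (vec≡ (w ∷ []) y (k :* x) e)
      C₁ = representatives w n
      C₂ = representatives (-1ℤ ∙ w) (by -1ℤ (-1ℤ :* v₀) v₀ refl n)
      C₃ = representatives (+ 2 ∙ w) n₂
      C₄ = representatives (-[1+ 1 ] ∙ w) (by -1ℤ (-[1+ 1 ] :* v₀) (+ 2 :* v₀) refl n₂)
      Bs : List Block
      Bs = (o , 14 , origin) ∷ (w , 4 , C₁) ∷ (-1ℤ ∙ w , 4 , C₂) ∷ (+ 2 ∙ w , 4 , C₃) ∷ (-[1+ 1 ] ∙ w , 4 , C₄) ∷ []
      separate : AllPairs (λ B B' → ¬ Formal D (proj₁ B ⊟ proj₁ B')) Bs
      separate =
        (by -1ℤ (:0 :- v₀) v₀ refl n ∷ by (+ 1) (:0 :- -1ℤ :* v₀) v₀ refl n ∷ by -1ℤ (:0 :- + 2 :* v₀) (+ 2 :* v₀) refl n₂ ∷ by (+ 1) (:0 :- -[1+ 1 ] :* v₀) (+ 2 :* v₀) refl n₂ ∷ [])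
        ∷ (by (+ 1) (v₀ :- -1ℤ :* v₀) (+ 2 :* v₀) refl n₂ ∷ by -1ℤ (v₀ :- + 2 :* v₀) v₀ refl n ∷ by (+ 1) (v₀ :- -[1+ 1 ] :* v₀) (+ 3 :* v₀) refl n₃ ∷ [])
        ∷ (by -1ℤ (-1ℤ :* v₀ :- + 2 :* v₀) (+ 3 :* v₀) refl n₃ ∷ by (+ 1) (-1ℤ :* v₀ :- -[1+ 1 ] :* v₀) v₀ refl n ∷ [])
        ∷ (by (+ 1) (+ 2 :* v₀ :- -[1+ 1 ] :* v₀) (+ 4 :* v₀) refl n₄ ∷ []) ∷ [] ∷ []
      block-size : ∀ B → length (points B) ≡ proj₁ (proj₂ B)
      block-size (w , _ , C) = trans (ListP.length-map (λ u → c ⊞ (w ⊞ u)) (Coset.us C)) (Coset.size C)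
      total-size : ∀ Bs → length (all-points Bs) ≡ ListAction.sum (List.map (λ B → proj₁ (proj₂ B)) Bs)
      total-size [] = refl
      total-size (B ∷ Bs) = trans (ListP.length-++ (points B)) (cong₂ ℕ._+_ (block-size B) (total-size Bs))
      impossible : length (all-points Bs) ℕ.≤ 27 → ⊥
      -- The classes have 30 points in all, written as 28 + 2.
      impossible le = contradiction (subst (ℕ._≤ 27) (total-size Bs) le) (λ le → ℕP.<⇒≱ (ℕP.m≤m+n 28 2) le)

    generates : ∀ w → Formal D w
    generates w = decidable-stable (formal? w) (nonformal-absurd w)

-- Rational polytopes and Minkowski sums

fromℚᵘ-+ : ∀ p q → fromℚᵘ p ℚ.+ fromℚᵘ q ≡ fromℚᵘ (p ℚᵘ.+ q)
fromℚᵘ-+ p q = ℚP.toℚᵘ-injective (ℚᵘP.≃-trans (ℚP.toℚᵘ-homo-+ (fromℚᵘ p) (fromℚᵘ q))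
  (ℚᵘP.≃-trans (ℚᵘP.+-cong (ℚP.toℚᵘ-fromℚᵘ p) (ℚP.toℚᵘ-fromℚᵘ q)) (ℚᵘP.≃-sym (ℚP.toℚᵘ-fromℚᵘ (p ℚᵘ.+ q)))))

fromℚᵘ-* : ∀ p q → fromℚᵘ p ℚ.* fromℚᵘ q ≡ fromℚᵘ (p ℚᵘ.* q)
fromℚᵘ-* p q = ℚP.toℚᵘ-injective (ℚᵘP.≃-trans (ℚP.toℚᵘ-homo-* (fromℚᵘ p) (fromℚᵘ q))
  (ℚᵘP.≃-trans (ℚᵘP.*-cong (ℚP.toℚᵘ-fromℚᵘ p) (ℚP.toℚᵘ-fromℚᵘ q)) (ℚᵘP.≃-sym (ℚP.toℚᵘ-fromℚᵘ (p ℚᵘ.* q)))))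

ιℤ-+ : ∀ a b → ιℤ (a ℤ.+ b) ≡ ιℤ a ℚ.+ ιℤ b
ιℤ-+ a b = sym (trans (fromℚᵘ-+ (mkℚᵘ a 0) (mkℚᵘ b 0)) (ℚP.fromℚᵘ-cong {mkℚᵘ a 0 ℚᵘ.+ mkℚᵘ b 0} {mkℚᵘ (a ℤ.+ b) 0} (*≡* (go a b))))
  where go : ∀ (a b : ℤ) → (a ℤ.* + 1 ℤ.+ b ℤ.* + 1) ℤ.* + 1 ≡ (a ℤ.+ b) ℤ.* + 1
        go = solve-∀

ιℤ-* : ∀ a b → ιℤ (a ℤ.* b) ≡ ιℤ a ℚ.* ιℤ b
ιℤ-* a b = sym (trans (fromℚᵘ-* (mkℚᵘ a 0) (mkℚᵘ b 0)) (ℚP.fromℚᵘ-cong {mkℚᵘ a 0 ℚᵘ.* mkℚᵘ b 0} {mkℚᵘ (a ℤ.* b) 0} (*≡* refl)))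

ιℤ-injective : ∀ {a b} → ιℤ a ≡ ιℤ b → a ≡ b
ιℤ-injective {a} {b} e = go (ℚP.fromℚᵘ-injective {mkℚᵘ a 0} {mkℚᵘ b 0} e)
  where go : mkℚᵘ a 0 ℚᵘ.≃ mkℚᵘ b 0 → a ≡ b
        go (*≡* q) = trans (sym (ℤP.*-identityʳ a)) (trans q (ℤP.*-identityʳ b))

ιℤ-nonneg : ∀ n → 0ℚ ℚ.≤ ιℤ (+ n)
ιℤ-nonneg n = ℚP.nonNegative⁻¹ (ιℤ (+ n)) {{ℚP.normalize-nonNeg n 1}}

q3≡ : {a b c a' b' c' : ℚ} → a ≡ a' → b ≡ b' → c ≡ c' → (a , b , c) ≡ (a' , b' , c')
q3≡ refl refl refl = refl

ι-⊞ : ∀ x y → ι (x ⊞ y) ≡ ι x +³ ι y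
ι-⊞ (a , b , c) (a' , b' , c') = q3≡ (ιℤ-+ a a') (ιℤ-+ b b') (ιℤ-+ c c')

ι-∙ : ∀ n x → ι (n ∙ x) ≡ ιℤ n ·³ ι x
ι-∙ n (a , b , c) = q3≡ (ιℤ-* n a) (ιℤ-* n b) (ιℤ-* n c)

ι-injective : ∀ {x y} → ι x ≡ ι y → x ≡ y
ι-injective {a , b , c} {a' , b' , c'} e = z3≡ (ιℤ-injective (cong proj₁ e)) (ιℤ-injective (cong (λ t → proj₁ (proj₂ t)) e)) (ιℤ-injective (cong (λ t → proj₂ (proj₂ t)) e))

+³-comm : ∀ x y → x +³ y ≡ y +³ x
+³-comm (a , b , c) (a' , b' , c') = q3≡ (ℚP.+-comm a a') (ℚP.+-comm b b') (ℚP.+-comm c c')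

+³-identityˡ : ∀ x → 0³ +³ x ≡ x
+³-identityˡ (a , b , c) = q3≡ (ℚP.+-identityˡ a) (ℚP.+-identityˡ b) (ℚP.+-identityˡ c)

+³-identityʳ : ∀ x → x +³ 0³ ≡ x
+³-identityʳ (a , b , c) = q3≡ (ℚP.+-identityʳ a) (ℚP.+-identityʳ b) (ℚP.+-identityʳ c)

+³-medial : ∀ x y z w → (x +³ y) +³ (z +³ w) ≡ (x +³ z) +³ (y +³ w)
+³-medial (a , b , c) (a₁ , b₁ , c₁) (a₂ , b₂ , c₂) (a₃ , b₃ , c₃) = q3≡ (go a a₁ a₂ a₃) (go b b₁ b₂ b₃) (go c c₁ c₂ c₃)
  where go : ∀ x y z w → (x ℚ.+ y) ℚ.+ (z ℚ.+ w) ≡ (x ℚ.+ z) ℚ.+ (y ℚ.+ w)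
        go = solveℚ 4 (λ x y z w → (x ⟨+⟩ y) ⟨+⟩ (z ⟨+⟩ w) := (x ⟨+⟩ z) ⟨+⟩ (y ⟨+⟩ w)) refl

·³-+³ : ∀ s x y → (s ·³ (x +³ y)) ≡ (s ·³ x) +³ (s ·³ y)
·³-+³ s (a , b , c) (a' , b' , c') = q3≡ (ℚP.*-distribˡ-+ s a a') (ℚP.*-distribˡ-+ s b b') (ℚP.*-distribˡ-+ s c c')

+-·³ : ∀ s t x → ((s ℚ.+ t) ·³ x) ≡ (s ·³ x) +³ (t ·³ x)
+-·³ s t (a , b , c) = q3≡ (ℚP.*-distribʳ-+ a s t) (ℚP.*-distribʳ-+ b s t) (ℚP.*-distribʳ-+ c s t)

*-·³ : ∀ s t x → ((s ℚ.* t) ·³ x) ≡ (s ·³ (t ·³ x))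
*-·³ s t (a , b , c) = q3≡ (ℚP.*-assoc s t a) (ℚP.*-assoc s t b) (ℚP.*-assoc s t c)

1-·³ : ∀ x → (1ℚ ·³ x) ≡ x
1-·³ (a , b , c) = q3≡ (ℚP.*-identityˡ a) (ℚP.*-identityˡ b) (ℚP.*-identityˡ c)

0-·³ : ∀ x → (0ℚ ·³ x) ≡ 0³
0-·³ (a , b , c) = q3≡ (ℚP.*-zeroˡ a) (ℚP.*-zeroˡ b) (ℚP.*-zeroˡ c)

·³-0³ : ∀ s → (s ·³ 0³) ≡ 0³
·³-0³ s = q3≡ (ℚP.*-zeroʳ s) (ℚP.*-zeroʳ s) (ℚP.*-zeroʳ s)

0≤1 : 0ℚ ℚ.≤ 1ℚ
0≤1 = ιℤ-nonneg 1

*-nonneg : ∀ {s t} → 0ℚ ℚ.≤ s → 0ℚ ℚ.≤ t → 0ℚ ℚ.≤ s ℚ.* t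
*-nonneg {s} {t} 0≤s 0≤t = subst (ℚ._≤ s ℚ.* t) (ℚP.*-zeroʳ s) (ℚP.*-monoˡ-≤-nonNeg s {{ℚ.nonNegative 0≤s}} 0≤t)

-- A cone over a polytope: the slice at height T is the T-fold dilate.
record Conic (C : ℚ → Q3 → Set) : Set where
  field
    apex  : C 0ℚ 0³
    add   : ∀ {T T' x x'} → C T x → C T' x' → C (T ℚ.+ T') (x +³ x')
    scale : ∀ {s T x} → 0ℚ ℚ.≤ s → C T x → C (s ℚ.* T) (s ·³ x)

-- An inductive form of `conv` with arbitrary total weight, which makes it closed under addition and
-- scaling.
data Cone : List Z3 → ℚ → Q3 → Set where
  []  : Cone [] 0ℚ 0³
  _∷_ : ∀ {t v vs T x} → 0ℚ ℚ.≤ t → Cone vs T x → Cone (v ∷ vs) (t ℚ.+ T) ((t ·³ ι v) +³ x)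

conv⇒cone : ∀ {vs x} → conv vs x → Cone vs 1ℚ x
conv⇒cone {vs} (ts , len , nn , sum≡ , eq) = subst₂ (Cone vs) sum≡ eq (go ts vs len nn)
  where
  go : ∀ ts vs → length ts ≡ length vs → All (0ℚ ℚ.≤_) ts → Cone vs (List.foldr ℚ._+_ 0ℚ ts) (lincomb ts vs)
  go [] [] _ [] = []
  go (t ∷ ts) (v ∷ vs) len (n ∷ nn) = n ∷ go ts vs (ℕP.suc-injective len) nn

cone⇒conv : ∀ {vs x} → Cone vs 1ℚ x → conv vs x
cone⇒conv c = go c
  where
  go : ∀ {vs T x} → Cone vs T x → ∃[ ts ] (length ts ≡ length vs × All (0ℚ ℚ.≤_) ts × List.foldr ℚ._+_ 0ℚ ts ≡ T × lincomb ts vs ≡ x)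
  go [] = [] , refl , [] , refl , refl
  go (_∷_ {t} {v} n c) with go c
  ... | ts , len , nn , sum≡ , eq = t ∷ ts , cong suc len , n ∷ nn , cong (t ℚ.+_) sum≡ , cong ((t ·³ ι v) +³_) eq

cone-conic : ∀ vs → Conic (Cone vs)
cone-conic vs = record { apex = origin vs ; add = plus ; scale = times }
  where
  origin : ∀ vs → Cone vs 0ℚ 0³
  origin [] = []
  origin (v ∷ vs) = subst₂ (Cone (v ∷ vs)) refl (trans (cong (_+³ 0³) (0-·³ (ι v))) refl) (ℚP.≤-refl ∷ origin vs)
  plus : ∀ {vs T T' x x'} → Cone vs T x → Cone vs T' x' → Cone vs (T ℚ.+ T') (x +³ x')
  plus [] [] = []
  plus (_∷_ {t} {v} {vs} {T} {x} n c) (_∷_ {t'} {T = T'} {x'} n' c') = subst₂ (Cone (v ∷ vs)) (medial t t' T T')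
    (trans (cong (_+³ (x +³ x')) (+-·³ t t' (ι v))) (+³-medial (t ·³ ι v) (t' ·³ ι v) x x')) (ℚP.+-mono-≤ n n' ∷ plus c c')
    where medial : ∀ t t' T T' → (t ℚ.+ t') ℚ.+ (T ℚ.+ T') ≡ (t ℚ.+ T) ℚ.+ (t' ℚ.+ T')
          medial = solveℚ 4 (λ x y z w → (x ⟨+⟩ y) ⟨+⟩ (z ⟨+⟩ w) := (x ⟨+⟩ z) ⟨+⟩ (y ⟨+⟩ w)) refl
  times : ∀ {vs s T x} → 0ℚ ℚ.≤ s → Cone vs T x → Cone vs (s ℚ.* T) (s ·³ x)
  times {s = s} 0≤s [] = subst₂ (Cone []) (sym (ℚP.*-zeroʳ s)) (sym (·³-0³ s)) []
  times {s = s} 0≤s (_∷_ {t} {v} {vs} {T} {x} n c) = subst₂ (Cone (v ∷ vs)) (sym (ℚP.*-distribˡ-+ s t T))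
    (trans (cong (_+³ (s ·³ x)) (*-·³ s t (ι v))) (sym (·³-+³ s (t ·³ ι v) x))) (*-nonneg 0≤s n ∷ times 0≤s c)

cone-vertex : ∀ {vs v} → v ∈ vs → Cone vs 1ℚ (ι v)
cone-vertex {v ∷ vs} (here refl) = subst₂ (Cone (v ∷ vs)) refl (trans (+³-identityʳ (1ℚ ·³ ι v)) (1-·³ (ι v))) (0≤1 ∷ Conic.apex (cone-conic vs))
cone-vertex {w ∷ vs} {v} (there v∈) = subst₂ (Cone (w ∷ vs)) refl (trans (cong (_+³ ι v) (0-·³ (ι w))) (+³-identityˡ (ι v))) (ℚP.≤-refl {0ℚ} ∷ cone-vertex v∈)

cone-into : ∀ {C} → Conic C → ∀ {vs} → All (λ v → C 1ℚ (ι v)) vs → ∀ {T x} → Cone vs T x → C T x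
cone-into K [] [] = Conic.apex K
cone-into {C} K (c ∷ cs) (_∷_ {t} {v} {T = T} {x} n d) = subst₂ C (cong (ℚ._+ T) (ℚP.*-identityʳ t)) refl (Conic.add K (Conic.scale K n c) (cone-into K cs d))

cone-⊆ : ∀ {vs ws} → All (λ v → Cone ws 1ℚ (ι v)) vs → ∀ {T x} → Cone vs T x → Cone ws T x
cone-⊆ {ws = ws} = cone-into (cone-conic ws)

-- The weighted points add up at the height of the total weight n, and scaling by 1/n returns to
-- height one.
lattice-convex : ∀ {C} → Conic C → Convex (λ z → C 1ℚ (ι z))
lattice-convex {C} K ws z cs 0<n e = divide (total ws) refl 0<n e
  where
  open Conic K
  weigh : ∀ ws → All (λ w → C 1ℚ (ι (proj₂ w))) ws → C (ιℤ (+ total ws)) (ι (weighted ws))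
  weigh [] [] = apex
  weigh ((n , x) ∷ ws) (c ∷ cs) = subst₂ C (trans (cong (ℚ._+ ιℤ (+ total ws)) (ℚP.*-identityʳ (ιℤ (+ n)))) (sym (ιℤ-+ (+ n) (+ total ws))))
    (sym (trans (ι-⊞ (+ n ∙ x) (weighted ws)) (cong (_+³ ι (weighted ws)) (ι-∙ (+ n) x)))) (add (scale (ιℤ-nonneg n) c) (weigh ws cs))
  divide : ∀ m → total ws ≡ m → 0 ℕ.< m → + m ∙ z ≡ weighted ws → C 1ℚ (ι z)
  divide zero _ () _
  divide (suc m) total≡ _ e = subst₂ C inverse (trans (cong (s ·³_) (ι-∙ (+ suc m) z)) (trans (sym (*-·³ s (ιℤ (+ suc m)) (ι z))) (trans (cong (_·³ ι z) inverse) (1-·³ (ι z)))))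
      (scale (ℚP.nonNegative⁻¹ s {{ℚP.normalize-nonNeg 1 (suc m)}}) slice)
    where
    s : ℚ
    s = fromℚᵘ (mkℚᵘ (+ 1) m)
    slice : C (ιℤ (+ suc m)) (ι (+ suc m ∙ z))
    slice = subst₂ C (cong (λ n → ιℤ (+ n)) total≡) (cong ι (sym e)) (weigh ws cs)
    inverse : s ℚ.* ιℤ (+ suc m) ≡ 1ℚ
    inverse = trans (fromℚᵘ-* (mkℚᵘ (+ 1) m) (mkℚᵘ (+ suc m) 0)) (ℚP.fromℚᵘ-cong {mkℚᵘ (+ 1) m ℚᵘ.* mkℚᵘ (+ suc m) 0} {mkℚᵘ (+ 1) 0} (*≡* (go (+ suc m))))
      where go : ∀ (k : ℤ) → (+ 1 ℤ.* k) ℤ.* + 1 ≡ + 1 ℤ.* (k ℤ.* + 1)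
            go = solve-∀

-- The translation grows with the height, so the shifted set is again conic.
shifted-conic : ∀ {C} → Conic C → ∀ p → Conic (λ T x → C T (x +³ (T ·³ p)))
shifted-conic {C} K p = record
  { apex = subst (C 0ℚ) (sym (trans (+³-identityˡ (0ℚ ·³ p)) (0-·³ p))) apex
  ; add = λ {T} {T'} {x} {x'} c c' → subst (C (T ℚ.+ T')) (trans (+³-medial x (T ·³ p) x' (T' ·³ p)) (cong ((x +³ x') +³_) (sym (+-·³ T T' p)))) (add c c')
  ; scale = λ {s} {T} {x} n c → subst (C (s ℚ.* T)) (trans (·³-+³ s x (T ·³ p)) (cong ((s ·³ x) +³_) (sym (*-·³ s T p)))) (scale n c) }
  where open Conic K

record Linear (L : Q3 → Q3) : Set where
  field
    vanish : L 0³ ≡ 0³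
    add   : ∀ x y → L (x +³ y) ≡ L x +³ L y
    scale : ∀ s x → L (s ·³ x) ≡ (s ·³ L x)

preimage-conic : ∀ {C L} → Conic C → Linear L → Conic (λ T x → C T (L x))
preimage-conic {C} K ℓ = record
  { apex = subst (C 0ℚ) (sym (Linear.vanish ℓ)) apex
  ; add = λ {T} {T'} {x} {x'} c c' → subst (C (T ℚ.+ T')) (sym (Linear.add ℓ x x')) (add c c')
  ; scale = λ {s} {T} {x} n c → subst (C (s ℚ.* T)) (sym (Linear.scale ℓ s x)) (scale n c) }
  where open Conic K

image-conic : ∀ {C L} → Conic C → Linear L → ∀ p → Conic (λ T x → ∃[ y ] (C T y × x ≡ L y +³ (T ·³ p)))
image-conic {C} {L} K ℓ p = record
  { apex = 0³ , apex , sym (trans (cong₂ _+³_ (Linear.vanish ℓ) (0-·³ p)) refl)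
  ; add = λ { {T} {T'} (y , c , refl) (y' , c' , refl) → y +³ y' , add c c' ,
      trans (+³-medial (L y) (T ·³ p) (L y') (T' ·³ p)) (cong₂ _+³_ (sym (Linear.add ℓ y y')) (sym (+-·³ T T' p))) }
  ; scale = λ { {s} {T} n (y , c , refl) → (s ·³ y) , scale n c , trans (·³-+³ s (L y) (T ·³ p)) (cong₂ _+³_ (sym (Linear.scale ℓ s y)) (sym (*-·³ s T p))) } }
  where open Conic K

Sum : (C C' : ℚ → Q3 → Set) → ℚ → Q3 → Set
Sum C C' T x = ∃[ p ] ∃[ q ] (C T p × C' T q × x ≡ p +³ q)

sum-conic : ∀ {C C'} → Conic C → Conic C' → Conic (Sum C C')
sum-conic K K' = record
  { apex = 0³ , 0³ , Conic.apex K , Conic.apex K' , refl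
  ; add = λ { (p , q , c , d , refl) (p' , q' , c' , d' , refl) → p +³ p' , q +³ q' , Conic.add K c c' , Conic.add K' d d' , +³-medial p q p' q' }
  ; scale = λ { {s} n (p , q , c , d , refl) → (s ·³ p) , (s ·³ q) , Conic.scale K n c , Conic.scale K' n d , ·³-+³ s p q } }

-- Sums of segments inside a polytope

vertexSums : List (List Z3) → List Z3
vertexSums [] = o ∷ []
vertexSums (V ∷ Vs) = List.concatMap (λ v → List.map (v ⊞_) (vertexSums Vs)) V

-- For a fixed point of the other summands the condition on the first is conic, so its vertices
-- suffice. The induction ranges over all conic sets, which absorb the shift by a vertex.
minkowski-into : ∀ Vs {C} → Conic C → All (λ s → C 1ℚ (ι s)) (vertexSums Vs) → ⨁ (List.map conv Vs) ⊆ᴿ C 1ℚ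
minkowski-into [] {C} K (c ∷ []) x refl = c
minkowski-into (V ∷ Vs) {C} K cs x (p , q , cp , sq , refl) = subst (C 1ℚ) (cong (p +³_) (1-·³ q)) (cone-into (shifted-conic K q) (vertices V cs) (conv⇒cone cp))
  where
  vertices : ∀ V → All (λ s → C 1ℚ (ι s)) (List.concatMap (λ v → List.map (v ⊞_) (vertexSums Vs)) V) → All (λ v → C 1ℚ (ι v +³ (1ℚ ·³ q))) V
  vertices [] _ = []
  vertices (v ∷ V) cs = subst (C 1ℚ) (trans (cong (q +³_) (1-·³ (ι v))) (trans (+³-comm q (ι v)) (cong (ι v +³_) (sym (1-·³ q)))))
      (minkowski-into Vs (shifted-conic K (ι v)) (All.map (λ {s} → subst (C 1ℚ) (trans (ι-⊞ v s) (trans (+³-comm (ι v) (ι s)) (cong (ι s +³_) (sym (1-·³ (ι v)))))))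
        (AllP.map⁻ (AllP.++⁻ˡ (List.map (v ⊞_) (vertexSums Vs)) cs))) q sq) ∷ vertices V (AllP.++⁻ʳ (List.map (v ⊞_) (vertexSums Vs)) cs)

segment-positive : ∀ {x y} → x ≢ y → PosDim (conv (x ∷ y ∷ []))
segment-positive {x} {y} n = ι x , ι y , cone⇒conv (cone-vertex (here refl)) , cone⇒conv (cone-vertex (there (here refl))) , λ e → n (ι-injective e)

module _ {A : Region} {C : ℚ → Q3 → Set} (K : Conic C) (C⊆A : C 1ℚ ⊆ᴿ A) where

  private
    In : Z3 → Set
    In z = C 1ℚ (ι z)
    nonzero : ∀ {v} → v ≢ o → o ≢ v
    nonzero n e = n (sym e)
    moves : ∀ {x u} → u ≢ o → x ≢ x ⊞ u
    moves {x} {u} n e = n (lin≡ (x ∷ u ∷ []) ((-1ℤ , v₀ , v₀ :+ v₁) ∷ []) (e ∷ []) v₁ :0 refl)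

  -- If both directions were nonzero, the parallelogram would be a sum of two segments of positive
  -- dimension.
  parallelogram : (∀ M → HasMinkSum A M → M ℕ.≤ 1) → ∀ x u v → In x → In (x ⊞ u) → In (x ⊞ v) → In (x ⊞ (u ⊞ v)) → u ≡ o ⊎ v ≡ o
  parallelogram bound x u v a b c d = go (u ≟³ o) (v ≟³ o)
    where
    H : Vec Z3 3
    H = x ∷ u ∷ v ∷ []
    go : Dec (u ≡ o) → Dec (v ≡ o) → u ≡ o ⊎ v ≡ o
    go (yes e) _ = inj₁ e
    go _ (yes e) = inj₂ e
    go (no n) (no m) = contradiction (bound 2 (Vs , refl , segment-positive (moves n) ∷ segment-positive (nonzero m) ∷ [] ,
        λ y s → C⊆A y (minkowski-into Vs K
          (subst In (vec≡ H v₀ (v₀ :+ (:0 :+ :0)) refl) a ∷ subst In (vec≡ H (v₀ :+ v₂) (v₀ :+ (v₂ :+ :0)) refl) c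
            ∷ subst In (vec≡ H (v₀ :+ v₁) ((v₀ :+ v₁) :+ (:0 :+ :0)) refl) b ∷ subst In (vec≡ H (v₀ :+ (v₁ :+ v₂)) ((v₀ :+ v₁) :+ (v₂ :+ :0)) refl) d ∷ []) y s))) λ { (s≤s ()) }
      where
      Vs : List (List Z3)
      Vs = (x ∷ x ⊞ u ∷ []) ∷ (o ∷ v ∷ []) ∷ []

  parallelepiped : (∀ M → HasMinkSum A M → M ℕ.≤ 2) → ∀ x u v w → In x → In (x ⊞ u) → In (x ⊞ v) → In (x ⊞ w) → In (x ⊞ (u ⊞ v)) → In (x ⊞ (u ⊞ w)) →
    In (x ⊞ (v ⊞ w)) → In (x ⊞ (u ⊞ (v ⊞ w))) → u ≡ o ⊎ v ≡ o ⊎ w ≡ o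
  parallelepiped bound x u v w i₀ iu iv iw iuv iuw ivw iuvw = go (u ≟³ o) (v ≟³ o) (w ≟³ o)
    where
    H : Vec Z3 4
    H = x ∷ u ∷ v ∷ w ∷ []
    go : Dec (u ≡ o) → Dec (v ≡ o) → Dec (w ≡ o) → u ≡ o ⊎ v ≡ o ⊎ w ≡ o
    go (yes e) _ _ = inj₁ e
    go _ (yes e) _ = inj₂ (inj₁ e)
    go _ _ (yes e) = inj₂ (inj₂ e)
    go (no n) (no m) (no l) = contradiction (bound 3 (Vs , refl , segment-positive (moves n) ∷ segment-positive (nonzero m) ∷ segment-positive (nonzero l) ∷ [] ,
        λ y s → C⊆A y (minkowski-into Vs K
          (subst In (vec≡ H v₀ (v₀ :+ (:0 :+ (:0 :+ :0))) refl) i₀ ∷ subst In (vec≡ H (v₀ :+ v₃) (v₀ :+ (:0 :+ (v₃ :+ :0))) refl) iw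
            ∷ subst In (vec≡ H (v₀ :+ v₂) (v₀ :+ (v₂ :+ (:0 :+ :0))) refl) iv ∷ subst In (vec≡ H (v₀ :+ (v₂ :+ v₃)) (v₀ :+ (v₂ :+ (v₃ :+ :0))) refl) ivw
            ∷ subst In (vec≡ H (v₀ :+ v₁) ((v₀ :+ v₁) :+ (:0 :+ (:0 :+ :0))) refl) iu ∷ subst In (vec≡ H (v₀ :+ (v₁ :+ v₃)) ((v₀ :+ v₁) :+ (:0 :+ (v₃ :+ :0))) refl) iuw
            ∷ subst In (vec≡ H (v₀ :+ (v₁ :+ v₂)) ((v₀ :+ v₁) :+ (v₂ :+ (:0 :+ :0))) refl) iuv
            ∷ subst In (vec≡ H (v₀ :+ (v₁ :+ (v₂ :+ v₃))) ((v₀ :+ v₁) :+ (v₂ :+ (v₃ :+ :0))) refl) iuvw ∷ []) y s))) λ { (s≤s (s≤s ())) }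
      where
      Vs : List (List Z3)
      Vs = (x ∷ x ⊞ u ∷ []) ∷ (o ∷ v ∷ []) ∷ (o ∷ w ∷ []) ∷ []

  between : ∀ {x y} p k z → k ℕ.≤ p → 0 ℕ.< p → In x → In y → y ⊟ x ≡ + p ∙ z → In (x ⊞ + k ∙ z)
  between {x} {y} p k z k≤p 0<p a b e = lattice-convex K ((p ℕ.∸ k , x) ∷ (k , y) ∷ []) (x ⊞ + k ∙ z) (a ∷ b ∷ []) (subst (0 ℕ.<_) (sym total≡) 0<p)
      (trans (cong (λ n → + n ∙ (x ⊞ + k ∙ z)) total≡) (trans (identity≡ x y z e) (cong (λ m → m ∙ x ⊞ (+ k ∙ y ⊞ o)) (sym (difference-nat k≤p)))))
    where
    total≡ : (p ℕ.∸ k) ℕ.+ (k ℕ.+ 0) ≡ p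
    total≡ = trans (cong ((p ℕ.∸ k) ℕ.+_) (ℕP.+-identityʳ k)) (ℕP.m∸n+n≡m k≤p)
    identity≡ : ∀ x y z → y ⊟ x ≡ + p ∙ z → + p ∙ (x ⊞ + k ∙ z) ≡ (+ p ℤ.- + k) ∙ x ⊞ (+ k ∙ y ⊞ o)
    identity≡ (a , b , c) (a' , b' , c') (u , v , w) e = z3≡ (step a a' u (cong proj₁ e)) (step b b' v (cong (λ t → proj₁ (proj₂ t)) e)) (step c c' w (cong (λ t → proj₂ (proj₂ t)) e))
      where
      step : ∀ x y z → y ℤ.- x ≡ + p ℤ.* z → + p ℤ.* (x ℤ.+ + k ℤ.* z) ≡ (+ p ℤ.- + k) ℤ.* x ℤ.+ (+ k ℤ.* y ℤ.+ + 0)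
      step x y z e = trans (lhs (+ p) (+ k) x z) (trans (cong (λ t → + p ℤ.* x ℤ.+ + k ℤ.* t) (sym e)) (rhs (+ p) (+ k) x y))
        where
        lhs : ∀ (p k x z : ℤ) → p ℤ.* (x ℤ.+ k ℤ.* z) ≡ p ℤ.* x ℤ.+ k ℤ.* (p ℤ.* z)
        lhs = solve-∀
        rhs : ∀ (p k x y : ℤ) → p ℤ.* x ℤ.+ k ℤ.* (y ℤ.- x) ≡ (p ℤ.- k) ℤ.* x ℤ.+ (k ℤ.* y ℤ.+ + 0)
        rhs = solve-∀

  length-one : (∀ M → HasMinkSum A M → M ℕ.≤ 1) → LengthOne In
  length-one bound = record { convex = lattice-convex K ; indivisible = λ {x} {y} → indivisible {x} {y} ; crossing = λ {a} {b} {c} {d} → crossing {a} {b} {c} {d} }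
    where
    -- A segment of lattice length at least two contains the degenerate parallelogram y, y + z, y +
    -- z, y + 2z.
    indivisible : ∀ {x y} p → 2 ℕ.≤ p → In x → In y → Multiple p (x ⊟ y) → x ≡ y
    indivisible {x} {y} p le a b (z , e) = go (parallelogram bound y z z b (at 1 z (vec≡ (z ∷ []) (+ 1 :* v₀) v₀ refl) (ℕP.≤-trans (s≤s z≤n) le))
        (at 1 z (vec≡ (z ∷ []) (+ 1 :* v₀) v₀ refl) (ℕP.≤-trans (s≤s z≤n) le)) (at 2 (z ⊞ z) (vec≡ (z ∷ []) (+ 2 :* v₀) (v₀ :+ v₀) refl) le))
      where
      at : ∀ k w → + k ∙ z ≡ w → k ℕ.≤ p → In (y ⊞ w)
      at k w q k≤p = subst (λ t → In (y ⊞ t)) q (between {y} {x} p k z k≤p (ℕP.≤-trans (s≤s z≤n) le) b a e)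
      finish : z ≡ o → x ≡ y
      finish refl = ⊟≡o⇒≡ {x} {y} (trans e (∙-o (+ p)))
      go : z ≡ o ⊎ z ≡ o → x ≡ y
      go (inj₁ q) = finish q
      go (inj₂ q) = finish q
    crossing : ∀ {a b c d} → In a → In b → In c → In d → a ⊞ b ≡ c ⊞ d → a ≡ c ⊎ b ≡ c
    crossing {a} {b} {c} {d} A B C D e = go (parallelogram bound a (c ⊟ a) (d ⊟ a) A (subst In (vec≡ H v₂ (v₀ :+ (v₂ :- v₀)) refl) C) (subst In (vec≡ H v₃ (v₀ :+ (v₃ :- v₀)) refl) D)
        (subst In (lin≡ H ((+ 1 , v₀ :+ v₁ , v₂ :+ v₃) ∷ []) (e ∷ []) v₁ (v₀ :+ ((v₂ :- v₀) :+ (v₃ :- v₀))) refl) B))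
      where
      H : Vec Z3 4
      H = a ∷ b ∷ c ∷ d ∷ []
      go : c ⊟ a ≡ o ⊎ d ⊟ a ≡ o → a ≡ c ⊎ b ≡ c
      go (inj₁ q) = inj₁ (sym (⊟≡o⇒≡ {c} {a} q))
      go (inj₂ q) = inj₂ (lin≡ H ((+ 1 , v₀ :+ v₁ , v₂ :+ v₃) ∷ (+ 1 , v₃ :- v₀ , :0) ∷ []) (e ∷ q ∷ []) v₁ v₂ refl)

system : ∀ {VP VQ} → MinkowskiLength (conv VP) 1 → MinkowskiLength (conv VQ) 1 → MinkowskiLength (conv VP ⊕ conv VQ) 2 →
         System (λ z → Cone VP 1ℚ (ι z)) (λ z → Cone VQ 1ℚ (ι z)) (λ z → Sum (Cone VP) (Cone VQ) 1ℚ (ι z))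
system {VP} {VQ} (_ , mP) (_ , mQ) (_ , mK) = record
  { oneP = length-one {A = conv VP} (cone-conic VP) (λ _ → cone⇒conv) mP ; oneQ = length-one {A = conv VQ} (cone-conic VQ) (λ _ → cone⇒conv) mQ
  ; sum = λ {x} {y} p q → ι x , ι y , p , q , ι-⊞ x y ; convex = lattice-convex K ; triple = λ {x} {y} → triple {x} {y} ; ladder = λ {x} {x'} {y} {y'} → ladder {x} {x'} {y} {y'}
  ; box = λ {x} u v w → cell x u v w }
  where
  K = sum-conic (cone-conic VP) (cone-conic VQ)
  In : Z3 → Set
  In z = Sum (Cone VP) (Cone VQ) 1ℚ (ι z)
  K⊆ : Sum (Cone VP) (Cone VQ) 1ℚ ⊆ᴿ (conv VP ⊕ conv VQ)
  K⊆ x (p , q , c , d , e) = p , q , cone⇒conv c , cone⇒conv d , e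
  cell = parallelepiped {A = conv VP ⊕ conv VQ} K K⊆ mK
  along : ∀ {x y} p k z w → k ℕ.≤ p → 0 ℕ.< p → In x → In y → y ⊟ x ≡ + p ∙ z → + k ∙ z ≡ w → In (x ⊞ w)
  along {x} {y} p k z w k≤p 0<p a b e q = subst (λ t → In (x ⊞ t)) q (between {A = conv VP ⊕ conv VQ} K K⊆ {x} {y} p k z k≤p 0<p a b e)
  -- The degenerate box with all three edges equal to z lies on a segment of lattice length three.
  triple : ∀ {x y} → In x → In y → Multiple 3 (x ⊟ y) → x ≡ y
  triple {x} {y} a b (z , e) = go (cell y z z z b s₁ s₁ s₁ s₂ s₂ s₂ s₃)
    where
    s₁ = along {y} {x} 3 1 z z (s≤s z≤n) (s≤s z≤n) b a e (vec≡ (z ∷ []) (+ 1 :* v₀) v₀ refl)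
    s₂ = along {y} {x} 3 2 z (z ⊞ z) (s≤s (s≤s z≤n)) (s≤s z≤n) b a e (vec≡ (z ∷ []) (+ 2 :* v₀) (v₀ :+ v₀) refl)
    s₃ = along {y} {x} 3 3 z (z ⊞ (z ⊞ z)) (s≤s (s≤s (s≤s z≤n))) (s≤s z≤n) b a e (vec≡ (z ∷ []) (+ 3 :* v₀) (v₀ :+ (v₀ :+ v₀)) refl)
    finish : z ≡ o → x ≡ y
    finish refl = ⊟≡o⇒≡ {x} {y} e
    go : z ≡ o ⊎ z ≡ o ⊎ z ≡ o → x ≡ y
    go (inj₁ q) = finish q
    go (inj₂ (inj₁ q)) = finish q
    go (inj₂ (inj₂ q)) = finish q
  -- The box has the edges w, w and y - x.
  ladder : ∀ {x x' y y'} w → In x → In x' → In y → In y' → x' ⊟ x ≡ + 2 ∙ w → y' ⊟ y ≡ + 2 ∙ w → w ≡ o ⊎ x ≡ y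
  ladder {x} {x'} {y} {y'} w a a' b b' e f = go (cell x w w (y ⊟ x) a r₁ r₁ (subst In (vec≡ H v₁ (v₀ :+ (v₁ :- v₀)) refl) b) r₂
      (subst In (vec≡ H (v₁ :+ v₂) (v₀ :+ (v₂ :+ (v₁ :- v₀))) refl) t₁) (subst In (vec≡ H (v₁ :+ v₂) (v₀ :+ (v₂ :+ (v₁ :- v₀))) refl) t₁)
      (subst In (vec≡ H (v₁ :+ (v₂ :+ v₂)) (v₀ :+ (v₂ :+ (v₂ :+ (v₁ :- v₀)))) refl) t₂))
    where
    H : Vec Z3 3
    H = x ∷ y ∷ w ∷ []
    r₁ = along {x} {x'} 2 1 w w (s≤s z≤n) (s≤s z≤n) a a' e (vec≡ (w ∷ []) (+ 1 :* v₀) v₀ refl)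
    r₂ = along {x} {x'} 2 2 w (w ⊞ w) (s≤s (s≤s z≤n)) (s≤s z≤n) a a' e (vec≡ (w ∷ []) (+ 2 :* v₀) (v₀ :+ v₀) refl)
    t₁ = along {y} {y'} 2 1 w w (s≤s z≤n) (s≤s z≤n) b b' f (vec≡ (w ∷ []) (+ 1 :* v₀) v₀ refl)
    t₂ = along {y} {y'} 2 2 w (w ⊞ w) (s≤s (s≤s z≤n)) (s≤s z≤n) b b' f (vec≡ (w ∷ []) (+ 2 :* v₀) (v₀ :+ v₀) refl)
    go : w ≡ o ⊎ w ≡ o ⊎ y ⊟ x ≡ o → w ≡ o ⊎ x ≡ y
    go (inj₁ q) = inj₁ q
    go (inj₂ (inj₁ q)) = inj₁ q
    go (inj₂ (inj₂ q)) = inj₂ (sym (⊟≡o⇒≡ {y} {x} q))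

-- Unimodular equivalence

-- One inclusion is checked on the given generators; for the other, each generator of the image may
-- come from any lattice point of the hull.
hull-image : ∀ {L : Q3 → Q3} {f : Z3 → Z3} → Linear L → (∀ z → L (ι z) ≡ ι (f z)) → ∀ {vs ws} v →
  All (λ z → Cone ws 1ℚ (ι (f z ⊞ v))) vs → All (λ w → ∃[ z ] (Cone vs 1ℚ (ι z) × w ≡ f z ⊞ v)) ws →
  ∀ x → conv ws x ⇔ (∃[ y ] (conv vs y × x ≡ L y +³ ι v))
hull-image {L} {f} ℓ Lι {vs} {ws} v into onto x = mk⇔ to from
  where
  at : ∀ z → ι (f z ⊞ v) ≡ L (ι z) +³ (1ℚ ·³ ι v)
  at z = trans (ι-⊞ (f z) v) (cong₂ _+³_ (sym (Lι z)) (sym (1-·³ (ι v))))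
  to : conv ws x → ∃[ y ] (conv vs y × x ≡ L y +³ ι v)
  to c = finish (cone-into (image-conic (cone-conic vs) ℓ (ι v)) (All.map (λ { (z , d , refl) → ι z , d , at z }) onto) (conv⇒cone c))
    where
    finish : ∃[ y ] (Cone vs 1ℚ y × x ≡ L y +³ (1ℚ ·³ ι v)) → ∃[ y ] (conv vs y × x ≡ L y +³ ι v)
    finish (y , d , e) = y , cone⇒conv d , trans e (cong (L y +³_) (1-·³ (ι v)))
  from : ∃[ y ] (conv vs y × x ≡ L y +³ ι v) → conv ws x
  from (y , c , e) = cone⇒conv (subst (Cone ws 1ℚ) (trans (cong (L y +³_) (1-·³ (ι v))) (sym e))
    (cone-into (preimage-conic (shifted-conic (cone-conic ws) (ι v)) ℓ) (All.map (λ {z} → subst (Cone ws 1ℚ) (at z)) into) (conv⇒cone c)))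

apply : Mat3 → Z3 → Z3
apply (r₁ , r₂ , r₃) z = dotℤ r₁ z , dotℤ r₂ z , dotℤ r₃ z

linear : Mat3 → Q3 → Q3
linear (r₁ , r₂ , r₃) x = dotℚ r₁ x , dotℚ r₂ x , dotℚ r₃ x

linear-ι : ∀ U z → linear U (ι z) ≡ ι (apply U z)
linear-ι (r₁ , r₂ , r₃) z = q3≡ (row r₁ z) (row r₂ z) (row r₃ z)
  where
  row : ∀ r z → dotℚ r (ι z) ≡ ιℤ (dotℤ r z)
  row (a , b , c) (x , y , z) = sym (trans (ιℤ-+ (a ℤ.* x ℤ.+ b ℤ.* y) (c ℤ.* z)) (cong₂ ℚ._+_ (trans (ιℤ-+ (a ℤ.* x) (b ℤ.* y)) (cong₂ ℚ._+_ (ιℤ-* a x) (ιℤ-* b y))) (ιℤ-* c z)))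

linear-linear : ∀ U → Linear (linear U)
linear-linear (r₁ , r₂ , r₃) = record
  { vanish = q3≡ (row-0 r₁) (row-0 r₂) (row-0 r₃)
  ; add = λ x y → q3≡ (row-+ r₁ x y) (row-+ r₂ x y) (row-+ r₃ x y)
  ; scale = λ s x → q3≡ (row-* r₁ s x) (row-* r₂ s x) (row-* r₃ s x) }
  where
  row-0 : ∀ r → dotℚ r 0³ ≡ 0ℚ
  row-0 (a , b , c) = trans (cong₂ ℚ._+_ (cong₂ ℚ._+_ (ℚP.*-zeroʳ (ιℤ a)) (ℚP.*-zeroʳ (ιℤ b))) (ℚP.*-zeroʳ (ιℤ c))) refl
  row-+ : ∀ r x y → dotℚ r (x +³ y) ≡ dotℚ r x ℚ.+ dotℚ r y
  row-+ (a , b , c) (x , y , z) (x' , y' , z') = step (ιℤ a) (ιℤ b) (ιℤ c) x y z x' y' z'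
    where step : ∀ a b c x y z x' y' z' → a ℚ.* (x ℚ.+ x') ℚ.+ b ℚ.* (y ℚ.+ y') ℚ.+ c ℚ.* (z ℚ.+ z') ≡ (a ℚ.* x ℚ.+ b ℚ.* y ℚ.+ c ℚ.* z) ℚ.+ (a ℚ.* x' ℚ.+ b ℚ.* y' ℚ.+ c ℚ.* z')
          step = solveℚ 9 (λ a b c x y z x' y' z' → (a ⟨*⟩ (x ⟨+⟩ x') ⟨+⟩ b ⟨*⟩ (y ⟨+⟩ y')) ⟨+⟩ c ⟨*⟩ (z ⟨+⟩ z') :=
            ((a ⟨*⟩ x ⟨+⟩ b ⟨*⟩ y) ⟨+⟩ c ⟨*⟩ z) ⟨+⟩ ((a ⟨*⟩ x' ⟨+⟩ b ⟨*⟩ y') ⟨+⟩ c ⟨*⟩ z')) refl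
  row-* : ∀ r s x → dotℚ r (s ·³ x) ≡ s ℚ.* dotℚ r x
  row-* (a , b , c) s (x , y , z) = step (ιℤ a) (ιℤ b) (ιℤ c) s x y z
    where step : ∀ a b c s x y z → a ℚ.* (s ℚ.* x) ℚ.+ b ℚ.* (s ℚ.* y) ℚ.+ c ℚ.* (s ℚ.* z) ≡ s ℚ.* (a ℚ.* x ℚ.+ b ℚ.* y ℚ.+ c ℚ.* z)
          step = solveℚ 7 (λ a b c s x y z → (a ⟨*⟩ (s ⟨*⟩ x) ⟨+⟩ b ⟨*⟩ (s ⟨*⟩ y)) ⟨+⟩ c ⟨*⟩ (s ⟨*⟩ z) := s ⟨*⟩ ((a ⟨*⟩ x ⟨+⟩ b ⟨*⟩ y) ⟨+⟩ c ⟨*⟩ z)) refl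

apply-⊞ : ∀ U x y → apply U (x ⊞ y) ≡ apply U x ⊞ apply U y
apply-⊞ (r₁ , r₂ , r₃) x y = z3≡ (row r₁ x y) (row r₂ x y) (row r₃ x y)
  where
  row : ∀ r x y → dotℤ r (x ⊞ y) ≡ dotℤ r x ℤ.+ dotℤ r y
  row (a , b , c) (x , y , z) (x' , y' , z') = step a b c x y z x' y' z'
    where step : ∀ (a b c x y z x' y' z' : ℤ) → a ℤ.* (x ℤ.+ x') ℤ.+ b ℤ.* (y ℤ.+ y') ℤ.+ c ℤ.* (z ℤ.+ z') ≡ (a ℤ.* x ℤ.+ b ℤ.* y ℤ.+ c ℤ.* z) ℤ.+ (a ℤ.* x' ℤ.+ b ℤ.* y' ℤ.+ c ℤ.* z')
          step = solve-∀

affine-image : ∀ {vs ws} U v → All (λ z → Cone ws 1ℚ (ι (apply U z ⊞ v))) vs → All (λ w → ∃[ z ] (Cone vs 1ℚ (ι z) × w ≡ apply U z ⊞ v)) ws →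
               conv ws ≐ (image (affine U o) (conv vs) +ᵛ v)
affine-image {vs} {ws} U v into onto x = mk⇔ (λ c → to (Equivalence.to e c)) (λ d → Equivalence.from e (from d))
  where
  e = hull-image {L = linear U} {f = apply U} (linear-linear U) (linear-ι U) v into onto x
  to : ∃[ y ] (conv vs y × x ≡ linear U y +³ ι v) → (image (affine U o) (conv vs) +ᵛ v) x
  to (y , c , q) = affine U o y , (y , c , refl) , trans q (cong (_+³ ι v) (sym (+³-identityʳ (linear U y))))
  from : (image (affine U o) (conv vs) +ᵛ v) x → ∃[ y ] (conv vs y × x ≡ linear U y +³ ι v)
  from (p , (y , c , refl) , q) = y , c , trans q (cong (_+³ ι v) (+³-identityʳ (linear U y)))

translate-image : ∀ {vs ws} v → All (λ z → Cone ws 1ℚ (ι (z ⊞ v))) vs → All (λ w → ∃[ z ] (Cone vs 1ℚ (ι z) × w ≡ z ⊞ v)) ws → conv ws ≐ (conv vs +ᵛ v)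
translate-image v into onto = hull-image {L = λ x → x} {f = λ z → z} (record { vanish = refl ; add = λ _ _ → refl ; scale = λ _ _ → refl }) (λ _ → refl) v into onto

toZ : V 3 → Z3
toZ (x ∷ y ∷ z ∷ []) = x , y , z

fromZ : Z3 → V 3
fromZ (x , y , z) = x ∷ y ∷ z ∷ []

columns : Z3 → Z3 → Z3 → Mat3
columns (a , a' , a″) (b , b' , b″) (c , c' , c″) = (a , b , c) , (a' , b' , c') , (a″ , b″ , c″)

apply-columns : ∀ x y z v → apply (columns x y z) v ≡ ev (fromZ v) (x ∷ y ∷ z ∷ [])
apply-columns (a , a' , a″) (b , b' , b″) (c , c' , c″) (x , y , z) = z3≡ (step a b c x y z) (step a' b' c' x y z) (step a″ b″ c″ x y z)
  where step : ∀ (a b c x y z : ℤ) → a ℤ.* x ℤ.+ b ℤ.* y ℤ.+ c ℤ.* z ≡ x ℤ.* a ℤ.+ (y ℤ.* b ℤ.+ (z ℤ.* c ℤ.+ + 0))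
        step = solve-∀

⊗-columns : ∀ A x y z → A ⊗ columns x y z ≡ columns (apply A x) (apply A y) (apply A z)
⊗-columns (r₁ , r₂ , r₃) x y z = refl

module Coordinates (d₁ d₂ d₃ : Z3) (ind₃ : Independent₃ (d₁ ∷ d₂ ∷ d₃ ∷ [])) (generates : ∀ z → Formal (d₁ ∷ d₂ ∷ d₃ ∷ []) z) where

  private
    D : Vec Z3 3
    D = d₁ ∷ d₂ ∷ d₃ ∷ []
    c₁ c₂ c₃ : V 3
    c₁ = proj₁ (generates e₁)
    c₂ = proj₁ (generates e₂)
    c₃ = proj₁ (generates e₃)

  open Independent D ind₃ using (injective)

  -- The columns of `U` are the coordinates of e₁, e₂, e₃ with respect to D; `W` is its inverse.
  U W : Mat3
  U = columns (toZ c₁) (toZ c₂) (toZ c₃)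
  W = columns d₁ d₂ d₃

  to-from : ∀ c → fromZ (toZ c) ≡ c
  to-from (x ∷ y ∷ z ∷ []) = refl

  ev-apply : ∀ z → ev (fromZ (apply U z)) D ≡ z
  ev-apply z = trans (cong (λ t → ev (fromZ t) D) (apply-columns (toZ c₁) (toZ c₂) (toZ c₃) z)) (trans (cong (λ c → ev c D) (split z c₁ c₂ c₃)) (expand z))
    where
    split : ∀ z (a b c : V 3) → fromZ (ev (fromZ z) (toZ a ∷ toZ b ∷ toZ c ∷ [])) ≡ proj₁ z ⊛ a ⊕ᵥ (proj₁ (proj₂ z) ⊛ b ⊕ᵥ (proj₂ (proj₂ z) ⊛ c ⊕ᵥ Vec.replicate 3 0ℤ))
    split (x , y , z) (a ∷ a' ∷ a″ ∷ []) (b ∷ b' ∷ b″ ∷ []) (c ∷ c' ∷ c″ ∷ []) = refl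
    expand : ∀ z → ev (proj₁ z ⊛ c₁ ⊕ᵥ (proj₁ (proj₂ z) ⊛ c₂ ⊕ᵥ (proj₂ (proj₂ z) ⊛ c₃ ⊕ᵥ Vec.replicate 3 0ℤ))) D ≡ z
    expand (x , y , z) = trans (ev-⊕ (x ⊛ c₁) (y ⊛ c₂ ⊕ᵥ (z ⊛ c₃ ⊕ᵥ Vec.replicate 3 0ℤ)) D) (trans (cong₂ _⊞_ (term x c₁ (proj₂ (generates e₁)))
      (trans (ev-⊕ (y ⊛ c₂) (z ⊛ c₃ ⊕ᵥ Vec.replicate 3 0ℤ) D) (cong₂ _⊞_ (term y c₂ (proj₂ (generates e₂)))
        (trans (ev-⊕ (z ⊛ c₃) (Vec.replicate 3 0ℤ) D) (cong₂ _⊞_ (term z c₃ (proj₂ (generates e₃))) (ev-0 D))))))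
      (z3≡ (first x y z) (second′ x y z) (third′ x y z)))
      where
      term : ∀ x c {e} → e ≡ ev c D → ev (x ⊛ c) D ≡ x ∙ e
      term x c q = trans (ev-⊛ x c D) (cong (x ∙_) (sym q))
      first : ∀ (x y z : ℤ) → x ℤ.* + 1 ℤ.+ (y ℤ.* + 0 ℤ.+ (z ℤ.* + 0 ℤ.+ + 0)) ≡ x
      first = solve-∀
      second′ : ∀ (x y z : ℤ) → x ℤ.* + 0 ℤ.+ (y ℤ.* + 1 ℤ.+ (z ℤ.* + 0 ℤ.+ + 0)) ≡ y
      second′ = solve-∀
      third′ : ∀ (x y z : ℤ) → x ℤ.* + 0 ℤ.+ (y ℤ.* + 0 ℤ.+ (z ℤ.* + 1 ℤ.+ + 0)) ≡ z
      third′ = solve-∀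

  apply-ev : ∀ c → apply U (ev c D) ≡ toZ c
  apply-ev c = cong toZ (injective (fromZ (apply U (ev c D))) c (ev-apply (ev c D)))

  unimodular : GL3ℤ U
  unimodular = W , trans (⊗-columns U d₁ d₂ d₃) (cong₃ columns (at v₀) (at v₁) (at v₂)) ,
      trans (⊗-columns W (toZ c₁) (toZ c₂) (toZ c₃)) (cong₃ columns (back c₁ (proj₂ (generates e₁))) (back c₂ (proj₂ (generates e₂))) (back c₃ (proj₂ (generates e₃))))
    where
    cong₃ : ∀ {A B : Set} (f : A → A → A → B) {x x' y y' z z'} → x ≡ x' → y ≡ y' → z ≡ z' → f x y z ≡ f x' y' z'
    cong₃ f refl refl refl = refl
    at : ∀ (x : Expr 3) → apply U (⟦ x ⟧ D) ≡ toZ (nf x)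
    at x = trans (cong (apply U) (nf-sound x D)) (apply-ev (nf x))
    back : ∀ c {e} → e ≡ ev c D → apply W (toZ c) ≡ e
    back c q = trans (apply-columns d₁ d₂ d₃ (toZ c)) (trans (cong (λ t → ev t D) (to-from c)) (sym q))

  chart : ∀ {b x} p → x ≡ b ⊞ ev p D → apply U x ⊞ (o ⊟ apply U b) ≡ toZ p
  chart {b} {x} p refl = trans (cong (_⊞ (o ⊟ apply U b)) (trans (apply-⊞ U b (ev p D)) (cong (apply U b ⊞_) (apply-ev p))))
    (vec≡ (apply U b ∷ toZ p ∷ []) ((v₀ :+ v₁) :+ (:0 :- v₀)) v₁ refl)

placed-lookup : ∀ b (D : Vec Z3 3) {ps xs} → Pointwise (λ p x → x ≡ b ⊞ ev p D) ps xs → ∀ {z} → z ∈ xs → ∃[ p ] (p ∈ ps × z ≡ b ⊞ ev p D)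
placed-lookup b D (_∷_ {x = p} e es) (here refl) = p , here refl , e
placed-lookup b D (e ∷ es) (there z∈) with placed-lookup b D es z∈
... | p , p∈ , q = p , there p∈ , q

placed-find : ∀ b (D : Vec Z3 3) {ps xs} → Pointwise (λ p x → x ≡ b ⊞ ev p D) ps xs → ∀ {p} → p ∈ ps → ∃[ x ] (x ∈ xs × x ≡ b ⊞ ev p D)
placed-find b D (_∷_ {y = x} e es) (here refl) = x , here refl , e
placed-find b D (e ∷ es) (there p∈) with placed-find b D es p∈
... | x , x∈ , q = x , there x∈ , q

-- From lists of lattice points to equivalences of pairs

LatticePoint : List Z3 → Z3 → Set
LatticePoint vs z = Cone vs 1ℚ (ι z)

module _ {vs : List Z3} {n : ℕ} (num : NumLatticePoints (conv vs) n) where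

  all-lattice : All (LatticePoint vs) (proj₁ num)
  all-lattice = All.tabulate (λ {z} z∈ → conv⇒cone (Equivalence.to (proj₂ (proj₂ (proj₂ num)) z) z∈))

  all-distinct : AllPairs _≢_ (proj₁ num)
  all-distinct = proj₁ (proj₂ num)

  -- A point missing from the list would give n + 1 distinct lattice points.
  complete : ∀ {xs} → All (LatticePoint vs) xs → AllPairs _≢_ xs → length xs ≡ n → ∀ {z} → LatticePoint vs z → z ∈ xs
  complete {xs} ps ds len {z} c = decidable-stable (any? (z ≟³_) xs) λ z∉ → ℕP.<⇒≱ (ℕP.n<1+n n)
    (subst₂ ℕ._≤_ (cong suc len) (proj₁ (proj₂ (proj₂ num)))
      (unique-length (All.tabulate (λ y∈ e → z∉ (subst (_∈ xs) (sym e) y∈)) ∷ ds) λ {y} y∈ → Equivalence.from (proj₂ (proj₂ (proj₂ num)) y) (cone⇒conv (All.lookup (c ∷ ps) y∈))))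

  another : ∀ xs → length xs ℕ.< n → ∃[ y ] (LatticePoint vs y × All (_≢ y) xs)
  another xs lt = go (any? (λ y → ¬? (any? (y ≟³_) xs)) (proj₁ num))
    where
    go : Dec (Any (λ y → ¬ (y ∈ xs)) (proj₁ num)) → ∃[ y ] (LatticePoint vs y × All (_≢ y) xs)
    go (yes a) with find a
    ... | y , y∈ , y∉ = y , All.lookup all-lattice y∈ , All.tabulate (λ x∈ e → y∉ (subst (_∈ xs) e x∈))
    go (no none) = contradiction (unique-length all-distinct (λ {y} y∈ → decidable-stable (any? (y ≟³_) xs) λ y∉ → none (lose y∈ y∉)))
      (ℕP.<⇒≱ (subst (length xs ℕ.<_) (sym (proj₁ (proj₂ (proj₂ num)))) lt))

verticesK₁ verticesK₂ : List Z3
verticesK₁ = e₁ ∷ e₂ ∷ e₃ ∷ (-[1+ 0 ] , -[1+ 0 ] , -[1+ 0 ]) ∷ []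
verticesK₂ = e₁ ∷ e₂ ∷ (+ 1 , + 1 , + 2) ∷ (-[1+ 0 ] , -[1+ 0 ] , -[1+ 0 ]) ∷ []

centre-K₁ : Cone verticesK₁ 1ℚ (ι o)
centre-K₁ = lattice-convex (cone-conic verticesK₁) (List.map (1 ,_) verticesK₁) o
  (cone-vertex (here refl) ∷ cone-vertex (there (here refl)) ∷ cone-vertex (there (there (here refl))) ∷ cone-vertex (there (there (there (here refl)))) ∷ []) (s≤s z≤n) refl

-- The weights 1, 1, 1, 2 are those of the relation `kindK₂` with p₄ at the origin.
centre-K₂ : Cone verticesK₂ 1ℚ (ι o)
centre-K₂ = lattice-convex (cone-conic verticesK₂) ((1 , e₁) ∷ (1 , e₂) ∷ (1 , (+ 1 , + 1 , + 2)) ∷ (2 , (-[1+ 0 ] , -[1+ 0 ] , -[1+ 0 ])) ∷ []) o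
  (cone-vertex (here refl) ∷ cone-vertex (there (here refl)) ∷ cone-vertex (there (there (here refl))) ∷ cone-vertex (there (there (there (here refl)))) ∷ []) (s≤s z≤n) refl

-- The change of basis replacing d₄ by − d₁ − d₂ − d₄.
changeBasis : V 3 → V 3
changeBasis (x ∷ y ∷ z ∷ []) = (x ℤ.- z) ∷ (y ℤ.- z) ∷ -1ℤ ℤ.* z ∷ []

changeBasis-ev : ∀ a b c p → ev p (a ∷ b ∷ c ∷ []) ≡ ev (changeBasis p) (a ∷ b ∷ -1ℤ ∙ (a ⊞ b ⊞ c) ∷ [])
changeBasis-ev (a , a' , a″) (b , b' , b″) (c , c' , c″) (x ∷ y ∷ z ∷ []) = z3≡ (step x y z a b c) (step x y z a' b' c') (step x y z a″ b″ c″)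
  where step : ∀ (x y z a b c : ℤ) → x ℤ.* a ℤ.+ (y ℤ.* b ℤ.+ (z ℤ.* c ℤ.+ + 0)) ≡ (x ℤ.- z) ℤ.* a ℤ.+ ((y ℤ.- z) ℤ.* b ℤ.+ (-[1+ 0 ] ℤ.* z ℤ.* (-[1+ 0 ] ℤ.* (a ℤ.+ b ℤ.+ c)) ℤ.+ + 0))
        step = solve-∀

resolvedK₂″ : Resolved₃ (configOf (List.map changeBasis pointsK₂) (List.map changeBasis pointsK₂′)) plain
resolvedK₂″ = toWitness {a? = resolved₃? (configOf (List.map changeBasis pointsK₂) (List.map changeBasis pointsK₂′)) plain} _

module Assembly {VP VQ : List Z3} (S : System (LatticePoint VP) (LatticePoint VQ) (λ z → Sum (Cone VP) (Cone VQ) 1ℚ (ι z)))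
  (numP : NumLatticePoints (conv VP) 5) (numQ : NumLatticePoints (conv VQ) 4) where

  -- The common linear part takes D to the standard basis, and separate translations move the base
  -- points of P and Q to the origin.
  equivalence : ∀ {d₁ d₂ d₃ ps qs} → Placement S (d₁ ∷ d₂ ∷ d₃ ∷ []) ps qs → length qs ≡ 4 → Independent₃ (d₁ ∷ d₂ ∷ d₃ ∷ []) →
    (∀ z → Formal (d₁ ∷ d₂ ∷ d₃ ∷ []) z) → ∀ {W₁ W₂} →
    All (λ p → Cone W₁ 1ℚ (ι (toZ p))) ps → All (λ w → fromZ w ∈ ps) W₁ → All (λ q → Cone W₂ 1ℚ (ι (toZ q))) qs → All (λ w → fromZ w ∈ qs) W₂ →
    PairEquiv (conv VP , conv VQ) (conv W₁ , conv W₂)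
  equivalence {d₁} {d₂} {d₃} {ps} {qs} pl four ind₃ gen in₁ on₁ in₂ on₂ =
      U , o , (o ⊟ apply U b) , (o ⊟ apply U b') , unimodular , side b atP inP (complete numP inP dP five) in₁ on₁ ,
      side b' atQ inQ (complete numQ inQ dQ (trans (sym (same-length b' atQ)) four)) in₂ on₂
    where
    open Placement pl
    open Coordinates d₁ d₂ d₃ ind₃ gen
    same-length : ∀ c {fs zs} → Pointwise (λ p x → x ≡ c ⊞ ev p (d₁ ∷ d₂ ∷ d₃ ∷ [])) fs zs → length fs ≡ length zs
    same-length c [] = refl
    same-length c (e ∷ es) = cong suc (same-length c es)
    side : ∀ {vs ws fs zs} c → Pointwise (λ p x → x ≡ c ⊞ ev p (d₁ ∷ d₂ ∷ d₃ ∷ [])) fs zs → All (LatticePoint vs) zs → (∀ {z} → LatticePoint vs z → z ∈ zs) →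
      All (λ p → Cone ws 1ℚ (ι (toZ p))) fs → All (λ w → fromZ w ∈ fs) ws → conv ws ≐ (image (affine U o) (conv vs) +ᵛ (o ⊟ apply U c))
    side {vs} {ws} {fs} {zs} c at ins only in-hull on = affine-image U (o ⊟ apply U c)
        (All.tabulate λ {z} z∈ → into (placed-lookup c (d₁ ∷ d₂ ∷ d₃ ∷ []) at (only (cone-vertex z∈))))
        (All.map (λ {w} w∈ → onto w (placed-find c (d₁ ∷ d₂ ∷ d₃ ∷ []) at w∈)) on)
      where
      into : ∀ {z} → ∃[ p ] (p ∈ fs × z ≡ c ⊞ ev p (d₁ ∷ d₂ ∷ d₃ ∷ [])) → Cone ws 1ℚ (ι (apply U z ⊞ (o ⊟ apply U c)))
      into {z} (p , p∈ , e) = subst (λ t → Cone ws 1ℚ (ι t)) (sym (chart {c} {z} p e)) (All.lookup in-hull p∈)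
      onto : ∀ w → ∃[ x ] (x ∈ zs × x ≡ c ⊞ ev (fromZ w) (d₁ ∷ d₂ ∷ d₃ ∷ [])) → ∃[ z ] (Cone vs 1ℚ (ι z) × w ≡ apply U z ⊞ (o ⊟ apply U c))
      onto w (x , x∈ , e) = x , All.lookup ins x∈ , sym (chart {c} {x} (fromZ w) e)

  full : Full S
  full = complete numP

  relocate : ∀ {p₁ p₂ p₃ p₄ a q₁ q₂ q₃ q₄ x₁ x₂ x₃ y} → p₁ ≡ x₁ → p₂ ≡ x₂ → p₃ ≡ x₃ → a ≡ y → Inside S p₁ p₂ p₃ p₄ a q₁ q₂ q₃ q₄ → Inside S x₁ x₂ x₃ p₄ y q₁ q₂ q₃ q₄
  relocate refl refl refl refl I = I

  difference : ∀ x y → x ≡ y ⊞ (x ⊟ y)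
  difference x y = vec≡ (x ∷ y ∷ []) v₀ (v₁ :+ (v₀ :- v₁)) refl

  typeE : ∀ {p₁ p₂ p₃ p₄ a q₁ q₂ q₃ q₄} → Inside S p₁ p₂ p₃ p₄ a q₁ q₂ q₃ q₄ → p₁ ⊞ p₂ ⊞ p₃ ≡ p₄ ⊞ + 2 ∙ a → PairEquiv (conv VP , conv VQ) (E , S₂)
  typeE {p₁} {p₂} {p₃} {p₄} {a} {q₁} {q₂} {q₃} {q₄} I e = equivalence (T.placement R) refl (Frame.ind₃ (T.Fr R)) (T.generates R)
      (cone-vertex (here refl) ∷ cone-vertex (there (here refl)) ∷ cone-vertex (there (there (here refl))) ∷ cone-vertex (there (there (there (here refl)))) ∷ cone-vertex (there (there (there (there (here refl))))) ∷ [])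
      (here refl ∷ there (here refl) ∷ there (there (here refl)) ∷ there (there (there (here refl))) ∷ there (there (there (there (here refl)))) ∷ [])
      (cone-vertex (here refl) ∷ cone-vertex (there (here refl)) ∷ cone-vertex (there (there (here refl))) ∷ cone-vertex (there (there (there (here refl)))) ∷ [])
      (here refl ∷ there (here refl) ∷ there (there (here refl)) ∷ there (there (there (here refl))) ∷ [])
    where
    module T = TypeE S full {p₄} {a} {q₄}
    R : T.Data (p₁ ⊟ a) (p₂ ⊟ a) (p₃ ⊟ a)
    R = q₁ , q₂ , q₃ , relocate (difference p₁ a) (difference p₂ a) (difference p₃ a) refl I ,
      lin≡ (p₁ ∷ p₂ ∷ p₃ ∷ p₄ ∷ a ∷ []) ((-1ℤ , v₀ :+ v₁ :+ v₂ , v₃ :+ + 2 :* v₄) ∷ []) (e ∷ []) v₃ (v₄ :+ ((v₀ :- v₄) :+ (v₁ :- v₄) :+ (v₂ :- v₄))) refl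

  typeK₁ : ∀ {p₁ p₂ p₃ p₄ a q₁ q₂ q₃ q₄} → Inside S p₁ p₂ p₃ p₄ a q₁ q₂ q₃ q₄ → a ⊞ (p₁ ⊞ p₂ ⊞ p₃) ≡ + 4 ∙ p₄ → PairEquiv (conv VP , conv VQ) (K₁ , S₁)
  typeK₁ {p₁} {p₂} {p₃} {p₄} {a} {q₁} {q₂} {q₃} {q₄} I e = equivalence (T.placement R) refl (Frame.ind₃ (T.Fr R)) (T.generates R)
      (centre-K₁ ∷ cone-vertex (here refl) ∷ cone-vertex (there (here refl)) ∷ cone-vertex (there (there (here refl))) ∷ cone-vertex (there (there (there (here refl)))) ∷ [])
      (there (here refl) ∷ there (there (here refl)) ∷ there (there (there (here refl))) ∷ there (there (there (there (here refl)))) ∷ [])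
      (cone-vertex (here refl) ∷ cone-vertex (there (here refl)) ∷ cone-vertex (there (there (here refl))) ∷ cone-vertex (there (there (there (here refl)))) ∷ [])
      (here refl ∷ there (here refl) ∷ there (there (here refl)) ∷ there (there (there (here refl))) ∷ [])
    where
    module T = TypeK₁ S full {p₄} {a} {q₄}
    R : T.Data (p₁ ⊟ p₄) (p₂ ⊟ p₄) (p₃ ⊟ p₄)
    R = q₁ , q₂ , q₃ , relocate (difference p₁ p₄) (difference p₂ p₄) (difference p₃ p₄) refl I ,
      lin≡ (p₁ ∷ p₂ ∷ p₃ ∷ p₄ ∷ a ∷ []) ((+ 1 , v₄ :+ (v₀ :+ v₁ :+ v₂) , + 4 :* v₃) ∷ []) (e ∷ []) v₄ (v₃ :+ -1ℤ :* ((v₀ :- v₃) :+ (v₁ :- v₃) :+ (v₂ :- v₃))) refl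

  typeK₂ : ∀ {p₁ p₂ p₃ p₄ a q₁ q₂ q₃ q₄} → Inside S p₁ p₂ p₃ p₄ a q₁ q₂ q₃ q₄ → + 2 ∙ a ⊞ (p₁ ⊞ p₂ ⊞ p₃) ≡ + 5 ∙ p₄ → PairEquiv (conv VP , conv VQ) (K₂ , Defs.S)
  typeK₂ {p₁} {p₂} {p₃} {p₄} {a} {q₁} {q₂} {q₃} {q₄} I e = equivalence placement′ refl (Frame.ind₃ (frame S placement′ full resolvedK₂″)) generates′
      (centre-K₂ ∷ cone-vertex (here refl) ∷ cone-vertex (there (here refl)) ∷ cone-vertex (there (there (here refl))) ∷ cone-vertex (there (there (there (here refl)))) ∷ [])
      (there (here refl) ∷ there (there (here refl)) ∷ there (there (there (here refl))) ∷ there (there (there (there (here refl)))) ∷ [])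
      (cone-vertex (here refl) ∷ cone-vertex (there (there (here refl))) ∷ cone-vertex (there (here refl)) ∷ cone-vertex (there (there (there (here refl)))) ∷ [])
      (here refl ∷ there (there (here refl)) ∷ there (here refl) ∷ there (there (there (here refl))) ∷ [])
    where
    module T = TypeK₂ S full {p₄} {q₄} {a ⊟ p₄}
    R : T.Data (p₁ ⊟ p₄) (p₂ ⊟ p₄) (p₃ ⊟ p₄)
    R = q₁ , q₂ , q₃ , relocate (difference p₁ p₄) (difference p₂ p₄) (difference p₃ p₄) (difference a p₄) I ,
      lin≡ (p₁ ∷ p₂ ∷ p₃ ∷ p₄ ∷ a ∷ []) ((+ 1 , + 2 :* v₄ :+ (v₀ :+ v₁ :+ v₂) , + 5 :* v₃) ∷ []) (e ∷ []) ((v₀ :- v₃) :+ (v₁ :- v₃) :+ (v₂ :- v₃) :+ + 2 :* (v₄ :- v₃)) :0 refl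
    d₁ d₂ d₄ d₅ : Z3
    d₁ = p₁ ⊟ p₄
    d₂ = p₂ ⊟ p₄
    d₄ = a ⊟ p₄
    -- With d₅ in place of d₄ the point a gets coordinates (-1, -1, -1) and d₃ becomes (1, 1, 2), as
    -- in K₂.
    d₅ = -1ℤ ∙ (d₁ ⊞ d₂ ⊞ d₄)
    pl = T.placement R
    rebased : ∀ c {fs zs} → Pointwise (λ p x → x ≡ c ⊞ ev p (d₁ ∷ d₂ ∷ d₄ ∷ [])) fs zs → Pointwise (λ p x → x ≡ c ⊞ ev p (d₁ ∷ d₂ ∷ d₅ ∷ [])) (List.map changeBasis fs) zs
    rebased c [] = []
    rebased c {f ∷ _} (e ∷ es) = trans e (cong (c ⊞_) (changeBasis-ev d₁ d₂ d₄ f)) ∷ rebased c es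
    placement′ : Placement S (d₁ ∷ d₂ ∷ d₅ ∷ []) (List.map changeBasis pointsK₂) (List.map changeBasis pointsK₂′)
    placement′ = record { b = Placement.b pl ; b' = Placement.b' pl ; atP = rebased (Placement.b pl) (Placement.atP pl) ; atQ = rebased (Placement.b' pl) (Placement.atQ pl)
      ; inP = Placement.inP pl ; inQ = Placement.inQ pl ; dP = Placement.dP pl ; dQ = Placement.dQ pl ; five = Placement.five pl }
    generates′ : ∀ z → Formal (d₁ ∷ d₂ ∷ d₅ ∷ []) z
    generates′ z = convert (T.generates R z)
      where
      convert : Formal (d₁ ∷ d₂ ∷ d₄ ∷ []) z → Formal (d₁ ∷ d₂ ∷ d₅ ∷ []) z
      convert (c , e) = changeBasis c , trans e (changeBasis-ev d₁ d₂ d₄ c)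

-- Labellings of the points of E, K₂ and K₁

kind? : ∀ x y z u w → Dec (Kind x y z u w)
kind? x y z u w = map′ to from ((x ⊞ y ⊞ z ≟³ u ⊞ + 2 ∙ w) ⊎-dec ((+ 2 ∙ w ⊞ (x ⊞ y ⊞ z) ≟³ + 5 ∙ u) ⊎-dec (w ⊞ (x ⊞ y ⊞ z) ≟³ + 4 ∙ u)))
  where
  to : _ ⊎ _ ⊎ _ → Kind x y z u w
  to (inj₁ e) = kindE e
  to (inj₂ (inj₁ e)) = kindK₂ e
  to (inj₂ (inj₂ e)) = kindK₁ e
  from : Kind x y z u w → _ ⊎ _ ⊎ _
  from (kindE e) = inj₁ e
  from (kindK₂ e) = inj₂ (inj₁ e)
  from (kindK₁ e) = inj₂ (inj₂ e)

-- Both sides of each relation have the same total weight.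
kind-translate : ∀ v x y z u w → Kind (x ⊞ v) (y ⊞ v) (z ⊞ v) (u ⊞ v) (w ⊞ v) → Kind x y z u w
kind-translate v x y z u w = λ
  { (kindE e) → kindE (lin≡ H ((+ 1 , (v₁ :+ v₀) :+ (v₂ :+ v₀) :+ (v₃ :+ v₀) , (v₄ :+ v₀) :+ + 2 :* (v₅ :+ v₀)) ∷ []) (e ∷ []) (v₁ :+ v₂ :+ v₃) (v₄ :+ + 2 :* v₅) refl)
  ; (kindK₂ e) → kindK₂ (lin≡ H ((+ 1 , + 2 :* (v₅ :+ v₀) :+ ((v₁ :+ v₀) :+ (v₂ :+ v₀) :+ (v₃ :+ v₀)) , + 5 :* (v₄ :+ v₀)) ∷ []) (e ∷ []) (+ 2 :* v₅ :+ (v₁ :+ v₂ :+ v₃)) (+ 5 :* v₄) refl)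
  ; (kindK₁ e) → kindK₁ (lin≡ H ((+ 1 , (v₅ :+ v₀) :+ ((v₁ :+ v₀) :+ (v₂ :+ v₀) :+ (v₃ :+ v₀)) , + 4 :* (v₄ :+ v₀)) ∷ []) (e ∷ []) (v₅ :+ (v₁ :+ v₂ :+ v₃)) (+ 4 :* v₄) refl) }
  where
  H : Vec Z3 6
  H = v ∷ x ∷ y ∷ z ∷ u ∷ w ∷ []

-- The inequalities are interleaved with the quantifiers, so that the search over labels is cut off
-- early.
Labelled : List Z3 → (Z3 → Z3 → Z3 → Z3 → Z3 → Set) → Set
Labelled ts R = All (λ x → All (λ y → x ≢ y → All (λ z → x ≢ z × y ≢ z → All (λ u → x ≢ u × y ≢ u × z ≢ u → All (λ w →
  x ≢ w × y ≢ w × z ≢ w × u ≢ w → Kind x y z u w → R x y z u w) ts) ts) ts) ts) ts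

labelled? : ∀ ts {R} → (∀ x y z u w → Dec (R x y z u w)) → Dec (Labelled ts R)
labelled? ts R? = all? (λ x → all? (λ y → apart x y →-dec all? (λ z → (apart x z ×-dec apart y z) →-dec all? (λ u → (apart x u ×-dec (apart y u ×-dec apart z u)) →-dec
    all? (λ w → (apart x w ×-dec (apart y w ×-dec (apart z w ×-dec apart u w))) →-dec (kind? x y z u w →-dec R? x y z u w)) ts) ts) ts) ts) ts
  where
  apart : ∀ x y → Dec (x ≢ y)
  apart x y = ¬? (x ≟³ y)

latticeE latticeK₁ latticeK₂ verticesS₂ verticesS : List Z3
latticeE = o ∷ e₁ ∷ e₂ ∷ e₃ ∷ (+ 1 , + 1 , + 1) ∷ []
latticeK₁ = o ∷ verticesK₁
latticeK₂ = o ∷ verticesK₂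
verticesS₂ = e₁ ∷ e₂ ∷ e₃ ∷ (+ 1 , + 1 , + 1) ∷ []
verticesS = o ∷ (+ 0 , + 1 , + 0) ∷ (+ 1 , + 0 , + 0) ∷ (+ 1 , + 1 , + 2) ∷ []

Enumerates : List Z3 → Z3 → Z3 → Z3 → Z3 → Z3 → Set
Enumerates W x y z u w = All (_∈ x ∷ y ∷ z ∷ u ∷ []) W × All (_∈ W) (x ∷ y ∷ z ∷ u ∷ [])

enumerates? : ∀ W x y z u w → Dec (Enumerates W x y z u w)
enumerates? W x y z u w = all? (λ t → any? (t ≟³_) (x ∷ y ∷ z ∷ u ∷ [])) W ×-dec all? (λ t → any? (t ≟³_) W) (x ∷ y ∷ z ∷ u ∷ [])

Spanning : Z3 → Z3 → Z3 → Z3 → Z3 → Set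
Spanning x y z u w = det3 (y ⊟ x) (z ⊟ x) (u ⊟ x) ≢ + 0

-- Whichever of the three relations holds, the omitted label is the origin. Hence Q is determined
-- without knowing which type the classification returned.
labelledE : Labelled latticeE (Enumerates verticesS₂)
labelledE = toWitness {a? = labelled? latticeE (enumerates? verticesS₂)} _

labelledK₂ : Labelled latticeK₂ (Enumerates verticesS)
labelledK₂ = toWitness {a? = labelled? latticeK₂ (enumerates? verticesS)} _

-- In K₁ the omitted vertex is not determined, so only the affine independence of the other four
-- points is recorded.
labelledK₁ : Labelled latticeK₁ Spanning
labelledK₁ = toWitness {a? = labelled? latticeK₁ (λ x y z u w → ¬? (det3 (y ⊟ x) (z ⊟ x) (u ⊟ x) ℤ.≟ + 0))} _

module Conclusion {VP VQ : List Z3} (S : System (LatticePoint VP) (LatticePoint VQ) (λ z → Sum (Cone VP) (Cone VQ) 1ℚ (ι z)))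
  (numP : NumLatticePoints (conv VP) 5) (numQ : NumLatticePoints (conv VQ) 4) where

  open Assembly S numP numQ

  classification : Classified S
  classification = from-lists (proj₁ numP) (proj₁ numQ) (all-lattice numP) (all-lattice numQ) (all-distinct numP) (all-distinct numQ) (proj₁ (proj₂ (proj₂ numP))) (proj₁ (proj₂ (proj₂ numQ)))
    where
    from-lists : ∀ ps qs → All (LatticePoint VP) ps → All (LatticePoint VQ) qs → AllPairs _≢_ ps → AllPairs _≢_ qs → length ps ≡ 5 → length qs ≡ 4 → Classified S
    from-lists (_ ∷ _ ∷ _ ∷ _ ∷ _ ∷ []) (_ ∷ _ ∷ _ ∷ _ ∷ []) inP inQ dP dQ refl refl = from-common (common S inQ dQ (complete numQ inQ dQ refl) inP dP)
      where
      from-common : Common (LatticePoint VP) (LatticePoint VQ) → Classified S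
      from-common C = from-fourth (another numQ (q₁ ∷ q₂ ∷ q₃ ∷ []) ℕP.≤-refl) (another numP (p₁ ∷ p₂ ∷ p₃ ∷ []) (ℕP.n≤1+n 4))
        where
        open Common C
        from-fourth : ∃[ y ] (LatticePoint VQ y × All (_≢ y) (q₁ ∷ q₂ ∷ q₃ ∷ [])) → ∃[ y ] (LatticePoint VP y × All (_≢ y) (p₁ ∷ p₂ ∷ p₃ ∷ [])) → Classified S
        from-fourth (q₄ , Q₄ , m₁ ∷ m₂ ∷ m₃ ∷ []) (a , A , n₁ ∷ n₂ ∷ n₃ ∷ []) = from-fifth (another numP (p₁ ∷ p₂ ∷ p₃ ∷ a ∷ []) ℕP.≤-refl)
          where
          finish : ∀ {p₁ p₂ p₃ p₄ a q₁ q₂ q₃ q₄} → Inside S p₁ p₂ p₃ p₄ a q₁ q₂ q₃ q₄ → Classified S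
          finish I = classified S I (complete numP (Inside.inP I) (Inside.dP I) refl) (complete numQ (Inside.inQ I) (Inside.dQ I) refl)
          either : ∀ {a a'} → Inside S p₁ p₂ p₃ a a' q₁ q₂ q₃ q₄ ⊎ Inside S p₁ p₂ p₃ a' a q₁ q₂ q₃ q₄ → Classified S
          either (inj₁ I) = finish I
          either (inj₂ I) = finish I
          from-fifth : ∃[ y ] (LatticePoint VP y × All (_≢ y) (p₁ ∷ p₂ ∷ p₃ ∷ a ∷ [])) → Classified S
          from-fifth (a' , A' , k₁ ∷ k₂ ∷ k₃ ∷ k ∷ []) = either (inside S (P₁ ∷ P₂ ∷ P₃ ∷ A ∷ A' ∷ []) (Q₁ ∷ Q₂ ∷ Q₃ ∷ Q₄ ∷ [])
            ((proj₁ differentP ∷ proj₁ (proj₂ differentP) ∷ n₁ ∷ k₁ ∷ []) ∷ (proj₂ (proj₂ differentP) ∷ n₂ ∷ k₂ ∷ []) ∷ (n₃ ∷ k₃ ∷ []) ∷ (k ∷ []) ∷ [] ∷ [])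
            ((proj₁ differentQ ∷ proj₁ (proj₂ differentQ) ∷ m₁ ∷ []) ∷ (proj₂ (proj₂ differentQ) ∷ m₂ ∷ []) ∷ (m₃ ∷ []) ∷ [] ∷ []) (proj₁ same) (proj₂ same))

  open Classified classification
  open Inside removed

  equivalent : PairEquiv (conv VP , conv VQ) (K₁ , S₁) ⊎ PairEquiv (conv VP , conv VQ) (K₂ , Defs.S) ⊎ PairEquiv (conv VP , conv VQ) (E , S₂)
  equivalent = go kind
    where
    go : Kind p₁ p₂ p₃ p₄ a → _
    go (kindK₁ e) = inj₁ (typeK₁ removed e)
    go (kindK₂ e) = inj₂ (inj₁ (typeK₂ removed e))
    go (kindE e) = inj₂ (inj₂ (typeE removed e))

  record Labels (ts : List Z3) (R : Z3 → Z3 → Z3 → Z3 → Z3 → Set) : Set where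
    field
      v x y z u w : Z3
      x∈ : x ∈ ts
      y∈ : y ∈ ts
      z∈ : z ∈ ts
      u∈ : u ∈ ts
      w∈ : w ∈ ts
      x≡ : p₁ ≡ x ⊞ v
      y≡ : p₂ ≡ y ⊞ v
      z≡ : p₃ ≡ z ⊞ v
      u≡ : p₄ ≡ u ⊞ v
      w≡ : a ≡ w ⊞ v
      related : R x y z u w

  -- By counting, the points of P are the translated points of the model, so the classified points
  -- carry labels to which the finite check applies.
  labels : ∀ {W ts R} → All (λ t → Cone W 1ℚ (ι t)) ts → AllPairs _≢_ ts → length ts ≡ 5 → Labelled ts R → LatticeTranslate (conv VP) (conv W) → Labels ts R
  labels {W} {ts} {R} hull ds five lab (v , eq) = go (find′ inP)
    where
    moved : ∀ {ts} → All (λ t → Cone W 1ℚ (ι t)) ts → All (LatticePoint VP) (List.map (_⊞ v) ts)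
    moved [] = []
    moved {t ∷ _} (c ∷ cs) = conv⇒cone (Equivalence.from (eq (ι (t ⊞ v))) (ι t , cone⇒conv c , ι-⊞ t v)) ∷ moved cs
    cancelled : ∀ {x y} → x ⊞ v ≡ y ⊞ v → x ≡ y
    cancelled {x} {y} e = lin≡ (x ∷ y ∷ v ∷ []) ((+ 1 , v₀ :+ v₂ , v₁ :+ v₂) ∷ []) (e ∷ []) v₀ v₁ refl
    locate′ : ∀ {p} → LatticePoint VP p → ∃[ t ] (t ∈ ts × p ≡ t ⊞ v)
    locate′ c = MemP.∈-map⁻ (_⊞ v) (complete numP (moved hull) (AllPairsP.map⁺ (AllPairs.map (λ n e → n (cancelled e)) ds)) (trans (ListP.length-map (_⊞ v) ts) five) c)
    Located′ : Z3 → Set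
    Located′ p = ∃[ t ] (t ∈ ts × p ≡ t ⊞ v)
    find′ : ∀ {ps} → All (LatticePoint VP) ps → All Located′ ps
    find′ = All.map locate′
    go : All Located′ (p₁ ∷ p₂ ∷ p₃ ∷ p₄ ∷ a ∷ []) → Labels ts R
    go ((x , x∈ , ex) ∷ (y , y∈ , ey) ∷ (z , z∈ , ez) ∷ (u , u∈ , eu) ∷ (w , w∈ , ew) ∷ []) = record
      { v = v ; x = x ; y = y ; z = z ; u = u ; w = w ; x∈ = x∈ ; y∈ = y∈ ; z∈ = z∈ ; u∈ = u∈ ; w∈ = w∈ ; x≡ = ex ; y≡ = ey ; z≡ = ez ; u≡ = eu ; w≡ = ew
      ; related = relate dP }
      where
      off : ∀ {p p' s s'} → p ≡ s ⊞ v → p' ≡ s' ⊞ v → p ≢ p' → s ≢ s'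
      off e e' n refl = n (trans e (sym e'))
      moved-kind : Kind x y z u w
      moved-kind = kind-translate v x y z u w (transport ex ey ez eu ew kind)
        where
        transport : ∀ {a b c d e a' b' c' d' e'} → a ≡ a' → b ≡ b' → c ≡ c' → d ≡ d' → e ≡ e' → Kind a b c d e → Kind a' b' c' d' e'
        transport refl refl refl refl refl k = k
      relate : AllPairs _≢_ (p₁ ∷ p₂ ∷ p₃ ∷ p₄ ∷ a ∷ []) → R x y z u w
      relate ((n₁₂ ∷ n₁₃ ∷ n₁₄ ∷ n₁₅ ∷ []) ∷ (n₂₃ ∷ n₂₄ ∷ n₂₅ ∷ []) ∷ (n₃₄ ∷ n₃₅ ∷ []) ∷ (n₄₅ ∷ []) ∷ [] ∷ []) =
        All.lookup (All.lookup (All.lookup (All.lookup (All.lookup lab x∈) y∈ (off ex ey n₁₂)) z∈ (off ex ez n₁₃ , off ey ez n₂₃)) u∈ (off ex eu n₁₄ , off ey eu n₂₄ , off ez eu n₃₄))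
          w∈ (off ex ew n₁₅ , off ey ew n₂₅ , off ez ew n₃₅ , off eu ew n₄₅) moved-kind

  module Remaining {ts R} (L : Labels ts R) where
    open Labels L

    -- The translation from the model to P followed by the one from P to Q.
    v′ : Z3
    v′ = v ⊞ (q₁ ⊟ p₁)

    positions : Pointwise (λ t q → q ≡ t ⊞ v′) (x ∷ y ∷ z ∷ u ∷ []) (q₁ ∷ q₂ ∷ q₃ ∷ q₄ ∷ [])
    positions = at x p₁ q₁ x≡ (trans (⊟-self p₁) (sym (⊟-self q₁))) ∷ at y p₂ q₂ y≡ same₂ ∷ at z p₃ q₃ z≡ same₃ ∷ at u p₄ q₄ u≡ same₄ ∷ []
      where
      at : ∀ t p q → p ≡ t ⊞ v → p ⊟ p₁ ≡ q ⊟ q₁ → q ≡ t ⊞ v′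
      at t p q e s = lin≡ (t ∷ p ∷ q ∷ p₁ ∷ q₁ ∷ v ∷ []) ((-1ℤ , v₁ :- v₃ , v₂ :- v₄) ∷ (+ 1 , v₁ , v₀ :+ v₅) ∷ []) (s ∷ e ∷ []) v₂ (v₀ :+ (v₅ :+ (v₄ :- v₃))) refl

    forth : ∀ {ts qs} → Pointwise (λ t q → q ≡ t ⊞ v′) ts qs → All (LatticePoint VQ) qs → ∀ {t} → t ∈ ts → LatticePoint VQ (t ⊞ v′)
    forth (e ∷ es) (c ∷ cs) (here refl) = subst (LatticePoint VQ) e c
    forth (e ∷ es) (c ∷ cs) (there t∈) = forth es cs t∈

    back′ : ∀ {ts qs} → Pointwise (λ t q → q ≡ t ⊞ v′) ts qs → ∀ {q} → q ∈ qs → ∃[ t ] (t ∈ ts × q ≡ t ⊞ v′)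
    back′ (_∷_ {x = t} e es) (here refl) = t , here refl , e
    back′ (e ∷ es) (there q∈) with back′ es q∈
    ... | t , t∈ , f = t , there t∈ , f

    labelled-point : ∀ {q} → LatticePoint VQ q → ∃[ t ] (t ∈ x ∷ y ∷ z ∷ u ∷ [] × q ≡ t ⊞ v′)
    labelled-point c = back′ positions (complete numQ inQ dQ refl c)

    translate : ∀ {W} → All (_∈ x ∷ y ∷ z ∷ u ∷ []) W → All (_∈ W) (x ∷ y ∷ z ∷ u ∷ []) → LatticeTranslate (conv VQ) (conv W)
    translate {W} sub sup = v′ , translate-image v′ (All.map (forth positions inQ) sub) (All.tabulate λ q∈ → onto (labelled-point (cone-vertex q∈)))
      where
      onto : ∀ {q} → ∃[ t ] (t ∈ x ∷ y ∷ z ∷ u ∷ [] × q ≡ t ⊞ v′) → ∃[ t ] (Cone W 1ℚ (ι t) × q ≡ t ⊞ v′)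
      onto (t , t∈ , e) = t , cone-vertex (All.lookup sup t∈) , e

    -- A lattice point of the hull translates to one of the four lattice points of Q, which are the
    -- translated vertices.
    empty : Empty (x ∷ y ∷ z ∷ u ∷ [])
    empty s c = finish (labelled-point (subst (Cone VQ 1ℚ) (sym (at s)) (cone-into (shifted-conic (cone-conic VQ) (ι v′))
        (All.tabulate λ {t} t∈ → subst (Cone VQ 1ℚ) (at t) (forth positions inQ t∈)) (conv⇒cone c))))
      where
      at : ∀ t → ι (t ⊞ v′) ≡ ι t +³ (1ℚ ·³ ι v′)
      at t = trans (ι-⊞ t v′) (cong (ι t +³_) (sym (1-·³ (ι v′))))
      finish : ∃[ t ] (t ∈ x ∷ y ∷ z ∷ u ∷ [] × s ⊞ v′ ≡ t ⊞ v′) → s ∈ x ∷ y ∷ z ∷ u ∷ []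
      finish (t , t∈ , e) = subst (_∈ x ∷ y ∷ z ∷ u ∷ []) (lin≡ (s ∷ t ∷ v′ ∷ []) ((-1ℤ , v₀ :+ v₂ , v₁ :+ v₂) ∷ []) (e ∷ []) v₁ v₀ refl) t∈

    w∉ : w ∈ x ∷ y ∷ z ∷ u ∷ [] → AllPairs _≢_ (p₁ ∷ p₂ ∷ p₃ ∷ p₄ ∷ a ∷ []) → ⊥
    w∉ (here refl) ((_ ∷ _ ∷ _ ∷ n ∷ []) ∷ _) = n (trans x≡ (sym w≡))
    w∉ (there (here refl)) (_ ∷ (_ ∷ _ ∷ n ∷ []) ∷ _) = n (trans y≡ (sym w≡))
    w∉ (there (there (here refl))) (_ ∷ _ ∷ (_ ∷ n ∷ []) ∷ _) = n (trans z≡ (sym w≡))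
    w∉ (there (there (there (here refl)))) (_ ∷ _ ∷ _ ∷ (n ∷ []) ∷ _) = n (trans u≡ (sym w≡))

  hullE : All (λ t → Cone latticeE 1ℚ (ι t)) latticeE
  hullE = All.tabulate cone-vertex
  hullK₁ : All (λ t → Cone verticesK₁ 1ℚ (ι t)) latticeK₁
  hullK₁ = centre-K₁ ∷ All.tabulate cone-vertex
  hullK₂ : All (λ t → Cone verticesK₂ 1ℚ (ι t)) latticeK₂
  hullK₂ = centre-K₂ ∷ All.tabulate cone-vertex

  distinct? : ∀ ts → Dec (AllPairs _≢_ ts)
  distinct? = AllPairs.allPairs? (λ s t → ¬? (s ≟³ t))

  translateE : LatticeTranslate (conv VP) E → LatticeTranslate (conv VQ) S₂
  translateE t = uncurry (Remaining.translate L) (Labels.related L)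
    where L = labels {R = Enumerates verticesS₂} hullE (toWitness {a? = distinct? latticeE} _) refl labelledE t

  translateK₂ : LatticeTranslate (conv VP) K₂ → LatticeTranslate (conv VQ) Defs.S
  translateK₂ t = uncurry (Remaining.translate L) (Labels.related L)
    where L = labels {R = Enumerates verticesS} hullK₂ (toWitness {a? = distinct? latticeK₂} _) refl labelledK₂ t

  translateK₁ : LatticeTranslate (conv VP) K₁ → ∃[ T ] (Tetrahedron T × Empty T × ProperlyContained (conv T) K₁ × LatticeTranslate (conv VQ) (conv T))
  translateK₁ t = T , (x , y , z , u , refl , related) , empty ,
      ((λ _ c → cone⇒conv (cone-⊆ (All.lookup hullK₁ x∈ ∷ All.lookup hullK₁ y∈ ∷ All.lookup hullK₁ z∈ ∷ All.lookup hullK₁ u∈ ∷ []) (conv⇒cone c))) ,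
       -- The removed point lies in K₁; by emptiness it would otherwise be one of the four vertices.
       λ sub → w∉ (empty w (sub (ι w) (cone⇒conv (All.lookup hullK₁ w∈)))) dP) ,
      translate (All.tabulate (λ m → m)) (All.tabulate (λ m → m))
    where
    L = labels {R = Spanning} hullK₁ (toWitness {a? = distinct? latticeK₁} _) refl labelledK₁ t
    open Labels L
    open Remaining L
    T : List Z3
    T = x ∷ y ∷ z ∷ u ∷ []

theorem3p21 : (VP VQ : List Z3) →
    MinkowskiLength (conv VP) 1 → MinkowskiLength (conv VQ) 1 →
    MinkowskiLength (conv VP ⊕ conv VQ) 2 →
    NumLatticePoints (conv VP) 5 → NumLatticePoints (conv VQ) 4 →
    (PairEquiv (conv VP , conv VQ) (K₁ , S₁)
      ⊎ PairEquiv (conv VP , conv VQ) (K₂ , S)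
      ⊎ PairEquiv (conv VP , conv VQ) (E , S₂))
    × (LatticeTranslate (conv VP) E → LatticeTranslate (conv VQ) S₂)
    × (LatticeTranslate (conv VP) K₂ → LatticeTranslate (conv VQ) S)
    × (LatticeTranslate (conv VP) K₁ →
        ∃[ T ] (Tetrahedron T × Empty T × ProperlyContained (conv T) K₁
                × LatticeTranslate (conv VQ) (conv T)))
theorem3p21 VP VQ mP mQ mK numP numQ = equivalent , translateE , translateK₂ , translateK₁
  where open Conclusion (system {VP} {VQ} mP mQ mK) numP numQ
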